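{- Let $l\geq 1$ be an odd integer and let $p\ge l^2+3l+5$ be a prime. Then there exists an infinite sequence of pairs of primes $\{(q_j,r_j)\}_{j=1}^{\infty}$ with $p<q_j$, $pq_j<r_j$ and $q_{j+1}>q_j$ for all $j$, such that $$\{a_{pq_jr_j}(k):k\geq 0\}=\Big\{ -\frac{p-l-2}{2},-\frac{p-l-2}{2}+1,\dots,\frac{p+l+2}{2}\Big\}$$ (the set of all integers in the interval $[-(p-l-2)/2,(p+l+2)/2]$).
   Context: For a positive integer $n$, the $n$-th cyclotomic polynomial is $\Phi_n(x)=\prod_{1\le j\le n,\ \gcd(j,n)=1}(x-e^{2\pi i j/n})=\sum_{k=0}^{\varphi(n)}a_n(k)x^k$, and $a_n(k)=0$ for $k>\varphi(n)$. -}

module Defs where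

open import Data.Nat as ℕ using (ℕ; zero; suc; _∸_)
open import Data.Nat.Divisibility using (_∣?_)
open import Data.Integer as ℤ using (ℤ; +_; _+_; _*_; _-_; -_)
open import Data.List using (List; []; _∷_; _++_; [_]; reverse; replicate; length; foldr)
open import Data.Product using (_×_; _,_)
open import Relation.Nullary using (yes; no)

-- Integer polynomials as coefficient lists, lowest degree first.
Poly : Set
Poly = List ℤ

infixl 6 _+ₚ_
infixl 7 _*ₚ_

_+ₚ_ : Poly → Poly → Poly
[] +ₚ q = q
(a ∷ p) +ₚ [] = a ∷ p
(a ∷ p) +ₚ (b ∷ q) = (a + b) ∷ (p +ₚ q)

scale : ℤ → Poly → Poly
scale c [] = []
scale c (a ∷ p) = (c * a) ∷ scale c p

_*ₚ_ : Poly → Poly → Poly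
[] *ₚ q = []
(a ∷ p) *ₚ q = scale a q +ₚ (+ 0 ∷ (p *ₚ q))

xpow-minus-one : ℕ → Poly
xpow-minus-one zero = []
xpow-minus-one (suc n) = (- (+ 1)) ∷ (replicate n (+ 0) ++ [ + 1 ])

-- Long division by a monic polynomial, lists written highest degree first.
-- gs = the divisor with its leading coefficient 1 removed.
subS : ℤ → List ℤ → List ℤ → List ℤ
subS c [] fs = fs
subS c (g ∷ gs) [] = []
subS c (g ∷ gs) (f ∷ fs) = (f - c * g) ∷ subS c gs fs

divH : ℕ → List ℤ → List ℤ → List ℤ
divH zero _ _ = []
divH (suc k) [] gs = []
divH (suc k) (c ∷ fs) gs = c ∷ divH k (subS c gs fs) gs

tail' : List ℤ → List ℤ
tail' [] = []
tail' (_ ∷ xs) = xs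

divMonic : Poly → Poly → Poly
divMonic f g =
  let fH = reverse f
      gsH = tail' (reverse g)
  in reverse (divH (length fH ∸ length gsH) fH gsH)

-- Table of cyclotomic polynomials (d , Φ_d) for d = 1 … n, via
-- Φ_m = (x^m - 1) / ∏_{d ∣ m, d < m} Φ_d.
cycTable : ℕ → List (ℕ × Poly)
cycTable zero = []
cycTable (suc n) =
  let prev = cycTable n
      m = suc n
      g = foldr (λ { (d , φ) acc → step d φ acc }) [ + 1 ] prev
  in prev ++ [ (m , divMonic (xpow-minus-one m) g) ]
  where
  step : ℕ → Poly → Poly → Poly
  step d φ acc with d ∣? suc n
  ... | yes _ = φ *ₚ acc
  ... | no _ = acc

lookupTab : ℕ → List (ℕ × Poly) → Poly
lookupTab n [] = []
lookupTab n ((d , φ) ∷ rest) with n ℕ.≟ d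
... | yes _ = φ
... | no _ = lookupTab n rest

-- Φ_n (coefficients, lowest degree first); Φ_0 is not used.
cyclotomic : ℕ → Poly
cyclotomic n = lookupTab n (cycTable n)

coeff : Poly → ℕ → ℤ
coeff [] k = + 0
coeff (a ∷ p) zero = a
coeff (a ∷ p) (suc k) = coeff p k

a : ℕ → ℕ → ℤ
a n k = coeff (cyclotomic n) k

{-# OPTIONS --safe #-}
module Submission where

-- Put λ = (p + l + 2)/2 and β = p − λ, and choose a prime q with λ q ≡ 1 mod p, so that μ p + λ q = p q + 1 for some μ.
-- In the coordinates x p + y q mod p q, Φ_pq has coefficient [x < μ] + [y < λ] − 1. Multiplying Φ_pq(x^r) by a series of period p q,
-- one finds that every coefficient of Φ_pqr is a sum over a walk through the p columns y, one visit each, in which a column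
-- y < λ contributes 0 or 1 and any other column 0 or −1. Hence all coefficients lie in [ −β , λ ]. Choosing r suitably modulo p q
-- makes the walk move by a prescribed step, for which both bounds are attained. Neighbouring coefficients differ by at most 1,
-- so all values in between occur as well.
--
-- The primes q and r come from Dirichlet's theorem, proved by elementary means with a rational-valued approximate logarithm:
-- by Selberg's relation, the primes p ≤ x weighted by (log p)/p are equidistributed modulo m unless they concentrate on a coset
-- of a subgroup of index two, and that is excluded by the lower bound for L(1, χ) for the corresponding real character χ.

open import Data.Nat as ℕ using (ℕ; zero; suc; z≤n; s≤s; _∸_)
import Data.Nat.Properties as ℕ
open import Data.Nat.Primality using (Prime)
import Data.Nat.Tactic.RingSolver as ℕR
open import Data.Product using (_×_; _,_; proj₁; proj₂; ∃)
open import Data.Sum using (_⊎_; inj₁; inj₂)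
open import Data.Empty using (⊥; ⊥-elim)
open import Function using (_∘_)
open import Relation.Nullary using (Dec; yes; no; ¬_)
open import Relation.Binary.PropositionalEquality hiding ([_]; J)

-- The walk changes (x, y) by (-e, 1) modulo (q, p), and each visit compares a column with the one
-- `ω` further on, where r ω ≡ -1 mod p. Both extremes occur if `ω` lies between w = ℓ + 2 and β: in
-- the columns that count, the visited points stay below the cut-off and the compared ones lie above
-- it. The choice τ r ≡ -1 or 1 mod p q, with τ = q - e p, gives ω = u or ω = p - u for u = q mod p,
-- and w u ≡ 2 mod p. The bound on p puts one of the two in the required interval.
--
-- Over the rationals the obstacle is the error in Selberg's relation. It is used in Mertens form
-- with two cut-offs 2^k and 2^k': the error is of order 2^k + k' against a main term 2 k k', so k'
-- is taken far above 2^k. If a class had no primes in a long range, the densities f, g at two such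
-- scales would satisfy g + f ⋆ g ≈ 2/h, for h units, and almost vanish at that class; counting the
-- points where f is not small then yields the subgroup. The refutation holds for an explicit range,
-- so a bounded search finds the prime.

module RationalSums where
  open import Data.Nat.Divisibility using (_∣_; _∣?_; ∣⇒≤; divides; m∣m*n; ∣n⇒∣m*n; *-cancelˡ-∣; *-monoʳ-∣)
  open import Data.Nat.Primality using (Prime; prime⇒nonZero; euclidsLemma)
  open import Data.Integer as ℤ using ()
  open import Data.Rational as ℚ
  open import Data.Rational.Properties
  open import Data.Maybe using (Maybe; just; nothing)
  open import Level using (0ℓ)
  open import Tactic.RingSolver using (solve-∀)
  open import Tactic.RingSolver.Core.AlmostCommutativeRing using (AlmostCommutativeRing; fromCommutativeRing)

  -- Rational arithmetic, finite sums and divisor sums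

  isZero : (x : ℚ) → Maybe (0ℚ ≡ x)
  isZero x with 0ℚ ≟ x
  ... | yes p = just p
  ... | no _ = nothing

  ℚ-ring : AlmostCommutativeRing 0ℓ 0ℓ
  ℚ-ring = fromCommutativeRing +-*-commutativeRing isZero

  -- An inequality by certificate: the long estimates exhibit the difference `d` as a sum of visibly
  -- nonnegative terms and leave the identity to the ring solver.
  via : ∀ {x y} d → 0ℚ ≤ d → y ≡ x + d → x ≤ y
  via {x} d 0≤d refl = subst (_≤ x + d) (+-identityʳ x) (+-monoʳ-≤ x 0≤d)

  0≤y-x : ∀ {x y} → x ≤ y → 0ℚ ≤ y - x
  0≤y-x {x} {y} h = subst (_≤ y - x) (+-inverseʳ x) (+-monoˡ-≤ (- x) h)

  0≤+ : ∀ {x y} → 0ℚ ≤ x → 0ℚ ≤ y → 0ℚ ≤ x + y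
  0≤+ = +-mono-≤

  *-monoˡ : ∀ c {x y} → 0ℚ ≤ c → x ≤ y → c * x ≤ c * y
  *-monoˡ c 0≤c = *-monoˡ-≤-nonNeg c {{nonNegative 0≤c}}

  *-monoʳ : ∀ c {x y} → 0ℚ ≤ c → x ≤ y → x * c ≤ y * c
  *-monoʳ c 0≤c = *-monoʳ-≤-nonNeg c {{nonNegative 0≤c}}

  0≤* : ∀ {x y} → 0ℚ ≤ x → 0ℚ ≤ y → 0ℚ ≤ x * y
  0≤* {x} {y} 0≤x 0≤y = subst (_≤ x * y) (*-zeroʳ x) (*-monoˡ x 0≤x 0≤y)

  *-mono : ∀ {a b c d} → 0ℚ ≤ c → 0ℚ ≤ b → a ≤ b → c ≤ d → a * c ≤ b * d
  *-mono {a} {b} {c} 0≤c 0≤b a≤b c≤d = ≤-trans (*-monoʳ c 0≤c a≤b) (*-monoˡ b 0≤b c≤d)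

  x≤∣x∣ : ∀ x → x ≤ ∣ x ∣
  x≤∣x∣ x with ≤-total 0ℚ x
  ... | inj₁ h = ≤-reflexive (sym (0≤p⇒∣p∣≡p h))
  ... | inj₂ h = ≤-trans h (0≤∣p∣ x)

  -x≤∣x∣ : ∀ x → - x ≤ ∣ x ∣
  -x≤∣x∣ x = subst (- x ≤_) (∣-p∣≡∣p∣ x) (x≤∣x∣ (- x))

  ∣∣≤ : ∀ {x c} → - c ≤ x → x ≤ c → ∣ x ∣ ≤ c
  ∣∣≤ {x} {c} l u with ∣p∣≡p∨∣p∣≡-p x
  ... | inj₁ e = subst (_≤ c) (sym e) u
  ... | inj₂ e = subst (_≤ c) (sym e) (subst (- x ≤_) (eq c) (neg-antimono-≤ l))
    where
    eq : ∀ c → - (- c) ≡ c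
    eq = solve-∀ ℚ-ring

  ∣∣-tri : ∀ {x y a b} → ∣ x ∣ ≤ a → ∣ y ∣ ≤ b → ∣ x + y ∣ ≤ a + b
  ∣∣-tri {x} {y} h k = ≤-trans (∣p+q∣≤∣p∣+∣q∣ x y) (+-mono-≤ h k)

  ∣∣-* : ∀ {x y a b} → ∣ x ∣ ≤ a → ∣ y ∣ ≤ b → ∣ x * y ∣ ≤ a * b
  ∣∣-* {x} {y} {a} h k = subst (_≤ a * _) (sym (∣p*q∣≡∣p∣*∣q∣ x y))
    (*-mono (0≤∣p∣ y) (≤-trans (0≤∣p∣ x) h) h k)

  ∣∣-sym : ∀ x y → ∣ x - y ∣ ≡ ∣ y - x ∣
  ∣∣-sym x y = trans (sym (∣-p∣≡∣p∣ (x - y))) (cong ∣_∣ (eq x y))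
    where
    eq : ∀ x y → - (x - y) ≡ y - x
    eq = solve-∀ ℚ-ring

  ≤-∣∣ˡ : ∀ {x c} → ∣ x ∣ ≤ c → - c ≤ x
  ≤-∣∣ˡ {x} {c} h = subst (- c ≤_) (eq x) (neg-antimono-≤ (≤-trans (-x≤∣x∣ x) h))
    where
    eq : ∀ c → - (- c) ≡ c
    eq = solve-∀ ℚ-ring

  ≤-∣∣ʳ : ∀ {x c} → ∣ x ∣ ≤ c → x ≤ c
  ≤-∣∣ʳ {x} h = ≤-trans (x≤∣x∣ x) h

  -- Recursive, so that closed numerals such as `ι 3` unfold to sums of `1ℚ`, with which the ring
  -- solver computes.
  ι : ℕ → ℚ
  ι zero = 0ℚ
  ι (suc n) = 1ℚ + ι n

  0≤1 : 0ℚ ≤ 1ℚ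
  0≤1 = nonNegative⁻¹ 1ℚ

  0≤ι : ∀ n → 0ℚ ≤ ι n
  0≤ι zero = ≤-refl
  0≤ι (suc n) = 0≤+ 0≤1 (0≤ι n)

  ι-+ : ∀ m n → ι (m ℕ.+ n) ≡ ι m + ι n
  ι-+ zero n = sym (+-identityˡ (ι n))
  ι-+ (suc m) n = trans (cong (λ z → 1ℚ + z) (ι-+ m n)) (sym (+-assoc 1ℚ (ι m) (ι n)))

  ι-* : ∀ m n → ι (m ℕ.* n) ≡ ι m * ι n
  ι-* zero n = sym (*-zeroˡ (ι n))
  ι-* (suc m) n = trans (ι-+ n (m ℕ.* n)) (trans (cong (ι n +_) (ι-* m n)) (eq (ι m) (ι n)))
    where
    eq : ∀ a b → b + a * b ≡ (1ℚ + a) * b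
    eq = solve-∀ ℚ-ring

  ι-mono : ∀ {m n} → m ℕ.≤ n → ι m ≤ ι n
  ι-mono {n = n} z≤n = 0≤ι n
  ι-mono (s≤s h) = +-monoʳ-≤ 1ℚ (ι-mono h)

  1≤ι : ∀ {n} → 1 ℕ.≤ n → 1ℚ ≤ ι n
  1≤ι {n} h = subst (_≤ ι n) (+-identityʳ 1ℚ) (ι-mono h)

  0<ι : ∀ {n} → 1 ℕ.≤ n → 0ℚ < ι n
  0<ι {n} h = <-≤-trans (positive⁻¹ 1ℚ) (1≤ι {n} h)

  -- The value at 0 is a default that keeps `0≤inv` and `inv≤1` free of side conditions.
  inv : ℕ → ℚ
  inv zero = 0ℚ
  inv (suc n) = 1/_ (ι (suc n)) {{pos⇒nonZero (ι (suc n)) {{positive (0<ι {suc n} (s≤s z≤n))}}}}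

  ι*inv : ∀ {n} → 1 ℕ.≤ n → ι n * inv n ≡ 1ℚ
  ι*inv {suc n} _ = *-inverseʳ (ι (suc n)) {{pos⇒nonZero (ι (suc n)) {{positive (0<ι {suc n} (s≤s z≤n))}}}}

  *-cancelˡ : ∀ c {x y} → 0ℚ < c → c * x ≡ c * y → x ≡ y
  *-cancelˡ c {x} {y} h e = ≤-antisym
    (*-cancelˡ-≤-pos c {{positive h}} (≤-reflexive e))
    (*-cancelˡ-≤-pos c {{positive h}} (≤-reflexive (sym e)))

  *-cancelˡ-≤ : ∀ c {x y} → 0ℚ < c → c * x ≤ c * y → x ≤ y
  *-cancelˡ-≤ c h = *-cancelˡ-≤-pos c {{positive h}}

  0≤inv : ∀ n → 0ℚ ≤ inv n
  0≤inv zero = ≤-refl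
  0≤inv (suc n) = *-cancelˡ-≤ (ι (suc n)) (0<ι {suc n} (s≤s z≤n))
    (subst₂ _≤_ (sym (*-zeroʳ (ι (suc n)))) (sym (ι*inv {suc n} (s≤s z≤n))) 0≤1)

  inv-* : ∀ {m n} → 1 ℕ.≤ m → 1 ℕ.≤ n → inv (m ℕ.* n) ≡ inv m * inv n
  inv-* {m} {n} 1≤m 1≤n = *-cancelˡ (ι (m ℕ.* n)) (0<ι (ℕ.*-mono-≤ 1≤m 1≤n))
    (trans (ι*inv (ℕ.*-mono-≤ 1≤m 1≤n)) (sym (trans (cong (_* (inv m * inv n)) (ι-* m n))
      (trans (eq (ι m) (ι n) (inv m) (inv n)) (cong₂ _*_ (ι*inv 1≤m) (ι*inv 1≤n))))))
    where
    eq : ∀ a b c d → a * b * (c * d) ≡ a * c * (b * d)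
    eq = solve-∀ ℚ-ring

  inv-anti : ∀ {m n} → 1 ℕ.≤ m → m ℕ.≤ n → inv n ≤ inv m
  inv-anti {m} {n} 1≤m m≤n = *-cancelˡ-≤ (ι n) (0<ι 1≤n) (subst (_≤ ι n * inv m) (sym (ι*inv 1≤n))
      (subst (_≤ ι n * inv m) (ι*inv 1≤m) (*-monoʳ (inv m) (0≤inv m) (ι-mono m≤n))))
    where 1≤n = ℕ.≤-trans 1≤m m≤n

  inv≤1 : ∀ n → inv n ≤ 1ℚ
  inv≤1 zero = 0≤1
  inv≤1 (suc n) = inv-anti {1} {suc n} (s≤s z≤n) (s≤s z≤n)

  inv-tele : ∀ {k} → 1 ℕ.≤ k → inv k - inv (suc k) ≡ inv k * inv (suc k)
  inv-tele {k} h = trans (eq₁ (inv k) (inv (suc k)))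
    (trans (cong₂ _-_ (trans (cong (inv k *_) (sym (ι*inv {suc k} (s≤s z≤n)))) refl) (trans (cong (inv (suc k) *_) (sym (ι*inv h))) refl)) (eq₂ (inv k) (inv (suc k)) (ι k)))
    where
    eq₁ : ∀ a b → a - b ≡ a * 1ℚ - b * 1ℚ
    eq₁ = solve-∀ ℚ-ring
    eq₂ : ∀ a b c → a * ((1ℚ + c) * b) - b * (c * a) ≡ a * b
    eq₂ = solve-∀ ℚ-ring

  -- The Iverson bracket, taken of a decision so that conditions enter sums and products as rational
  -- factors.
  χ : ∀ {P : Set} → Dec P → ℚ
  χ (yes _) = 1ℚ
  χ (no _) = 0ℚ

  χ-yes : ∀ {P : Set} (d : Dec P) → P → χ d ≡ 1ℚ
  χ-yes (yes _) _ = refl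
  χ-yes (no ¬p) p = ⊥-elim (¬p p)

  χ-no : ∀ {P : Set} (d : Dec P) → ¬ P → χ d ≡ 0ℚ
  χ-no (yes p) ¬p = ⊥-elim (¬p p)
  χ-no (no _) _ = refl

  χ-iff : ∀ {P Q : Set} (d : Dec P) (e : Dec Q) → (P → Q) → (Q → P) → χ d ≡ χ e
  χ-iff (yes p) e f g = sym (χ-yes e (f p))
  χ-iff (no ¬p) e f g = sym (χ-no e (λ q → ¬p (g q)))

  0≤χ : ∀ {P : Set} (d : Dec P) → 0ℚ ≤ χ d
  0≤χ (yes _) = 0≤1
  0≤χ (no _) = ≤-refl

  χ≤1 : ∀ {P : Set} (d : Dec P) → χ d ≤ 1ℚ
  χ≤1 (yes _) = ≤-refl
  χ≤1 (no _) = 0≤1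

  -- Sums run from 1 to n.
  sum : ℕ → (ℕ → ℚ) → ℚ
  sum zero f = 0ℚ
  sum (suc n) f = sum n f + f (suc n)

  sum-cong : ∀ n {f g} → (∀ k → 1 ℕ.≤ k → k ℕ.≤ n → f k ≡ g k) → sum n f ≡ sum n g
  sum-cong zero h = refl
  sum-cong (suc n) h = cong₂ _+_ (sum-cong n (λ k a b → h k a (ℕ.m≤n⇒m≤1+n b))) (h (suc n) (s≤s z≤n) ℕ.≤-refl)

  sum-ext : ∀ n {f g} → (∀ k → f k ≡ g k) → sum n f ≡ sum n g
  sum-ext n h = sum-cong n (λ k _ _ → h k)

  sum-zero : ∀ n {f} → (∀ k → 1 ℕ.≤ k → k ℕ.≤ n → f k ≡ 0ℚ) → sum n f ≡ 0ℚ
  sum-zero zero h = refl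
  sum-zero (suc n) h = cong₂ _+_ (sum-zero n (λ k a b → h k a (ℕ.m≤n⇒m≤1+n b))) (h (suc n) (s≤s z≤n) ℕ.≤-refl)

  sum-+ : ∀ n f g → sum n (λ k → f k + g k) ≡ sum n f + sum n g
  sum-+ zero f g = refl
  sum-+ (suc n) f g = trans (cong (_+ (f (suc n) + g (suc n))) (sum-+ n f g)) (eq (sum n f) (sum n g) (f (suc n)) (g (suc n)))
    where
    eq : ∀ a b c d → a + b + (c + d) ≡ a + c + (b + d)
    eq = solve-∀ ℚ-ring

  sum-*ˡ : ∀ n c f → sum n (λ k → c * f k) ≡ c * sum n f
  sum-*ˡ zero c f = sym (*-zeroʳ c)
  sum-*ˡ (suc n) c f = trans (cong (_+ c * f (suc n)) (sum-*ˡ n c f)) (sym (*-distribˡ-+ c (sum n f) (f (suc n))))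

  sum-*ʳ : ∀ n c f → sum n (λ k → f k * c) ≡ sum n f * c
  sum-*ʳ n c f = trans (sum-ext n (λ k → *-comm (f k) c)) (trans (sum-*ˡ n c f) (*-comm c (sum n f)))

  sum-neg : ∀ n f → sum n (λ k → - f k) ≡ - sum n f
  sum-neg zero f = refl
  sum-neg (suc n) f = trans (cong (_- f (suc n)) (sum-neg n f)) (sym (neg-distrib-+ (sum n f) (f (suc n))))

  sum-- : ∀ n f g → sum n (λ k → f k - g k) ≡ sum n f - sum n g
  sum-- n f g = trans (sum-+ n f (λ k → - g k)) (cong (sum n f +_) (sum-neg n g))

  sum-mono : ∀ n {f g} → (∀ k → 1 ℕ.≤ k → k ℕ.≤ n → f k ≤ g k) → sum n f ≤ sum n g
  sum-mono zero h = ≤-refl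
  sum-mono (suc n) h = +-mono-≤ (sum-mono n (λ k a b → h k a (ℕ.m≤n⇒m≤1+n b))) (h (suc n) (s≤s z≤n) ℕ.≤-refl)

  sum-nonneg : ∀ n {f} → (∀ k → 1 ℕ.≤ k → k ℕ.≤ n → 0ℚ ≤ f k) → 0ℚ ≤ sum n f
  sum-nonneg zero h = ≤-refl
  sum-nonneg (suc n) h = 0≤+ (sum-nonneg n (λ k a b → h k a (ℕ.m≤n⇒m≤1+n b))) (h (suc n) (s≤s z≤n) ℕ.≤-refl)

  sum-abs : ∀ n {f g} → (∀ k → 1 ℕ.≤ k → k ℕ.≤ n → ∣ f k ∣ ≤ g k) → ∣ sum n f ∣ ≤ sum n g
  sum-abs zero h = ≤-refl
  sum-abs (suc n) h = ∣∣-tri (sum-abs n (λ k a b → h k a (ℕ.m≤n⇒m≤1+n b))) (h (suc n) (s≤s z≤n) ℕ.≤-refl)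

  sum-const : ∀ n c → sum n (λ _ → c) ≡ ι n * c
  sum-const zero c = sym (*-zeroˡ c)
  sum-const (suc n) c = trans (cong (_+ c) (sum-const n c)) (eq (ι n) c)
    where
    eq : ∀ a c → a * c + c ≡ (1ℚ + a) * c
    eq = solve-∀ ℚ-ring

  sum-swap : ∀ m n (f : ℕ → ℕ → ℚ) → sum m (λ i → sum n (f i)) ≡ sum n (λ j → sum m (λ i → f i j))
  sum-swap zero n f = sym (sum-zero n (λ _ _ _ → refl))
  sum-swap (suc m) n f = trans (cong (_+ sum n (f (suc m))) (sum-swap m n f))
    (sym (sum-+ n (λ j → sum m (λ i → f i j)) (f (suc m))))

  sum-append : ∀ m n f → sum (m ℕ.+ n) f ≡ sum m f + sum n (λ k → f (m ℕ.+ k))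
  sum-append m zero f = trans (cong (λ z → sum z f) (ℕ.+-identityʳ m)) (sym (+-identityʳ _))
  sum-append m (suc n) f = trans (cong (λ z → sum z f) (ℕ.+-suc m n))
    (trans (cong₂ _+_ (sum-append m n f) (cong f (sym (ℕ.+-suc m n)))) (+-assoc (sum m f) _ _))

  sum-extend : ∀ {m n} f → m ℕ.≤ n → (∀ k → m ℕ.< k → k ℕ.≤ n → f k ≡ 0ℚ) → sum n f ≡ sum m f
  sum-extend {m} {n} f m≤n h = trans (cong (λ z → sum z f) (sym (ℕ.m+[n∸m]≡n m≤n)))
    (trans (sum-append m (n ℕ.∸ m) f) (trans (cong (sum m f +_) (sum-zero (n ℕ.∸ m)
      (λ k a b → h (m ℕ.+ k) (ℕ.m<m+n m a) (subst (m ℕ.+ k ℕ.≤_) (ℕ.m+[n∸m]≡n m≤n) (ℕ.+-monoʳ-≤ m b))))) (+-identityʳ _)))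

  sum-grow : ∀ {m n} f → m ℕ.≤ n → (∀ k → m ℕ.< k → k ℕ.≤ n → 0ℚ ≤ f k) → sum m f ≤ sum n f
  sum-grow {m} {n} f m≤n h = via (sum (n ℕ.∸ m) (λ k → f (m ℕ.+ k))) (sum-nonneg (n ℕ.∸ m)
      (λ k a b → h (m ℕ.+ k) (ℕ.m<m+n m a) (subst (m ℕ.+ k ℕ.≤_) (ℕ.m+[n∸m]≡n m≤n) (ℕ.+-monoʳ-≤ m b))))
    (trans (cong (λ z → sum z f) (sym (ℕ.m+[n∸m]≡n m≤n))) (sum-append m (n ℕ.∸ m) f))

  sum-single : ∀ n a f → 1 ℕ.≤ a → a ℕ.≤ n → (∀ k → 1 ℕ.≤ k → k ℕ.≤ n → k ≢ a → f k ≡ 0ℚ) → sum n f ≡ f a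
  sum-single zero a f 1≤a a≤n h = ⊥-elim (ℕ.<⇒≱ 1≤a a≤n)
  sum-single (suc n) a f 1≤a a≤n h with a ℕ.≟ suc n
  ... | yes refl = trans (cong (_+ f a) (sum-zero n (λ k p q → h k p (ℕ.m≤n⇒m≤1+n q) (λ e → ℕ.<⇒≢ (s≤s q) e)))) (+-identityˡ (f a))
  ... | no a≢ = trans (cong₂ _+_ (sum-single n a f 1≤a (ℕ.≤-pred (ℕ.≤∧≢⇒< a≤n a≢)) (λ k p q r → h k p (ℕ.m≤n⇒m≤1+n q) r))
       (h (suc n) (s≤s z≤n) ℕ.≤-refl (λ e → a≢ (sym e)))) (+-identityʳ (f a))

  sum-term : ∀ n a f → 1 ℕ.≤ a → a ℕ.≤ n → (∀ k → 1 ℕ.≤ k → k ℕ.≤ n → 0ℚ ≤ f k) → f a ≤ sum n f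
  sum-term n (suc a) f _ a≤n h = ≤-trans
    (via (sum a f) (sum-nonneg a (λ k p q → h k p (ℕ.≤-trans q (ℕ.≤-trans (ℕ.n≤1+n a) a≤n)))) (+-comm (sum a f) (f (suc a))))
    (sum-grow f a≤n (λ k p q → h k (ℕ.≤-trans (s≤s z≤n) p) q))

  -- quo x d = ⌊x / d⌋ for d ≥ 1, as the number of multiples of d up to x.
  quo : ℕ → ℕ → ℕ
  quo zero d = 0
  quo (suc x) d with d ∣? suc x
  ... | yes _ = suc (quo x d)
  ... | no _ = quo x d

  quo-bounds : ∀ x d → 1 ℕ.≤ d → d ℕ.* quo x d ℕ.≤ x × x ℕ.< d ℕ.* suc (quo x d)
  quo-bounds zero d 1≤d = ℕ.≤-reflexive (ℕ.*-zeroʳ d) , ℕ.*-mono-≤ 1≤d (s≤s z≤n)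
  quo-bounds (suc x) d 1≤d with d ∣? suc x | quo-bounds x d 1≤d
  ... | yes (divides c e) | lo , hi = ℕ.≤-reflexive d*c≡ , subst (ℕ._< d ℕ.* suc (suc (quo x d))) d*c≡ (ℕ.*-monoʳ-< d {{ℕ.>-nonZero 1≤d}} (ℕ.n<1+n (suc (quo x d))))
    where
    q<c : quo x d ℕ.< c
    q<c = ℕ.*-cancelˡ-< d _ _ (ℕ.≤-<-trans lo (subst (x ℕ.<_) (trans e (ℕ.*-comm c d)) ℕ.≤-refl))
    c≤q+1 : c ℕ.≤ suc (quo x d)
    c≤q+1 = ℕ.*-cancelˡ-≤ d {{ℕ.>-nonZero 1≤d}} (subst (ℕ._≤ d ℕ.* suc (quo x d)) (trans e (ℕ.*-comm c d)) hi)
    d*c≡ : d ℕ.* suc (quo x d) ≡ suc x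
    d*c≡ = trans (cong (d ℕ.*_) (ℕ.≤-antisym q<c c≤q+1)) (trans (ℕ.*-comm d c) (sym e))
  ... | no ∤ | lo , hi = ℕ.m≤n⇒m≤1+n lo , ℕ.≤∧≢⇒< hi (λ e → ∤ (divides (suc (quo x d)) (trans e (ℕ.*-comm d _))))

  quo-≤ : ∀ {x d k} → 1 ℕ.≤ d → k ℕ.≤ quo x d → d ℕ.* k ℕ.≤ x
  quo-≤ {x} {d} 1≤d h = ℕ.≤-trans (ℕ.*-monoʳ-≤ d h) (proj₁ (quo-bounds x d 1≤d))

  ≤-quo : ∀ {x d k} → 1 ℕ.≤ d → d ℕ.* k ℕ.≤ x → k ℕ.≤ quo x d
  ≤-quo {x} {d} {k} 1≤d h = ℕ.≤-pred (ℕ.*-cancelˡ-< d k (suc (quo x d)) (ℕ.≤-<-trans h (proj₂ (quo-bounds x d 1≤d))))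

  quo-* : ∀ d k → 1 ℕ.≤ d → quo (d ℕ.* k) d ≡ k
  quo-* d k 1≤d = ℕ.≤-antisym (ℕ.*-cancelˡ-≤ d {{ℕ.>-nonZero 1≤d}} (proj₁ (quo-bounds (d ℕ.* k) d 1≤d))) (≤-quo 1≤d ℕ.≤-refl)

  inv-quo : ∀ x d → 1 ℕ.≤ d → ι x * inv (suc (quo x d)) ≤ ι d
  inv-quo x d 1≤d = subst (ι x * inv y ≤_) (trans (cong (_* inv y) (ι-* d y)) (trans (*-assoc (ι d) (ι y) (inv y)) (trans (cong (ι d *_) (ι*inv {y} (s≤s z≤n))) (*-identityʳ (ι d)))))
     (*-monoʳ (inv y) (0≤inv y) (ι-mono (ℕ.<⇒≤ (proj₂ (quo-bounds x d 1≤d)))))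
    where y = suc (quo x d)

  sum-multiples : ∀ x d (g : ℕ → ℚ) → 1 ℕ.≤ d → sum x (λ k → χ (d ∣? k) * g k) ≡ sum (quo x d) (λ k → g (d ℕ.* k))
  sum-multiples zero d g 1≤d = refl
  sum-multiples (suc x) d g 1≤d with d ∣? suc x | quo-bounds (suc x) d 1≤d
  ... | yes (divides c e) | lo , hi = cong₂ _+_ (sum-multiples x d g 1≤d) (trans (*-identityˡ (g (suc x))) (cong g (trans e (trans (ℕ.*-comm c d) (cong (d ℕ.*_) c≡)))))
    where
    c≡ : c ≡ suc (quo x d)
    c≡ = ℕ.≤-antisym (ℕ.≤-pred (ℕ.*-cancelˡ-< d _ _ (subst (ℕ._< d ℕ.* suc (suc (quo x d))) (trans e (ℕ.*-comm c d)) hi)))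
       (ℕ.*-cancelˡ-≤ d {{ℕ.>-nonZero 1≤d}} (subst (d ℕ.* suc (quo x d) ℕ.≤_) (trans e (ℕ.*-comm c d)) lo))
  ... | no _ | _ = trans (cong₂ _+_ (sum-multiples x d g 1≤d) (*-zeroˡ (g (suc x)))) (+-identityʳ _)

  dsum : ℕ → (ℕ → ℚ) → ℚ
  dsum n g = sum n (λ d → χ (d ∣? n) * g d)

  -- No divisor of n exceeds n. A range independent of n is what allows the sums over n and over its
  -- divisors to be interchanged.
  dsum-extend : ∀ {n x} (g : ℕ → ℚ) → 1 ℕ.≤ n → n ℕ.≤ x → sum x (λ d → χ (d ∣? n) * g d) ≡ dsum n g
  dsum-extend {n} g 1≤n n≤x = sum-extend (λ d → χ (d ∣? n) * g d) n≤x
    (λ k p _ → trans (cong (_* g k) (χ-no (k ∣? n) (λ k∣n → ℕ.<⇒≱ p (∣⇒≤ {{ℕ.>-nonZero 1≤n}} k∣n)))) (*-zeroˡ (g k)))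

  -- The sums over n and d are interchanged and n = d k is substituted, which leaves k ≤ ⌊x / d⌋.
  hyperbola : ∀ x (f h : ℕ → ℚ) → sum x (λ n → f n * dsum n h) ≡ sum x (λ d → h d * sum (quo x d) (λ k → f (d ℕ.* k)))
  hyperbola x f h = trans (sum-cong x (λ n 1≤n n≤x → trans (cong (f n *_) (sym (dsum-extend h 1≤n n≤x))) (sym (sum-*ˡ x (f n) _))))
    (trans (sum-swap x x _) (sum-cong x (λ d 1≤d _ → trans (sum-ext x (λ n → eq (f n) (χ (d ∣? n)) (h d)))
      (trans (sum-*ˡ x (h d) _) (cong (h d *_) (sum-multiples x d f 1≤d))))))
    where
    eq : ∀ a b c → a * (b * c) ≡ c * (b * a)
    eq = solve-∀ ℚ-ring

  sum-shift : ∀ n f → sum (suc n) f ≡ f 1 + sum n (f ∘ suc)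
  sum-shift zero f = +-comm 0ℚ (f 1)
  sum-shift (suc n) f = trans (cong (_+ f (suc (suc n))) (sum-shift n f)) (+-assoc (f 1) _ _)

  -- The divisors of q n are the divisors of n prime to q and q times the divisors of n.
  dsum-prime : ∀ q n (g : ℕ → ℚ) → Prime q → 1 ℕ.≤ n →
    dsum (q ℕ.* n) g ≡ dsum n (λ d → (1ℚ - χ (q ∣? d)) * g d + g (q ℕ.* d))
  dsum-prime q n g pq 1≤n = begin
    dsum (q ℕ.* n) g
      ≡⟨ sum-ext (q ℕ.* n) (λ d → eq₁ (χ (d ∣? (q ℕ.* n))) (χ (q ∣? d)) (g d)) ⟩
    sum (q ℕ.* n) (λ d → χ (d ∣? (q ℕ.* n)) * ((1ℚ - χ (q ∣? d)) * g d) + χ (q ∣? d) * (χ (d ∣? (q ℕ.* n)) * g d))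
      ≡⟨ sum-+ (q ℕ.* n) _ _ ⟩
    sum (q ℕ.* n) (λ d → χ (d ∣? (q ℕ.* n)) * ((1ℚ - χ (q ∣? d)) * g d)) + sum (q ℕ.* n) (λ d → χ (q ∣? d) * (χ (d ∣? (q ℕ.* n)) * g d))
      ≡⟨ cong₂ _+_ (sum-ext (q ℕ.* n) part₁) part₂ ⟩
    sum (q ℕ.* n) (λ d → χ (d ∣? n) * ((1ℚ - χ (q ∣? d)) * g d)) + sum n (λ e → χ (e ∣? n) * g (q ℕ.* e))
      ≡⟨ cong (_+ sum n (λ e → χ (e ∣? n) * g (q ℕ.* e))) (dsum-extend {n} (λ d → (1ℚ - χ (q ∣? d)) * g d) 1≤n (ℕ.m≤n*m n q {{prime⇒nonZero pq}})) ⟩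
    dsum n (λ d → (1ℚ - χ (q ∣? d)) * g d) + dsum n (λ e → g (q ℕ.* e))
      ≡⟨ sym (sum-+ n _ _) ⟩
    sum n (λ d → χ (d ∣? n) * ((1ℚ - χ (q ∣? d)) * g d) + χ (d ∣? n) * g (q ℕ.* d))
      ≡⟨ sum-ext n (λ d → sym (*-distribˡ-+ (χ (d ∣? n)) _ _)) ⟩
    dsum n (λ d → (1ℚ - χ (q ∣? d)) * g d + g (q ℕ.* d)) ∎
    where
    open ≡-Reasoning
    1≤q : 1 ℕ.≤ q
    1≤q = ℕ.>-nonZero⁻¹ q {{prime⇒nonZero pq}}
    eq₁ : ∀ a b c → a * c ≡ a * ((1ℚ - b) * c) + b * (a * c)
    eq₁ = solve-∀ ℚ-ring
    eq₂ : ∀ a b → a * ((1ℚ - 1ℚ) * b) ≡ 0ℚ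
    eq₂ = solve-∀ ℚ-ring
    part₁ : ∀ d → χ (d ∣? (q ℕ.* n)) * ((1ℚ - χ (q ∣? d)) * g d) ≡ χ (d ∣? n) * ((1ℚ - χ (q ∣? d)) * g d)
    part₁ d with q ∣? d
    ... | yes _ = trans (eq₂ (χ (d ∣? (q ℕ.* n))) (g d)) (sym (eq₂ (χ (d ∣? n)) (g d)))
    ... | no q∤d = cong (_* ((1ℚ - 0ℚ) * g d)) (χ-iff (d ∣? (q ℕ.* n)) (d ∣? n) f (∣n⇒∣m*n q))
      where
      f : d ∣ q ℕ.* n → d ∣ n
      f (divides k e) with euclidsLemma k d pq (subst (q ∣_) e (m∣m*n n))
      ... | inj₂ q∣d = ⊥-elim (q∤d q∣d)
      ... | inj₁ (divides k' e') = divides k' (ℕ.*-cancelˡ-≡ n (k' ℕ.* d) q {{prime⇒nonZero pq}}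
               (trans e (trans (cong (ℕ._* d) (trans e' (ℕ.*-comm k' q))) (ℕ.*-assoc q k' d))))
    part₂ : sum (q ℕ.* n) (λ d → χ (q ∣? d) * (χ (d ∣? (q ℕ.* n)) * g d)) ≡ sum n (λ e → χ (e ∣? n) * g (q ℕ.* e))
    part₂ = trans (sum-multiples (q ℕ.* n) q (λ d → χ (d ∣? (q ℕ.* n)) * g d) 1≤q)
      (trans (cong (λ z → sum z (λ k → χ ((q ℕ.* k) ∣? (q ℕ.* n)) * g (q ℕ.* k))) (quo-* q n 1≤q))
       (sum-ext n (λ e → cong (_* g (q ℕ.* e)) (χ-iff ((q ℕ.* e) ∣? (q ℕ.* n)) (e ∣? n) (*-cancelˡ-∣ q {{prime⇒nonZero pq}}) (*-monoʳ-∣ q)))))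

-- Möbius and von Mangoldt functions, for arbitrary weights on the primes

module Multiplicative where
  open import Data.Nat.Divisibility
  open import Data.Nat.Primality
  open import Data.Nat.Induction using (<-rec)
  open import Data.Rational as ℚ hiding (nonNegative; nonZero; NonZero)
  open import Data.Rational.Properties
  open import Tactic.RingSolver using (solve-∀)
  open RationalSums

  prime≥2 : ∀ {q} → Prime q → 2 ℕ.≤ q
  prime≥2 {q} pq = ℕ.nonTrivial⇒n>1 q {{prime⇒nonTrivial pq}}

  prime≥1 : ∀ {q} → Prime q → 1 ℕ.≤ q
  prime≥1 pq = ℕ.<⇒≤ (prime≥2 pq)

  prime∤1 : ∀ {q} → Prime q → ¬ q ∣ 1
  prime∤1 pq d = ℕ.<⇒≱ (prime≥2 pq) (∣⇒≤ d)

  prime-∣-prime : ∀ {q q'} → Prime q → Prime q' → q ∣ q' → q ≡ q'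
  prime-∣-prime pq pq' d with prime⇒irreducible pq' d
  ... | inj₁ refl = ⊥-elim (¬prime[1] pq)
  ... | inj₂ e = e

  prime-∣-^ : ∀ {q a} k → Prime q → q ∣ a ℕ.^ k → q ∣ a
  prime-∣-^ zero pq d = ⊥-elim (prime∤1 pq d)
  prime-∣-^ {a = a} (suc k) pq d with euclidsLemma a (a ℕ.^ k) pq d
  ... | inj₁ x = x
  ... | inj₂ y = prime-∣-^ k pq y

  prime-divisor : ∀ n → 2 ℕ.≤ n → ∃ λ q → Prime q × q ∣ n
  prime-divisor = <-rec _ go
    where
    go : ∀ n → (∀ {m} → m ℕ.< n → 2 ℕ.≤ m → ∃ λ q → Prime q × q ∣ m) → 2 ℕ.≤ n → ∃ λ q → Prime q × q ∣ n
    go n rec 2≤n with prime? n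
    ... | yes pn = n , pn , ∣-refl
    ... | no ¬p with ¬prime⇒composite {{ℕ.n>1⇒nonTrivial 2≤n}} ¬p
    ... | composite {d} d<n d∣n with rec d<n (ℕ.nonTrivial⇒n>1 d)
    ... | q , pq , q∣d = q , pq , ∣-trans q∣d d∣n

  -- Takes the place of unique factorisation: arithmetic functions are described here by their
  -- behaviour under n ↦ q n only.
  prime-induction : (P : ℕ → Set) → P 1 → (∀ q n → Prime q → 1 ℕ.≤ n → P n → P (q ℕ.* n)) → ∀ n → 1 ℕ.≤ n → P n
  prime-induction P p1 step = <-rec _ go
    where
    go : ∀ n → (∀ {m} → m ℕ.< n → 1 ℕ.≤ m → P m) → 1 ℕ.≤ n → P n
    go n rec 1≤n with n ℕ.≟ 1
    ... | yes refl = p1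
    ... | no n≢1 with prime-divisor n (ℕ.≤∧≢⇒< 1≤n (λ e → n≢1 (sym e)))
    ... | q , pq , divides zero e = ⊥-elim (ℕ.<⇒≢ 1≤n (sym e))
    ... | q , pq , divides (suc k) e = subst P (trans (ℕ.*-comm q (suc k)) (sym e))
          (step q (suc k) pq (s≤s z≤n) (rec (subst (suc k ℕ.<_) (sym e) (ℕ.m<m*n (suc k) q (prime≥2 pq))) (s≤s z≤n)))

  χ-idem : ∀ {P : Set} (d : Dec P) → χ d * χ d ≡ χ d
  χ-idem (yes _) = refl
  χ-idem (no _) = refl

  dsum-1 : ∀ g → dsum 1 g ≡ g 1
  dsum-1 g = trans (+-identityˡ _) (trans (cong (_* g 1) (χ-yes (1 ∣? 1) ∣-refl)) (*-identityˡ (g 1)))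

  dsum-cong : ∀ n {f g : ℕ → ℚ} → (∀ k → 1 ℕ.≤ k → k ℕ.≤ n → f k ≡ g k) → dsum n f ≡ dsum n g
  dsum-cong n h = sum-cong n (λ k a b → cong (χ (k ∣? n) *_) (h k a b))

  dsum-*ˡ : ∀ n c (f : ℕ → ℚ) → dsum n (λ k → c * f k) ≡ c * dsum n f
  dsum-*ˡ n c f = trans (sum-ext n (λ k → eq (χ (k ∣? n)) c (f k))) (sum-*ˡ n c _)
    where
    eq : ∀ a b c → a * (b * c) ≡ b * (a * c)
    eq = solve-∀ ℚ-ring

  dsum-zero : ∀ n {f : ℕ → ℚ} → (∀ k → 1 ℕ.≤ k → k ℕ.≤ n → f k ≡ 0ℚ) → dsum n f ≡ 0ℚ
  dsum-zero n h = sum-zero n (λ k a b → trans (cong (χ (k ∣? n) *_) (h k a b)) (*-zeroʳ (χ (k ∣? n))))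

  prod : ℕ → (ℕ → ℚ) → ℚ
  prod zero f = 1ℚ
  prod (suc n) f = prod n f * f (suc n)

  prod-cong : ∀ n {f g} → (∀ k → 1 ℕ.≤ k → k ℕ.≤ n → f k ≡ g k) → prod n f ≡ prod n g
  prod-cong zero h = refl
  prod-cong (suc n) h = cong₂ _*_ (prod-cong n (λ k a b → h k a (ℕ.m≤n⇒m≤1+n b))) (h (suc n) (s≤s z≤n) ℕ.≤-refl)

  prod-ones : ∀ n {f} → (∀ k → f k ≡ 1ℚ) → prod n f ≡ 1ℚ
  prod-ones zero h = refl
  prod-ones (suc n) h = cong₂ _*_ (prod-ones n h) (h (suc n))

  prod-abs : ∀ n {f} → (∀ k → ∣ f k ∣ ≤ 1ℚ) → ∣ prod n f ∣ ≤ 1ℚ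
  prod-abs zero h = ≤-refl
  prod-abs (suc n) h = ∣∣-* {b = 1ℚ} (prod-abs n h) (h (suc n))

  prod-zero : ∀ n a {f} → 1 ℕ.≤ a → a ℕ.≤ n → f a ≡ 0ℚ → prod n f ≡ 0ℚ
  prod-zero zero a 1≤a a≤n h = ⊥-elim (ℕ.<⇒≱ 1≤a a≤n)
  prod-zero (suc n) a {f} 1≤a a≤n h with a ℕ.≟ suc n
  ... | yes refl = trans (cong (prod n f *_) h) (*-zeroʳ (prod n f))
  ... | no a≢ = trans (cong (_* f (suc n)) (prod-zero n a 1≤a (ℕ.≤-pred (ℕ.≤∧≢⇒< a≤n a≢)) h)) (*-zeroˡ (f (suc n)))

  -- A change of one factor of a product, written without division because that factor may be 0.
  prod-swap : ∀ n a f g → 1 ℕ.≤ a → a ℕ.≤ n → (∀ k → k ≢ a → f k ≡ g k) → prod n f * g a ≡ prod n g * f a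
  prod-swap zero a f g 1≤a a≤n h = ⊥-elim (ℕ.<⇒≱ 1≤a a≤n)
  prod-swap (suc n) a f g 1≤a a≤n h with a ℕ.≟ suc n
  ... | yes refl = trans (cong (λ z → z * f a * g a) (prod-cong n (λ k p q → h k (ℕ.<⇒≢ (s≤s q))))) (eq (prod n g) (f a) (g a))
    where
    eq : ∀ a b c → a * b * c ≡ a * c * b
    eq = solve-∀ ℚ-ring
  ... | no a≢ = trans (eq (prod n f) (f (suc n)) (g a)) (trans (cong₂ _*_ (prod-swap n a f g 1≤a (ℕ.≤-pred (ℕ.≤∧≢⇒< a≤n a≢)) h) (h (suc n) (λ e → a≢ (sym e))))
       (eq (prod n g) (f a) (g (suc n))))
    where
    eq : ∀ a b c → a * b * c ≡ a * c * b
    eq = solve-∀ ℚ-ring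

  -- μ restricted to the primes up to X, as a product of local factors.
  local : ℕ → ℕ → ℚ
  local q n = 1ℚ - χ (q ∣? n) - χ (q ∣? n) + χ ((q ℕ.* q) ∣? n)

  factor : ℕ → ℕ → ℚ
  factor n q with prime? q
  ... | yes _ = local q n
  ... | no _ = 1ℚ

  factor-prime : ∀ {q} n → Prime q → factor n q ≡ local q n
  factor-prime {q} n pq with prime? q
  ... | yes _ = refl
  ... | no ¬p = ⊥-elim (¬p pq)

  factor-cong : ∀ m n q → (Prime q → local q m ≡ local q n) → factor m q ≡ factor n q
  factor-cong m n q h with prime? q
  ... | yes p = h p
  ... | no _ = refl

  ∣factor∣≤1 : ∀ n q → ∣ factor n q ∣ ≤ 1ℚ
  ∣factor∣≤1 n q with prime? q
  ... | no _ = ≤-refl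
  ... | yes _ with q ∣? n | (q ℕ.* q) ∣? n
  ... | yes _ | yes _ = 0≤1
  ... | yes _ | no _ = ≤-refl
  ... | no _ | no _ = ≤-refl
  ... | no a | yes b = ⊥-elim (a (∣-trans (m∣m*n q) b))

  local-∤ : ∀ {q n} → ¬ q ∣ n → local q n ≡ 1ℚ
  local-∤ {q} {n} h rewrite χ-no (q ∣? n) h | χ-no ((q ℕ.* q) ∣? n) (λ d → h (∣-trans (m∣m*n q) d)) = refl

  local-other : ∀ {q q'} n → Prime q → Prime q' → q' ≢ q → local q' (q ℕ.* n) ≡ local q' n
  local-other {q} {q'} n pq pq' ne = cong₂ (λ a b → 1ℚ - a - a + b)
      (χ-iff (q' ∣? (q ℕ.* n)) (q' ∣? n) f (∣n⇒∣m*n q))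
      (χ-iff ((q' ℕ.* q') ∣? (q ℕ.* n)) ((q' ℕ.* q') ∣? n) g (∣n⇒∣m*n q))
    where
    f : ∀ {n} → q' ∣ q ℕ.* n → q' ∣ n
    f {n} d with euclidsLemma q n pq' d
    ... | inj₁ x = ⊥-elim (ne (prime-∣-prime pq' pq x))
    ... | inj₂ y = y
    g : q' ℕ.* q' ∣ q ℕ.* n → q' ℕ.* q' ∣ n
    g d with f {n} (∣-trans (m∣m*n q') d)
    ... | divides c refl = subst (q' ℕ.* q' ∣_) (ℕ.*-comm q' c) (*-monoʳ-∣ q' (f {c}
            (*-cancelˡ-∣ q' {{prime⇒nonZero pq'}} (subst (q' ℕ.* q' ∣_) (trans (sym (ℕ.*-assoc q c q')) (ℕ.*-comm (q ℕ.* c) q')) d))))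

  module Moebius (X : ℕ) where

    μ : ℕ → ℚ
    μ n = prod X (factor n)

    ∣μ∣≤1 : ∀ n → ∣ μ n ∣ ≤ 1ℚ
    ∣μ∣≤1 n = prod-abs X (∣factor∣≤1 n)

    μ-1 : μ 1 ≡ 1ℚ
    μ-1 = prod-ones X h
      where
      h : ∀ q → factor 1 q ≡ 1ℚ
      h q with prime? q
      ... | yes pq = local-∤ (prime∤1 pq)
      ... | no _ = refl

    -- Only the local factor at q changes: from 1 to -1 if q does not divide n, and to 0 if it does.
    μ-prime : ∀ q n → Prime q → q ℕ.≤ X → μ (q ℕ.* n) ≡ - ((1ℚ - χ (q ∣? n)) * μ n)
    μ-prime q n pq q≤X with q ∣? n
    ... | no q∤n = trans (sym (*-identityʳ (μ (q ℕ.* n)))) (trans (cong (μ (q ℕ.* n) *_) (sym f≡1))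
          (trans (prod-swap X q (factor (q ℕ.* n)) (factor n) (prime≥1 pq) q≤X
            (λ k k≢q → factor-cong (q ℕ.* n) n k (λ pk → local-other n pq pk k≢q)))
          (trans (cong (μ n *_) f≡-1) (eq (μ n)))))
      where
      f≡1 : factor n q ≡ 1ℚ
      f≡1 = trans (factor-prime n pq) (local-∤ q∤n)
      f≡-1 : factor (q ℕ.* n) q ≡ - 1ℚ
      f≡-1 rewrite factor-prime (q ℕ.* n) pq | χ-yes (q ∣? (q ℕ.* n)) (m∣m*n n)
        | χ-no ((q ℕ.* q) ∣? (q ℕ.* n)) (λ d → q∤n (*-cancelˡ-∣ q {{prime⇒nonZero pq}} d)) = refl
      eq : ∀ a → a * - 1ℚ ≡ - ((1ℚ - 0ℚ) * a)
      eq = solve-∀ ℚ-ring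
    ... | yes q∣n = trans (prod-zero X q (prime≥1 pq) q≤X f≡0) (eq (μ n))
      where
      f≡0 : factor (q ℕ.* n) q ≡ 0ℚ
      f≡0 rewrite factor-prime (q ℕ.* n) pq | χ-yes (q ∣? (q ℕ.* n)) (m∣m*n n)
        | χ-yes ((q ℕ.* q) ∣? (q ℕ.* n)) (*-monoʳ-∣ q q∣n) = refl
      eq : ∀ b → 0ℚ ≡ - ((1ℚ - 1ℚ) * b)
      eq = solve-∀ ℚ-ring

    -- For a prime q dividing n = q k, `dsum-prime` pairs each divisor d of k prime to q with q d,
    -- and `μ-prime` makes each pair cancel.
    μ-sum : ∀ n → 1 ℕ.≤ n → n ℕ.≤ X → dsum n μ ≡ χ (n ℕ.≟ 1)
    μ-sum n 1≤n n≤X with n ℕ.≟ 1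
    ... | yes refl = trans (dsum-1 μ) μ-1
    ... | no n≢1 with prime-divisor n (ℕ.≤∧≢⇒< 1≤n (λ e → n≢1 (sym e)))
    ... | q , pq , divides zero e = ⊥-elim (ℕ.<⇒≢ 1≤n (sym e))
    ... | q , pq , divides k@(suc _) e = trans (cong (λ z → dsum z μ) (trans e (ℕ.*-comm k q)))
        (trans (dsum-prime q k μ pq (s≤s z≤n)) (dsum-zero k (λ d _ _ →
          trans (cong ((1ℚ - χ (q ∣? d)) * μ d +_) (μ-prime q d pq (ℕ.≤-trans (∣⇒≤ {{ℕ.>-nonZero 1≤n}} (divides k e)) n≤X))) (+-inverseʳ ((1ℚ - χ (q ∣? d)) * μ d)))))

    -- The Möbius sum over the divisors prime to q. As long as the primes of n are at most X, it is
    -- 1 if n is a power of q and 0 otherwise, which the next three lemmas express recursively.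
    μ-coprime : ℕ → ℕ → ℚ
    μ-coprime q n = dsum n (λ d → (1ℚ - χ (q ∣? d)) * μ d)

    μ-coprime-1 : ∀ q → Prime q → μ-coprime q 1 ≡ 1ℚ
    μ-coprime-1 q pq = trans (dsum-1 (λ d → (1ℚ - χ (q ∣? d)) * μ d)) (cong₂ (λ a b → (1ℚ - a) * b) (χ-no (q ∣? 1) (prime∤1 pq)) μ-1)

    μ-coprime-same : ∀ q n → Prime q → 1 ℕ.≤ n → μ-coprime q (q ℕ.* n) ≡ μ-coprime q n
    μ-coprime-same q n pq 1≤n = trans (dsum-prime q n _ pq 1≤n) (dsum-cong n (λ d _ _ → h d))
      where
      eq : ∀ a b c → a * a ≡ a → (1ℚ - a) * ((1ℚ - a) * b) + (1ℚ - 1ℚ) * c ≡ (1ℚ - a) * b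
      eq a b c i = trans (eq₁ a b c) (trans (cong (λ z → (1ℚ - a - a + z) * b) i) (eq₂ a b))
        where
        eq₁ : ∀ a b c → (1ℚ - a) * ((1ℚ - a) * b) + (1ℚ - 1ℚ) * c ≡ (1ℚ - a - a + a * a) * b
        eq₁ = solve-∀ ℚ-ring
        eq₂ : ∀ a b → (1ℚ - a - a + a) * b ≡ (1ℚ - a) * b
        eq₂ = solve-∀ ℚ-ring
      h : ∀ d → (1ℚ - χ (q ∣? d)) * ((1ℚ - χ (q ∣? d)) * μ d) + (1ℚ - χ (q ∣? (q ℕ.* d))) * μ (q ℕ.* d) ≡ (1ℚ - χ (q ∣? d)) * μ d
      h d = trans (cong (λ z → (1ℚ - χ (q ∣? d)) * ((1ℚ - χ (q ∣? d)) * μ d) + (1ℚ - z) * μ (q ℕ.* d)) (χ-yes (q ∣? (q ℕ.* d)) (m∣m*n d)))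
        (eq (χ (q ∣? d)) (μ d) (μ (q ℕ.* d)) (χ-idem (q ∣? d)))

    μ-coprime-other : ∀ q q' n → Prime q → Prime q' → q' ≢ q → q' ℕ.≤ X → 1 ℕ.≤ n → μ-coprime q (q' ℕ.* n) ≡ 0ℚ
    μ-coprime-other q q' n pq pq' ne q'≤X 1≤n = trans (dsum-prime q' n _ pq' 1≤n) (dsum-zero n (λ d _ _ →
       trans (cong₂ (λ a b → (1ℚ - χ (q' ∣? d)) * ((1ℚ - χ (q ∣? d)) * μ d) + (1ℚ - a) * b) (χ-iff (q ∣? (q' ℕ.* d)) (q ∣? d) (f d) (∣n⇒∣m*n q')) (μ-prime q' d pq' q'≤X))
         (eq (χ (q ∣? d)) (χ (q' ∣? d)) (μ d))))
      where
      f : ∀ d → q ∣ q' ℕ.* d → q ∣ d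
      f d x with euclidsLemma q' d pq x
      ... | inj₁ y = ⊥-elim (ne (sym (prime-∣-prime pq pq' y)))
      ... | inj₂ y = y
      eq : ∀ a b c → (1ℚ - b) * ((1ℚ - a) * c) + (1ℚ - a) * - ((1ℚ - b) * c) ≡ 0ℚ
      eq = solve-∀ ℚ-ring

  m<2^m : ∀ m → m ℕ.< 2 ℕ.^ m
  m<2^m zero = s≤s z≤n
  m<2^m (suc m) = subst (suc (suc m) ℕ.≤_) (cong (2 ℕ.^ m ℕ.+_) (sym (ℕ.+-identityʳ (2 ℕ.^ m))))
    (ℕ.+-mono-≤ {1} (ℕ.≤-trans (s≤s z≤n) (m<2^m m)) (m<2^m m))

  m<q^m : ∀ {q} m → 2 ℕ.≤ q → m ℕ.< q ℕ.^ m
  m<q^m m h = ℕ.<-≤-trans (m<2^m m) (ℕ.^-monoˡ-≤ m h)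

  module Mangoldt (X : ℕ) (β : ℕ → ℚ) (0≤β : ∀ q → 0ℚ ≤ β q) where
    open Moebius X

    -- Counts the exponents k ≥ 1 with q^k = n; for a prime q and n ≤ X the range k ≤ X is enough
    -- because q^k > k.
    powers : ℕ → ℕ → ℚ
    powers n q = sum X (λ k → χ (q ℕ.^ k ℕ.≟ n))

    -- The von Mangoldt function with `β q` in the role of log q. It is a sum over all primes
    -- instead of a case distinction on n, so that its recursion is an identity between sums.
    Λ : ℕ → ℚ
    Λ n = sum X (λ q → χ (prime? q) * (β q * powers n q))

    L : ℕ → ℚ
    L n = dsum n Λ

    0≤Λ : ∀ n → 0ℚ ≤ Λ n
    0≤Λ n = sum-nonneg X (λ q _ _ → 0≤* (0≤χ (prime? q)) (0≤* (0≤β q) (sum-nonneg X (λ k _ _ → 0≤χ (q ℕ.^ k ℕ.≟ n)))))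

    0≤L : ∀ n → 0ℚ ≤ L n
    0≤L n = sum-nonneg n (λ d _ _ → 0≤* (0≤χ (d ∣? n)) (0≤Λ d))

    powers-∤ : ∀ q q' n → Prime q → Prime q' → q ≢ q' → q ∣ n → powers n q' ≡ 0ℚ
    powers-∤ q q' n pq pq' ne q∣n = sum-zero X (λ k _ _ → χ-no (q' ℕ.^ k ℕ.≟ n)
      (λ { refl → ne (prime-∣-prime pq pq' (prime-∣-^ k pq q∣n)) }))

    powers-step : ∀ q e → Prime q → 1 ℕ.≤ X → e ℕ.≤ X → powers (q ℕ.* e) q ≡ χ (q ∣? e) * powers e q + χ (e ℕ.≟ 1)
    powers-step q e pq 1≤X e≤X = go X refl 1≤X
      where
      go : ∀ Y → Y ≡ X → 1 ℕ.≤ Y → sum Y (λ k → χ (q ℕ.^ k ℕ.≟ q ℕ.* e)) ≡ χ (q ∣? e) * powers e q + χ (e ℕ.≟ 1)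
      go (suc Y) refl _ = begin
        sum (suc Y) (λ k → χ (q ℕ.^ k ℕ.≟ q ℕ.* e))
          ≡⟨ sum-shift Y (λ k → χ (q ℕ.^ k ℕ.≟ q ℕ.* e)) ⟩
        χ (q ℕ.* 1 ℕ.≟ q ℕ.* e) + sum Y (λ k → χ (q ℕ.* q ℕ.^ k ℕ.≟ q ℕ.* e))
          ≡⟨ cong₂ _+_ (χ-iff (q ℕ.* 1 ℕ.≟ q ℕ.* e) (e ℕ.≟ 1) (λ h → sym (cancel h)) (λ h → cong (q ℕ.*_) (sym h)))
               (sum-ext Y (λ k → χ-iff (q ℕ.* q ℕ.^ k ℕ.≟ q ℕ.* e) (q ℕ.^ k ℕ.≟ e) cancel (cong (q ℕ.*_)))) ⟩
        χ (e ℕ.≟ 1) + sum Y (λ k → χ (q ℕ.^ k ℕ.≟ e))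
          ≡⟨ cong (χ (e ℕ.≟ 1) +_) (sym (trans (cong (sum Y (λ k → χ (q ℕ.^ k ℕ.≟ e)) +_) last) (+-identityʳ _))) ⟩
        χ (e ℕ.≟ 1) + powers e q
          ≡⟨ cong (χ (e ℕ.≟ 1) +_) (trans (sum-cong X (λ { (suc k) _ _ → absorb k })) (sum-*ˡ X (χ (q ∣? e)) _)) ⟩
        χ (e ℕ.≟ 1) + χ (q ∣? e) * powers e q
          ≡⟨ +-comm (χ (e ℕ.≟ 1)) _ ⟩
        χ (q ∣? e) * powers e q + χ (e ℕ.≟ 1) ∎
        where
        open ≡-Reasoning
        cancel : ∀ {a b} → q ℕ.* a ≡ q ℕ.* b → a ≡ b
        cancel {a} {b} = ℕ.*-cancelˡ-≡ a b q {{prime⇒nonZero pq}}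
        -- The exponent lost by the shift is X itself, and q^X > X ≥ e.
        last : χ (q ℕ.^ suc Y ℕ.≟ e) ≡ 0ℚ
        last = χ-no (q ℕ.^ suc Y ℕ.≟ e) (λ { refl → ℕ.<⇒≱ (m<q^m (suc Y) (prime≥2 pq)) e≤X })
        absorb : ∀ k → χ (q ℕ.^ suc k ℕ.≟ e) ≡ χ (q ∣? e) * χ (q ℕ.^ suc k ℕ.≟ e)
        absorb k with q ℕ.^ suc k ℕ.≟ e
        ... | yes refl = sym (trans (cong (_* 1ℚ) (χ-yes (q ∣? (q ℕ.* q ℕ.^ k)) (m∣m*n (q ℕ.^ k)))) refl)
        ... | no _ = sym (*-zeroʳ (χ (q ∣? e)))

    -- q e is a prime power only if it is a power of q: either e = 1, or q already divides e and e
    -- is itself such a power.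
    Λ-prime : ∀ q e → Prime q → 1 ℕ.≤ e → q ℕ.* e ℕ.≤ X → Λ (q ℕ.* e) ≡ χ (q ∣? e) * Λ e + χ (e ℕ.≟ 1) * β q
    Λ-prime q e pq 1≤e qe≤X = begin
      Λ (q ℕ.* e)
        ≡⟨ sum-ext X term ⟩
      sum X (λ q' → χ (q ∣? e) * (χ (prime? q') * (β q' * powers e q')) + χ (e ℕ.≟ 1) * (χ (q' ℕ.≟ q) * β q'))
        ≡⟨ sum-+ X _ _ ⟩
      sum X (λ q' → χ (q ∣? e) * (χ (prime? q') * (β q' * powers e q'))) + sum X (λ q' → χ (e ℕ.≟ 1) * (χ (q' ℕ.≟ q) * β q'))
        ≡⟨ cong₂ _+_ (sum-*ˡ X (χ (q ∣? e)) (λ q' → χ (prime? q') * (β q' * powers e q'))) (sum-*ˡ X (χ (e ℕ.≟ 1)) (λ q' → χ (q' ℕ.≟ q) * β q')) ⟩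
      χ (q ∣? e) * Λ e + χ (e ℕ.≟ 1) * sum X (λ q' → χ (q' ℕ.≟ q) * β q')
        ≡⟨ cong (λ z → χ (q ∣? e) * Λ e + χ (e ℕ.≟ 1) * z) (trans (sum-single X q _ (prime≥1 pq) q≤X
             (λ k _ _ ne → trans (cong (_* β k) (χ-no (k ℕ.≟ q) ne)) (*-zeroˡ (β k)))) (trans (cong (_* β q) (χ-yes (q ℕ.≟ q) refl)) (*-identityˡ (β q)))) ⟩
      χ (q ∣? e) * Λ e + χ (e ℕ.≟ 1) * β q ∎
      where
      open ≡-Reasoning
      q≤X : q ℕ.≤ X
      q≤X = ℕ.≤-trans (ℕ.m≤m*n q e {{ℕ.>-nonZero 1≤e}}) qe≤X
      e≤X : e ℕ.≤ X
      e≤X = ℕ.≤-trans (ℕ.m≤n*m e q {{prime⇒nonZero pq}}) qe≤X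
      eq₁ : ∀ a b c d → 1ℚ * (b * (a * d + c)) ≡ a * (1ℚ * (b * d)) + c * (1ℚ * b)
      eq₁ = solve-∀ ℚ-ring
      eq₃ : ∀ b d → 1ℚ * (b * 0ℚ) ≡ 0ℚ + d * (0ℚ * b)
      eq₃ = solve-∀ ℚ-ring
      term : ∀ q' → χ (prime? q') * (β q' * powers (q ℕ.* e) q') ≡
                    χ (q ∣? e) * (χ (prime? q') * (β q' * powers e q')) + χ (e ℕ.≟ 1) * (χ (q' ℕ.≟ q) * β q')
      term q' = go (prime? q') (q' ℕ.≟ q)
        where
        go : ∀ (a : Dec (Prime q')) (b : Dec (q' ≡ q)) → χ a * (β q' * powers (q ℕ.* e) q') ≡
                    χ (q ∣? e) * (χ a * (β q' * powers e q')) + χ (e ℕ.≟ 1) * (χ b * β q')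
        go (yes _) (yes refl) = trans (cong (λ z → 1ℚ * (β q * z)) (powers-step q e pq (ℕ.≤-trans (prime≥1 pq) q≤X) e≤X))
             (eq₁ (χ (q ∣? e)) (β q) (χ (e ℕ.≟ 1)) (powers e q))
        go (no ¬p) (yes refl) = ⊥-elim (¬p pq)
        go (no _) (no _) = trans (*-zeroˡ (β q' * powers (q ℕ.* e) q')) (sym (trans (cong₂ (λ a b → χ (q ∣? e) * a + χ (e ℕ.≟ 1) * b) (*-zeroˡ (β q' * powers e q')) (*-zeroˡ (β q'))) (eqz (χ (q ∣? e)) (χ (e ℕ.≟ 1)))))
          where
          eqz : ∀ a b → a * 0ℚ + b * 0ℚ ≡ 0ℚ
          eqz = solve-∀ ℚ-ring
        go (yes pq') (no ne) = trans (cong (λ z → 1ℚ * (β q' * z)) (powers-∤ q q' (q ℕ.* e) pq pq' (λ x → ne (sym x)) (m∣m*n e)))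
           (trans (eq₃ (β q') (χ (e ℕ.≟ 1))) (cong (_+ χ (e ℕ.≟ 1) * (0ℚ * β q')) (sym zero')))
          where
          eq₄ : ∀ a b → a * (1ℚ * (b * 0ℚ)) ≡ 0ℚ
          eq₄ = solve-∀ ℚ-ring
          zero' : χ (q ∣? e) * (1ℚ * (β q' * powers e q')) ≡ 0ℚ
          zero' with q ∣? e
          ... | no _ = *-zeroˡ (1ℚ * (β q' * powers e q'))
          ... | yes q∣e = trans (cong (λ z → 1ℚ * (1ℚ * (β q' * z))) (powers-∤ q q' e pq pq' (λ x → ne (sym x)) q∣e)) (eq₄ 1ℚ (β q'))

    Λ-two : ∀ q q' n → Prime q → Prime q' → q ≢ q' → q ∣ n → q' ∣ n → Λ n ≡ 0ℚ
    Λ-two q q' n pq pq' ne q∣n q'∣n = sum-zero X (λ a _ _ → go a (prime? a))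
      where
      eq₃ : ∀ b → 1ℚ * (b * 0ℚ) ≡ 0ℚ
      eq₃ = solve-∀ ℚ-ring
      go : ∀ a (d : Dec (Prime a)) → χ d * (β a * powers n a) ≡ 0ℚ
      go a (no _) = *-zeroˡ (β a * powers n a)
      go a (yes pa) with q ℕ.≟ a
      ... | no q≢a = trans (cong (λ z → 1ℚ * (β a * z)) (powers-∤ q a n pq pa q≢a q∣n)) (eq₃ (β a))
      ... | yes refl = trans (cong (λ z → 1ℚ * (β a * z)) (powers-∤ q' a n pq' pa (λ e → ne (sym e)) q'∣n)) (eq₃ (β a))

    Λ-1 : Λ 1 ≡ 0ℚ
    Λ-1 = sum-zero X (λ a _ _ → go a (prime? a))
      where
      eq₃ : ∀ b → 1ℚ * (b * 0ℚ) ≡ 0ℚ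
      eq₃ = solve-∀ ℚ-ring
      go : ∀ a (d : Dec (Prime a)) → χ d * (β a * powers 1 a) ≡ 0ℚ
      go a (no _) = *-zeroˡ (β a * powers 1 a)
      go a (yes pa) = trans (cong (λ z → 1ℚ * (β a * z)) (sum-zero X λ { (suc k) _ _ → χ-no (a ℕ.^ suc k ℕ.≟ 1) (λ e → prime∤1 pa (subst (a ∣_) e (m∣m*n (a ℕ.^ k)))) })) (eq₃ (β a))

    L-1 : L 1 ≡ 0ℚ
    L-1 = trans (dsum-1 Λ) Λ-1

    -- Complete additivity. After `dsum-prime` the part of Λ on divisors prime to q and the part on
    -- multiples of q recombine to Λ, and the divisor d = 1 alone adds `β q`.
    L-prime : ∀ q n → Prime q → 1 ℕ.≤ n → q ℕ.* n ℕ.≤ X → L (q ℕ.* n) ≡ β q + L n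
    L-prime q n pq 1≤n qn≤X = begin
      dsum (q ℕ.* n) Λ
        ≡⟨ dsum-prime q n Λ pq 1≤n ⟩
      dsum n (λ d → (1ℚ - χ (q ∣? d)) * Λ d + Λ (q ℕ.* d))
        ≡⟨ dsum-cong n (λ d 1≤d d≤n → trans (cong ((1ℚ - χ (q ∣? d)) * Λ d +_) (Λ-prime q d pq 1≤d (ℕ.≤-trans (ℕ.*-monoʳ-≤ q d≤n) qn≤X)))
             (eq (χ (q ∣? d)) (Λ d) (χ (d ℕ.≟ 1)) (β q))) ⟩
      dsum n (λ d → χ (d ℕ.≟ 1) * β q + Λ d)
        ≡⟨ trans (sum-ext n (λ d → *-distribˡ-+ (χ (d ∣? n)) _ _)) (sum-+ n _ _) ⟩
      dsum n (λ d → χ (d ℕ.≟ 1) * β q) + L n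
        ≡⟨ cong (_+ L n) (trans (sum-single n 1 _ ℕ.≤-refl 1≤n (λ k _ _ ne → trans (cong (λ z → χ (k ∣? n) * (z * β q)) (χ-no (k ℕ.≟ 1) ne)) (eq₂ (χ (k ∣? n)) (β q))))
             (trans (cong (_* (1ℚ * β q)) (χ-yes (1 ∣? n) (1∣ n))) (eq₃ (β q)))) ⟩
      β q + L n ∎
      where
      open ≡-Reasoning
      eq : ∀ a b c d → (1ℚ - a) * b + (a * b + c * d) ≡ c * d + b
      eq = solve-∀ ℚ-ring
      eq₂ : ∀ a b → a * (0ℚ * b) ≡ 0ℚ
      eq₂ = solve-∀ ℚ-ring
      eq₃ : ∀ b → 1ℚ * (1ℚ * b) ≡ b
      eq₃ = solve-∀ ℚ-ring

    -- Both sides are `β q` if n is a power of q and vanish otherwise; the induction strips one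
    -- prime of n at a time.
    Λ-μ-coprime : ∀ q n → Prime q → 1 ℕ.≤ n → q ℕ.* n ℕ.≤ X → Λ (q ℕ.* n) ≡ β q * μ-coprime q n
    Λ-μ-coprime q n pq 1≤n = prime-induction (λ n → q ℕ.* n ℕ.≤ X → Λ (q ℕ.* n) ≡ β q * μ-coprime q n) base step n 1≤n
      where
      eq₁ : ∀ a b → a * 0ℚ + 1ℚ * b ≡ b * 1ℚ
      eq₁ = solve-∀ ℚ-ring
      eq₂ : ∀ a b → 1ℚ * a + 0ℚ * b ≡ a
      eq₂ = solve-∀ ℚ-ring
      base : q ℕ.* 1 ℕ.≤ X → Λ (q ℕ.* 1) ≡ β q * μ-coprime q 1
      base h = trans (Λ-prime q 1 pq ℕ.≤-refl h) (trans (cong (λ z → χ (q ∣? 1) * z + 1ℚ * β q) Λ-1)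
        (trans (eq₁ (χ (q ∣? 1)) (β q)) (cong (β q *_) (sym (μ-coprime-1 q pq)))))
      step : ∀ q' n → Prime q' → 1 ℕ.≤ n → (q ℕ.* n ℕ.≤ X → Λ (q ℕ.* n) ≡ β q * μ-coprime q n) →
             q ℕ.* (q' ℕ.* n) ℕ.≤ X → Λ (q ℕ.* (q' ℕ.* n)) ≡ β q * μ-coprime q (q' ℕ.* n)
      step q' n pq' 1≤n ih h with q' ℕ.≟ q
      ... | yes refl = trans (Λ-prime q (q ℕ.* n) pq (ℕ.*-mono-≤ (prime≥1 pq) 1≤n) h)
            (trans (cong₂ (λ a b → a * Λ (q ℕ.* n) + b * β q) (χ-yes (q ∣? (q ℕ.* n)) (m∣m*n n)) (χ-no (q ℕ.* n ℕ.≟ 1) (λ e → prime∤1 pq (subst (q ∣_) e (m∣m*n n)))))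
            (trans (eq₂ (Λ (q ℕ.* n)) (β q)) (trans (ih (ℕ.≤-trans (ℕ.m≤n*m (q ℕ.* n) q {{prime⇒nonZero pq}}) h)) (cong (β q *_) (sym (μ-coprime-same q n pq 1≤n))))))
      ... | no ne = trans (Λ-two q q' _ pq pq' (λ e → ne (sym e)) (m∣m*n (q' ℕ.* n)) (∣n⇒∣m*n q (m∣m*n n)))
            (sym (trans (cong (β q *_) (μ-coprime-other q q' n pq pq' ne q'≤X 1≤n)) (*-zeroʳ (β q))))
        where
        q'≤X : q' ℕ.≤ X
        q'≤X = ℕ.≤-trans (ℕ.m≤m*n q' n {{ℕ.>-nonZero 1≤n}}) (ℕ.≤-trans (ℕ.m≤n*m (q' ℕ.* n) q {{prime⇒nonZero pq}}) h)

    -- Möbius inversion of L = 1 ⋆ Λ without a double sum. With n = q k, the terms d and q d carry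
    -- opposite signs and L (q d) - L d = `β q`, so -`β q` times `μ-coprime q k` remains.
    μL : ∀ n → 1 ℕ.≤ n → n ℕ.≤ X → dsum n (λ d → μ d * L d) ≡ - Λ n
    μL n 1≤n n≤X with n ℕ.≟ 1
    ... | yes refl = trans (dsum-1 (λ d → μ d * L d)) (trans (cong (μ 1 *_) L-1) (trans (*-zeroʳ (μ 1)) (cong -_ (sym Λ-1))))
    ... | no n≢1 with prime-divisor n (ℕ.≤∧≢⇒< 1≤n (λ e → n≢1 (sym e)))
    ... | q , pq , divides zero e = ⊥-elim (ℕ.<⇒≢ 1≤n (sym e))
    ... | q , pq , divides k@(suc _) e = subst (λ n → dsum n (λ d → μ d * L d) ≡ - Λ n) (sym n≡)
        (trans (dsum-prime q k _ pq (s≤s z≤n)) (trans (dsum-cong k (λ d 1≤d d≤k →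
          trans (cong₂ (λ a b → (1ℚ - χ (q ∣? d)) * (μ d * L d) + a * b) (μ-prime q d pq q≤X) (L-prime q d pq 1≤d (ℕ.≤-trans (ℕ.*-monoʳ-≤ q d≤k) qk≤X)))
            (eq (χ (q ∣? d)) (μ d) (L d) (β q))))
          (trans (dsum-*ˡ k (- β q) (λ d → (1ℚ - χ (q ∣? d)) * μ d)) (trans (sym (neg-distribˡ-* (β q) _)) (cong -_ (sym (Λ-μ-coprime q k pq (s≤s z≤n) qk≤X)))))))
      where
      n≡ : n ≡ q ℕ.* k
      n≡ = trans e (ℕ.*-comm k q)
      qk≤X : q ℕ.* k ℕ.≤ X
      qk≤X = subst (ℕ._≤ X) n≡ n≤X
      q≤X : q ℕ.≤ X
      q≤X = ℕ.≤-trans (ℕ.m≤m*n q k) qk≤X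
      eq : ∀ a m l b → (1ℚ - a) * (m * l) + - ((1ℚ - a) * m) * (b + l) ≡ - b * ((1ℚ - a) * m)
      eq = solve-∀ ℚ-ring

-- Contribution of prime powers, and the convolution of a real character with 1

module PrimePowerSums where
  open import Data.Nat.Divisibility
  open import Data.Nat.Primality
  open import Data.Nat.Induction using (<-rec)
  open import Data.Rational as ℚ hiding (nonNegative; nonZero; NonZero)
  open import Data.Rational.Properties
  open import Tactic.RingSolver using (solve-∀)
  open RationalSums
  open Multiplicative

  inv2 : inv 2 + inv 2 ≡ 1ℚ
  inv2 = trans (eq (inv 2)) (ι*inv {2} (s≤s z≤n))
    where
    eq : ∀ a → a + a ≡ (1ℚ + (1ℚ + 0ℚ)) * a
    eq = solve-∀ ℚ-ring

  geometric : ∀ q M → 2 ℕ.≤ q → sum M (λ k → inv (q ℕ.^ k)) ≤ inv q + inv q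
  geometric q M 2≤q = ≤-trans (via ((inv q + inv q) * inv (q ℕ.^ M)) (0≤* (0≤+ (0≤inv q) (0≤inv q)) (0≤inv (q ℕ.^ M))) refl) (go M)
    where
    a = inv q
    1≤q : 1 ℕ.≤ q
    1≤q = ℕ.<⇒≤ 2≤q
    2a≤1 : a + a ≤ 1ℚ
    2a≤1 = ≤-trans (+-mono-≤ (inv-anti {2} {q} (s≤s z≤n) 2≤q) (inv-anti {2} {q} (s≤s z≤n) 2≤q)) (≤-reflexive inv2)
    -- The added remainder 2 a q^(-M) lets the induction close, because 2 a ≤ 1.
    go : ∀ M → sum M (λ k → inv (q ℕ.^ k)) + (a + a) * inv (q ℕ.^ M) ≤ a + a
    go zero = ≤-reflexive (eq a)
      where
      eq : ∀ a → 0ℚ + (a + a) * 1ℚ ≡ a + a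
      eq = solve-∀ ℚ-ring
    go (suc M) = subst (λ z → sum M (λ k → inv (q ℕ.^ k)) + z + (a + a) * z ≤ a + a) (sym (inv-* {q} {q ℕ.^ M} 1≤q (ℕ.m^n>0 q {{ℕ.>-nonZero 1≤q}} M)))
        (≤-trans (via (a * b * (1ℚ - (a + a))) (0≤* (0≤* (0≤inv q) (0≤inv (q ℕ.^ M))) (0≤y-x 2a≤1)) (eq (sum M (λ k → inv (q ℕ.^ k))) a b)) (go M))
      where
      b = inv (q ℕ.^ M)
      eq : ∀ s a b → s + (a + a) * b ≡ s + a * b + (a + a) * (a * b) + a * b * (1ℚ - (a + a))
      eq = solve-∀ ℚ-ring

  sum-pick : ∀ X a (w : ℕ → ℚ) → 1 ℕ.≤ a → a ℕ.≤ X → sum X (λ n → χ (a ℕ.≟ n) * w n) ≡ w a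
  sum-pick X a w 1≤a a≤X = trans (sum-single X a (λ n → χ (a ℕ.≟ n) * w n) 1≤a a≤X
      (λ k _ _ ne → trans (cong (_* w k) (χ-no (a ℕ.≟ k) (λ e → ne (sym e)))) (*-zeroˡ (w k))))
    (trans (cong (_* w a) (χ-yes (a ℕ.≟ a) refl)) (*-identityˡ (w a)))

  module PrimePowers (X : ℕ) (β : ℕ → ℚ) (0≤β : ∀ q → 0ℚ ≤ β q) where
    open Mangoldt X β 0≤β

    module _ (N : ℕ) (g : ℕ → ℚ) (0≤g : ∀ n → 0ℚ ≤ g n) (g≤1 : ∀ n → g n ≤ 1ℚ)
             (g-prime : ∀ q → Prime q → N ℕ.< q → q ℕ.≤ X → g q ≡ 0ℚ) where

      w : ℕ → ℚ
      w n = g n * inv n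

      w≤inv : ∀ n → w n ≤ inv n
      w≤inv n = subst (w n ≤_) (*-identityˡ (inv n)) (*-monoʳ (inv n) (0≤inv n) (g≤1 n))

      H : ℕ → ℕ → ℚ
      H q k = sum X (λ n → χ (q ℕ.^ k ℕ.≟ n) * w n)

      H≤ : ∀ q k → 1 ℕ.≤ q → H q k ≤ inv (q ℕ.^ k)
      H≤ q k 1≤q with q ℕ.^ k ℕ.≤? X
      ... | yes h = subst (_≤ inv (q ℕ.^ k)) (sym (sum-pick X (q ℕ.^ k) w (ℕ.m^n>0 q {{ℕ.>-nonZero 1≤q}} k) h)) (w≤inv (q ℕ.^ k))
      ... | no h = subst (_≤ inv (q ℕ.^ k)) (sym (sum-zero X (λ n _ n≤X → trans (cong (_* w n) (χ-no (q ℕ.^ k ℕ.≟ n) (λ { refl → h n≤X }))) (*-zeroˡ (w n))))) (0≤inv (q ℕ.^ k))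

      -- The first power counts only below N, by `g-prime`; the higher powers are 1/q times a
      -- geometric sum of at most 2/q.
      G≤ : ∀ q → Prime q → q ℕ.≤ X → sum X (H q) ≤ χ (q ℕ.≤? N) + (inv q * inv q + inv q * inv q)
      G≤ q pq q≤X = go X refl (ℕ.≤-trans (prime≥1 pq) q≤X)
        where
        a = inv q
        first : H q 1 ≤ χ (q ℕ.≤? N)
        first with q ℕ.≤? N
        ... | yes _ = ≤-trans (H≤ q 1 (prime≥1 pq)) (inv≤1 (q ℕ.^ 1))
        ... | no h = ≤-reflexive (trans (sum-pick X (q ℕ.^ 1) w (subst (1 ℕ.≤_) (sym (ℕ.^-identityʳ q)) (prime≥1 pq)) (subst (ℕ._≤ X) (sym (ℕ.^-identityʳ q)) q≤X))
             (trans (cong w (ℕ.^-identityʳ q)) (trans (cong (_* inv q) (g-prime q pq (ℕ.≰⇒> h) q≤X)) (*-zeroˡ (inv q)))))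
        go : ∀ Y → Y ≡ X → 1 ℕ.≤ Y → sum Y (H q) ≤ χ (q ℕ.≤? N) + (a * a + a * a)
        go (suc Y) e _ = subst (_≤ χ (q ℕ.≤? N) + (a * a + a * a)) (sym (sum-shift Y (H q))) (+-mono-≤ first
          (≤-trans (sum-mono Y (λ k _ _ → H≤ q (suc k) (prime≥1 pq)))
          (≤-trans (≤-reflexive (trans (sum-ext Y (λ k → inv-* {q} {q ℕ.^ k} (prime≥1 pq) (ℕ.m^n>0 q {{prime⇒nonZero pq}} k))) (sum-*ˡ Y a (λ k → inv (q ℕ.^ k)))))
          (≤-trans (*-monoˡ a (0≤inv q) (geometric q Y (prime≥2 pq))) (≤-reflexive (*-distribˡ-+ a a a))))))

      -- To be applied to the indicator of a class without primes beyond N: only small primes and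
      -- proper prime powers are left, and these give a convergent sum.
      prime-power-bound : sum X (λ n → g n * (Λ n * inv n)) ≤ sum X (λ q → χ (prime? q) * (β q * (χ (q ℕ.≤? N) + (inv q * inv q + inv q * inv q))))
      prime-power-bound = ≤-trans (≤-reflexive expand) (sum-mono X (λ q _ q≤X → bd q q≤X (prime? q)))
        where
        bd : ∀ q → q ℕ.≤ X → (d : Dec (Prime q)) → χ d * (β q * sum X (H q)) ≤ χ d * (β q * (χ (q ℕ.≤? N) + (inv q * inv q + inv q * inv q)))
        bd q q≤X (yes pq) = *-monoˡ 1ℚ 0≤1 (*-monoˡ (β q) (0≤β q) (G≤ q pq q≤X))
        bd q q≤X (no _) = ≤-reflexive (trans (*-zeroˡ (β q * sum X (H q))) (sym (*-zeroˡ (β q * (χ (q ℕ.≤? N) + (inv q * inv q + inv q * inv q))))))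
        eq₁ : ∀ a b c → a * (b * c) ≡ a * c * b
        eq₁ = solve-∀ ℚ-ring
        eq₂ : ∀ a b c d → d * (a * (b * c)) ≡ a * (b * (d * c))
        eq₂ = solve-∀ ℚ-ring
        open ≡-Reasoning
        expand : sum X (λ n → g n * (Λ n * inv n)) ≡ sum X (λ q → χ (prime? q) * (β q * sum X (H q)))
        expand = begin
          sum X (λ n → g n * (Λ n * inv n))
            ≡⟨ sum-ext X (λ n → trans (eq₁ (g n) (Λ n) (inv n)) (sym (sum-*ˡ X (w n) (λ q → χ (prime? q) * (β q * powers n q))))) ⟩
          sum X (λ n → sum X (λ q → w n * (χ (prime? q) * (β q * powers n q))))
            ≡⟨ sum-swap X X (λ n q → w n * (χ (prime? q) * (β q * powers n q))) ⟩
          sum X (λ q → sum X (λ n → w n * (χ (prime? q) * (β q * powers n q))))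
            ≡⟨ sum-ext X (λ q → trans (sum-ext X (λ n → eq₂ (χ (prime? q)) (β q) (powers n q) (w n)))
                 (trans (sum-*ˡ X (χ (prime? q)) (λ n → β q * (w n * powers n q))) (cong (χ (prime? q) *_) (trans (sum-*ˡ X (β q) (λ n → w n * powers n q)) (cong (β q *_) (inner q)))))) ⟩
          sum X (λ q → χ (prime? q) * (β q * sum X (H q))) ∎
          where
          inner : ∀ q → sum X (λ n → w n * powers n q) ≡ sum X (H q)
          inner q = trans (sum-ext X (λ n → trans (*-comm (w n) (powers n q)) (sym (sum-*ʳ X (w n) (λ k → χ (q ℕ.^ k ℕ.≟ n))))))
            (sum-swap X X (λ n k → χ (q ℕ.^ k ℕ.≟ n) * w n))

  valuation : ∀ q n → 2 ℕ.≤ q → 1 ℕ.≤ n → ∃ λ v → ∃ λ k → n ≡ q ℕ.^ v ℕ.* k × ¬ q ∣ k × 1 ℕ.≤ k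
  valuation q n 2≤q = <-rec (λ n → 1 ℕ.≤ n → ∃ λ v → ∃ λ k → n ≡ q ℕ.^ v ℕ.* k × ¬ q ∣ k × 1 ℕ.≤ k) go n
    where
    go : ∀ n → (∀ {m} → m ℕ.< n → 1 ℕ.≤ m → ∃ λ v → ∃ λ k → m ≡ q ℕ.^ v ℕ.* k × ¬ q ∣ k × 1 ℕ.≤ k) →
         1 ℕ.≤ n → ∃ λ v → ∃ λ k → n ≡ q ℕ.^ v ℕ.* k × ¬ q ∣ k × 1 ℕ.≤ k
    go n rec 1≤n with q ∣? n
    ... | no q∤n = 0 , n , sym (ℕ.+-identityʳ n) , q∤n , 1≤n
    ... | yes (divides zero e) = ⊥-elim (ℕ.<⇒≢ 1≤n (sym e))
    ... | yes (divides m@(suc _) e) with rec (subst (m ℕ.<_) (sym e) (ℕ.m<m*n m q 2≤q)) (s≤s z≤n)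
    ... | v , k , e' , q∤k , 1≤k = suc v , k , trans e (trans (ℕ.*-comm m q) (trans (cong (q ℕ.*_) e') (sym (ℕ.*-assoc q (q ℕ.^ v) k)))) , q∤k , 1≤k

  prod-∤ : ∀ {q} a b → Prime q → ¬ q ∣ a → ¬ q ∣ b → ¬ q ∣ a ℕ.* b
  prod-∤ a b pq na nb d with euclidsLemma a b pq d
  ... | inj₁ x = na x
  ... | inj₂ y = nb y

  module RealCharacter (ψ : ℕ → ℚ) (ψ-* : ∀ a b → ψ (a ℕ.* b) ≡ ψ a * ψ b) (ψ-1 : ψ 1 ≡ 1ℚ)
                       (ψ-values : ∀ n → ψ n ≡ 1ℚ ⊎ ψ n ≡ 0ℚ ⊎ ψ n ≡ - 1ℚ) where

    r : ℕ → ℚ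
    r n = dsum n ψ

    -- 1 + s + ⋯ + s^v, the value of `r` at q^v when s = `ψ q`.
    geo : ℚ → ℕ → ℚ
    geo s zero = 1ℚ
    geo s (suc v) = 1ℚ + s * geo s v

    r-coprime : ℕ → ℕ → ℚ
    r-coprime q n = dsum n (λ d → (1ℚ - χ (q ∣? d)) * ψ d)

    r-prime : ∀ q n → Prime q → 1 ℕ.≤ n → r (q ℕ.* n) ≡ r-coprime q n + ψ q * r n
    r-prime q n pq 1≤n = trans (dsum-prime q n ψ pq 1≤n) (trans (sum-ext n (λ d → *-distribˡ-+ (χ (d ∣? n)) ((1ℚ - χ (q ∣? d)) * ψ d) (ψ (q ℕ.* d))))
      (trans (sum-+ n _ _) (cong (r-coprime q n +_) (trans (dsum-cong n (λ k _ _ → ψ-* q k)) (dsum-*ˡ n (ψ q) ψ)))))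

    r-coprime-power : ∀ q v k → Prime q → ¬ q ∣ k → 1 ℕ.≤ k → r-coprime q (q ℕ.^ v ℕ.* k) ≡ r k
    r-coprime-power q zero k pq q∤k 1≤k = trans (cong (r-coprime q) (ℕ.+-identityʳ k)) (sum-ext k f)
      where
      eq : ∀ a → (1ℚ - 0ℚ) * a ≡ a
      eq = solve-∀ ℚ-ring
      f : ∀ d → χ (d ∣? k) * ((1ℚ - χ (q ∣? d)) * ψ d) ≡ χ (d ∣? k) * ψ d
      f d with d ∣? k
      ... | no _ = trans (*-zeroˡ ((1ℚ - χ (q ∣? d)) * ψ d)) (sym (*-zeroˡ (ψ d)))
      ... | yes d∣k = cong (1ℚ *_) (trans (cong (λ z → (1ℚ - z) * ψ d) (χ-no (q ∣? d) (λ q∣d → q∤k (∣-trans q∣d d∣k)))) (eq (ψ d)))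
    r-coprime-power q (suc v) k pq q∤k 1≤k = trans (cong (r-coprime q) (ℕ.*-assoc q (q ℕ.^ v) k))
        (trans (dsum-prime q m _ pq 1≤m) (trans (dsum-cong m (λ d _ _ → h d)) (r-coprime-power q v k pq q∤k 1≤k)))
      where
      m = q ℕ.^ v ℕ.* k
      1≤m : 1 ℕ.≤ m
      1≤m = ℕ.*-mono-≤ (ℕ.m^n>0 q {{prime⇒nonZero pq}} v) 1≤k
      eq₁ : ∀ a b c → (1ℚ - a) * ((1ℚ - a) * b) + (1ℚ - 1ℚ) * c ≡ (1ℚ - a - a + a * a) * b
      eq₁ = solve-∀ ℚ-ring
      eq₂ : ∀ a b → (1ℚ - a - a + a) * b ≡ (1ℚ - a) * b
      eq₂ = solve-∀ ℚ-ring
      h : ∀ d → (1ℚ - χ (q ∣? d)) * ((1ℚ - χ (q ∣? d)) * ψ d) + (1ℚ - χ (q ∣? (q ℕ.* d))) * ψ (q ℕ.* d) ≡ (1ℚ - χ (q ∣? d)) * ψ d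
      h d = trans (cong (λ z → (1ℚ - χ (q ∣? d)) * ((1ℚ - χ (q ∣? d)) * ψ d) + (1ℚ - z) * ψ (q ℕ.* d)) (χ-yes (q ∣? (q ℕ.* d)) (m∣m*n d)))
        (trans (eq₁ (χ (q ∣? d)) (ψ d) (ψ (q ℕ.* d))) (trans (cong (λ z → (1ℚ - χ (q ∣? d) - χ (q ∣? d) + z) * ψ d) (χ-idem (q ∣? d))) (eq₂ (χ (q ∣? d)) (ψ d))))

    r-power : ∀ q v k → Prime q → ¬ q ∣ k → 1 ℕ.≤ k → r (q ℕ.^ v ℕ.* k) ≡ geo (ψ q) v * r k
    r-power q zero k pq q∤k 1≤k = trans (cong r (ℕ.+-identityʳ k)) (sym (*-identityˡ (r k)))
    r-power q (suc v) k pq q∤k 1≤k = trans (cong r (ℕ.*-assoc q (q ℕ.^ v) k))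
       (trans (r-prime q (q ℕ.^ v ℕ.* k) pq (ℕ.*-mono-≤ (ℕ.m^n>0 q {{prime⇒nonZero pq}} v) 1≤k))
       (trans (cong₂ (λ a b → a + ψ q * b) (r-coprime-power q v k pq q∤k 1≤k) (r-power q v k pq q∤k 1≤k)) (eq (r k) (ψ q) (geo (ψ q) v))))
      where
      eq : ∀ r s g → r + s * (g * r) ≡ (1ℚ + s * g) * r
      eq = solve-∀ ℚ-ring

    0≤geo : ∀ s v → 0ℚ ≤ s → 1ℚ ≤ geo s v
    0≤geo s zero 0≤s = ≤-refl
    0≤geo s (suc v) 0≤s = via (s * geo s v) (0≤* 0≤s (≤-trans 0≤1 (0≤geo s v 0≤s))) refl

    geo-alt : ∀ v → geo (- 1ℚ) (suc (suc v)) ≡ geo (- 1ℚ) v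
    geo-alt v = eq (geo (- 1ℚ) v)
      where
      eq : ∀ g → 1ℚ + - 1ℚ * (1ℚ + - 1ℚ * g) ≡ g
      eq = solve-∀ ℚ-ring

    geo-nonneg : ∀ n v → 0ℚ ≤ geo (ψ n) v
    geo-nonneg n v with ψ-values n
    ... | inj₁ e = ≤-trans 0≤1 (0≤geo (ψ n) v (subst (0ℚ ≤_) (sym e) 0≤1))
    ... | inj₂ (inj₁ e) = ≤-trans 0≤1 (0≤geo (ψ n) v (subst (0ℚ ≤_) (sym e) ≤-refl))
    ... | inj₂ (inj₂ e) = subst (λ z → 0ℚ ≤ geo z v) (sym e) (go v)
      where
      go : ∀ v → 0ℚ ≤ geo (- 1ℚ) v
      go zero = 0≤1
      go (suc zero) = ≤-refl
      go (suc (suc v)) = subst (0ℚ ≤_) (sym (geo-alt v)) (go v)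

    geo-even : ∀ n v → 1ℚ ≤ geo (ψ n) (v ℕ.+ v)
    geo-even n v with ψ-values n
    ... | inj₁ e = 0≤geo (ψ n) (v ℕ.+ v) (subst (0ℚ ≤_) (sym e) 0≤1)
    ... | inj₂ (inj₁ e) = 0≤geo (ψ n) (v ℕ.+ v) (subst (0ℚ ≤_) (sym e) ≤-refl)
    ... | inj₂ (inj₂ e) = subst (λ z → 1ℚ ≤ geo z (v ℕ.+ v)) (sym e) (go v)
      where
      go : ∀ v → 1ℚ ≤ geo (- 1ℚ) (v ℕ.+ v)
      go zero = ≤-refl
      go (suc v) = subst (λ z → 1ℚ ≤ geo (- 1ℚ) (suc z)) (sym (ℕ.+-suc v v)) (subst (1ℚ ≤_) (sym (geo-alt (v ℕ.+ v))) (go v))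

    r-1 : r 1 ≡ 1ℚ
    r-1 = trans (dsum-1 ψ) ψ-1

    decompose : ∀ n → 2 ℕ.≤ n → ∃ λ q → ∃ λ v → ∃ λ k → Prime q × n ≡ q ℕ.^ v ℕ.* k × ¬ q ∣ k × 1 ℕ.≤ k × k ℕ.< n
    decompose n 2≤n with prime-divisor n 2≤n
    ... | q , pq , q∣n with valuation q n (prime≥2 pq) (ℕ.<⇒≤ 2≤n)
    ... | zero , k , e , q∤k , 1≤k = ⊥-elim (q∤k (subst (q ∣_) (trans e (ℕ.+-identityʳ k)) q∣n))
    ... | suc v , k , e , q∤k , 1≤k = q , suc v , k , pq , e , q∤k , 1≤k ,
          subst (k ℕ.<_) (trans (ℕ.*-comm k (q ℕ.^ suc v)) (sym e)) (ℕ.m<m*n k (q ℕ.^ suc v) {{ℕ.>-nonZero 1≤k}} (ℕ.≤-trans (prime≥2 pq) (ℕ.m≤m*n q (q ℕ.^ v) {{ℕ.>-nonZero (ℕ.m^n>0 q {{prime⇒nonZero pq}} v)}})))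

    0≤r : ∀ n → 1 ℕ.≤ n → 0ℚ ≤ r n
    0≤r = <-rec (λ n → 1 ℕ.≤ n → 0ℚ ≤ r n) go
      where
      go : ∀ n → (∀ {m} → m ℕ.< n → 1 ℕ.≤ m → 0ℚ ≤ r m) → 1 ℕ.≤ n → 0ℚ ≤ r n
      go n rec 1≤n with n ℕ.≟ 1
      ... | yes refl = subst (0ℚ ≤_) (sym r-1) 0≤1
      ... | no n≢1 with decompose n (ℕ.≤∧≢⇒< 1≤n (λ e → n≢1 (sym e)))
      ... | q , v , k , pq , e , q∤k , 1≤k , k<n = subst (0ℚ ≤_) (sym (trans (cong r e) (r-power q v k pq q∤k 1≤k))) (0≤* (geo-nonneg q v) (rec k<n 1≤k))

    -- By multiplicativity it is enough to look at even powers of a prime, where 1 + s + ⋯ + s^(2v)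
    -- ≥ 1 even for s = -1. These squares are the source of the lower bound for L(1, ψ).
    1≤r-square : ∀ n → 1 ℕ.≤ n → 1ℚ ≤ r (n ℕ.* n)
    1≤r-square = <-rec (λ n → 1 ℕ.≤ n → 1ℚ ≤ r (n ℕ.* n)) go
      where
      go : ∀ n → (∀ {m} → m ℕ.< n → 1 ℕ.≤ m → 1ℚ ≤ r (m ℕ.* m)) → 1 ℕ.≤ n → 1ℚ ≤ r (n ℕ.* n)
      go n rec 1≤n with n ℕ.≟ 1
      ... | yes refl = ≤-reflexive (sym r-1)
      ... | no n≢1 with decompose n (ℕ.≤∧≢⇒< 1≤n (λ e → n≢1 (sym e)))
      ... | q , v , k , pq , e , q∤k , 1≤k , k<n = subst (1ℚ ≤_) (sym (trans (cong r n²≡) (r-power q (v ℕ.+ v) (k ℕ.* k) pq (prod-∤ k k pq q∤k q∤k) (ℕ.*-mono-≤ 1≤k 1≤k))))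
          (subst (_≤ geo (ψ q) (v ℕ.+ v) * r (k ℕ.* k)) (*-identityˡ 1ℚ) (*-mono 0≤1 (≤-trans 0≤1 (geo-even q v)) (geo-even q v) (rec k<n 1≤k)))
        where
        n²≡ : n ℕ.* n ≡ q ℕ.^ (v ℕ.+ v) ℕ.* (k ℕ.* k)
        n²≡ = trans (cong₂ ℕ._*_ e e) (trans (ℕ.[m*n]*[o*p]≡[m*o]*[n*p] (q ℕ.^ v) k (q ℕ.^ v) k) (cong (ℕ._* (k ℕ.* k)) (sym (ℕ.^-distribˡ-+-* q v v))))

-- Integer estimates behind the approximate logarithm

module LogarithmApproximation where
  open import Data.Nat using (_^_; _≤_; _<_; _+_; _*_)
  open import Data.Nat.Properties
  open import Data.Nat.DivMod using (_/_; _%_; m≡m%n+[m/n]*n; m%n<n)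
  open import Data.Nat.Tactic.RingSolver using (solve-∀)

  floor-log : ∀ n → 1 ≤ n → ∃ λ e → 2 ^ e ≤ n × n < 2 ^ suc e
  floor-log (suc zero) _ = 0 , s≤s z≤n , s≤s (s≤s z≤n)
  floor-log (suc (suc n)) _ with floor-log (suc n) (s≤s z≤n)
  ... | e , lo , hi with suc (suc n) <? 2 ^ suc e
  ... | yes h = e , m≤n⇒m≤1+n lo , h
  ... | no h = suc e , ≤-reflexive (sym n≡) , subst (_< 2 ^ suc (suc e)) (sym n≡) (^-monoʳ-< 2 (s≤s (s≤s z≤n)) (n<1+n (suc e)))
    where
    n≡ : suc (suc n) ≡ 2 ^ suc e
    n≡ = ≤-antisym hi (≮⇒≥ h)

  lg : ℕ → ℕ
  lg zero = 0
  lg (suc n) = proj₁ (floor-log (suc n) (s≤s z≤n))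

  lg-lower : ∀ n → 1 ≤ n → 2 ^ lg n ≤ n
  lg-lower (suc n) _ = proj₁ (proj₂ (floor-log (suc n) (s≤s z≤n)))

  lg-upper : ∀ n → 1 ≤ n → n < 2 ^ suc (lg n)
  lg-upper (suc n) _ = proj₂ (proj₂ (floor-log (suc n) (s≤s z≤n)))

  2^-cancel-≤ : ∀ {a b} → 2 ^ a ≤ 2 ^ b → a ≤ b
  2^-cancel-≤ {a} {b} h with a ≤? b
  ... | yes p = p
  ... | no p = ⊥-elim (<⇒≱ (^-monoʳ-< 2 (s≤s (s≤s z≤n)) (≰⇒> p)) h)

  2^-cancel-< : ∀ {a b} → 2 ^ a < 2 ^ b → a < b
  2^-cancel-< {a} {b} h with a <? b
  ... | yes p = p
  ... | no p = ⊥-elim (<⇒≱ h (^-monoʳ-≤ 2 (≮⇒≥ p)))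

  lg-2^ : ∀ k → lg (2 ^ k) ≡ k
  lg-2^ k = ≤-antisym (2^-cancel-≤ (lg-lower (2 ^ k) (m^n>0 2 k))) (≤-pred (2^-cancel-< (lg-upper (2 ^ k) (m^n>0 2 k))))

  ^-distribʳ-* : ∀ s a b → (a * b) ^ s ≡ a ^ s * b ^ s
  ^-distribʳ-* zero a b = refl
  ^-distribʳ-* (suc s) a b = trans (cong (a * b *_) (^-distribʳ-* s a b)) (eq a b (a ^ s) (b ^ s))
    where
    eq : ∀ a b c d → a * b * (c * d) ≡ a * c * (b * d)
    eq = solve-∀

  -- Bernoulli's inequality (1 - 1/(n+1))^m ≥ 1 - m/(n+1) with denominators cleared; `k` stands for
  -- n + 1 - m to avoid truncated subtraction.
  bernoulli : ∀ n m k → k + m ≡ suc n → suc n ^ m * k ≤ n ^ m * suc n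
  bernoulli n zero k e = ≤-reflexive (cong (_+ 0) (trans (sym (+-identityʳ k)) e))
  bernoulli n (suc m) k e = begin
    suc n * suc n ^ m * k ≡⟨ eq₁ (suc n) (suc n ^ m) k ⟩
    suc n ^ m * (suc n * k) ≤⟨ *-monoʳ-≤ (suc n ^ m) lem ⟩
    suc n ^ m * (n * suc k) ≡⟨ eq₂ (suc n ^ m) n (suc k) ⟩
    n * (suc n ^ m * suc k) ≤⟨ *-monoʳ-≤ n (bernoulli n m (suc k) (trans (sym (+-suc k m)) e)) ⟩
    n * (n ^ m * suc n) ≡⟨ sym (*-assoc n (n ^ m) (suc n)) ⟩
    n * n ^ m * suc n ∎
    where
    open ≤-Reasoning
    eq₁ : ∀ a b c → a * b * c ≡ b * (a * c)
    eq₁ = solve-∀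
    eq₂ : ∀ a b c → a * (b * c) ≡ b * (a * c)
    eq₂ = solve-∀
    k≤n : k ≤ n
    k≤n = ≤-pred (subst (suc k ≤_) (trans (sym (+-suc k m)) e) (s≤s (m≤m+n k m)))
    lem : suc n * k ≤ n * suc k
    lem = subst (k + n * k ≤_) (sym (*-suc n k)) (+-monoˡ-≤ (n * k) k≤n)

  bernoulli₂ : ∀ n m → m + m ≤ suc n → suc n ^ m ≤ 2 * n ^ m
  bernoulli₂ n m h = *-cancelʳ-≤ (suc n ^ m) (2 * n ^ m) (suc n) (begin
    suc n ^ m * suc n ≤⟨ *-monoʳ-≤ (suc n ^ m) 2k ⟩
    suc n ^ m * (2 * k) ≡⟨ eq₁ (suc n ^ m) k ⟩
    2 * (suc n ^ m * k) ≤⟨ *-monoʳ-≤ 2 (bernoulli n m k k+m) ⟩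
    2 * (n ^ m * suc n) ≡⟨ sym (*-assoc 2 (n ^ m) (suc n)) ⟩
    2 * n ^ m * suc n ∎)
    where
    open ≤-Reasoning
    k = suc n ℕ.∸ m
    k+m : k + m ≡ suc n
    k+m = m∸n+n≡m (≤-trans (m≤m+n m m) h)
    m≤k : m ≤ k
    m≤k = +-cancelʳ-≤ m m k (subst (m + m ≤_) (sym k+m) h)
    2k : suc n ≤ 2 * k
    2k = subst₂ _≤_ k+m (cong (k +_) (sym (+-identityʳ k))) (+-monoʳ-≤ k m≤k)
    eq₁ : ∀ a b → a * (2 * b) ≡ 2 * (a * b)
    eq₁ = solve-∀

  halve : ∀ n → ∃ λ m → n ≤ m + m × m + m ≤ suc n
  halve zero = 0 , z≤n , z≤n
  halve (suc zero) = 1 , s≤s z≤n , ≤-refl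
  halve (suc (suc n)) with halve n
  ... | m , lo , hi = suc m , subst (suc (suc n) ≤_) (cong suc (sym (+-suc m m))) (s≤s (s≤s lo)) , subst (_≤ suc (suc (suc n))) (cong suc (sym (+-suc m m))) (s≤s (s≤s hi))

  -- In logarithms: log₂(1 + 1/n) ≤ 2/n + 1/K. The exponent K is cut into s blocks of length about
  -- n/2 and a shorter rest, and by Bernoulli each of these costs at most a factor 2.
  suc-power : ∀ n K → 1 ≤ n → ∃ λ s → suc n ^ K ≤ 2 ^ suc s * n ^ K × n * s ≤ 2 * K
  suc-power n K 1≤n with halve n
  ... | zero , lo , hi = ⊥-elim (<⇒≱ 1≤n lo)
  ... | m@(suc _) , lo , hi = s , main , ns
    where
    open ≤-Reasoning
    s = K / m
    r = K % m
    K≡ : K ≡ r + s * m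
    K≡ = m≡m%n+[m/n]*n K m
    ns : n * s ≤ 2 * K
    ns = begin
      n * s ≤⟨ *-monoˡ-≤ s lo ⟩
      (m + m) * s ≡⟨ eq m s ⟩
      2 * (s * m) ≤⟨ *-monoʳ-≤ 2 (m≤n+m (s * m) r) ⟩
      2 * (r + s * m) ≡⟨ cong (2 *_) (sym K≡) ⟩
      2 * K ∎
      where
      eq : ∀ m s → (m + m) * s ≡ 2 * (s * m)
      eq = solve-∀
    split : ∀ a → a ^ K ≡ a ^ r * (a ^ m) ^ s
    split a = trans (cong (a ^_) (trans K≡ (cong (r +_) (*-comm s m)))) (trans (^-distribˡ-+-* a r (m * s)) (cong (a ^ r *_) (sym (^-*-assoc a m s))))
    r+r : r + r ≤ suc n
    r+r = ≤-trans (+-mono-≤ (<⇒≤ (m%n<n K m)) (<⇒≤ (m%n<n K m))) hi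
    main : suc n ^ K ≤ 2 ^ suc s * n ^ K
    main = begin
      suc n ^ K ≡⟨ split (suc n) ⟩
      suc n ^ r * (suc n ^ m) ^ s ≤⟨ *-mono-≤ (bernoulli₂ n r r+r) (^-monoˡ-≤ s (bernoulli₂ n m hi)) ⟩
      2 * n ^ r * (2 * n ^ m) ^ s ≡⟨ cong (2 * n ^ r *_) (^-distribʳ-* s 2 (n ^ m)) ⟩
      2 * n ^ r * (2 ^ s * (n ^ m) ^ s) ≡⟨ eq (n ^ r) (2 ^ s) ((n ^ m) ^ s) ⟩
      2 ^ suc s * (n ^ r * (n ^ m) ^ s) ≡⟨ cong (2 ^ suc s *_) (sym (split n)) ⟩
      2 ^ suc s * n ^ K ∎
      where
      eq : ∀ a b c → 2 * a * (b * c) ≡ 2 * b * (a * c)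
      eq = solve-∀

-- A rational logarithm, accurate up to a prescribed bound

module Logarithm where
  open import Data.Nat.Divisibility
  open import Data.Nat.Primality
  open import Data.Rational as ℚ hiding (nonNegative; nonZero; NonZero)
  open import Data.Rational.Properties
  open import Tactic.RingSolver using (solve-∀)
  open RationalSums
  open Multiplicative
  open PrimePowerSums
  open LogarithmApproximation

  -- A rational-valued logarithm to base 2, accurate up to Y, with its von Mangoldt and Möbius functions.
  record LogData (Y : ℕ) : Set where
    field
      L Λ μ : ℕ → ℚ
      L-1 : L 1 ≡ 0ℚ
      L-2 : ∀ n → 1 ℕ.≤ n → 2 ℕ.* n ℕ.≤ Y → L (2 ℕ.* n) ≡ 1ℚ + L n
      0≤L : ∀ n → 0ℚ ≤ L n
      L-step : ∀ n → 1 ℕ.≤ n → suc n ℕ.≤ Y → ∣ L (suc n) - L n ∣ ≤ ι 3 * inv n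
      0≤Λ : ∀ n → 0ℚ ≤ Λ n
      ΛL : ∀ n → dsum n Λ ≡ L n
      ∣μ∣≤1 : ∀ n → ∣ μ n ∣ ≤ 1ℚ
      μ-sum : ∀ n → 1 ℕ.≤ n → n ℕ.≤ Y → dsum n μ ≡ χ (n ℕ.≟ 1)
      μL : ∀ n → 1 ℕ.≤ n → n ℕ.≤ Y → dsum n (λ d → μ d * L d) ≡ - Λ n
      prime-powers : ∀ N (g : ℕ → ℚ) → (∀ n → 0ℚ ≤ g n) → (∀ n → g n ≤ 1ℚ) →
        (∀ q → Prime q → N ℕ.< q → q ℕ.≤ Y → g q ≡ 0ℚ) →
        sum Y (λ n → g n * (Λ n * inv n)) ≤ sum Y (λ q → L q * (χ (q ℕ.≤? N) + (inv q * inv q + inv q * inv q)))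

  module Construct (Y : ℕ) (1≤Y : 1 ℕ.≤ Y) where

    -- The precision. Rounding costs less than 1/K per prime factor, hence at most n/K for `L n`;
    -- since n (n+1) ≤ Y² this is no larger than 1/n, the size of log(n+1) - log n.
    K : ℕ
    K = Y ℕ.* Y

    1≤K : 1 ℕ.≤ K
    1≤K = ℕ.*-mono-≤ 1≤Y 1≤Y

    -- log₂ q rounded down to a multiple of 1/K.
    β : ℕ → ℚ
    β q = ι (lg (q ℕ.^ K)) * inv K

    0≤β : ∀ q → 0ℚ ≤ β q
    0≤β q = 0≤* (0≤ι (lg (q ℕ.^ K))) (0≤inv K)

    open Moebius Y
    open Mangoldt Y β 0≤β
    open PrimePowers Y β 0≤β

    β-2 : β 2 ≡ 1ℚ
    β-2 = trans (cong (λ z → ι z * inv K) (lg-2^ K)) (ι*inv {K} 1≤K)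

    -- Says that k/K ≤ log₂ n < (k + n)/K. The slack n is generous, but it survives multiplication
    -- by a prime.
    Approx : ℕ → Set
    Approx n = ∃ λ k → L n ≡ ι k * inv K × 2 ℕ.^ k ℕ.≤ n ℕ.^ K × n ℕ.^ K ℕ.< 2 ℕ.^ (k ℕ.+ n)

    approx : ∀ n → 1 ℕ.≤ n → n ℕ.≤ Y → Approx n
    approx = prime-induction P base step
      where
      P : ℕ → Set
      P n = n ℕ.≤ Y → Approx n
      base : P 1
      base _ = 0 , trans L-1 (sym (*-zeroˡ (inv K))) , ℕ.≤-reflexive (sym (ℕ.^-zeroˡ K)) , subst (ℕ._< 2) (sym (ℕ.^-zeroˡ K)) (s≤s (s≤s z≤n))
      step : ∀ q n → Prime q → 1 ℕ.≤ n → P n → P (q ℕ.* n)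
      step q n pq 1≤n ih h = go (ih (ℕ.≤-trans (ℕ.m≤n*m n q {{prime⇒nonZero pq}}) h))
       where
       go : Approx n → Approx (q ℕ.* n)
       go (k , e , lo , hi) = j ℕ.+ k , trans (L-prime q n pq 1≤n h) (trans (cong (β q +_) e) (trans (sym (*-distribʳ-+ (inv K) (ι j) (ι k))) (cong (_* inv K) (sym (ι-+ j k)))))
            , subst₂ ℕ._≤_ (sym (ℕ.^-distribˡ-+-* 2 j k)) (sym (^-distribʳ-* K q n)) (ℕ.*-mono-≤ (lg-lower (q ℕ.^ K) 1≤q^K) lo)
            , subst (ℕ._< 2 ℕ.^ (j ℕ.+ k ℕ.+ q ℕ.* n)) (sym (^-distribʳ-* K q n))
               (ℕ.<-≤-trans (ℕ.*-mono-< (lg-upper (q ℕ.^ K) 1≤q^K) hi)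
                 (ℕ.≤-trans (ℕ.≤-reflexive (sym (ℕ.^-distribˡ-+-* 2 (suc j) (k ℕ.+ n)))) (ℕ.^-monoʳ-≤ 2 exps)))
         where
        j = lg (q ℕ.^ K)
        1≤q^K : 1 ℕ.≤ q ℕ.^ K
        1≤q^K = ℕ.m^n>0 q {{prime⇒nonZero pq}} K
        -- Rounding at q adds 1 to the slack, and n + 1 ≤ 2 n ≤ q n.
        exps : suc j ℕ.+ (k ℕ.+ n) ℕ.≤ j ℕ.+ k ℕ.+ q ℕ.* n
        exps = subst (ℕ._≤ j ℕ.+ k ℕ.+ q ℕ.* n) (eq j k n) (ℕ.+-monoʳ-≤ (j ℕ.+ k) (ℕ.≤-trans (subst (suc n ℕ.≤_) (cong (n ℕ.+_) (sym (ℕ.+-identityʳ n))) (ℕ.+-monoˡ-≤ n 1≤n)) (ℕ.*-monoˡ-≤ n (prime≥2 pq))))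
          where
          eq : ∀ j k n → j ℕ.+ k ℕ.+ suc n ≡ suc j ℕ.+ (k ℕ.+ n)
          eq = ℕR.solve-∀

    scaled : ∀ n a b → 1 ℕ.≤ n → n ℕ.* a ℕ.≤ n ℕ.* b ℕ.+ 3 ℕ.* K → ι a * inv K - ι b * inv K ≤ ι 3 * inv n
    scaled n a b 1≤n h = *-cancelˡ-≤ (ι n) (0<ι 1≤n) (*-cancelˡ-≤ (ι K) (0<ι 1≤K)
       (subst₂ _≤_ (sym (trans (eq₁ (ι n) (ι K) (ι a) (ι b) (inv K)) (trans (cong (λ z → z * (ι n * ι a - ι n * ι b)) (ι*inv {K} 1≤K)) (*-identityˡ _))))
          (sym (trans (eq₂ (ι n) (ι K) (ι 3) (inv n)) (trans (cong (λ z → z * (ι 3 * ι K)) (ι*inv {n} 1≤n)) (*-identityˡ (ι 3 * ι K)))))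
          (≤-trans (+-monoˡ-≤ (- (ι n * ι b)) (subst₂ _≤_ (ι-* n a) (trans (ι-+ (n ℕ.* b) (3 ℕ.* K)) (cong₂ _+_ (ι-* n b) (ι-* 3 K))) (ι-mono h)))
             (≤-reflexive (eq₃ (ι n * ι b) (ι 3 * ι K))))))
      where
      eq₁ : ∀ n k a b i → k * (n * (a * i - b * i)) ≡ k * i * (n * a - n * b)
      eq₁ = solve-∀ ℚ-ring
      eq₂ : ∀ n k t i → k * (n * (t * i)) ≡ n * i * (t * k)
      eq₂ = solve-∀ ℚ-ring
      eq₃ : ∀ a b → a + b - a ≡ b
      eq₃ = solve-∀ ℚ-ring

    -- Of the constant 3, the growth of the true logarithm accounts for 2 through `suc-power`, and
    -- the rounding error for 1 through n² ≤ K.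
    step-bound : ∀ n → 1 ℕ.≤ n → suc n ℕ.≤ Y → ∣ L (suc n) - L n ∣ ≤ ι 3 * inv n
    step-bound n 1≤n n<Y = go (approx n 1≤n (ℕ.<⇒≤ n<Y)) (approx (suc n) (s≤s z≤n) n<Y) (suc-power n K 1≤n)
     where
     go : Approx n → Approx (suc n) → (∃ λ s → suc n ℕ.^ K ℕ.≤ 2 ℕ.^ suc s ℕ.* n ℕ.^ K × n ℕ.* s ℕ.≤ 2 ℕ.* K) → ∣ L (suc n) - L n ∣ ≤ ι 3 * inv n
     go (k , e , lo , hi) (k' , e' , lo' , hi') (s , pw , ns) =
        subst (λ z → ∣ z ∣ ≤ ι 3 * inv n) (sym (cong₂ _-_ e' e)) (∣∣≤ lower upper)
      where
      n[n+1]≤K : n ℕ.* suc n ℕ.≤ K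
      n[n+1]≤K = ℕ.*-mono-≤ (ℕ.<⇒≤ n<Y) n<Y
      k'≤ : k' ℕ.< suc s ℕ.+ (k ℕ.+ n)
      k'≤ = 2^-cancel-< (ℕ.≤-<-trans lo' (ℕ.≤-<-trans pw (subst (2 ℕ.^ suc s ℕ.* n ℕ.^ K ℕ.<_) (sym (ℕ.^-distribˡ-+-* 2 (suc s) (k ℕ.+ n)))
              (ℕ.*-monoʳ-< (2 ℕ.^ suc s) {{ℕ.>-nonZero (ℕ.m^n>0 2 (suc s))}} hi))))
      k≤ : k ℕ.< k' ℕ.+ suc n
      k≤ = 2^-cancel-< (ℕ.≤-<-trans lo (ℕ.≤-<-trans (ℕ.^-monoˡ-≤ K (ℕ.n≤1+n n)) hi'))
      nn≤K : n ℕ.* n ℕ.≤ K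
      nn≤K = ℕ.≤-trans (ℕ.*-monoʳ-≤ n (ℕ.n≤1+n n)) n[n+1]≤K
      upper : ι k' * inv K - ι k * inv K ≤ ι 3 * inv n
      upper = scaled n k' k 1≤n (ℕ.≤-trans (ℕ.*-monoʳ-≤ n (ℕ.≤-pred k'≤)) (ℕ.≤-trans (ℕ.≤-reflexive (eq n s k))
          (ℕ.≤-trans (ℕ.+-monoʳ-≤ (n ℕ.* k) (ℕ.+-mono-≤ ns nn≤K)) (ℕ.≤-reflexive (cong (n ℕ.* k ℕ.+_) (eq' K))))))
        where
        eq : ∀ n s k → n ℕ.* (s ℕ.+ (k ℕ.+ n)) ≡ n ℕ.* k ℕ.+ (n ℕ.* s ℕ.+ n ℕ.* n)
        eq = ℕR.solve-∀
        eq' : ∀ K → 2 ℕ.* K ℕ.+ K ≡ 3 ℕ.* K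
        eq' = ℕR.solve-∀
      lower' : ι k * inv K - ι k' * inv K ≤ ι 3 * inv n
      lower' = scaled n k k' 1≤n (ℕ.≤-trans (ℕ.*-monoʳ-≤ n (ℕ.<⇒≤ k≤)) (ℕ.≤-trans (ℕ.≤-reflexive (ℕ.*-distribˡ-+ n k' (suc n)))
          (ℕ.+-monoʳ-≤ (n ℕ.* k') (ℕ.≤-trans n[n+1]≤K (ℕ.m≤n*m K 3)))))
      lower : - (ι 3 * inv n) ≤ ι k' * inv K - ι k * inv K
      lower = subst (- (ι 3 * inv n) ≤_) (eq (ι k * inv K) (ι k' * inv K)) (neg-antimono-≤ lower')
        where
        eq : ∀ a b → - (a - b) ≡ b - a
        eq = solve-∀ ℚ-ring

    βL : ∀ q → q ℕ.≤ Y → (d : Dec (Prime q)) → χ d * β q ≤ L q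
    βL q q≤Y (no _) = subst (_≤ L q) (sym (*-zeroˡ (β q))) (0≤L q)
    βL q q≤Y (yes pq) = ≤-reflexive (trans (*-identityˡ (β q)) (sym (trans (cong L (sym (ℕ.*-identityʳ q)))
       (trans (L-prime q 1 pq ℕ.≤-refl (subst (ℕ._≤ Y) (sym (ℕ.*-identityʳ q)) q≤Y)) (trans (cong (β q +_) L-1) (+-identityʳ (β q)))))))

    logData : LogData Y
    logData = record
      { L = L ; Λ = Λ ; μ = μ ; L-1 = L-1
      ; L-2 = λ n 1≤n h → trans (L-prime 2 n prime[2] 1≤n h) (cong (_+ L n) β-2)
      ; 0≤L = 0≤L ; L-step = step-bound ; 0≤Λ = 0≤Λ ; ΛL = λ n → refl ; ∣μ∣≤1 = ∣μ∣≤1 ; μ-sum = μ-sum ; μL = μL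
      ; prime-powers = λ N g 0≤g g≤1 gp → ≤-trans (prime-power-bound N g 0≤g g≤1 gp)
          (sum-mono Y (λ q _ q≤Y → let z = χ (q ℕ.≤? N) + (inv q * inv q + inv q * inv q) in
             subst (_≤ L q * z) (*-assoc (χ (prime? q)) (β q) z)
               (*-monoʳ z (0≤+ (0≤χ (q ℕ.≤? N)) (0≤+ (0≤* (0≤inv q) (0≤inv q)) (0≤* (0≤inv q) (0≤inv q)))) (βL q q≤Y (prime? q)))))
      }

  log-data : ∀ Y → LogData Y
  log-data zero = record
    { L = λ _ → 0ℚ ; Λ = λ _ → 0ℚ ; μ = λ _ → 0ℚ ; L-1 = refl ; L-2 = λ { (suc _) _ () } ; 0≤L = λ _ → ≤-refl
    ; L-step = λ { _ _ () } ; 0≤Λ = λ _ → ≤-refl ; ΛL = λ n → sum-zero n (λ d _ _ → *-zeroʳ (χ (d ∣? n)))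
    ; ∣μ∣≤1 = λ _ → 0≤1 ; μ-sum = λ { (suc _) _ () } ; μL = λ { (suc _) _ () } ; prime-powers = λ _ _ _ _ _ → ≤-refl }
  log-data (suc Y) = Construct.logData (suc Y) (s≤s z≤n)

-- Partial summation and periodic test functions

module TestFunctions where
  open import Data.Nat.Induction using (<-rec)
  open import Data.Rational as ℚ hiding (nonNegative; nonZero; NonZero)
  open import Data.Rational.Properties
  open import Tactic.RingSolver using (solve-∀)
  open RationalSums

  sum-periodic : ∀ m φ → (∀ k → φ (m ℕ.+ k) ≡ φ k) → sum m φ ≡ 0ℚ → ∀ y → sum (m ℕ.+ y) φ ≡ sum y φ
  sum-periodic m φ per z y = trans (sum-append m y φ) (trans (cong₂ _+_ z (sum-ext y per)) (+-identityˡ _))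

  partial-bound : ∀ m b φ → 1 ℕ.≤ m → 0ℚ ≤ b → (∀ k → φ (m ℕ.+ k) ≡ φ k) → (∀ k → ∣ φ k ∣ ≤ b) → sum m φ ≡ 0ℚ →
    ∀ y → ∣ sum y φ ∣ ≤ ι m * b
  partial-bound m b φ 1≤m 0≤b per bd z = <-rec _ go
    where
    go : ∀ y → (∀ {y'} → y' ℕ.< y → ∣ sum y' φ ∣ ≤ ι m * b) → ∣ sum y φ ∣ ≤ ι m * b
    go y rec with y ℕ.≤? m
    ... | yes y≤m = ≤-trans (sum-abs y (λ k _ _ → bd k)) (≤-trans (≤-reflexive (sum-const y b)) (*-monoʳ b 0≤b (ι-mono y≤m)))
    ... | no y≰m = subst (λ w → ∣ w ∣ ≤ ι m * b) (trans (sym (sum-periodic m φ per z (y ℕ.∸ m))) (cong (λ w → sum w φ) y≡))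
          (rec (subst (y ℕ.∸ m ℕ.<_) y≡ (ℕ.m<n+m (y ℕ.∸ m) 1≤m)))
      where
      y≡ : m ℕ.+ (y ℕ.∸ m) ≡ y
      y≡ = ℕ.m+[n∸m]≡n (ℕ.<⇒≤ (ℕ.≰⇒> y≰m))

  abel : ∀ x (φ g : ℕ → ℚ) → sum x (λ k → φ k * g k) ≡ sum x φ * g (suc x) + sum x (λ k → sum k φ * (g k - g (suc k)))
  abel zero φ g = eq (g 1)
    where
    eq : ∀ a → 0ℚ ≡ 0ℚ * a + 0ℚ
    eq = solve-∀ ℚ-ring
  abel (suc x) φ g = trans (cong (_+ φ (suc x) * g (suc x)) (abel x φ g))
    (eq (sum x φ) (φ (suc x)) (g (suc x)) (g (suc (suc x))) (sum x (λ k → sum k φ * (g k - g (suc k)))))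
    where
    eq : ∀ p f a b s → p * a + s + f * a ≡ (p + f) * b + (s + (p + f) * (a - b))
    eq = solve-∀ ℚ-ring

  abel-bound : ∀ x (φ g : ℕ → ℚ) M → (∀ y → ∣ sum y φ ∣ ≤ M) →
    ∣ sum x (λ k → φ k * g k) ∣ ≤ M * (∣ g (suc x) ∣ + sum x (λ k → ∣ g k - g (suc k) ∣))
  abel-bound x φ g M h = subst₂ _≤_ (cong ∣_∣ (sym (abel x φ g))) (trans (cong (M * ∣ g (suc x) ∣ +_) (sum-*ˡ x M _)) (sym (*-distribˡ-+ M _ _)))
    (∣∣-tri (∣∣-* (h x) ≤-refl) (sum-abs x (λ k _ _ → ∣∣-* (h k) (≤-refl {∣ g k - g (suc k) ∣}))))

  harmonic : (ℕ → ℚ) → ℕ → ℚ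
  harmonic φ y = sum y (λ k → φ k * inv k)

  -- Summation by parts with decreasing weights: the variations telescope, so the first weight after
  -- y controls the whole tail.
  abel-tail : ∀ (φ : ℕ → ℚ) M → (∀ y → ∣ sum y φ ∣ ≤ M) → ∀ (g : ℕ → ℚ) → (∀ k → 0ℚ ≤ g (suc k)) → (∀ k → g (suc (suc k)) ≤ g (suc k)) →
    ∀ y z → y ℕ.≤ z → ∣ sum z (λ k → φ k * g k) - sum y (λ k → φ k * g k) ∣ ≤ (M + M) * g (suc y)
  abel-tail φ M h g 0≤g anti y z y≤z = subst (λ w → ∣ G w - G y ∣ ≤ (M + M) * g (suc y)) (ℕ.m+[n∸m]≡n y≤z)
      (subst₂ _≤_ (cong ∣_∣ (eq₁ (G w - G y) (sum w φ * g (suc w)))) (eq₂ M (g (suc y)) (g (suc w)))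
        (∣∣-tri (go (z ℕ.∸ y)) (∣∣-* (h w) (≤-reflexive (0≤p⇒∣p∣≡p (0≤g w))))))
    where
    G : ℕ → ℚ
    G z = sum z (λ k → φ k * g k)
    w = y ℕ.+ (z ℕ.∸ y)
    eq₁ : ∀ a b → a - b + b ≡ a
    eq₁ = solve-∀ ℚ-ring
    eq₂ : ∀ m a b → (m + m) * a - m * b + m * b ≡ (m + m) * a
    eq₂ = solve-∀ ℚ-ring
    eq₃ : ∀ a m → (m + m) * a - m * a ≡ m * a
    eq₃ = solve-∀ ℚ-ring
    eq₄ : ∀ t p a → t - t - p * a ≡ - (p * a)
    eq₄ = solve-∀ ℚ-ring
    eq₅ : ∀ t t' p f a b → (t - t' - p * a) + (p + f) * (a - b) ≡ t + f * a - t' - (p + f) * b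
    eq₅ = solve-∀ ℚ-ring
    eq₆ : ∀ m a b c → (m + m) * a - m * b + m * (b - c) ≡ (m + m) * a - m * c
    eq₆ = solve-∀ ℚ-ring
    -- Carries the boundary term of the summation by parts along; it is removed at the end at the
    -- cost M g(w+1) that the right-hand side has in reserve.
    go : ∀ j → ∣ G (y ℕ.+ j) - G y - sum (y ℕ.+ j) φ * g (suc (y ℕ.+ j)) ∣ ≤ (M + M) * g (suc y) - M * g (suc (y ℕ.+ j))
    go zero rewrite ℕ.+-identityʳ y = subst₂ _≤_ (trans (sym (∣-p∣≡∣p∣ (sum y φ * g (suc y)))) (cong ∣_∣ (sym (eq₄ (G y) (sum y φ) (g (suc y)))))) (sym (eq₃ (g (suc y)) M))
       (∣∣-* (h y) (≤-reflexive (0≤p⇒∣p∣≡p (0≤g y))))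
    go (suc j) rewrite ℕ.+-suc y j = subst₂ _≤_ (cong ∣_∣ (eq₅ (G (y ℕ.+ j)) (G y) (sum (y ℕ.+ j) φ) (φ (suc (y ℕ.+ j))) (g (suc (y ℕ.+ j))) (g (suc (suc (y ℕ.+ j))))))
       (eq₆ M (g (suc y)) (g (suc (y ℕ.+ j))) (g (suc (suc (y ℕ.+ j)))))
       (∣∣-tri (go j) (∣∣-* (h (suc (y ℕ.+ j))) (≤-reflexive (0≤p⇒∣p∣≡p (0≤y-x (anti (y ℕ.+ j)))))))

  harmonic-tail : ∀ (φ : ℕ → ℚ) M → (∀ y → ∣ sum y φ ∣ ≤ M) → ∀ y z → y ℕ.≤ z →
    ∣ harmonic φ z - harmonic φ y ∣ ≤ (M + M) * inv (suc y)
  harmonic-tail φ M h = abel-tail φ M h inv (λ k → 0≤inv (suc k)) (λ k → inv-anti {suc k} (s≤s z≤n) (ℕ.n≤1+n (suc k)))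

  -- Mean zero is demanded of every dilate so that the class is closed under φ ↦ φ(d ·), which
  -- divisor sums produce. Differences of two reduced residue classes and nontrivial real characters
  -- are the instances.
  record Test (m : ℕ) (φ : ℕ → ℚ) : Set where
    field
      period : ∀ k → φ (m ℕ.+ k) ≡ φ k
      bound : ∀ k → ∣ φ k ∣ ≤ 1ℚ
      mean : ∀ d → sum m (λ i → φ (d ℕ.* i)) ≡ 0ℚ

  open Test

  period* : ∀ {m} {φ : ℕ → ℚ} → (∀ k → φ (m ℕ.+ k) ≡ φ k) → ∀ d k → φ (d ℕ.* m ℕ.+ k) ≡ φ k
  period* per zero k = refl
  period* {m} {φ} per (suc d) k = trans (cong φ (ℕ.+-assoc m (d ℕ.* m) k)) (trans (per (d ℕ.* m ℕ.+ k)) (period* {m} {φ} per d k))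

  dilate : ∀ {m φ} d → Test m φ → Test m (λ k → φ (d ℕ.* k))
  dilate {m} {φ} d t = record
    { period = λ k → trans (cong φ (ℕ.*-distribˡ-+ d m k)) (period* {m} {φ} (period t) d (d ℕ.* k))
    ; bound = λ k → bound t (d ℕ.* k)
    ; mean = λ e → trans (sum-ext m (λ i → cong φ (sym (ℕ.*-assoc d e i)))) (mean t (d ℕ.* e))
    }

  test-bound : ∀ {m φ} → 1 ℕ.≤ m → Test m φ → ∀ y → ∣ sum y φ ∣ ≤ ι m
  test-bound {m} {φ} 1≤m t y = subst (∣ sum y φ ∣ ≤_) (*-identityʳ (ι m)) (partial-bound m 1ℚ φ 1≤m 0≤1 (period t) (bound t)
    (trans (sum-ext m (λ i → cong φ (sym (ℕ.*-identityˡ i)))) (mean t 1)) y)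

open Logarithm using (LogData)

-- Chebyshev's bound and sums weighted by the logarithm

module Chebyshev (Y : ℕ) (D : LogData Y) where
  open import Data.Nat.Divisibility
  open import Data.Rational as ℚ hiding (nonNegative; nonZero; NonZero)
  open import Data.Rational.Properties
  open import Tactic.RingSolver using (solve-∀)
  open RationalSums
  open Multiplicative using (dsum-1)
  open TestFunctions
  open LogData D

  ∣∣-trans : ∀ a b c {p q} → ∣ a - b ∣ ≤ p → ∣ b - c ∣ ≤ q → ∣ a - c ∣ ≤ p + q
  ∣∣-trans a b c {p} {q} h k = subst (λ z → ∣ z ∣ ≤ p + q) (eq a b c) (∣∣-tri {a - b} {b - c} h k)
    where
    eq : ∀ a b c → a - b + (b - c) ≡ a - c
    eq = solve-∀ ℚ-ring

  ∣∣-pos : ∀ {a} → 0ℚ ≤ a → ∣ a ∣ ≤ a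
  ∣∣-pos h = ≤-reflexive (0≤p⇒∣p∣≡p h)

  telescope : ∀ x → sum x (λ k → inv k * inv (suc k)) ≤ 1ℚ
  telescope x = via (inv (suc x)) (0≤inv (suc x)) (sym (go x))
    where
    eq : ∀ s a b → s + (a - b) + b ≡ s + a
    eq = solve-∀ ℚ-ring
    go : ∀ x → sum x (λ k → inv k * inv (suc k)) + inv (suc x) ≡ 1ℚ
    go zero = refl
    go (suc x) = trans (cong (λ z → sum x (λ k → inv k * inv (suc k)) + z + inv (suc (suc x))) (sym (inv-tele {suc x} (s≤s z≤n))))
      (trans (eq (sum x (λ k → inv k * inv (suc k))) (inv (suc x)) (inv (suc (suc x)))) (go x))

  -- By parts, the left side is the sum of (L (k+1) - L k)/(k+1), since L 1 = 0; `L-step` bounds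
  -- each term by 3/(k (k+1)).
  weighted : ∀ x → suc x ℕ.≤ Y → sum x (λ k → L k * (inv k * inv (suc k))) + L (suc x) * inv (suc x) ≤ ι 3 * sum x (λ k → inv k * inv (suc k))
  weighted zero _ = ≤-reflexive (trans (cong (λ z → 0ℚ + z * inv 1) L-1) refl)
  weighted (suc x) h = subst (λ z → S + z + l' * b ≤ ι 3 * (T + a * b)) (cong (l *_) (inv-tele {suc x} (s≤s z≤n)))
     (≤-trans (via (b * (ι 3 * a - (l' - l))) (0≤* (0≤inv (suc (suc x))) (0≤y-x (≤-∣∣ʳ {l' - l} (L-step (suc x) (s≤s z≤n) h)))) (eq₁ S l l' a b (ι 3)))
       (subst₂ _≤_ (eq₂ S l a (ι 3 * (a * b))) (sym (*-distribˡ-+ (ι 3) T (a * b))) (+-monoˡ-≤ (ι 3 * (a * b)) (weighted x (ℕ.<⇒≤ h)))))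
    where
    a = inv (suc x)
    b = inv (suc (suc x))
    l = L (suc x)
    l' = L (suc (suc x))
    S = sum x (λ k → L k * (inv k * inv (suc k)))
    T = sum x (λ k → inv k * inv (suc k))
    eq₁ : ∀ s l l' a b t → s + l * a + t * (a * b) ≡ s + l * (a - b) + l' * b + b * (t * a - (l' - l))
    eq₁ = solve-∀ ℚ-ring
    eq₂ : ∀ s l a t → s + l * a + t ≡ s + l * a + t
    eq₂ = solve-∀ ℚ-ring

  0≤weight : ∀ k → 0ℚ ≤ L k * (inv k * inv (suc k))
  0≤weight k = 0≤* (0≤L k) (0≤* (0≤inv k) (0≤inv (suc k)))

  0≤ι3 : 0ℚ ≤ ι 3
  0≤ι3 = 0≤ι 3

  3T≤3 : ∀ x → ι 3 * sum x (λ k → inv k * inv (suc k)) ≤ ι 3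
  3T≤3 x = subst (ι 3 * sum x (λ k → inv k * inv (suc k)) ≤_) (*-identityʳ (ι 3)) (*-monoˡ (ι 3) 0≤ι3 (telescope x))

  weight-sum : ∀ x → suc x ℕ.≤ Y → sum x (λ k → L k * (inv k * inv (suc k))) ≤ ι 3
  weight-sum x h = ≤-trans (via (L (suc x) * inv (suc x)) (0≤* (0≤L (suc x)) (0≤inv (suc x))) refl) (≤-trans (weighted x h) (3T≤3 x))

  end-weight : ∀ x → suc x ℕ.≤ Y → L (suc x) * inv (suc x) ≤ ι 3
  end-weight x h = ≤-trans (via S (sum-nonneg x (λ k _ _ → 0≤weight k)) (+-comm S (L (suc x) * inv (suc x)))) (≤-trans (weighted x h) (3T≤3 x))
    where S = sum x (λ k → L k * (inv k * inv (suc k)))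

  variation : ∀ x → suc x ℕ.≤ Y → sum x (λ k → ∣ L k * inv k - L (suc k) * inv (suc k) ∣) ≤ ι 3 + ι 3
  variation x h = ≤-trans (sum-mono x term) (≤-trans (≤-reflexive (trans (sum-+ x (λ k → L k * (inv k * inv (suc k))) (λ k → ι 3 * (inv k * inv (suc k))))
       (cong (sum x (λ k → L k * (inv k * inv (suc k))) +_) (sum-*ˡ x (ι 3) (λ k → inv k * inv (suc k))))))
     (+-mono-≤ (weight-sum x h) (3T≤3 x)))
    where
    eq₁ : ∀ l l' a b → (l - l') * b + l * (a - b) ≡ l * a - l' * b
    eq₁ = solve-∀ ℚ-ring
    eq₂ : ∀ t a b w → t * a * b + w ≡ w + t * (a * b)
    eq₂ = solve-∀ ℚ-ring
    term : ∀ k → 1 ℕ.≤ k → k ℕ.≤ x → ∣ L k * inv k - L (suc k) * inv (suc k) ∣ ≤ L k * (inv k * inv (suc k)) + ι 3 * (inv k * inv (suc k))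
    term k 1≤k k≤x = subst₂ _≤_ (cong ∣_∣ (eq₁ (L k) (L (suc k)) (inv k) (inv (suc k)))) (eq₂ (ι 3) (inv k) (inv (suc k)) (L k * (inv k * inv (suc k))))
      (∣∣-tri {(L k - L (suc k)) * inv (suc k)} {L k * (inv k - inv (suc k))}
        (∣∣-* {L k - L (suc k)} {inv (suc k)} (subst (_≤ ι 3 * inv k) (∣∣-sym (L (suc k)) (L k)) (L-step k 1≤k (ℕ.≤-trans (s≤s k≤x) h))) (∣∣-pos (0≤inv (suc k))))
        (subst (λ z → ∣ L k * z ∣ ≤ L k * (inv k * inv (suc k))) (sym (inv-tele {k} 1≤k)) (∣∣-pos (0≤weight k))))

  -- `L k`/k need not be monotone, so its total variation is used: 9 = 3 for the end value plus 6
  -- for the variation.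
  log-sum : ∀ (φ : ℕ → ℚ) M → 0ℚ ≤ M → (∀ y → ∣ sum y φ ∣ ≤ M) → ∀ x → suc x ℕ.≤ Y → ∣ sum x (λ k → φ k * (L k * inv k)) ∣ ≤ M * ι 9
  log-sum φ M 0≤M bd x h = ≤-trans (abel-bound x φ (λ k → L k * inv k) M bd)
    (*-monoˡ M 0≤M (+-mono-≤ (≤-trans (∣∣-pos (0≤* (0≤L (suc x)) (0≤inv (suc x)))) (end-weight x h)) (variation x h)))

  -- The analogue of ∑ log(x/d) = O(x): passing from x to x + 1 moves each of x terms by at most
  -- 3/x.
  distance : ∀ x → x ℕ.≤ Y → sum x (λ d → ∣ L x - L d ∣) ≤ ι 3 * ι x
  distance zero _ = ≤-refl
  distance (suc zero) _ = subst (_≤ ι 3 * ι 1) (sym (trans (cong (λ z → 0ℚ + ∣ z ∣) (+-inverseʳ (L 1))) refl)) (0≤* (0≤ι 3) (0≤ι 1))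
  distance (suc x@(suc _)) h = ≤-trans (+-mono-≤ (sum-mono x (λ d _ _ → ∣∣-trans (L (suc x)) (L x) (L d) (L-step x (s≤s z≤n) h) ≤-refl)) (≤-reflexive (cong ∣_∣ (+-inverseʳ (L (suc x))))))
    (subst₂ _≤_ lhs (eq₂ (ι 3) (ι x)) (+-monoʳ-≤ (ι 3) (distance x (ℕ.<⇒≤ h))))
    where
    eq₁ : ∀ i t j s → i * (t * j) + s + 0ℚ ≡ i * j * t + s
    eq₁ = solve-∀ ℚ-ring
    eq₂ : ∀ t i → t + t * i ≡ t * (1ℚ + i)
    eq₂ = solve-∀ ℚ-ring
    S = sum x (λ d → ∣ L x - L d ∣)
    lhs : ι 3 + S ≡ sum x (λ d → ι 3 * inv x + ∣ L x - L d ∣) + 0ℚ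
    lhs = sym (trans (cong (_+ 0ℚ) (trans (sum-+ x (λ _ → ι 3 * inv x) (λ d → ∣ L x - L d ∣)) (cong (_+ S) (sum-const x (ι 3 * inv x)))))
      (trans (eq₁ (ι x) (ι 3) (inv x) S) (cong (_+ S) (trans (cong (_* ι 3) (ι*inv {x} (s≤s z≤n))) (*-identityˡ (ι 3))))))

  Ψ : ℕ → ℚ
  Ψ x = sum x Λ

  0≤Ψ : ∀ x → 0ℚ ≤ Ψ x
  0≤Ψ x = sum-nonneg x (λ k _ _ → 0≤Λ k)

  log-hyperbola : ∀ x → sum x L ≡ sum x (λ d → Λ d * ι (quo x d))
  log-hyperbola x = trans (sum-ext x (λ n → trans (sym (ΛL n)) (sym (*-identityˡ (dsum n Λ)))))
    (trans (hyperbola x (λ _ → 1ℚ) Λ) (sum-ext x (λ d → cong (Λ d *_) (trans (sum-const (quo x d) 1ℚ) (*-identityʳ (ι (quo x d)))))))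

  -- The terms 2 j - 1 and 2 j are paired: `L (2 j)` = 1 + `L j`, and its predecessor is at most 3
  -- larger, so a pair is at most 2 `L j` + 5.
  doubling : ∀ y → 2 ℕ.* y ℕ.≤ Y → sum (2 ℕ.* y) L ≤ sum y L + sum y L + ι 5 * ι y
  doubling zero _ = ≤-refl
  doubling (suc y) h = subst (λ z → sum z L ≤ sum (suc y) L + sum (suc y) L + ι 5 * ι (suc y)) (sym 2y≡)
     (≤-trans (+-mono-≤ (+-mono-≤ (doubling y (ℕ.≤-trans (ℕ.*-monoʳ-≤ 2 (ℕ.n≤1+n y)) h)) odd) even)
       (≤-reflexive (eq (sum y L) (L (suc y)) (ι y))))
    where
    2y≡ : 2 ℕ.* suc y ≡ suc (suc (2 ℕ.* y))
    2y≡ = ℕ.*-suc 2 y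
    h' : suc (suc (2 ℕ.* y)) ℕ.≤ Y
    h' = subst (ℕ._≤ Y) 2y≡ h
    even : L (suc (suc (2 ℕ.* y))) ≤ 1ℚ + L (suc y)
    even = ≤-reflexive (trans (cong L (sym 2y≡)) (L-2 (suc y) (s≤s z≤n) h))
    odd : L (suc (2 ℕ.* y)) ≤ ι 3 + (1ℚ + L (suc y))
    odd = ≤-trans (via (ι 3 - (l - l')) (0≤y-x (≤-trans (≤-∣∣ʳ {l - l'} (subst (_≤ ι 3 * inv (suc (2 ℕ.* y))) (∣∣-sym l' l) (L-step (suc (2 ℕ.* y)) (s≤s z≤n) h')))
       (subst (ι 3 * inv (suc (2 ℕ.* y)) ≤_) (*-identityʳ (ι 3)) (*-monoˡ (ι 3) 0≤ι3 (inv≤1 (suc (2 ℕ.* y))))))) (eq₀ (ι 3) l l')) (+-monoʳ-≤ (ι 3) even)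
      where
      l = L (suc (2 ℕ.* y))
      l' = L (suc (suc (2 ℕ.* y)))
      eq₀ : ∀ t l l' → t + l' ≡ l + (t - (l - l'))
      eq₀ = solve-∀ ℚ-ring
    eq : ∀ s l i → s + s + ι 5 * i + (ι 3 + (1ℚ + l)) + (1ℚ + l) ≡ s + l + (s + l) + ι 5 * (1ℚ + i)
    eq s l i = solve-eq s l i
      where
      solve-eq : ∀ s l i → s + s + (1ℚ + (1ℚ + (1ℚ + (1ℚ + (1ℚ + 0ℚ))))) * i + (1ℚ + (1ℚ + (1ℚ + 0ℚ)) + (1ℚ + l)) + (1ℚ + l) ≡ s + l + (s + l) + (1ℚ + (1ℚ + (1ℚ + (1ℚ + (1ℚ + 0ℚ))))) * (1ℚ + i)
      solve-eq = solve-∀ ℚ-ring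

  -- Chebyshev's argument with the central binomial coefficient: ⌊2y/d⌋ - 2⌊y/d⌋ is never negative
  -- and is at least 1 for y < d ≤ 2y, so Ψ(2y) - Ψ(y) is at most the logarithm of (2y)!/(y!)².
  Ψ-double : ∀ y → 2 ℕ.* y ℕ.≤ Y → Ψ (2 ℕ.* y) ≤ Ψ y + ι 5 * ι y
  Ψ-double y h = via (P + S₂ + (S + S + ι 5 * ι y) - (P₂ + (S + S)) - S₂)
      (0≤y-x {0ℚ} {P + S₂ + (S + S + ι 5 * ι y) - (P₂ + (S + S)) - S₂} (subst (0ℚ ≤_) (eq₀ P S₂ (S + S) P₂ (ι 5 * ι y)) (0≤+ (0≤y-x main) (0≤y-x (doubling y h)))) |> λ z → subst (0ℚ ≤_) (eq₁ (P + S₂ + (S + S + ι 5 * ι y) - (P₂ + (S + S)) - S₂)) z)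
      (eq₂ P S₂ (S + S) P₂ (ι 5 * ι y))
    where
    infixl 0 _|>_
    _|>_ : ∀ {A B : Set} → A → (A → B) → B
    x |> f = f x
    P = Ψ y
    P₂ = Ψ (2 ℕ.* y)
    S = sum y L
    S₂ = sum (2 ℕ.* y) L
    eq₀ : ∀ p s₂ s p₂ c → p + s₂ - (p₂ + s) + (s + c - s₂) ≡ p + s₂ + (s + c) - (p₂ + s) - s₂
    eq₀ = solve-∀ ℚ-ring
    eq₁ : ∀ a → a - 0ℚ ≡ a
    eq₁ = solve-∀ ℚ-ring
    eq₂ : ∀ p s₂ s p₂ c → p + c ≡ p₂ + (p + s₂ + (s + c) - (p₂ + s) - s₂)
    eq₂ = solve-∀ ℚ-ring
    y≤2y : y ℕ.≤ 2 ℕ.* y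
    y≤2y = ℕ.m≤n*m y 2
    extP : Ψ y ≡ sum (2 ℕ.* y) (λ d → χ (d ℕ.≤? y) * Λ d)
    extP = trans (sum-cong y (λ k _ k≤y → sym (trans (cong (_* Λ k) (χ-yes (k ℕ.≤? y) k≤y)) (*-identityˡ (Λ k)))))
      (sym (sum-extend (λ d → χ (d ℕ.≤? y) * Λ d) y≤2y (λ k y<k _ → trans (cong (_* Λ k) (χ-no (k ℕ.≤? y) (ℕ.<⇒≱ y<k))) (*-zeroˡ (Λ k)))))
    quo0 : ∀ k → y ℕ.< k → quo y k ≡ 0
    quo0 k y<k with quo y k in e
    ... | zero = refl
    ... | suc z = ⊥-elim (ℕ.<⇒≱ y<k (ℕ.≤-trans (ℕ.m≤m*n k (suc z)) (quo-≤ {y} {k} (ℕ.≤-trans (s≤s z≤n) y<k) (ℕ.≤-reflexive (sym e)))))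
    extS : S ≡ sum (2 ℕ.* y) (λ d → Λ d * ι (quo y d))
    extS = trans (log-hyperbola y) (sym (sum-extend (λ d → Λ d * ι (quo y d)) y≤2y (λ k y<k _ → trans (cong (λ z → Λ k * ι z) (quo0 k y<k)) (*-zeroʳ (Λ k)))))
    eq₃ : ∀ l a → l + (l * a + l * a) ≡ l * (1ℚ + (a + a))
    eq₃ = solve-∀ ℚ-ring
    eq₄ : ∀ l x a → x * l + l * a ≡ l * (x + a)
    eq₄ = solve-∀ ℚ-ring
    term : ∀ d → 1 ℕ.≤ d → d ℕ.≤ 2 ℕ.* y → Λ d + (Λ d * ι (quo y d) + Λ d * ι (quo y d)) ≤ χ (d ℕ.≤? y) * Λ d + Λ d * ι (quo (2 ℕ.* y) d)
    term d 1≤d d≤2y = subst₂ _≤_ (sym (eq₃ (Λ d) (ι (quo y d)))) (sym (eq₄ (Λ d) (χ (d ℕ.≤? y)) (ι (quo (2 ℕ.* y) d)))) (*-monoˡ (Λ d) (0≤Λ d) (cmp (d ℕ.≤? y)))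
      where
      cmp : (z : Dec (d ℕ.≤ y)) → 1ℚ + (ι (quo y d) + ι (quo y d)) ≤ χ z + ι (quo (2 ℕ.* y) d)
      cmp (yes _) = +-monoʳ-≤ 1ℚ (subst (_≤ ι (quo (2 ℕ.* y) d)) (ι-+ (quo y d) (quo y d)) (ι-mono (≤-quo {2 ℕ.* y} {d} 1≤d
          (subst₂ ℕ._≤_ (sym (ℕ.*-distribˡ-+ d (quo y d) (quo y d))) (cong (y ℕ.+_) (sym (ℕ.+-identityʳ y))) (ℕ.+-mono-≤ (proj₁ (quo-bounds y d 1≤d)) (proj₁ (quo-bounds y d 1≤d)))))))
      cmp (no ¬p) = subst₂ _≤_ (cong (λ z → 1ℚ + (ι z + ι z)) (sym (quo0 d (ℕ.≰⇒> ¬p)))) (sym (+-identityˡ (ι (quo (2 ℕ.* y) d))))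
          (ι-mono {1} (≤-quo {2 ℕ.* y} {d} 1≤d (subst (ℕ._≤ 2 ℕ.* y) (sym (ℕ.*-identityʳ d)) d≤2y)))
    main : P₂ + (S + S) ≤ P + S₂
    main = subst₂ _≤_ (trans (sum-+ (2 ℕ.* y) Λ (λ d → Λ d * ι (quo y d) + Λ d * ι (quo y d))) (cong (P₂ +_) (trans (sum-+ (2 ℕ.* y) (λ d → Λ d * ι (quo y d)) (λ d → Λ d * ι (quo y d))) (cong₂ _+_ (sym extS) (sym extS)))))
      (trans (sum-+ (2 ℕ.* y) (λ d → χ (d ℕ.≤? y) * Λ d) (λ d → Λ d * ι (quo (2 ℕ.* y) d))) (cong₂ _+_ (sym extP) (sym (log-hyperbola (2 ℕ.* y)))))
      (sum-mono (2 ℕ.* y) term)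

  chebyshev : ∀ k → 2 ℕ.^ k ℕ.≤ Y → Ψ (2 ℕ.^ k) ≤ ι 5 * ι (2 ℕ.^ k)
  chebyshev zero _ = subst (_≤ ι 5 * ι 1) (sym (trans (+-identityˡ (Λ 1)) (trans (sym (dsum-1 Λ)) (trans (ΛL 1) L-1)))) (0≤* (0≤ι 5) (0≤ι 1))
  chebyshev (suc k) h = ≤-trans (Ψ-double (2 ℕ.^ k) h) (≤-trans (+-monoˡ-≤ (ι 5 * ι (2 ℕ.^ k)) (chebyshev k (ℕ.≤-trans (ℕ.m≤n*m (2 ℕ.^ k) 2) h)))
     (≤-reflexive (trans (eq (ι 5) (ι (2 ℕ.^ k))) (cong (ι 5 *_) (sym (ι-* 2 (2 ℕ.^ k)))))))
    where
    eq : ∀ a b → a * b + a * b ≡ a * ((1ℚ + (1ℚ + 0ℚ)) * b)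
    eq = solve-∀ ℚ-ring

  L-2^ : ∀ k → 2 ℕ.^ k ℕ.≤ Y → L (2 ℕ.^ k) ≡ ι k
  L-2^ zero _ = L-1
  L-2^ (suc k) h = trans (L-2 (2 ℕ.^ k) (ℕ.m^n>0 2 k) h) (cong (1ℚ +_) (L-2^ k (ℕ.≤-trans (ℕ.m≤n*m (2 ℕ.^ k) 2) h)))

-- Mertens' theorem and Selberg's symmetry relation

module Selberg (Y : ℕ) (D : LogData Y) where
  open import Data.Nat.Divisibility
  open import Data.Rational as ℚ hiding (nonNegative; nonZero; NonZero)
  open import Data.Rational.Properties
  open import Tactic.RingSolver using (solve-∀)
  open RationalSums
  open Multiplicative using (m<2^m; dsum-*ˡ)
  open TestFunctions
  open LogData D
  open Chebyshev Y D

  0≤Λinv : ∀ d → 0ℚ ≤ Λ d * inv d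
  0≤Λinv d = 0≤* (0≤Λ d) (0≤inv d)

  quo-inv : ∀ x d → 1 ℕ.≤ d → ∣ ι (quo x d) - ι x * inv d ∣ ≤ 1ℚ
  quo-inv x d 1≤d = subst (_≤ 1ℚ) (∣∣-sym (ι x * inv d) (ι (quo x d))) (∣∣≤ (≤-trans (neg-antimono-≤ 0≤1) (0≤y-x lower)) upper)
    where
    q = quo x d
    eq₁ : ∀ a b i → a * b * i ≡ a * i * b
    eq₁ = solve-∀ ℚ-ring
    cancel : ∀ k → ι (d ℕ.* k) * inv d ≡ ι k
    cancel k = trans (cong (_* inv d) (ι-* d k)) (trans (eq₁ (ι d) (ι k) (inv d)) (trans (cong (_* ι k) (ι*inv {d} 1≤d)) (*-identityˡ (ι k))))
    lower : ι q ≤ ι x * inv d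
    lower = subst (_≤ ι x * inv d) (cancel q) (*-monoʳ (inv d) (0≤inv d) (ι-mono (proj₁ (quo-bounds x d 1≤d))))
    upper : ι x * inv d - ι q ≤ 1ℚ
    upper = via (1ℚ + ι q - ι x * inv d) (0≤y-x (subst (ι x * inv d ≤_) (cancel (suc q)) (*-monoʳ (inv d) (0≤inv d) (ι-mono (ℕ.<⇒≤ (proj₂ (quo-bounds x d 1≤d)))))))
       (eq₂ (ι x * inv d) (ι q))
      where
      eq₂ : ∀ a q → 1ℚ ≡ a - q + (1ℚ + q - a)
      eq₂ = solve-∀ ℚ-ring

  inv-quo-inv : ∀ x d → 1 ℕ.≤ x → 1 ℕ.≤ d → inv d * inv (suc (quo x d)) ≤ inv x
  inv-quo-inv x d 1≤x 1≤d = *-cancelˡ-≤ (ι x) (0<ι {x} 1≤x) (subst₂ _≤_ (eq (inv d) (ι x) (inv (suc (quo x d))))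
      (trans (*-comm (inv d) (ι d)) (trans (ι*inv {d} 1≤d) (sym (ι*inv {x} 1≤x)))) (*-monoˡ (inv d) (0≤inv d) (inv-quo x d 1≤d)))
    where
    eq : ∀ a b c → a * (b * c) ≡ b * (a * c)
    eq = solve-∀ ℚ-ring

  module Mertens (m : ℕ) (1≤m : 1 ℕ.≤ m) (U : ℕ → ℚ) (0≤U : ∀ n → 0ℚ ≤ U n) (U≤1 : ∀ n → U n ≤ 1ℚ)
                 (U-* : ∀ d k → U (d ℕ.* k) ≡ U d * U k) (period : ∀ k → U (m ℕ.+ k) ≡ U k) where

    h : ℚ
    h = sum m U

    0≤h : 0ℚ ≤ h
    0≤h = sum-nonneg m (λ k _ _ → 0≤U k)

    h≤m : h ≤ ι m
    h≤m = subst (h ≤_) (trans (sum-const m 1ℚ) (*-identityʳ (ι m))) (sum-mono m (λ k _ _ → U≤1 k))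

    N : ℕ → ℚ
    N y = sum y U

    -- m U - h is periodic with sum 0 over a period and values of size at most m.
    N-approx : ∀ y → ∣ ι m * N y - ι y * h ∣ ≤ ι m * ι m
    N-approx y = subst (λ z → ∣ z ∣ ≤ ι m * ι m) (sumφ y) (partial-bound m (ι m) φ 1≤m (0≤ι m) (λ k → cong (λ z → ι m * z - h) (period k)) bd mean0 y)
      where
      φ : ℕ → ℚ
      φ j = ι m * U j - h
      eq₁ : ∀ m → m * 1ℚ ≡ m
      eq₁ = solve-∀ ℚ-ring
      eq₂ : ∀ a → a - 0ℚ ≡ a
      eq₂ = solve-∀ ℚ-ring
      eq₃ : ∀ h → 0ℚ - h ≡ - h
      eq₃ = solve-∀ ℚ-ring
      sumφ : ∀ y → sum y φ ≡ ι m * N y - ι y * h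
      sumφ y = trans (sum-- y (λ j → ι m * U j) (λ _ → h)) (cong₂ _-_ (sum-*ˡ y (ι m) U) (sum-const y h))
      mean0 : sum m φ ≡ 0ℚ
      mean0 = trans (sumφ m) (+-inverseʳ (ι m * h))
      mU≤m : ∀ j → ι m * U j ≤ ι m
      mU≤m j = subst (ι m * U j ≤_) (eq₁ (ι m)) (*-monoˡ (ι m) (0≤ι m) (U≤1 j))
      bd : ∀ j → ∣ φ j ∣ ≤ ι m
      bd j = ∣∣≤ (≤-trans (neg-antimono-≤ h≤m) (subst (_≤ φ j) (eq₃ h) (+-monoˡ-≤ (- h) (0≤* (0≤ι m) (0≤U j)))))
                 (subst (φ j ≤_) (eq₂ (ι m)) (+-mono-≤ (mU≤m j) (neg-antimono-≤ 0≤h)))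

    F : ℕ → ℚ
    F x = sum x (λ d → U d * (Λ d * inv d))

    -- The sum of `U n` `L n` is evaluated twice: as k `N x` up to 3 x, and by divisors as ∑ Λ(d)
    -- U(d) N(x/d), which is close to (h/m) x `F x`. The constant is 14 = 1 + 3 + 5 + 5: the two
    -- replacements of `N` give 1 and 5, `distance` gives 3 and rounding ⌊x/d⌋ gives 5.
    mertens : ∀ k → 2 ℕ.^ k ℕ.≤ Y → 1ℚ ≤ h → ∣ F (2 ℕ.^ k) - ι k ∣ ≤ ι 14 * (ι m * ι m)
    mertens k x≤Y 1≤h = *-cancelˡ-≤ (ι x) (0<ι {x} 1≤x) (≤-trans (subst₂ _≤_ refl (trans (cong (λ z → z * (h * ∣ F x - t ∣)) (0≤p⇒∣p∣≡p (0≤ι x))) refl)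
         (*-mono (0≤∣p∣ (F x - t)) (0≤∣p∣ (ι x)) (x≤∣x∣ (ι x)) (subst (_≤ h * ∣ F x - t ∣) (*-identityˡ ∣ F x - t ∣) (*-monoʳ ∣ F x - t ∣ (0≤∣p∣ (F x - t)) 1≤h))))
       (subst (_≤ ι x * (ι 14 * (ι m * ι m))) absx total))
      where
      x = 2 ℕ.^ k
      t = ι k
      1≤x : 1 ℕ.≤ x
      1≤x = ℕ.m^n>0 2 k
      absx : ∣ ι x * (h * (F x - t)) ∣ ≡ ι x * (h * ∣ F x - t ∣)
      absx = trans (∣p*q∣≡∣p∣*∣q∣ (ι x) (h * (F x - t))) (cong₂ _*_ (0≤p⇒∣p∣≡p (0≤ι x)) (trans (∣p*q∣≡∣p∣*∣q∣ h (F x - t)) (cong (_* ∣ F x - t ∣) (0≤p⇒∣p∣≡p 0≤h))))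
      R : ℚ
      R = sum x (λ d → Λ d * (U d * N (quo x d)))
      hyp : sum x (λ n → U n * L n) ≡ R
      hyp = trans (sum-ext x (λ n → cong (U n *_) (sym (ΛL n)))) (trans (hyperbola x U Λ) (sum-ext x (λ d → cong (Λ d *_) (trans (sum-ext (quo x d) (U-* d)) (sum-*ˡ (quo x d) (U d) U)))))
      ΛU≤ : ∀ d → Λ d * U d ≤ Λ d
      ΛU≤ d = subst (Λ d * U d ≤_) (*-identityʳ (Λ d)) (*-monoˡ (Λ d) (0≤Λ d) (U≤1 d))
      Q : ℚ
      Q = sum x (λ d → Λ d * (U d * ι (quo x d)))
      ∣ΛU*∣ : ∀ d z b → ∣ z ∣ ≤ b → ∣ Λ d * U d * z ∣ ≤ Λ d * b
      ∣ΛU*∣ d z b hz = ∣∣-* {Λ d * U d} {z} (≤-trans (∣∣-pos (0≤* (0≤Λ d) (0≤U d))) (ΛU≤ d)) hz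
      stepA : ∣ ι m * R - h * Q ∣ ≤ Ψ x * (ι m * ι m)
      stepA = subst₂ _≤_ (cong ∣_∣ (trans (sum-- x (λ d → ι m * (Λ d * (U d * N (quo x d)))) (λ d → h * (Λ d * (U d * ι (quo x d))))) (cong₂ _-_ (sum-*ˡ x (ι m) (λ d → Λ d * (U d * N (quo x d)))) (sum-*ˡ x h (λ d → Λ d * (U d * ι (quo x d)))))))
          (sum-*ʳ x (ι m * ι m) Λ)
          (sum-abs x (λ d _ _ → subst (λ z → ∣ z ∣ ≤ Λ d * (ι m * ι m)) (eq (Λ d) (U d) (ι m) (N (quo x d)) (ι (quo x d)) h) (∣ΛU*∣ d (ι m * N (quo x d) - ι (quo x d) * h) (ι m * ι m) (N-approx (quo x d)))))
        where
        eq : ∀ l u m n q h → l * u * (m * n - q * h) ≡ m * (l * (u * n)) - h * (l * (u * q))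
        eq = solve-∀ ℚ-ring
      stepB : ∣ Q - ι x * F x ∣ ≤ Ψ x * 1ℚ
      stepB = subst₂ _≤_ (cong ∣_∣ (trans (sum-- x (λ d → Λ d * (U d * ι (quo x d))) (λ d → ι x * (U d * (Λ d * inv d)))) (cong (λ z → Q - z) (sum-*ˡ x (ι x) (λ d → U d * (Λ d * inv d))))))
          (sum-*ʳ x 1ℚ Λ)
          (sum-abs x (λ d 1≤d _ → subst (λ z → ∣ z ∣ ≤ Λ d * 1ℚ) (eq (Λ d) (U d) (ι (quo x d)) (ι x) (inv d)) (∣ΛU*∣ d (ι (quo x d) - ι x * inv d) 1ℚ (quo-inv x d 1≤d))))
        where
        eq : ∀ l u q x i → l * u * (q - x * i) ≡ l * (u * q) - x * (u * (l * i))
        eq = solve-∀ ℚ-ring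
      stepC : ∣ t * N x - R ∣ ≤ ι 3 * ι x
      stepC = subst (λ z → ∣ z ∣ ≤ ι 3 * ι x) (trans (sum-- x (λ n → t * U n) (λ n → U n * L n)) (cong₂ _-_ (sum-*ˡ x t U) hyp))
          (≤-trans (sum-abs x (λ n _ _ → subst (λ z → ∣ z ∣ ≤ ∣ L x - L n ∣) (trans (cong (λ z → U n * (z - L n)) (L-2^ k x≤Y)) (eq (U n) t (L n)))
              (subst (∣ U n * (L x - L n) ∣ ≤_) (*-identityˡ ∣ L x - L n ∣) (∣∣-* {U n} {L x - L n} (≤-trans (∣∣-pos (0≤U n)) (U≤1 n)) ≤-refl)))) (distance x x≤Y))
        where
        eq : ∀ u t l → u * (t - l) ≡ t * u - u * l
        eq = solve-∀ ℚ-ring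
      stepD : ∣ t * (ι x * h) - t * (ι m * N x) ∣ ≤ t * (ι m * ι m)
      stepD = subst (λ z → ∣ z ∣ ≤ t * (ι m * ι m)) (eq t (ι x * h) (ι m * N x)) (∣∣-* {t} {ι x * h - ι m * N x} (∣∣-pos (0≤ι k)) (subst (_≤ ι m * ι m) (∣∣-sym (ι m * N x) (ι x * h)) (N-approx x)))
        where
        eq : ∀ t a b → t * (a - b) ≡ t * a - t * b
        eq = solve-∀ ℚ-ring
      chain : ∣ t * (ι x * h) - h * (ι x * F x) ∣ ≤ t * (ι m * ι m) + (ι m * (ι 3 * ι x) + (Ψ x * (ι m * ι m) + ι m * (Ψ x * 1ℚ)))
      chain = ∣∣-trans (t * (ι x * h)) (t * (ι m * N x)) (h * (ι x * F x)) stepD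
        (∣∣-trans (t * (ι m * N x)) (ι m * R) (h * (ι x * F x))
          (subst (λ z → ∣ z ∣ ≤ ι m * (ι 3 * ι x)) (eq₁ (ι m) t (N x) R) (∣∣-* {ι m} {t * N x - R} (∣∣-pos (0≤ι m)) stepC))
          (∣∣-trans (ι m * R) (h * Q) (h * (ι x * F x)) stepA
            (subst (λ z → ∣ z ∣ ≤ ι m * (Ψ x * 1ℚ)) (eq₂ h Q (ι x * F x)) (∣∣-* {h} {Q - ι x * F x} (≤-trans (∣∣-pos 0≤h) h≤m) stepB))))
        where
        eq₁ : ∀ m t n r → m * (t * n - r) ≡ t * (m * n) - m * r
        eq₁ = solve-∀ ℚ-ring
        eq₂ : ∀ h q f → h * (q - f) ≡ h * q - h * f
        eq₂ = solve-∀ ℚ-ring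
      M : ℚ
      M = ι m * ι m
      m≤M : ι m ≤ M
      m≤M = subst (_≤ M) (*-identityʳ (ι m)) (*-monoˡ (ι m) (0≤ι m) (1≤ι {m} 1≤m))
      Ψ≤ : Ψ x ≤ ι 5 * ι x
      Ψ≤ = chebyshev k x≤Y
      0≤M : 0ℚ ≤ M
      0≤M = 0≤* (0≤ι m) (0≤ι m)
      t≤x : t ≤ ι x
      t≤x = ι-mono (ℕ.<⇒≤ (m<2^m k))
      total : ∣ ι x * (h * (F x - t)) ∣ ≤ ι x * (ι 14 * M)
      total = subst₂ _≤_ (trans (∣∣-sym (t * (ι x * h)) (h * (ι x * F x))) (cong ∣_∣ (eq₁ (ι x) h (F x) t))) (eq₂ (ι x) M)
        (≤-trans chain (+-mono-≤ (*-monoʳ M 0≤M t≤x) (+-mono-≤ (*-monoʳ (ι 3 * ι x) (0≤* (0≤ι 3) (0≤ι x)) m≤M)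
           (+-mono-≤ (*-monoʳ M 0≤M Ψ≤) (*-mono {ι m} {M} {Ψ x * 1ℚ} {ι 5 * ι x * 1ℚ} (0≤* (0≤Ψ x) 0≤1) 0≤M m≤M (*-monoʳ 1ℚ 0≤1 Ψ≤))))))
        where
        eq₁ : ∀ x h f t → h * (x * f) - t * (x * h) ≡ x * (h * (f - t))
        eq₁ = solve-∀ ℚ-ring
        eq₂ : ∀ x m → x * m + (m * ((1ℚ + (1ℚ + (1ℚ + 0ℚ))) * x) + ((1ℚ + (1ℚ + (1ℚ + (1ℚ + (1ℚ + 0ℚ))))) * x * m + m * ((1ℚ + (1ℚ + (1ℚ + (1ℚ + (1ℚ + 0ℚ))))) * x * 1ℚ)))
           ≡ x * ((1ℚ + (1ℚ + (1ℚ + (1ℚ + (1ℚ + (1ℚ + (1ℚ + (1ℚ + (1ℚ + (1ℚ + (1ℚ + (1ℚ + (1ℚ + (1ℚ + 0ℚ)))))))))))))) * m)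
        eq₂ = solve-∀ ℚ-ring

  F₁ : ℕ → ℚ
  F₁ x = sum x (λ d → Λ d * inv d)

  0≤F₁ : ∀ x → 0ℚ ≤ F₁ x
  0≤F₁ x = sum-nonneg x (λ d _ _ → 0≤Λinv d)

  F₁-bound : ∀ k → 2 ℕ.^ k ℕ.≤ Y → F₁ (2 ℕ.^ k) ≤ ι k + ι 14
  F₁-bound k hk = via (ι k + ι 14 - F₁ x) (0≤y-x (≤-trans (≤-reflexive (sum-ext x (λ d → sym (*-identityˡ (Λ d * inv d)))))
      (≤-trans (via (ι 14 - (F x - ι k)) (0≤y-x (≤-∣∣ʳ {F x - ι k} (mertens k hk ≤-refl))) (eq (ι k) (F x) (ι 14))) ≤-refl))) (eq' (ι k + ι 14) (F₁ x))
    where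
    open Mertens 1 ℕ.≤-refl (λ _ → 1ℚ) (λ _ → 0≤1) (λ _ → ≤-refl) (λ _ _ → refl) (λ _ → refl)
    x = 2 ℕ.^ k
    eq : ∀ k f c → k + c ≡ f + (c - (f - k))
    eq = solve-∀ ℚ-ring
    eq' : ∀ a b → a ≡ b + (a - b)
    eq' = solve-∀ ℚ-ring

  module _ (m : ℕ) (1≤m : 1 ℕ.≤ m) where

    -- A double sum of φ(d k) Λ(d)/(d k) with independent cut-offs. With y replaced by ⌊x/d⌋ it
    -- would collapse to ∑ φ(n) L(n)/n over n ≤ x.
    V : (ℕ → ℚ) → ℕ → ℕ → ℚ
    V φ x y = sum x (λ d → Λ d * inv d * harmonic (λ k → φ (d ℕ.* k)) y)

    tail-any : ∀ φ → Test m φ → ∀ y z → ∣ harmonic φ y - harmonic φ z ∣ ≤ (ι m + ι m) * inv (suc y) + (ι m + ι m) * inv (suc z)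
    tail-any φ tφ y z with ℕ.≤-total y z
    ... | inj₁ y≤z = ≤-trans (subst (_≤ (ι m + ι m) * inv (suc y)) (∣∣-sym (harmonic φ z) (harmonic φ y)) (harmonic-tail φ (ι m) (test-bound 1≤m tφ) y z y≤z))
         (via ((ι m + ι m) * inv (suc z)) (0≤* (0≤+ (0≤ι m) (0≤ι m)) (0≤inv (suc z))) refl)
    ... | inj₂ z≤y = ≤-trans (harmonic-tail φ (ι m) (test-bound 1≤m tφ) z y z≤y)
         (via ((ι m + ι m) * inv (suc y)) (0≤* (0≤+ (0≤ι m) (0≤ι m)) (0≤inv (suc y))) (+-comm ((ι m + ι m) * inv (suc y)) ((ι m + ι m) * inv (suc z))))

    -- Comparison with the collapsed sum `W`, which `log-sum` bounds by 9 m. The harmonic tails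
    -- differ by 2 m (1/(y+1) + 1/(⌊x/d⌋+1)); the second part sums to 10 m by Chebyshev, whence 19 =
    -- 9 + 10.
    V-bound : ∀ φ → Test m φ → ∀ k y → suc (2 ℕ.^ k) ℕ.≤ Y →
      ∣ V φ (2 ℕ.^ k) y ∣ ≤ ι m * ι 19 + (ι m + ι m) * inv (suc y) * F₁ (2 ℕ.^ k)
    V-bound φ tφ k y h = subst (∣ V φ x y ∣ ≤_) (eq-fin (ι m) (inv (suc y)) (F₁ x))
       (subst (λ z → ∣ z ∣ ≤ (ι m + ι m) * inv (suc y) * F₁ x + (ι m + ι m) * ι 5 + ι m * ι 9) (eq₀ (V φ x y) W)
        (∣∣-tri {V φ x y - W} {W} close (subst (λ z → ∣ z ∣ ≤ ι m * ι 9) hyp (log-sum φ (ι m) (0≤ι m) (test-bound 1≤m tφ) x h))))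
      where
      x = 2 ℕ.^ k
      1≤x : 1 ℕ.≤ x
      1≤x = ℕ.m^n>0 2 k
      M = ι m + ι m
      0≤M : 0ℚ ≤ M
      0≤M = 0≤+ (0≤ι m) (0≤ι m)
      φ' : ℕ → ℕ → ℚ
      φ' d j = φ (d ℕ.* j)
      W : ℚ
      W = sum x (λ d → Λ d * inv d * harmonic (φ' d) (quo x d))
      eq₀ : ∀ a b → a - b + b ≡ a
      eq₀ = solve-∀ ℚ-ring
      eq-fin : ∀ m i f → (m + m) * i * f + (m + m) * (1ℚ + (1ℚ + (1ℚ + (1ℚ + (1ℚ + 0ℚ))))) + m * (1ℚ + (1ℚ + (1ℚ + (1ℚ + (1ℚ + (1ℚ + (1ℚ + (1ℚ + (1ℚ + 0ℚ)))))))))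
        ≡ m * (1ℚ + (1ℚ + (1ℚ + (1ℚ + (1ℚ + (1ℚ + (1ℚ + (1ℚ + (1ℚ + (1ℚ + (1ℚ + (1ℚ + (1ℚ + (1ℚ + (1ℚ + (1ℚ + (1ℚ + (1ℚ + (1ℚ + 0ℚ))))))))))))))))))) + (m + m) * i * f
      eq-fin = solve-∀ ℚ-ring
      eq₁ : ∀ f i l → f * (l * i) ≡ f * i * l
      eq₁ = solve-∀ ℚ-ring
      eq₂ : ∀ f i j → f * (i * j) ≡ i * (f * j)
      eq₂ = solve-∀ ℚ-ring
      hyp : sum x (λ n → φ n * (L n * inv n)) ≡ W
      hyp = trans (sum-ext x (λ n → trans (eq₁ (φ n) (inv n) (L n)) (cong (φ n * inv n *_) (sym (ΛL n)))))
        (trans (hyperbola x (λ n → φ n * inv n) Λ) (sum-cong x (λ d 1≤d _ → trans (cong (Λ d *_) (trans (sum-cong (quo x d) (λ j 1≤j _ →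
             trans (cong (φ (d ℕ.* j) *_) (inv-* {d} {j} 1≤d 1≤j)) (eq₂ (φ (d ℕ.* j)) (inv d) (inv j)))) (sum-*ˡ (quo x d) (inv d) (λ j → φ (d ℕ.* j) * inv j)))) (sym (*-assoc (Λ d) (inv d) (harmonic (φ' d) (quo x d)))))))
      term : ∀ d → 1 ℕ.≤ d → d ℕ.≤ x → ∣ Λ d * inv d * harmonic (φ' d) y - Λ d * inv d * harmonic (φ' d) (quo x d) ∣ ≤ M * inv (suc y) * (Λ d * inv d) + M * inv x * Λ d
      term d 1≤d _ = subst (λ z → ∣ z ∣ ≤ M * inv (suc y) * (Λ d * inv d) + M * inv x * Λ d) (eq₃ (Λ d * inv d) (harmonic (φ' d) y) (harmonic (φ' d) (quo x d)))
        (≤-trans (∣∣-* {Λ d * inv d} {harmonic (φ' d) y - harmonic (φ' d) (quo x d)} (∣∣-pos (0≤Λinv d)) (tail-any (φ' d) (dilate d tφ) y (quo x d)))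
          (subst₂ _≤_ (sym (eq₄ (Λ d) (inv d) M (inv (suc y)) (inv (suc (quo x d))))) refl (+-monoʳ-≤ (M * inv (suc y) * (Λ d * inv d)) (subst₂ _≤_ refl (eq₆ (Λ d) M (inv x)) (*-monoˡ (Λ d * M) (0≤* (0≤Λ d) 0≤M) (inv-quo-inv x d 1≤x 1≤d))))))
        where
        eq₃ : ∀ l a b → l * (a - b) ≡ l * a - l * b
        eq₃ = solve-∀ ℚ-ring
        eq₄ : ∀ l i m a b → l * i * (m * a + m * b) ≡ m * a * (l * i) + l * m * (i * b)
        eq₄ = solve-∀ ℚ-ring
        eq₆ : ∀ l m i → l * m * i ≡ m * i * l
        eq₆ = solve-∀ ℚ-ring
      close : ∣ V φ x y - W ∣ ≤ M * inv (suc y) * F₁ x + M * ι 5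
      close = subst (λ z → ∣ z ∣ ≤ M * inv (suc y) * F₁ x + M * ι 5) (sum-- x (λ d → Λ d * inv d * harmonic (φ' d) y) (λ d → Λ d * inv d * harmonic (φ' d) (quo x d)))
        (≤-trans (sum-abs x term) (≤-trans (≤-reflexive (trans (sum-+ x (λ d → M * inv (suc y) * (Λ d * inv d)) (λ d → M * inv x * Λ d)) (cong₂ _+_ (sum-*ˡ x (M * inv (suc y)) (λ d → Λ d * inv d)) (sum-*ˡ x (M * inv x) Λ))))
          (+-monoʳ-≤ (M * inv (suc y) * F₁ x) (subst₂ _≤_ (sym (*-assoc M (inv x) (Ψ x))) refl (*-monoˡ M 0≤M
             (≤-trans (*-monoˡ (inv x) (0≤inv x) (chebyshev k (ℕ.<⇒≤ h))) (≤-reflexive (trans (eq₇ (inv x) (ι 5) (ι x)) (trans (cong (_* ι 5) (ι*inv {x} 1≤x)) (*-identityˡ (ι 5)))))))))))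
        where
        eq₇ : ∀ i a x → i * (a * x) ≡ x * i * a
        eq₇ = solve-∀ ℚ-ring

    -- Selberg's symmetry relation in Mertens form, for two widely separated scales 2^k < 2^k'.
    selberg : ∀ φ → Test m φ → ∀ k k' → 2 ℕ.^ k ℕ.≤ Y → suc (2 ℕ.^ k') ℕ.≤ Y →
      ∣ sum (2 ℕ.^ k') (λ n → Λ n * inv n * (ι k * φ n + sum (2 ℕ.^ k) (λ j → Λ j * inv j * φ (n ℕ.* j)))) ∣
        ≤ ι m * ι 57 * ι (2 ℕ.^ k) + ι m * ι 6 * F₁ (2 ℕ.^ k')
    selberg φ tφ k k' x≤Y h' = subst₂ _≤_ (cong ∣_∣ (sym rearrange)) refl (≤-trans (sum-abs x term) (≤-trans (≤-reflexive (trans (sum-+ x (λ d → ∣ L x - L d ∣ * C) (λ d → ∣ L x - L d ∣ * (M * inv x * F₁ x'))) (cong₂ _+_ (sum-*ʳ x C (λ d → ∣ L x - L d ∣)) (sum-*ʳ x (M * inv x * F₁ x') (λ d → ∣ L x - L d ∣)))))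
        (≤-trans (+-mono-≤ (*-monoʳ C 0≤C (distance x x≤Y)) (*-monoʳ (M * inv x * F₁ x') (0≤* (0≤* 0≤M (0≤inv x)) (0≤F₁ x')) (distance x x≤Y)))
          (≤-reflexive (cong₂ _+_ (eq-a (ι m) (ι x)) (trans (eq-b (ι x) (inv x) (ι m) (F₁ x')) (trans (cong (_* (ι m * ι 6 * F₁ x')) (ι*inv {x} 1≤x)) (*-identityˡ (ι m * ι 6 * F₁ x')))))))))
      where
      x = 2 ℕ.^ k
      x' = 2 ℕ.^ k'
      t = ι k
      1≤x : 1 ℕ.≤ x
      1≤x = ℕ.m^n>0 2 k
      C = ι m * ι 19
      0≤C : 0ℚ ≤ C
      0≤C = 0≤* (0≤ι m) (0≤ι 19)
      M = ι m + ι m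
      0≤M : 0ℚ ≤ M
      0≤M = 0≤+ (0≤ι m) (0≤ι m)
      eq-a : ∀ m x → (1ℚ + (1ℚ + (1ℚ + 0ℚ))) * x * (m * ι 19) ≡ m * ι 57 * x
      eq-a m x = trans (eq-a' m x (ι 19)) (cong (λ z → m * z * x) refl)
        where
        eq-a' : ∀ m x c → (1ℚ + (1ℚ + (1ℚ + 0ℚ))) * x * (m * c) ≡ m * ((1ℚ + (1ℚ + (1ℚ + 0ℚ))) * c) * x
        eq-a' = solve-∀ ℚ-ring
      eq-b : ∀ x i m f → (1ℚ + (1ℚ + (1ℚ + 0ℚ))) * x * ((m + m) * i * f) ≡ x * i * (m * (1ℚ + (1ℚ + (1ℚ + (1ℚ + (1ℚ + (1ℚ + 0ℚ)))))) * f)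
      eq-b = solve-∀ ℚ-ring
      -- Selberg's weights μ(d) log(x/d), whose divisor sum at j is log x [j = 1] + Λ(j): this
      -- produces both terms of the relation at once.
      c : ℕ → ℚ
      c d = μ d * (L x - L d)
      inner : ∀ (f : ℕ → ℚ) → t * f 1 + sum x (λ j → Λ j * inv j * f j) ≡ sum x (λ d → c d * inv d * harmonic (λ j → f (d ℕ.* j)) (quo x d))
      inner f = begin
        t * f 1 + sum x (λ j → Λ j * inv j * f j)
          ≡⟨ cong (_+ sum x (λ j → Λ j * inv j * f j)) (sym first) ⟩
        sum x (λ j → f j * inv j * (t * χ (j ℕ.≟ 1))) + sum x (λ j → Λ j * inv j * f j)
          ≡⟨ sym (sum-+ x _ _) ⟩
        sum x (λ j → f j * inv j * (t * χ (j ℕ.≟ 1)) + Λ j * inv j * f j)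
          ≡⟨ sum-cong x (λ j 1≤j j≤x → trans (eq₁ (f j) (inv j) (t * χ (j ℕ.≟ 1)) (Λ j)) (cong (f j * inv j *_) (sym (dsum-c j 1≤j (ℕ.≤-trans j≤x x≤Y))))) ⟩
        sum x (λ j → f j * inv j * dsum j c)
          ≡⟨ hyperbola x (λ j → f j * inv j) c ⟩
        sum x (λ d → c d * sum (quo x d) (λ j → f (d ℕ.* j) * inv (d ℕ.* j)))
          ≡⟨ sum-cong x (λ d 1≤d _ → trans (cong (c d *_) (trans (sum-cong (quo x d) (λ j 1≤j _ → trans (cong (f (d ℕ.* j) *_) (inv-* {d} {j} 1≤d 1≤j)) (eq₂ (f (d ℕ.* j)) (inv d) (inv j))))
               (sum-*ˡ (quo x d) (inv d) (λ j → f (d ℕ.* j) * inv j)))) (sym (*-assoc (c d) (inv d) _))) ⟩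
        sum x (λ d → c d * inv d * harmonic (λ j → f (d ℕ.* j)) (quo x d)) ∎
        where
        open ≡-Reasoning
        eq₁ : ∀ f i a l → f * i * a + l * i * f ≡ f * i * (a + l)
        eq₁ = solve-∀ ℚ-ring
        eq₂ : ∀ f i j → f * (i * j) ≡ i * (f * j)
        eq₂ = solve-∀ ℚ-ring
        eq₃ : ∀ m l d → m * (l - d) ≡ l * m - m * d
        eq₃ = solve-∀ ℚ-ring
        eq₄ : ∀ a l → a - - l ≡ a + l
        eq₄ = solve-∀ ℚ-ring
        eq₅ : ∀ f t → f * 1ℚ * (t * 1ℚ) ≡ t * f
        eq₅ = solve-∀ ℚ-ring
        eq₆ : ∀ a t → a * (t * 0ℚ) ≡ 0ℚ
        eq₆ = solve-∀ ℚ-ring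
        eq₇ : ∀ c a b → c * (a - b) ≡ c * a - c * b
        eq₇ = solve-∀ ℚ-ring
        first : sum x (λ j → f j * inv j * (t * χ (j ℕ.≟ 1))) ≡ t * f 1
        first = trans (sum-single x 1 _ ℕ.≤-refl 1≤x (λ j _ _ ne → trans (cong (λ z → f j * inv j * (t * z)) (χ-no (j ℕ.≟ 1) ne)) (eq₆ (f j * inv j) t))) (eq₅ (f 1) t)
        dsum-c : ∀ j → 1 ℕ.≤ j → j ℕ.≤ Y → dsum j c ≡ t * χ (j ℕ.≟ 1) + Λ j
        dsum-c j 1≤j j≤Y = trans (sum-ext j (λ d → trans (cong (χ (d ∣? j) *_) (eq₃ (μ d) (L x) (L d))) (eq₇ (χ (d ∣? j)) (L x * μ d) (μ d * L d))))
          (trans (sum-- j (λ d → χ (d ∣? j) * (L x * μ d)) (λ d → χ (d ∣? j) * (μ d * L d)))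
          (trans (cong₂ _-_ (trans (dsum-*ˡ j (L x) μ) (cong₂ _*_ (L-2^ k x≤Y) (μ-sum j 1≤j j≤Y))) (μL j 1≤j j≤Y)) (eq₄ (t * χ (j ℕ.≟ 1)) (Λ j))))
      φ' : ℕ → ℕ → ℚ
      φ' d j = φ (d ℕ.* j)
      rearrange : sum x' (λ n → Λ n * inv n * (t * φ n + sum x (λ j → Λ j * inv j * φ (n ℕ.* j)))) ≡ sum x (λ d → c d * inv d * V (φ' d) x' (quo x d))
      rearrange = begin
        sum x' (λ n → Λ n * inv n * (t * φ n + sum x (λ j → Λ j * inv j * φ (n ℕ.* j))))
          ≡⟨ sum-ext x' (λ n → cong (Λ n * inv n *_) (trans (cong (λ z → t * φ z + sum x (λ j → Λ j * inv j * φ (n ℕ.* j))) (sym (ℕ.*-identityʳ n))) (inner (λ j → φ (n ℕ.* j))))) ⟩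
        sum x' (λ n → Λ n * inv n * sum x (λ d → c d * inv d * harmonic (λ j → φ (n ℕ.* (d ℕ.* j))) (quo x d)))
          ≡⟨ sum-ext x' (λ n → sym (sum-*ˡ x (Λ n * inv n) _)) ⟩
        sum x' (λ n → sum x (λ d → Λ n * inv n * (c d * inv d * harmonic (λ j → φ (n ℕ.* (d ℕ.* j))) (quo x d))))
          ≡⟨ sum-swap x' x _ ⟩
        sum x (λ d → sum x' (λ n → Λ n * inv n * (c d * inv d * harmonic (λ j → φ (n ℕ.* (d ℕ.* j))) (quo x d))))
          ≡⟨ sum-ext x (λ d → trans (sum-ext x' (λ n → trans (cong (λ z → Λ n * inv n * (c d * inv d * z)) (sum-ext (quo x d) (λ j → cong (λ z → φ z * inv j) (swap n d j))))
                (eq₁ (Λ n * inv n) (c d * inv d) (harmonic (λ j → φ' d (n ℕ.* j)) (quo x d))))) (sum-*ˡ x' (c d * inv d) _)) ⟩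
        sum x (λ d → c d * inv d * V (φ' d) x' (quo x d)) ∎
        where
        open ≡-Reasoning
        eq₁ : ∀ a b h → a * (b * h) ≡ b * (a * h)
        eq₁ = solve-∀ ℚ-ring
        swap : ∀ n d j → n ℕ.* (d ℕ.* j) ≡ d ℕ.* (n ℕ.* j)
        swap = ℕR.solve-∀
      -- Summed over d with `distance`, the two parts give 3 · 19 = 57 and 3 · 2 = 6. The factor 1/d
      -- turns 1/(⌊x/d⌋+1) into 1/x.
      term : ∀ d → 1 ℕ.≤ d → d ℕ.≤ x → ∣ c d * inv d * V (φ' d) x' (quo x d) ∣ ≤ ∣ L x - L d ∣ * C + ∣ L x - L d ∣ * (M * inv x * F₁ x')
      term d 1≤d _ = ≤-trans (∣∣-* {c d * inv d} {V (φ' d) x' (quo x d)} (∣∣-* {c d} {inv d} ∣c∣ (∣∣-pos (0≤inv d))) (V-bound (φ' d) (dilate d tφ) k' (quo x d) h'))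
        (subst (_≤ ∣ L x - L d ∣ * C + ∣ L x - L d ∣ * (M * inv x * F₁ x')) (sym (eq₁ ∣ L x - L d ∣ (inv d) C M (inv (suc (quo x d))) (F₁ x')))
          (+-mono-≤ (subst (∣ L x - L d ∣ * C * inv d ≤_) (*-identityʳ (∣ L x - L d ∣ * C)) (*-monoˡ (∣ L x - L d ∣ * C) (0≤* (0≤∣p∣ (L x - L d)) 0≤C) (inv≤1 d)))
            (*-monoˡ ∣ L x - L d ∣ (0≤∣p∣ (L x - L d)) (*-monoʳ (F₁ x') (0≤F₁ x') (*-monoˡ M 0≤M (inv-quo-inv x d 1≤x 1≤d))))))
        where
        ∣c∣ : ∣ c d ∣ ≤ ∣ L x - L d ∣
        ∣c∣ = subst (∣ c d ∣ ≤_) (*-identityˡ ∣ L x - L d ∣) (∣∣-* {μ d} {L x - L d} (∣μ∣≤1 d) ≤-refl)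
        eq₁ : ∀ a i c m j f → a * i * (c + m * j * f) ≡ a * c * i + a * (m * (i * j) * f)
        eq₁ = solve-∀ ℚ-ring

-- Almost uniform distributions on a finite abelian group

module Distributions where
  open import Data.Integer as ℤ using ()
  open import Data.Rational as ℚ hiding (nonNegative; nonZero; NonZero)
  open import Data.Rational.Properties
  open import Algebra.Bundles using (AbelianGroup)
  import Algebra.Properties.AbelianGroup as AG
  open import Data.Unit using (tt)
  open import Level using (0ℓ)
  open import Relation.Nullary.Decidable using (toWitnessFalse; toWitness; True)
  open import Tactic.RingSolver using (solve-∀)
  open RationalSums

  -- Summation over a finite group given as a setoid. `S-count` records integrality, the point at
  -- which approximate counts become exact.
  record Summation (𝔾 : AbelianGroup 0ℓ 0ℓ) : Set where
    open AbelianGroup 𝔾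
    Respects : (Carrier → ℚ) → Set
    Respects f = ∀ {a b} → a ≈ b → f a ≡ f b
    field
      S : (Carrier → ℚ) → ℚ
      order : ℕ
      S-mono : ∀ {f g} → (∀ b → f b ≤ g b) → S f ≤ S g
      S-+ : ∀ f g → S (λ b → f b + g b) ≡ S f + S g
      S-* : ∀ c f → S (λ b → c * f b) ≡ c * S f
      S-1 : S (λ _ → 1ℚ) ≡ ι order
      S-term : ∀ f → Respects f → (∀ b → 0ℚ ≤ f b) → ∀ b → f b ≤ S f
      S-translate : ∀ f → Respects f → ∀ u → S (λ b → f (b ∙ u)) ≡ S f
      S-invert : ∀ f → Respects f → S (λ b → f (b ⁻¹)) ≡ S f
      S-count : ∀ f → (∀ b → f b ≡ 0ℚ ⊎ f b ≡ 1ℚ) → ∃ λ k → S f ≡ ι k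

  χ-01 : ∀ {P : Set} (d : Dec P) → χ d ≡ 0ℚ ⊎ χ d ≡ 1ℚ
  χ-01 (yes _) = inj₂ refl
  χ-01 (no _) = inj₁ refl

  q2 q3 q4 q5 q24 q8 : ℚ
  q2 = ℤ.+ 2 / 1
  q3 = ℤ.+ 3 / 1
  q4 = ℤ.+ 4 / 1
  q5 = ℤ.+ 5 / 1
  q24 = ℤ.+ 24 / 1
  q8 = ℤ.+ 8 / 1

  lit : ∀ x y {t : True (x ≤? y)} → x ≤ y
  lit x y {t} = toWitness {a? = x ≤? y} t

  pw : ℚ → ℕ → ℚ
  pw h zero = 1ℚ
  pw h (suc n) = h * pw h n

  -- Two distributions f, g that are almost uniform in the sense of Selberg's relation and almost vanish
  -- at a point are concentrated on the nontrivial coset of a subgroup of index two.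
  record AlmostUniform : Set₁ where
    field
      𝔾 : AbelianGroup 0ℓ 0ℓ
      sm : Summation 𝔾
      f g : AbelianGroup.Carrier 𝔾 → ℚ
      a : AbelianGroup.Carrier 𝔾
      ε : ℚ
      f-resp : Summation.Respects sm f
      g-resp : Summation.Respects sm g
      0≤f : ∀ b → 0ℚ ≤ f b
      0≤g : ∀ b → 0ℚ ≤ g b
      0≤ε : 0ℚ ≤ ε
      small : pw (ι (Summation.order sm)) 6 * ε ≤ ℤ.+ 1 / 1000
      f-total : ∣ Summation.S sm f - 1ℚ ∣ ≤ ε
      g-total : ∣ Summation.S sm g - 1ℚ ∣ ≤ ε
      f-upper : ∀ b → ι (Summation.order sm) * f b ≤ q2 + ε
      relation : ∀ b → ∣ ι (Summation.order sm) * (g b + Summation.S sm (λ u → f u * g (AbelianGroup._-_ 𝔾 b u))) - q2 ∣ ≤ ε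
      f-a : f a ≤ ε
      g-a : g a ≤ ε

  module Dichotomy (E : AlmostUniform) where
    open AlmostUniform E
    open AbelianGroup 𝔾 renaming (refl to ≈-refl; sym to ≈-sym; trans to ≈-trans; _-_ to _∙/_; ε to 1#) hiding (_≉_)
    open AG 𝔾
    open Summation sm

    h : ℚ
    h = ι order

    1≤h : 1ℚ ≤ h
    1≤h = subst (1ℚ ≤_) S-1 (S-term (λ _ → 1ℚ) (λ _ → refl) (λ _ → 0≤1) 1#)

    0≤h : 0ℚ ≤ h
    0≤h = 0≤ι order

    -- The common unit of all errors. Every error below is at most 400 w, and `small` makes 400 w
    -- less than 1; the power 6 is reached in `Q-alternate-out`.
    w : ℚ
    w = pw h 6 * ε

    0≤pw : ∀ n → 0ℚ ≤ pw h n
    0≤pw zero = 0≤1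
    0≤pw (suc n) = 0≤* 0≤h (0≤pw n)

    pw-step : ∀ n → pw h n * ε ≤ pw h (suc n) * ε
    pw-step n = *-monoʳ ε 0≤ε (subst (_≤ pw h (suc n)) (*-identityˡ (pw h n)) (*-monoʳ (pw h n) (0≤pw n) 1≤h))

    pw≤w : ∀ n k → n ℕ.+ k ≡ 6 → pw h n * ε ≤ w
    pw≤w n zero e = ≤-reflexive (cong (λ z → pw h z * ε) (trans (sym (ℕ.+-identityʳ n)) e))
    pw≤w n (suc k) e = ≤-trans (pw-step n) (pw≤w (suc n) k (trans (sym (ℕ.+-suc n k)) e))

    0≤w : 0ℚ ≤ w
    0≤w = 0≤* (0≤pw 6) 0≤ε

    absurd : 1ℚ ≤ (ℤ.+ 400 / 1) * w → ⊥
    absurd le = toWitnessFalse {a? = 1ℚ ≤? (ℤ.+ 400 / 1) * (ℤ.+ 1 / 1000)} tt (≤-trans le (*-monoˡ (ℤ.+ 400 / 1) (nonNegative⁻¹ (ℤ.+ 400 / 1)) small))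

    ε≤w : ε ≤ w
    ε≤w = subst (_≤ w) (*-identityˡ ε) (pw≤w 0 6 refl)

    ε≤1 : ε ≤ 1ℚ
    ε≤1 = ≤-trans ε≤w (≤-trans small (lit (ℤ.+ 1 / 1000) 1ℚ))

    -- 4 h² (5 ε + h ε) ≤ 24 h³ ε is the loss when `deficit` at a is divided by a value f(u) ≥ 1/(4
    -- h²).
    η : ℚ
    η = q24 * (pw h 3 * ε)

    Sf≤ : S f ≤ 1ℚ + ε
    Sf≤ = via (1ℚ + ε - S f) (subst (0ℚ ≤_) (eq (S f) ε) (0≤y-x (≤-∣∣ʳ {S f - 1ℚ} f-total))) (eq' (S f) ε)
      where
      eq : ∀ s e → e - (s - 1ℚ) ≡ 1ℚ + e - s
      eq = solve-∀ ℚ-ring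
      eq' : ∀ s e → 1ℚ + e ≡ s + (1ℚ + e - s)
      eq' = solve-∀ ℚ-ring

    ≤Sf : 1ℚ - ε ≤ S f
    ≤Sf = via (S f - 1ℚ - - ε) (0≤y-x (≤-∣∣ˡ {S f - 1ℚ} f-total)) (eq (S f) ε)
      where
      eq : ∀ s e → s ≡ 1ℚ - e + (s - 1ℚ - - e)
      eq = solve-∀ ℚ-ring

    Sg≤ : S g ≤ 1ℚ + ε
    Sg≤ = via (ε - (S g - 1ℚ)) (0≤y-x (≤-∣∣ʳ {S g - 1ℚ} g-total)) (eq (S g) ε)
      where
      eq : ∀ s e → 1ℚ + e ≡ s + (e - (s - 1ℚ))
      eq = solve-∀ ℚ-ring

    fg : Carrier → ℚ
    fg b = S (λ u → f u * g (b ∙/ u))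

    0≤fg-term : ∀ b u → 0ℚ ≤ f u * g (b ∙/ u)
    0≤fg-term b u = 0≤* (0≤f u) (0≤g (b ∙/ u))

    fg-term-resp : ∀ b → Respects (λ u → f u * g (b ∙/ u))
    fg-term-resp b e = cong₂ _*_ (f-resp e) (g-resp (∙-congˡ (⁻¹-cong e)))

    rel-upper : ∀ b → h * g b + h * fg b ≤ q2 + ε
    rel-upper b = via (ε - (h * (g b + fg b) - q2)) (0≤y-x (≤-∣∣ʳ {h * (g b + fg b) - q2} (relation b))) (eq h (g b) (fg b) ε q2)
      where
      eq : ∀ h g s e t → t + e ≡ h * g + h * s + (e - (h * (g + s) - t))
      eq = solve-∀ ℚ-ring

    rel-lower : ∀ b → q2 - ε ≤ h * g b + h * fg b
    rel-lower b = via (h * (g b + fg b) - q2 - - ε) (0≤y-x (≤-∣∣ˡ {h * (g b + fg b) - q2} (relation b))) (eq h (g b) (fg b) ε q2)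
      where
      eq : ∀ h g s e t → h * g + h * s ≡ t - e + (h * (g + s) - t - - e)
      eq = solve-∀ ℚ-ring

    0≤hfg : ∀ b → 0ℚ ≤ h * fg b
    0≤hfg b = 0≤* 0≤h (≤-trans (0≤fg-term b b) (S-term (λ u → f u * g (b ∙/ u)) (fg-term-resp b) (0≤fg-term b) b))

    g-upper : ∀ b → h * g b ≤ q2 + ε
    g-upper b = ≤-trans (via (h * fg b) (0≤hfg b) refl) (rel-upper b)

    -- 2 + ε - h g is nonnegative, so one term of its f-average around b is at most the whole
    -- average. That average is computed by the relation and is small whenever g(b) is small.
    deficit : ∀ b u → f u * (q2 + ε - h * g (b ∙/ u)) ≤ q5 * ε + h * g b
    deficit b u = ≤-trans (S-term φ (λ e → cong₂ (λ x y → x * (q2 + ε - h * y)) (f-resp e) (g-resp (∙-congˡ (⁻¹-cong e))))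
        (λ v → 0≤* (0≤f v) (0≤y-x (g-upper (b ∙/ v)))) u) (≤-trans (≤-reflexive Sφ) bound)
      where
      φ : Carrier → ℚ
      φ v = f v * (q2 + ε - h * g (b ∙/ v))
      eq₁ : ∀ f c h g → f * (c - h * g) ≡ c * f + (- h) * (f * g)
      eq₁ = solve-∀ ℚ-ring
      Sφ : S φ ≡ (q2 + ε) * S f + (- h) * fg b
      Sφ = trans (≤-antisym (S-mono (λ v → ≤-reflexive (eq₁ (f v) (q2 + ε) h (g (b ∙/ v))))) (S-mono (λ v → ≤-reflexive (sym (eq₁ (f v) (q2 + ε) h (g (b ∙/ v)))))))
        (trans (S-+ (λ v → (q2 + ε) * f v) (λ v → (- h) * (f v * g (b ∙/ v)))) (cong₂ _+_ (S-* (q2 + ε) f) (S-* (- h) (λ v → f v * g (b ∙/ v)))))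
      eq₂ : ∀ s p x g e → q5 * e + g ≡ (q2 + e) * s + (- x) * p + ((q2 + e) * (1ℚ + e - s) + (g + x * p - (q2 - e)) + e * (1ℚ - e))
      eq₂ = solve-∀ ℚ-ring
      bound : (q2 + ε) * S f + (- h) * fg b ≤ q5 * ε + h * g b
      bound = via ((q2 + ε) * (1ℚ + ε - S f) + (h * g b + h * fg b - (q2 - ε)) + ε * (1ℚ - ε))
        (0≤+ (0≤+ (0≤* (0≤+ (nonNegative⁻¹ q2) 0≤ε) (0≤y-x Sf≤)) (0≤y-x (rel-lower b))) (0≤* 0≤ε (0≤y-x ε≤1)))
        (eq₂ (S f) (fg b) h (h * g b) ε)

    -- Points with f(u) < 1/T = 1/(4 h²) carry total mass below 1/(4 h), too little to disturb a
    -- count of elements.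
    T : ℚ
    T = q4 * pw h 2

    0≤T : 0ℚ ≤ T
    0≤T = 0≤* (nonNegative⁻¹ q4) (0≤pw 2)

    P : ∀ u → Dec (1ℚ ≤ T * f u)
    P u = 1ℚ ≤? (T * f u)

    P-resp : Respects (λ u → χ (P u))
    P-resp {u} {v} e = χ-iff (P u) (P v) (subst (λ z → 1ℚ ≤ T * z) (f-resp e)) (subst (λ z → 1ℚ ≤ T * z) (sym (f-resp e)))

    amplify : ∀ u X Z → 1ℚ ≤ T * f u → 0ℚ ≤ X → f u * X ≤ Z → X ≤ T * Z
    amplify u X Z p 0≤X le = ≤-trans (subst (_≤ T * f u * X) (*-identityˡ X) (*-monoʳ X 0≤X p))
      (≤-trans (≤-reflexive (*-assoc T (f u) X)) (*-monoˡ T 0≤T le))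

    hε : ∀ n → pw h n * ε ≤ pw h (suc n) * ε
    hε = pw-step

    -- `deficit` at b = a, where g almost vanishes: h g must be almost maximal at every a/u for
    -- which f(u) is not small.
    large-lemma : ∀ u → 1ℚ ≤ T * f u → q2 - η ≤ h * g (a ∙/ u)
    large-lemma u p = via (T * (q5 * ε + h * g a) - (q2 + ε - h * g (a ∙/ u)) + (T * (h * (ε - g a)) + q4 * (q5 * (pw h 3 * ε - pw h 2 * ε)) + ε))
        (0≤+ (0≤y-x (amplify u (q2 + ε - h * g (a ∙/ u)) (q5 * ε + h * g a) p (0≤y-x (g-upper (a ∙/ u))) (deficit a u)))
          (0≤+ (0≤+ (0≤* 0≤T (0≤* 0≤h (0≤y-x g-a))) (0≤* (nonNegative⁻¹ q4) (0≤* (nonNegative⁻¹ q5) (0≤y-x (hε 2))))) 0≤ε))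
        (eq h ε (g a) (h * g (a ∙/ u)))
      where
      eq : ∀ h e ga x → x ≡ q2 - q24 * (h * (h * (h * 1ℚ)) * e) + ((q4 * (h * (h * 1ℚ))) * (q5 * e + h * ga) - (q2 + e - x)
          + ((q4 * (h * (h * 1ℚ))) * (h * (e - ga)) + q4 * (q5 * (h * (h * (h * 1ℚ)) * e - h * (h * 1ℚ) * e)) + e))
      eq = solve-∀ ℚ-ring

    p : ℚ
    p = S (λ u → χ (P u))

    p≤h : p ≤ h
    p≤h = subst (p ≤_) S-1 (S-mono (λ u → χ≤1 (P u)))

    0<h : 0ℚ < h
    0<h = <-≤-trans (positive⁻¹ 1ℚ) 1≤h

    -- The mass of f forces |P| ≥ h/2 - o(1).
    p-lower : q4 * h ≤ q8 * p + 1ℚ + q8 * w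
    p-lower = *-cancelˡ-≤ h 0<h (via D 0≤D (eq₂ h ε (S f) p w))
      where
      term : ∀ u → T * f u ≤ q4 * h * (q2 + ε) * χ (P u) + 1ℚ
      term u with P u
      ... | yes _ = subst₂ _≤_ (eq₁ h (f u)) (eq₀ (q4 * h * (q2 + ε))) (≤-trans (*-monoˡ (q4 * h) (0≤* (nonNegative⁻¹ q4) 0≤h) (f-upper u)) (via 1ℚ 0≤1 refl))
        where
        eq₁ : ∀ h f → q4 * h * (h * f) ≡ q4 * (h * (h * 1ℚ)) * f
        eq₁ = solve-∀ ℚ-ring
        eq₀ : ∀ x → x + 1ℚ ≡ x * 1ℚ + 1ℚ
        eq₀ = solve-∀ ℚ-ring
      ... | no ¬p = ≤-trans (<⇒≤ (≰⇒> ¬p)) (≤-reflexive (eq₀ (q4 * h * (q2 + ε))))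
        where
        eq₀ : ∀ x → 1ℚ ≡ x * 0ℚ + 1ℚ
        eq₀ = solve-∀ ℚ-ring
      total : T * S f ≤ q4 * h * (q2 + ε) * p + h
      total = subst₂ _≤_ (S-* T f) (trans (S-+ (λ u → q4 * h * (q2 + ε) * χ (P u)) (λ _ → 1ℚ)) (cong₂ _+_ (S-* (q4 * h * (q2 + ε)) (λ u → χ (P u))) S-1)) (S-mono term)
      D : ℚ
      D = (q4 * h * (q2 + ε) * p + h - T * S f) + T * (S f - (1ℚ - ε)) + q4 * h * (ε * (h - p)) + q8 * (h * (w - h * 1ℚ * ε))
      0≤D : 0ℚ ≤ D
      0≤D = 0≤+ (0≤+ (0≤+ (0≤y-x total) (0≤* 0≤T (0≤y-x ≤Sf))) (0≤* (0≤* (nonNegative⁻¹ q4) 0≤h) (0≤* 0≤ε (0≤y-x p≤h)))) (0≤* (nonNegative⁻¹ q8) (0≤* 0≤h (0≤y-x (pw≤w 1 5 refl))))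
      eq₂ : ∀ h e s p w → h * (q8 * p + 1ℚ + q8 * w) ≡ h * (q4 * h) + ((q4 * h * (q2 + e) * p + h - q4 * (h * (h * 1ℚ)) * s) + q4 * (h * (h * 1ℚ)) * (s - (1ℚ - e)) + q4 * h * (e * (h - p)) + q8 * (h * (w - h * 1ℚ * e)))
      eq₂ = solve-∀ ℚ-ring

    Q : ∀ b → Dec (1ℚ ≤ T * f (a ∙/ b))
    Q b = P (a ∙/ b)

    Q-resp : Respects (λ b → χ (Q b))
    Q-resp e = P-resp (∙-congˡ (⁻¹-cong e))

    Q-sum : S (λ b → χ (Q b)) ≡ p
    Q-sum = trans (S-invert (λ b → χ (P (a ∙ b))) (λ e → P-resp (∙-congˡ e)))
      (trans (≤-antisym (S-mono (λ b → ≤-reflexive (P-resp (comm a b)))) (S-mono (λ b → ≤-reflexive (P-resp (comm b a))))) (S-translate (λ u → χ (P u)) P-resp a))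

    a//b : ∀ b → a ∙/ (a ∙/ b) ≈ b
    a//b b = ≈-trans (∙-congˡ (≈-trans (≈-sym (⁻¹-∙-comm a (b ⁻¹))) (∙-congˡ (⁻¹-involutive b)))) (≈-trans (≈-sym (assoc a (a ⁻¹) b)) (≈-trans (∙-congʳ (inverseʳ a)) (identityˡ b)))

    Q-large : ∀ b → 1ℚ ≤ T * f (a ∙/ b) → q2 - η ≤ h * g b
    Q-large b q = subst (λ z → q2 - η ≤ h * z) (g-resp (a//b b)) (large-lemma (a ∙/ b) q)

    Q-excess : ∀ b → 0ℚ ≤ h * g b + (- (q2 - η)) * χ (Q b)
    Q-excess b = go (Q b)
      where
      eq₁ : ∀ x y → x - y ≡ x + (- y) * 1ℚ
      eq₁ = solve-∀ ℚ-ring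
      eq₂ : ∀ x y → x ≡ x + (- y) * 0ℚ
      eq₂ = solve-∀ ℚ-ring
      go : (d : Dec (1ℚ ≤ T * f (a ∙/ b))) → 0ℚ ≤ h * g b + (- (q2 - η)) * χ d
      go (yes q) = subst (0ℚ ≤_) (eq₁ (h * g b) (q2 - η)) (0≤y-x (Q-large b q))
      go (no _) = subst (0ℚ ≤_) (eq₂ (h * g b) (q2 - η)) (0≤* 0≤h (0≤g b))

    excess-sum : S (λ b → h * g b + (- (q2 - η)) * χ (Q b)) ≡ h * S g + (- (q2 - η)) * p
    excess-sum = trans (S-+ (λ b → h * g b) (λ b → (- (q2 - η)) * χ (Q b))) (cong₂ _+_ (S-* h g) (trans (S-* (- (q2 - η)) (λ b → χ (Q b))) (cong ((- (q2 - η)) *_) Q-sum)))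

    excess-resp : Respects (λ b → h * g b + (- (q2 - η)) * χ (Q b))
    excess-resp e = cong₂ (λ x y → h * x + (- (q2 - η)) * y) (g-resp e) (Q-resp e)

    excess-bound : ∀ b → h * g b + (- (q2 - η)) * χ (Q b) ≤ h * S g + (- (q2 - η)) * p
    excess-bound b = subst (h * g b + (- (q2 - η)) * χ (Q b) ≤_) excess-sum (S-term (λ b → h * g b + (- (q2 - η)) * χ (Q b)) excess-resp Q-excess b)

    0≤excess : 0ℚ ≤ h * S g + (- (q2 - η)) * p
    0≤excess = ≤-trans (Q-excess a) (excess-bound a)

    q25 : ℚ
    q25 = ℤ.+ 25 / 1

    -- Each of the p points of `Q` takes almost 2/h of the mass of g, which is about 1.
    p-upper : q2 * p ≤ h + q25 * w
    p-upper = via (h * S g + (- (q2 - η)) * p + h * (1ℚ + ε - S g) + q24 * (pw h 3 * ε * (h - p)) + (w - h * 1ℚ * ε) + q24 * (w - pw h 4 * ε))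
        (0≤+ (0≤+ (0≤+ (0≤+ 0≤excess (0≤* 0≤h (0≤y-x Sg≤))) (0≤* (nonNegative⁻¹ q24) (0≤* (0≤* (0≤pw 3) 0≤ε) (0≤y-x p≤h)))) (0≤y-x (pw≤w 1 5 refl))) (0≤* (nonNegative⁻¹ q24) (0≤y-x (pw≤w 4 2 refl))))
        (eq h (S g) p ε w)
      where
      eq : ∀ h s p e w → h + q25 * w ≡ q2 * p + (h * s + (- (q2 - q24 * (h * (h * (h * 1ℚ)) * e))) * p + h * (1ℚ + e - s) + q24 * (h * (h * (h * 1ℚ)) * e * (h - p)) + (w - h * 1ℚ * e) + q24 * (w - h * (h * (h * (h * 1ℚ))) * e))
      eq = solve-∀ ℚ-ring

    -- Both estimates of 2 p deviate from h by less than 1, and 2 p and h are integers.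
    2p≡h : q2 * p ≡ h
    2p≡h with S-count (λ u → χ (P u)) (λ u → χ-01 (P u))
    ... | k , p≡ = trans (cong (q2 *_) p≡) (trans (sym (ι-* 2 k)) (cong ι (ℕ.≤-antisym upper lower)))
      where
      lower : order ℕ.≤ 2 ℕ.* k
      lower = ℕ.≮⇒≥ (λ lt → absurd (≤-trans (via (q2 * 1ℚ) (≤-trans 0≤1 (via 1ℚ 0≤1 refl)) refl) (≤-trans (chain (subst (_≤ h) (cong (1ℚ +_) (ι-* 2 k)) (ι-mono lt))) (*-monoʳ w 0≤w (lit q8 (ℤ.+ 400 / 1))))))
        where
        eq : ∀ h k w → q8 * w ≡ 1ℚ + q2 * 1ℚ + (q4 * (h - (1ℚ + q2 * k)) + (q8 * k + 1ℚ + q8 * w - q4 * h))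
        eq = solve-∀ ℚ-ring
        chain : 1ℚ + q2 * ι k ≤ h → 1ℚ + q2 * 1ℚ ≤ q8 * w
        chain le = via (q4 * (h - (1ℚ + q2 * ι k)) + (q8 * ι k + 1ℚ + q8 * w - q4 * h))
          (0≤+ (0≤* (nonNegative⁻¹ q4) (0≤y-x le)) (0≤y-x (subst (λ z → q4 * h ≤ q8 * z + 1ℚ + q8 * w) p≡ p-lower))) (eq h (ι k) w)
      upper : 2 ℕ.* k ℕ.≤ order
      upper = ℕ.≮⇒≥ (λ lt → absurd (≤-trans (chain (subst (1ℚ + h ≤_) (ι-* 2 k) (ι-mono lt))) (*-monoʳ w 0≤w (lit q25 (ℤ.+ 400 / 1)))))
        where
        eq : ∀ h k c → c ≡ 1ℚ + (k - (1ℚ + h) + (h + c - k))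
        eq = solve-∀ ℚ-ring
        chain : 1ℚ + h ≤ q2 * ι k → 1ℚ ≤ q25 * w
        chain le = via (q2 * ι k - (1ℚ + h) + (h + q25 * w - q2 * ι k))
          (0≤+ (0≤y-x le) (0≤y-x (subst (λ z → q2 * z ≤ h + q25 * w) p≡ p-upper))) (eq h (q2 * ι k) (q25 * w))

    -- With exactly h/2 points, `Q` already exhausts the mass of g up to a small error.
    Q-small : ∀ b → ¬ (1ℚ ≤ T * f (a ∙/ b)) → h * g b ≤ q25 * w
    Q-small b ¬q = ≤-trans (subst (_≤ h * S g + (- (q2 - η)) * p) (trans (cong (λ z → h * g b + (- (q2 - η)) * z) (χ-no (Q b) ¬q)) (eq₀ (h * g b) (q2 - η))) (excess-bound b))
      (via (h * (1ℚ + ε - S g) + (q24 * (pw h 3 * ε * (h - p)) + (w - h * 1ℚ * ε) + q24 * (w - pw h 4 * ε)) + (q2 * p - h))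
        (0≤+ (0≤+ (0≤* 0≤h (0≤y-x Sg≤)) (0≤+ (0≤+ (0≤* (nonNegative⁻¹ q24) (0≤* (0≤* (0≤pw 3) 0≤ε) (0≤y-x p≤h))) (0≤y-x (pw≤w 1 5 refl))) (0≤* (nonNegative⁻¹ q24) (0≤y-x (pw≤w 4 2 refl))))) (0≤y-x (≤-reflexive (sym 2p≡h))))
        (eq h (S g) p ε w))
      where
      eq₀ : ∀ x y → x + (- y) * 0ℚ ≡ x
      eq₀ = solve-∀ ℚ-ring
      eq : ∀ h s p e w → q25 * w ≡ h * s + (- (q2 - q24 * (h * (h * (h * 1ℚ)) * e))) * p + (h * (1ℚ + e - s) + (q24 * (h * (h * (h * 1ℚ)) * e * (h - p)) + (w - h * 1ℚ * e) + q24 * (w - h * (h * (h * (h * 1ℚ))) * e)) + (q2 * p - h))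
      eq = solve-∀ ℚ-ring

    η≤ : η ≤ q24 * w
    η≤ = *-monoˡ q24 (nonNegative⁻¹ q24) (pw≤w 3 3 refl)

    contra : ∀ c x → c ≤ ℤ.+ 400 / 1 → 1ℚ ≤ x → x ≤ c * w → ⊥
    contra c x c≤ 1≤x x≤ = absurd (≤-trans 1≤x (≤-trans x≤ (*-monoʳ w 0≤w c≤)))

    -- Where h g(b) is almost 2 the relation leaves almost nothing for the convolution, hence
    -- nothing for its term f(u) g(b/u).
    Q-alternate-in : ∀ b u → 1ℚ ≤ T * f (a ∙/ b) → 1ℚ ≤ T * f u → ¬ (1ℚ ≤ T * f (a ∙/ (b ∙/ u)))
    Q-alternate-in b u qb pu qbu = contra (ℤ.+ 124 / 1) q2 (lit (ℤ.+ 124 / 1) (ℤ.+ 400 / 1)) (lit 1ℚ q2)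
      (via (h * x - (q2 - η) + (T * (ε + η) - h * x) + (q4 * (w - pw h 2 * ε) + (q4 * (q24 * (w - pw h 5 * ε)) + (q24 * w - η))))
        (0≤+ (0≤+ (0≤y-x (Q-large (b ∙/ u) qbu)) (0≤y-x (amplify u (h * x) (ε + η) pu (0≤* 0≤h (0≤g (b ∙/ u))) bound)))
          (0≤+ (0≤* (nonNegative⁻¹ q4) (0≤y-x (pw≤w 2 4 refl))) (0≤+ (0≤* (nonNegative⁻¹ q4) (0≤* (nonNegative⁻¹ q24) (0≤y-x (pw≤w 5 1 refl)))) (0≤y-x η≤))))
        (eq h ε (h * x) w))
      where
      x = g (b ∙/ u)
      eq : ∀ h e x w → (ℤ.+ 124 / 1) * w ≡ q2 + (x - (q2 - q24 * (h * (h * (h * 1ℚ)) * e)) + (q4 * (h * (h * 1ℚ)) * (e + q24 * (h * (h * (h * 1ℚ)) * e)) - x)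
         + (q4 * (w - h * (h * 1ℚ) * e) + (q4 * (q24 * (w - h * (h * (h * (h * (h * 1ℚ)))) * e)) + (q24 * w - q24 * (h * (h * (h * 1ℚ)) * e)))))
      eq = solve-∀ ℚ-ring
      eq₁ : ∀ h f x → h * (f * x) ≡ f * (h * x)
      eq₁ = solve-∀ ℚ-ring
      eq₂ : ∀ e n gb s t → e + n ≡ s + (t + e - (gb + s) + (gb - (t - n)))
      eq₂ = solve-∀ ℚ-ring
      bound : f u * (h * x) ≤ ε + η
      bound = ≤-trans (subst (_≤ h * fg b) (eq₁ h (f u) x) (*-monoˡ h 0≤h (S-term (λ u → f u * g (b ∙/ u)) (fg-term-resp b) (0≤fg-term b) u)))
        (via (q2 + ε - (h * g b + h * fg b) + (h * g b - (q2 - η))) (0≤+ (0≤y-x (rel-upper b)) (0≤y-x (Q-large b qb))) (eq₂ ε η (h * g b) (h * fg b) q2))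

    -- Where g(b) is small, `deficit` forces h g to be almost 2 at every b/u with u in `P`.
    Q-alternate-out : ∀ b u → ¬ (1ℚ ≤ T * f (a ∙/ b)) → 1ℚ ≤ T * f u → 1ℚ ≤ T * f (a ∙/ (b ∙/ u))
    Q-alternate-out b u ¬qb pu with Q (b ∙/ u)
    ... | yes q = q
    ... | no ¬q = ⊥-elim (contra (ℤ.+ 245 / 1) q2 (lit (ℤ.+ 245 / 1) (ℤ.+ 400 / 1)) (lit 1ℚ q2)
        (via (T * (q5 * ε + h * g b) - (q2 + ε - h * x) + (T * (κ - h * g b) + ε + (q25 * w - h * x) + q4 * (q5 * (w - pw h 2 * ε)) + q4 * (w - pw h 3 * ε) + q4 * (q24 * (w - pw h 6 * ε)) + (ℤ.+ 100 / 1) * w))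
          (0≤+ (0≤y-x (amplify u (q2 + ε - h * x) (q5 * ε + h * g b) pu (0≤y-x (g-upper (b ∙/ u))) (deficit b u)))
            (0≤+ (0≤+ (0≤+ (0≤+ (0≤+ (0≤+ (0≤* 0≤T (0≤y-x κ-bound)) 0≤ε) (0≤y-x (Q-small (b ∙/ u) ¬q)))
              (0≤* (nonNegative⁻¹ q4) (0≤* (nonNegative⁻¹ q5) (0≤y-x (pw≤w 2 4 refl))))) (0≤* (nonNegative⁻¹ q4) (0≤y-x (pw≤w 3 3 refl)))) (0≤* (nonNegative⁻¹ q4) (0≤* (nonNegative⁻¹ q24) (0≤y-x (pw≤w 6 0 refl)))))
              (0≤* (nonNegative⁻¹ (ℤ.+ 100 / 1)) 0≤w)))
          (eq h ε (g b) (h * x) w)))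
      where
      x = g (b ∙/ u)
      κ : ℚ
      κ = h * 1ℚ * ε + q24 * (pw h 4 * ε)
      eq₀ : ∀ x y → x + (- y) * 0ℚ ≡ x
      eq₀ = solve-∀ ℚ-ring
      eq₁ : ∀ h s p e → h * 1ℚ * e + q24 * (h * (h * (h * (h * 1ℚ))) * e) ≡ h * s + (- (q2 - q24 * (h * (h * (h * 1ℚ)) * e))) * p + (h * (1ℚ + e - s) + q24 * (h * (h * (h * 1ℚ)) * e * (h - p)) + (q2 * p - h))
      eq₁ = solve-∀ ℚ-ring
      κ-bound : h * g b ≤ κ
      κ-bound = ≤-trans (subst (_≤ h * S g + (- (q2 - η)) * p) (trans (cong (λ z → h * g b + (- (q2 - η)) * z) (χ-no (Q b) ¬qb)) (eq₀ (h * g b) (q2 - η))) (excess-bound b))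
        (via (h * (1ℚ + ε - S g) + q24 * (pw h 3 * ε * (h - p)) + (q2 * p - h))
          (0≤+ (0≤+ (0≤* 0≤h (0≤y-x Sg≤)) (0≤* (nonNegative⁻¹ q24) (0≤* (0≤* (0≤pw 3) 0≤ε) (0≤y-x p≤h)))) (0≤y-x (≤-reflexive (sym 2p≡h))))
          (eq₁ h (S g) p ε))
      eq : ∀ h e gb x w → (ℤ.+ 245 / 1) * w ≡ q2 + (q4 * (h * (h * 1ℚ)) * (q5 * e + h * gb) - (q2 + e - x) + (q4 * (h * (h * 1ℚ)) * (h * 1ℚ * e + q24 * (h * (h * (h * (h * 1ℚ))) * e) - h * gb) + e + (q25 * w - x)
         + q4 * (q5 * (w - h * (h * 1ℚ) * e)) + q4 * (w - h * (h * (h * 1ℚ)) * e) + q4 * (q24 * (w - h * (h * (h * (h * (h * (h * 1ℚ))))) * e)) + (ℤ.+ 100 / 1) * w))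
      eq = solve-∀ ℚ-ring

    a∉P : ¬ (1ℚ ≤ T * f a)
    a∉P pa = contra q4 1ℚ (lit q4 (ℤ.+ 400 / 1)) ≤-refl (≤-trans pa (≤-trans (*-monoˡ T 0≤T f-a) (≤-trans (≤-reflexive (*-assoc q4 (pw h 2) ε)) (*-monoˡ q4 (nonNegative⁻¹ q4) (pw≤w 2 4 refl)))))

    a∉Q : ¬ (1ℚ ≤ T * f (a ∙/ a))
    a∉Q qa = contra q25 q2 (lit q25 (ℤ.+ 400 / 1)) (lit 1ℚ q2)
      (via (h * g a - (q2 - η) + (h * (ε - g a) + (w - h * 1ℚ * ε) + (q24 * w - η))) (0≤+ (0≤y-x (Q-large a qa)) (0≤+ (0≤+ (0≤* 0≤h (0≤y-x g-a)) (0≤y-x (pw≤w 1 5 refl))) (0≤y-x η≤))) (eq h ε (g a) η w))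
      where
      eq : ∀ h e ga n w → q25 * w ≡ q2 + (h * ga - (q2 - n) + (h * (e - ga) + (w - h * 1ℚ * e) + (q24 * w - n)))
      eq = solve-∀ ℚ-ring

    inP : Carrier → Set
    inP u = 1ℚ ≤ T * f u

    inQ : Carrier → Set
    inQ b = 1ℚ ≤ T * f (a ∙/ b)

    inP-resp : ∀ {u v} → u ≈ v → inP u → inP v
    inP-resp e = subst (λ z → 1ℚ ≤ T * z) (f-resp e)

    inQ-resp : ∀ {u v} → u ≈ v → inQ u → inQ v
    inQ-resp e = inP-resp (∙-congˡ (⁻¹-cong e))

    mul-div : ∀ b u → (b ∙ u) ∙/ u ≈ b
    mul-div b u = ≈-trans (assoc b u (u ⁻¹)) (≈-trans (∙-congˡ (inverseʳ u)) (identityʳ b))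

    -- Otherwise u/u = 1 would make `P` and `Q` disjoint by `Q-alternate-in`. Having h/2 elements
    -- each, they would fill the group, yet a lies in neither.
    1∉Q : ¬ inQ 1#
    1∉Q q1 = contra 0ℚ 1ℚ (lit 0ℚ (ℤ.+ 400 / 1)) ≤-refl (≤-trans (subst (_≤ S F) F-a (S-term F F-resp 0≤F a)) (≤-reflexive (trans S-F (sym (*-zeroˡ w)))))
      where
      F : Carrier → ℚ
      F u = 1ℚ + (- 1ℚ) * (χ (P u) + χ (Q u))
      F-resp : Respects F
      F-resp e = cong₂ (λ x y → 1ℚ + (- 1ℚ) * (x + y)) (P-resp e) (Q-resp e)
      disjoint : ∀ u → inP u → ¬ inQ u
      disjoint u pu qu = Q-alternate-in u u qu pu (inQ-resp (≈-sym (inverseʳ u)) q1)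
      0≤F : ∀ u → 0ℚ ≤ F u
      0≤F u = go (P u) (Q u)
        where
        go : (x : Dec (inP u)) (y : Dec (inQ u)) → 0ℚ ≤ 1ℚ + (- 1ℚ) * (χ x + χ y)
        go (yes pu) (yes qu) = ⊥-elim (disjoint u pu qu)
        go (yes _) (no _) = ≤-refl
        go (no _) (yes _) = ≤-refl
        go (no _) (no _) = 0≤1
      F-a : F a ≡ 1ℚ
      F-a = cong₂ (λ x y → 1ℚ + (- 1ℚ) * (x + y)) (χ-no (P a) a∉P) (χ-no (Q a) a∉Q)
      eq : ∀ x p → x + (- 1ℚ) * (p + p) ≡ x - q2 * p
      eq = solve-∀ ℚ-ring
      S-F : S F ≡ 0ℚ
      S-F = trans (S-+ (λ _ → 1ℚ) (λ u → (- 1ℚ) * (χ (P u) + χ (Q u)))) (trans (cong₂ _+_ S-1 (trans (S-* (- 1ℚ) (λ u → χ (P u) + χ (Q u))) (cong ((- 1ℚ) *_) (trans (S-+ (λ u → χ (P u)) (λ u → χ (Q u))) (cong (p +_) Q-sum)))))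
        (trans (eq h p) (trans (cong (λ z → h - z) 2p≡h) (+-inverseʳ h))))

    -- If u in `P` were outside `Q`, then u/u = 1 would lie in `Q`.
    P⊆Q : ∀ u → inP u → inQ u
    P⊆Q u pu with Q u
    ... | yes q = q
    ... | no ¬q = ⊥-elim (1∉Q (inQ-resp (inverseʳ u) (Q-alternate-out u u ¬q pu)))

    -- `P` is contained in `Q` and has equally many elements: the nonnegative function χ_Q - χ_P has
    -- sum 0.
    Q⊆P : ∀ u → inQ u → inP u
    Q⊆P u qu with P u
    ... | yes pu = pu
    ... | no ¬pu = ⊥-elim (contra 0ℚ 1ℚ (lit 0ℚ (ℤ.+ 400 / 1)) ≤-refl (≤-trans (subst (_≤ S F) F-u (S-term F F-resp 0≤F u)) (≤-reflexive (trans S-F (sym (*-zeroˡ w))))))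
      where
      F : Carrier → ℚ
      F u = χ (Q u) + (- 1ℚ) * χ (P u)
      F-resp : Respects F
      F-resp e = cong₂ (λ x y → x + (- 1ℚ) * y) (Q-resp e) (P-resp e)
      0≤F : ∀ u → 0ℚ ≤ F u
      0≤F u = go (P u) (Q u)
        where
        go : (x : Dec (inP u)) (y : Dec (inQ u)) → 0ℚ ≤ χ y + (- 1ℚ) * χ x
        go (yes pu) (yes qu) = ≤-refl
        go (yes pu) (no ¬q) = ⊥-elim (¬q (P⊆Q u pu))
        go (no _) (yes _) = 0≤1
        go (no _) (no _) = ≤-refl
      F-u : F u ≡ 1ℚ
      F-u = cong₂ (λ x y → x + (- 1ℚ) * y) (χ-yes (Q u) qu) (χ-no (P u) ¬pu)
      S-F : S F ≡ 0ℚ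
      S-F = trans (S-+ (λ u → χ (Q u)) (λ u → (- 1ℚ) * χ (P u))) (trans (cong₂ _+_ Q-sum (S-* (- 1ℚ) (λ u → χ (P u)))) (eq p))
        where
        eq : ∀ p → p + (- 1ℚ) * p ≡ 0ℚ
        eq = solve-∀ ℚ-ring

    flip-in : ∀ b c → inQ c → inQ b → ¬ inQ (b ∙ c)
    flip-in b c qc qb qbc = Q-alternate-in (b ∙ c) c qbc (Q⊆P c qc) (inQ-resp (≈-sym (mul-div b c)) qb)

    flip-out : ∀ b c → inQ c → ¬ inQ b → inQ (b ∙ c)
    flip-out b c qc ¬qb with Q (b ∙ c)
    ... | yes q = q
    ... | no ¬q = ⊥-elim (¬qb (inQ-resp (mul-div b c) (Q-alternate-out (b ∙ c) c ¬q (Q⊆P c qc))))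

    -- If b c were in Q with b, c outside, then c⁻¹ = b (b c)⁻¹ and hence 1 = c c⁻¹ would be as well.
    stay-out : ∀ b c → ¬ inQ b → ¬ inQ c → ¬ inQ (b ∙ c)
    stay-out b c ¬qb ¬qc q = 1∉Q (inQ-resp (inverseʳ c) (flip-out c (c ⁻¹) c⁻¹∈Q ¬qc))
      where
      c⁻¹∈Q : inQ (c ⁻¹)
      c⁻¹∈Q = inQ-resp (≈-trans (∙-congˡ (≈-sym (⁻¹-∙-comm b c))) (≈-trans (≈-sym (assoc b (b ⁻¹) (c ⁻¹))) (≈-trans (∙-congʳ (inverseʳ b)) (identityˡ (c ⁻¹)))))
        (Q-alternate-out b (b ∙ c) ¬qb (Q⊆P (b ∙ c) q))

    -- The quadratic character whose kernel is the complement of `Q`.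
    sign : Carrier → ℚ
    sign b = 1ℚ + (- q2) * χ (Q b)

    sign-resp : Respects sign
    sign-resp e = cong (λ z → 1ℚ + (- q2) * z) (Q-resp e)

    sign-values : ∀ b → sign b ≡ 1ℚ ⊎ sign b ≡ - 1ℚ
    sign-values b with Q b
    ... | yes _ = inj₂ refl
    ... | no _ = inj₁ refl

    sign-in : ∀ b → inQ b → sign b ≡ - 1ℚ
    sign-in b q = cong (λ z → 1ℚ + (- q2) * z) (χ-yes (Q b) q)

    sign-out : ∀ b → ¬ inQ b → sign b ≡ 1ℚ
    sign-out b q = cong (λ z → 1ℚ + (- q2) * z) (χ-no (Q b) q)

    sign-∙ : ∀ b c → sign (b ∙ c) ≡ sign b * sign c
    sign-∙ b c = go (Q b) (Q c)
      where
      go : Dec (inQ b) → Dec (inQ c) → sign (b ∙ c) ≡ sign b * sign c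
      go (yes qb) (yes qc) = trans (sign-out (b ∙ c) (flip-in b c qc qb)) (sym (cong₂ _*_ (sign-in b qb) (sign-in c qc)))
      go (no ¬b) (yes qc) = trans (sign-in (b ∙ c) (flip-out b c qc ¬b)) (sym (cong₂ _*_ (sign-out b ¬b) (sign-in c qc)))
      go (yes qb) (no ¬c) = trans (sign-in (b ∙ c) (inQ-resp (comm c b) (flip-out c b qb ¬c))) (sym (cong₂ _*_ (sign-in b qb) (sign-out c ¬c)))
      go (no ¬b) (no ¬c) = trans (sign-out (b ∙ c) (stay-out b c ¬b ¬c)) (sym (cong₂ _*_ (sign-out b ¬b) (sign-out c ¬c)))

    sign-1 : sign 1# ≡ 1ℚ
    sign-1 = sign-out 1# 1∉Q

    sign-mean : S sign ≡ 0ℚ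
    sign-mean = trans (S-+ (λ _ → 1ℚ) (λ b → (- q2) * χ (Q b))) (trans (cong₂ _+_ S-1 (trans (S-* (- q2) (λ b → χ (Q b))) (cong ((- q2) *_) Q-sum)))
      (trans (eq h p) (trans (cong (λ z → h - z) 2p≡h) (+-inverseʳ h))))
      where
      eq : ∀ x p → x + (- q2) * p ≡ x - q2 * p
      eq = solve-∀ ℚ-ring

    -- Since g lives on `Q`, where the sign is -1, the true value is near -1; the bound -1/2 absorbs
    -- all errors.
    sign-g : h * S (λ b → sign b * g b) ≤ h * (- ½)
    sign-g = ≤-trans (subst₂ _≤_ (S-* h (λ b → sign b * g b)) total (S-mono term))
        (via (h * (1ℚ + ε - S g) + (w - h * 1ℚ * ε) + (q24 * (w - pw h 4 * ε)) + ((½ * h - ½ * 1ℚ) + (½ - q25 * w)) + (q2 * p - h) * (1ℚ + 1ℚ - η))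
          (0≤+ (0≤+ (0≤+ (0≤+ (0≤* 0≤h (0≤y-x Sg≤)) (0≤y-x (pw≤w 1 5 refl))) (0≤* (nonNegative⁻¹ q24) (0≤y-x (pw≤w 4 2 refl)))) (0≤+ (0≤y-x (*-monoˡ ½ (nonNegative⁻¹ ½) 1≤h)) (0≤y-x (≤-trans (*-monoˡ q25 (nonNegative⁻¹ q25) small) (lit (q25 * (ℤ.+ 1 / 1000)) ½)))))
            (≤-reflexive (sym (trans (cong (_* (1ℚ + 1ℚ - η)) (trans (cong (_- h) 2p≡h) (+-inverseʳ h))) (*-zeroˡ (1ℚ + 1ℚ - η))))))
          (eq h (S g) p ε w))
      where
      eq : ∀ h s p e w → h * (- ½) ≡ h * s + (- q2) * ((q2 - q24 * (h * (h * (h * 1ℚ)) * e)) * p) + (h * (1ℚ + e - s) + (w - h * 1ℚ * e) + (q24 * (w - h * (h * (h * (h * 1ℚ))) * e)) + ((½ * h - ½ * 1ℚ) + (½ - q25 * w)) + (q2 * p - h) * (1ℚ + 1ℚ - q24 * (h * (h * (h * 1ℚ)) * e)))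
      eq = solve-∀ ℚ-ring
      total : S (λ b → h * g b + (- q2) * ((q2 - η) * χ (Q b))) ≡ h * S g + (- q2) * ((q2 - η) * p)
      total = trans (S-+ (λ b → h * g b) (λ b → (- q2) * ((q2 - η) * χ (Q b)))) (cong₂ _+_ (S-* h g) (trans (S-* (- q2) (λ b → (q2 - η) * χ (Q b))) (cong ((- q2) *_) (trans (S-* (q2 - η) (λ b → χ (Q b))) (cong ((q2 - η) *_) Q-sum)))))
      term : ∀ b → h * (sign b * g b) ≤ h * g b + (- q2) * ((q2 - η) * χ (Q b))
      term b = go (Q b)
        where
        eq₁ : ∀ h g n → h * g + (- q2) * ((q2 - n) * 1ℚ) ≡ h * ((1ℚ + (- q2) * 1ℚ) * g) + q2 * (h * g - (q2 - n))
        eq₁ = solve-∀ ℚ-ring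
        eq₂ : ∀ h g n → h * ((1ℚ + (- q2) * 0ℚ) * g) ≡ h * g + (- q2) * ((q2 - n) * 0ℚ)
        eq₂ = solve-∀ ℚ-ring
        go : (d : Dec (inQ b)) → h * ((1ℚ + (- q2) * χ d) * g b) ≤ h * g b + (- q2) * ((q2 - η) * χ d)
        go (yes q) = via (q2 * (h * g b - (q2 - η))) (0≤* (nonNegative⁻¹ q2) (0≤y-x (Q-large b q))) (eq₁ h (g b) η)
        go (no _) = ≤-reflexive (eq₂ h (g b) η)

-- A lower bound for L(1, ψ) for real characters ψ

module RealCharacterBound where
  open import Data.Rational as ℚ hiding (nonNegative; nonZero; NonZero)
  open import Data.Rational.Properties
  open import Tactic.RingSolver using (solve-∀)
  open RationalSums
  open PrimePowerSums using (module RealCharacter)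
  open TestFunctions

  sum-squares : ∀ s (f : ℕ → ℚ) → (∀ n → 1 ℕ.≤ n → 0ℚ ≤ f n) → sum s (λ j → f (j ℕ.* j)) ≤ sum (s ℕ.* s) f
  sum-squares zero f h = ≤-refl
  sum-squares (suc s) f h = +-monoˡ-≤ (f (suc s ℕ.* suc s)) (≤-trans (sum-squares s f h)
    (sum-grow f (ℕ.≤-trans (ℕ.*-monoʳ-≤ s (ℕ.n≤1+n s)) (ℕ.m≤n+m (s ℕ.* suc s) s)) (λ k p _ → h k (ℕ.≤-trans (s≤s z≤n) p))))

  ι-∸ : ∀ {a b} → b ℕ.≤ a → ι (a ℕ.∸ b) ≡ ι a - ι b
  ι-∸ {a} {b} h = trans (eq (ι (a ℕ.∸ b)) (ι b)) (cong (_- ι b) (trans (sym (ι-+ (a ℕ.∸ b) b)) (cong ι (ℕ.m∸n+n≡m h))))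
    where
    eq : ∀ x y → x ≡ x + y - y
    eq = solve-∀ ℚ-ring

  progression : ∀ q X d → sum q (λ k → X - d * ι k) + sum q (λ k → X - d * ι k) ≡ ι q * X + ι q * X - d * (ι q * (1ℚ + ι q))
  progression zero X d = eq X d
    where
    eq : ∀ X d → 0ℚ + 0ℚ ≡ 0ℚ * X + 0ℚ * X - d * (0ℚ * (1ℚ + 0ℚ))
    eq = solve-∀ ℚ-ring
  progression (suc q) X d = trans (eq₁ (sum q (λ k → X - d * ι k)) (X - d * (1ℚ + ι q))) (trans (cong (_+ ((X - d * (1ℚ + ι q)) + (X - d * (1ℚ + ι q)))) (progression q X d)) (eq₂ (ι q) X d))
    where
    eq₁ : ∀ s t → s + t + (s + t) ≡ s + s + (t + t)
    eq₁ = solve-∀ ℚ-ring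
    eq₂ : ∀ q X d → q * X + q * X - d * (q * (1ℚ + q)) + ((X - d * (1ℚ + q)) + (X - d * (1ℚ + q))) ≡ (1ℚ + q) * X + (1ℚ + q) * X - d * ((1ℚ + q) * (1ℚ + (1ℚ + q)))
    eq₂ = solve-∀ ℚ-ring

  -- The weight ∑ₖ max(0, x - d k) attached to d by the sum of (x - n) r(n), r = 1 ⋆ ψ.
  weight : ℕ → ℕ → ℚ
  weight x d = sum (quo x d) (λ k → ι (x ℕ.∸ d ℕ.* k))

  0≤weight : ∀ x d → 0ℚ ≤ weight x d
  0≤weight x d = sum-nonneg (quo x d) (λ k _ _ → 0≤ι (x ℕ.∸ d ℕ.* k))

  weight-anti : ∀ x d → weight x (suc (suc d)) ≤ weight x (suc d)
  weight-anti x d = ≤-trans (sum-mono (quo x (suc (suc d))) (λ k _ _ → ι-mono (ℕ.∸-monoʳ-≤ x (ℕ.*-monoˡ-≤ k (ℕ.n≤1+n (suc d))))))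
    (sum-grow (λ k → ι (x ℕ.∸ suc d ℕ.* k)) (≤-quo {x} {suc d} (s≤s z≤n) (ℕ.≤-trans (ℕ.*-monoˡ-≤ (quo x (suc (suc d))) (ℕ.n≤1+n (suc d))) (proj₁ (quo-bounds x (suc (suc d)) (s≤s z≤n)))))
      (λ k _ _ → 0≤ι (x ℕ.∸ suc d ℕ.* k)))

  quo-upper : ∀ x d → 1 ℕ.≤ d → ι (quo x d) ≤ ι x * inv d
  quo-upper x d 1≤d = subst (_≤ ι x * inv d) (trans (cong (_* inv d) (ι-* d (quo x d))) (trans (eq (ι d) (ι (quo x d)) (inv d)) (trans (cong (_* ι (quo x d)) (ι*inv {d} 1≤d)) (*-identityˡ (ι (quo x d))))))
    (*-monoʳ (inv d) (0≤inv d) (ι-mono (proj₁ (quo-bounds x d 1≤d))))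
    where
    eq : ∀ a b i → a * b * i ≡ a * i * b
    eq = solve-∀ ℚ-ring

  weight-upper : ∀ x d → 1 ℕ.≤ d → weight x d ≤ ι x * ι x * inv d
  weight-upper x d 1≤d = ≤-trans (sum-mono (quo x d) (λ k _ _ → ι-mono (ℕ.m∸n≤m x (d ℕ.* k)))) (≤-trans (≤-reflexive (sum-const (quo x d) (ι x)))
    (≤-trans (*-monoʳ (ι x) (0≤ι x) (quo-upper x d 1≤d)) (≤-reflexive (eq (ι x) (inv d)))))
    where
    eq : ∀ x i → x * i * x ≡ x * x * i
    eq = solve-∀ ℚ-ring

  -- With x = d q + ρ, the difference is exactly ρ (1 - ρ/d), which lies between 0 and d. The weight
  -- is doubled to avoid halves.
  weight-approx : ∀ x d → 1 ℕ.≤ d → ∣ weight x d + weight x d - (ι x * ι x * inv d - ι x) ∣ ≤ ι d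
  weight-approx x d 1≤d = subst (λ z → ∣ z ∣ ≤ ι d) (sym main) (≤-trans (≤-reflexive (0≤p⇒∣p∣≡p (0≤* (0≤ι ρ) (0≤y-x ρi≤1)))) (≤-trans (subst (ι ρ * (1ℚ - ι ρ * i) ≤_) (*-identityʳ (ι ρ)) (*-monoˡ (ι ρ) (0≤ι ρ) (via (ι ρ * i) (0≤* (0≤ι ρ) (0≤inv d)) (eq₀ (ι ρ * i))))) (ι-mono ρ≤d)))
    where
    i = inv d
    q = quo x d
    ρ = x ℕ.∸ d ℕ.* q
    lo : d ℕ.* q ℕ.≤ x
    lo = proj₁ (quo-bounds x d 1≤d)
    x≡ : ι x ≡ ι d * ι q + ι ρ
    x≡ = trans (cong ι (sym (ℕ.m+[n∸m]≡n lo))) (trans (ι-+ (d ℕ.* q) ρ) (cong (_+ ι ρ) (ι-* d q)))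
    ρ≤d : ρ ℕ.≤ d
    ρ≤d = ℕ.m≤n+o⇒m∸n≤o x (d ℕ.* q) (ℕ.<⇒≤ (subst (x ℕ.<_) (trans (ℕ.*-suc d q) (ℕ.+-comm d (d ℕ.* q))) (proj₂ (quo-bounds x d 1≤d))))
    ρi≤1 : ι ρ * i ≤ 1ℚ
    ρi≤1 = subst (ι ρ * i ≤_) (ι*inv {d} 1≤d) (*-monoʳ i (0≤inv d) (ι-mono ρ≤d))
    eq₀ : ∀ z → 1ℚ ≡ 1ℚ - z + z
    eq₀ = solve-∀ ℚ-ring
    w≡ : weight x d ≡ sum q (λ k → ι x - ι d * ι k)
    w≡ = sum-cong q (λ k _ k≤q → trans (ι-∸ {x} {d ℕ.* k} (quo-≤ {x} {d} 1≤d k≤q)) (cong (λ z → ι x - z) (ι-* d k)))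
    eq₁ : ∀ d q r i → q * (d * q + r) + q * (d * q + r) - d * (q * (1ℚ + q)) - ((d * q + r) * (d * q + r) * i - (d * q + r))
        ≡ r * (1ℚ - r * i) + (1ℚ - d * i) * (d * q * q + q * r + q * r)
    eq₁ = solve-∀ ℚ-ring
    eq₂ : ∀ a b → a + (1ℚ - 1ℚ) * b ≡ a
    eq₂ = solve-∀ ℚ-ring
    main : weight x d + weight x d - (ι x * ι x * i - ι x) ≡ ι ρ * (1ℚ - ι ρ * i)
    main = trans (cong (_- (ι x * ι x * i - ι x)) (trans (cong₂ _+_ w≡ w≡) (progression q (ι x) (ι d))))
      (trans (cong (λ X → ι q * X + ι q * X - ι d * (ι q * (1ℚ + ι q)) - (X * X * i - X)) x≡)
      (trans (eq₁ (ι d) (ι q) (ι ρ) i) (trans (cong (λ z → ι ρ * (1ℚ - ι ρ * i) + (1ℚ - z) * (ι d * ι q * ι q + ι q * ι ρ + ι q * ι ρ)) (ι*inv {d} 1≤d)) (eq₂ (ι ρ * (1ℚ - ι ρ * i)) (ι d * ι q * ι q + ι q * ι ρ + ι q * ι ρ)))))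

  -- With s = 4096 m², x = 4 s² and D' = 64 m s, the error D'² from small d and the tail 4 m x²/D'
  -- from large d both equal s³.
  scale : ℕ → ℕ
  scale m = 16 ℕ.* (16 ℕ.* (16 ℕ.* (m ℕ.* m)))

  threshold : ℕ → ℕ
  threshold m = 16 ℕ.* (4 ℕ.* (m ℕ.* scale m))

  module _ (m : ℕ) (1≤m : 1 ℕ.≤ m) (ψ : ℕ → ℚ) (tψ : Test m ψ) (ψ-* : ∀ a b → ψ (a ℕ.* b) ≡ ψ a * ψ b) (ψ-1 : ψ 1 ≡ 1ℚ)
           (ψ-values : ∀ n → ψ n ≡ 1ℚ ⊎ ψ n ≡ 0ℚ ⊎ ψ n ≡ - 1ℚ) where
    open RealCharacter ψ ψ-* ψ-1 ψ-values

    private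
      s x D' D : ℕ
      s = scale m
      x = 4 ℕ.* (s ℕ.* s)
      D' = threshold m
      D = ℕ.pred D'
      A B M S X T : ℚ
      A = ι 4
      B = ι 16
      M = ι m
      S = ι s
      X = ι x
      T = harmonic ψ D
      1≤s : 1 ℕ.≤ s
      1≤s = ℕ.*-mono-≤ {1} {16} (s≤s z≤n) (ℕ.*-mono-≤ {1} {16} (s≤s z≤n) (ℕ.*-mono-≤ {1} {16} (s≤s z≤n) (ℕ.*-mono-≤ 1≤m 1≤m)))
      1≤D' : 1 ℕ.≤ D'
      1≤D' = ℕ.*-mono-≤ {1} {16} (s≤s z≤n) (ℕ.*-mono-≤ {1} {4} (s≤s z≤n) (ℕ.*-mono-≤ 1≤m 1≤s))
      sucD : suc D ≡ D'
      sucD = ℕ.suc-pred D' {{ℕ.>-nonZero 1≤D'}}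
      S≡ : S ≡ B * (B * (B * (M * M)))
      S≡ = trans (ι-* 16 (16 ℕ.* (16 ℕ.* (m ℕ.* m)))) (cong (B *_) (trans (ι-* 16 (16 ℕ.* (m ℕ.* m))) (cong (B *_) (trans (ι-* 16 (m ℕ.* m)) (cong (B *_) (ι-* m m))))))
      X≡ : X ≡ A * (S * S)
      X≡ = trans (ι-* 4 (s ℕ.* s)) (cong (A *_) (ι-* s s))
      D'≡ : ι D' ≡ B * (A * (M * S))
      D'≡ = trans (ι-* 16 (4 ℕ.* (m ℕ.* s))) (cong (B *_) (trans (ι-* 4 (m ℕ.* s)) (cong (A *_) (ι-* m s))))
      D≤x : D ℕ.≤ x
      D≤x = ℕ.≤-trans (ℕ.pred[n]≤n {D'}) (ℕ.≤-trans (ℕ.≤-reflexive (eqn m s)) (ℕ.*-monoʳ-≤ 4 (ℕ.*-monoˡ-≤ s (ℕ.*-monoʳ-≤ 16 lem))))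
        where
        eqn : ∀ m s → 16 ℕ.* (4 ℕ.* (m ℕ.* s)) ≡ 4 ℕ.* (16 ℕ.* m ℕ.* s)
        eqn = ℕR.solve-∀
        lem : m ℕ.≤ 16 ℕ.* (16 ℕ.* (m ℕ.* m))
        lem = ℕ.≤-trans (ℕ.m≤m*n m m {{ℕ.>-nonZero 1≤m}}) (ℕ.≤-trans (ℕ.m≤n*m (m ℕ.* m) 16) (ℕ.m≤n*m (16 ℕ.* (m ℕ.* m)) 16))

      total : ℚ
      total = sum x (λ n → ι (x ℕ.∸ n) * r n)

      total≡ : total ≡ sum x (λ d → ψ d * weight x d)
      total≡ = hyperbola x (λ n → ι (x ℕ.∸ n)) ψ

      0≤S : 0ℚ ≤ S
      0≤S = 0≤ι s

      -- Since `r` is nonnegative, only the squares j² with j ≤ s are kept. There r ≥ 1 and x - j² ≥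
      -- 3 s².
      total-lower : ι 3 * (S * (S * S)) ≤ total
      total-lower = ≤-trans (≤-reflexive (trans (eq₀ (ι 3) S) (sym (sum-const s (ι 3 * (S * S)))))) (≤-trans (sum-mono s term)
         (≤-trans (sum-squares s (λ n → ι (x ℕ.∸ n) * r n) nn) (sum-grow (λ n → ι (x ℕ.∸ n) * r n) (ℕ.m≤n*m (s ℕ.* s) 4) (λ k p _ → nn k (ℕ.≤-trans (s≤s z≤n) p)))))
        where
        eq₀ : ∀ t s → t * (s * (s * s)) ≡ s * (t * (s * s))
        eq₀ = solve-∀ ℚ-ring
        nn : ∀ n → 1 ℕ.≤ n → 0ℚ ≤ ι (x ℕ.∸ n) * r n
        nn n 1≤n = 0≤* (0≤ι (x ℕ.∸ n)) (0≤r n 1≤n)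
        term : ∀ j → 1 ℕ.≤ j → j ℕ.≤ s → ι 3 * (S * S) ≤ ι (x ℕ.∸ j ℕ.* j) * r (j ℕ.* j)
        term j 1≤j j≤s = subst (_≤ ι (x ℕ.∸ j ℕ.* j) * r (j ℕ.* j)) (*-identityʳ (ι 3 * (S * S))) (*-mono 0≤1 (0≤ι (x ℕ.∸ j ℕ.* j)) big (1≤r-square j 1≤j))
          where
          big : ι 3 * (S * S) ≤ ι (x ℕ.∸ j ℕ.* j)
          big = subst (_≤ ι (x ℕ.∸ j ℕ.* j)) (trans (ι-* 3 (s ℕ.* s)) (cong (ι 3 *_) (ι-* s s))) (ι-mono
            (subst (ℕ._≤ x ℕ.∸ j ℕ.* j) (ℕ.m+n∸m≡n (s ℕ.* s) (3 ℕ.* (s ℕ.* s))) (ℕ.∸-monoʳ-≤ x (ℕ.*-mono-≤ j≤s j≤s))))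

      low : ∣ sum D (λ d → ψ d * (weight x d + weight x d)) - (X * X * T - X * sum D ψ) ∣ ≤ ι D * ι D
      low = subst₂ _≤_ (cong ∣_∣ split) (sum-const D (ι D)) (sum-abs D (λ d 1≤d d≤D → ≤-trans (subst (∣ ψ d * (weight x d + weight x d - (X * X * inv d - X)) ∣ ≤_) (*-identityˡ (ι d))
           (∣∣-* {ψ d} {weight x d + weight x d - (X * X * inv d - X)} (Test.bound tψ d) (weight-approx x d 1≤d))) (ι-mono d≤D)))
        where
        eq₁ : ∀ p w x i → p * (w - (x * x * i - x)) ≡ p * w + ((- (x * x)) * (p * i) + x * p)
        eq₁ = solve-∀ ℚ-ring
        eq₂ : ∀ a x t p → a + ((- (x * x)) * t + x * p) ≡ a - (x * x * t - x * p)
        eq₂ = solve-∀ ℚ-ring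
        split : sum D (λ d → ψ d * (weight x d + weight x d - (X * X * inv d - X))) ≡ sum D (λ d → ψ d * (weight x d + weight x d)) - (X * X * T - X * sum D ψ)
        split = trans (sum-ext D (λ d → eq₁ (ψ d) (weight x d + weight x d) X (inv d)))
          (trans (sum-+ D (λ d → ψ d * (weight x d + weight x d)) (λ d → (- (X * X)) * (ψ d * inv d) + X * ψ d))
          (trans (cong (sum D (λ d → ψ d * (weight x d + weight x d)) +_) (trans (sum-+ D (λ d → (- (X * X)) * (ψ d * inv d)) (λ d → X * ψ d)) (cong₂ _+_ (sum-*ˡ D (- (X * X)) (λ d → ψ d * inv d)) (sum-*ˡ D X ψ))))
            (eq₂ (sum D (λ d → ψ d * (weight x d + weight x d))) X T (sum D ψ))))

      -- The weights decrease with d, so the bounded partial sums of ψ reduce the whole tail to its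
      -- first weight.
      high : ∣ total - sum D (λ d → ψ d * weight x d) ∣ ≤ (M + M) * (X * X * inv D')
      high = subst (λ z → ∣ z - sum D (λ d → ψ d * weight x d) ∣ ≤ (M + M) * (X * X * inv D')) (sym total≡)
        (≤-trans (abel-tail ψ M (test-bound 1≤m tψ) (weight x) (λ k → 0≤weight x (suc k)) (weight-anti x) D x D≤x)
          (subst (λ z → (M + M) * weight x z ≤ (M + M) * (X * X * inv D')) (sym sucD) (*-monoˡ (M + M) (0≤+ (0≤ι m) (0≤ι m)) (weight-upper x D' 1≤D'))))

      D'inv : ι D' * inv D' ≡ 1ℚ
      D'inv = ι*inv {D'} 1≤D'

      two-low : ∀ n → sum n (λ d → ψ d * (weight x d + weight x d)) ≡ sum n (λ d → ψ d * weight x d) + sum n (λ d → ψ d * weight x d)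
      two-low n = trans (sum-ext n (λ d → *-distribˡ-+ (ψ d) (weight x d) (weight x d))) (sum-+ n (λ d → ψ d * weight x d) (λ d → ψ d * weight x d))

      0<S : 0ℚ < S
      0<S = 0<ι {s} 1≤s

      -- 6 s³ ≤ 2 `total` ≤ x² T + x m + D'² + 4 m x²/D'. Each of the last three terms is at most
      -- s³, so 3 s³ ≤ x² T = 16 s⁴ T.
      main : ι 3 ≤ B * (S * T)
      main = *-cancelˡ-≤ S 0<S (*-cancelˡ-≤ S 0<S (*-cancelˡ-≤ S 0<S (via R 0≤R identity)))
        where
        i = inv D'
        Dq = ι D
        LD = sum D (λ d → ψ d * weight x d)
        Pd = sum D ψ
        R₁ R₂ R₃ R₄ R₅ R : ℚ
        R₁ = (total - ι 3 * (S * (S * S))) + (total - ι 3 * (S * (S * S)))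
        R₂ = Dq * Dq - ((LD + LD) - (X * X * T - X * Pd))
        R₃ = ((M + M) * (X * X * i) - (total - LD)) + ((M + M) * (X * X * i) - (total - LD))
        R₄ = X * (Pd - - M)
        R₅ = (ι D' * ι D' - Dq * Dq) + S * S * (S - A * M)
        R = R₁ + R₂ + R₃ + R₄ + R₅
        D≤D' : Dq ≤ ι D'
        D≤D' = ι-mono (ℕ.pred[n]≤n {D'})
        4M≤S : A * M ≤ S
        4M≤S = subst (_≤ S) (ι-* 4 m) (ι-mono (ℕ.*-mono-≤ {4} {16} (s≤s (s≤s (s≤s (s≤s z≤n)))) (ℕ.≤-trans (ℕ.m≤m*n m m {{ℕ.>-nonZero 1≤m}}) (ℕ.≤-trans (ℕ.m≤n*m (m ℕ.* m) 16) (ℕ.m≤n*m (16 ℕ.* (m ℕ.* m)) 16)))))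
        0≤R₁ : 0ℚ ≤ R₁
        0≤R₁ = 0≤+ (0≤y-x total-lower) (0≤y-x total-lower)
        0≤R₂ : 0ℚ ≤ R₂
        0≤R₂ = 0≤y-x (subst (λ z → z - (X * X * T - X * Pd) ≤ Dq * Dq) (two-low D) (≤-∣∣ʳ {sum D (λ d → ψ d * (weight x d + weight x d)) - (X * X * T - X * Pd)} low))
        0≤R₃ : 0ℚ ≤ R₃
        0≤R₃ = 0≤+ (0≤y-x (≤-∣∣ʳ {total - LD} high)) (0≤y-x (≤-∣∣ʳ {total - LD} high))
        0≤R : 0ℚ ≤ R
        0≤R = 0≤+ (0≤+ (0≤+ (0≤+ 0≤R₁ 0≤R₂) 0≤R₃) (0≤* (0≤ι x) (0≤y-x (≤-∣∣ˡ {Pd} (test-bound 1≤m tψ D)))))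
          (0≤+ (0≤y-x (*-mono (0≤ι D) (0≤ι D') D≤D' D≤D')) (0≤* (0≤* 0≤S 0≤S) (0≤y-x 4M≤S)))
        -- after substituting X = 4 S², ι D' = 64 M S and S = 4096 M² in one factor
        eq₁ : ∀ S M T t l p d i → S * (S * (S * (B * (S * T)))) ≡ S * (S * (S * ι 3))
           + ((t - ι 3 * (S * (S * S))) + (t - ι 3 * (S * (S * S)))
             + (d * d - ((l + l) - ((A * (S * S)) * (A * (S * S)) * T - (A * (S * S)) * p)))
             + (((M + M) * ((A * (S * S)) * (A * (S * S)) * i) - (t - l)) + ((M + M) * ((A * (S * S)) * (A * (S * S)) * i) - (t - l)))
             + (A * (S * S)) * (p - - M)
             + (((B * (A * (M * S))) * (B * (A * (M * S))) - d * d) + S * S * (S - A * M)))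
           + S * (S * S) * (1ℚ - (B * (A * (M * S))) * i) + S * S * (S - B * (B * (B * (M * M))))
        eq₁ = solve-∀ ℚ-ring
        eq₂ : ∀ a b c → a + b * (1ℚ - 1ℚ) + c * (S - S) ≡ a
        eq₂ a b c = eq₂' a b c S
          where
          eq₂' : ∀ a b c S → a + b * (1ℚ - 1ℚ) + c * (S - S) ≡ a
          eq₂' = solve-∀ ℚ-ring
        identity : S * (S * (S * (B * (S * T)))) ≡ S * (S * (S * ι 3)) + R
        identity = trans (eq₁ S M T total LD Pd Dq i)
          (trans (cong₂ (λ y z → S * (S * (S * ι 3)) + (R₁ + (Dq * Dq - ((LD + LD) - (A * (S * S) * (A * (S * S)) * T - A * (S * S) * Pd)))
              + (((M + M) * ((A * (S * S)) * (A * (S * S)) * i) - (total - LD)) + ((M + M) * ((A * (S * S)) * (A * (S * S)) * i) - (total - LD)))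
              + (A * (S * S)) * (Pd - - M) + (((B * (A * (M * S))) * (B * (A * (M * S))) - Dq * Dq) + S * S * (S - A * M)))
              + S * (S * S) * (1ℚ - y) + S * S * (S - z)) (trans (cong (_* i) (sym D'≡)) D'inv) (sym S≡))
          (trans (eq₂ _ (S * (S * S)) (S * S)) (cong₂ (λ X E → S * (S * (S * ι 3)) + (R₁ + (Dq * Dq - ((LD + LD) - (X * X * T - X * Pd)))
              + (((M + M) * (X * X * i) - (total - LD)) + ((M + M) * (X * X * i) - (total - LD)))
              + X * (Pd - - M) + ((E * E - Dq * Dq) + S * S * (S - A * M)))) (sym X≡) (sym D'≡))))

    -- L(1, ψ) is bounded below in terms of the modulus only.
    character-lower : ∀ y → threshold m ℕ.≤ y → 1ℚ ≤ ι 32 * (ι (scale m) * harmonic ψ y)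
    character-lower y h = ≤-trans (≤-trans (via (ι 2 + ι 2) (0≤+ (0≤ι 2) (0≤ι 2)) refl) ≤-refl) (via (ι 2 * (B * (S * T) - ι 3) + ι 32 * (S * ((M + M) * inv D' - (T - Ty)))) nn identity)
      where
      Ty = harmonic ψ y
      -- 32 s times the tail 2 m/D' is 1, whereas 32 s T ≥ 6.
      close : T - Ty ≤ (M + M) * inv D'
      close = subst (λ z → T - Ty ≤ (M + M) * inv z) sucD (≤-∣∣ʳ {T - Ty} (subst (_≤ (M + M) * inv (suc D)) (∣∣-sym Ty T) (harmonic-tail ψ M (test-bound 1≤m tψ) D y (ℕ.≤-trans (ℕ.pred[n]≤n {D'}) h))))
      nn : 0ℚ ≤ ι 2 * (B * (S * T) - ι 3) + ι 32 * (S * ((M + M) * inv D' - (T - Ty)))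
      nn = 0≤+ (0≤* (0≤ι 2) (0≤y-x main)) (0≤* (0≤ι 32) (0≤* 0≤S (0≤y-x close)))
      eq : ∀ S M T y i → ι 32 * (S * y) ≡ 1ℚ + (ι 2 + ι 2) + (ι 2 * (B * (S * T) - ι 3) + ι 32 * (S * ((M + M) * i - (T - y)))) + (1ℚ - (B * (A * (M * S))) * i)
      eq = solve-∀ ℚ-ring
      eq₂ : ∀ a → a + (1ℚ - 1ℚ) ≡ a
      eq₂ = solve-∀ ℚ-ring
      identity : ι 32 * (S * Ty) ≡ 1ℚ + (ι 2 + ι 2) + (ι 2 * (B * (S * T) - ι 3) + ι 32 * (S * ((M + M) * inv D' - (T - Ty))))
      identity = trans (eq S M T Ty (inv D')) (trans (cong (λ z → 1ℚ + (ι 2 + ι 2) + (ι 2 * (B * (S * T) - ι 3) + ι 32 * (S * ((M + M) * inv D' - (T - Ty)))) + (1ℚ - z)) (trans (cong (_* inv D') (sym D'≡)) D'inv)) (eq₂ _))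

-- The units modulo m and sums over residue classes

module UnitGroup (m : ℕ) (2≤m : 2 ℕ.≤ m) where
  open import Data.Nat.DivMod
  open import Data.Nat.Divisibility
  open import Data.Nat.Coprimality as C using (Coprime; coprime?; coprime-Bézout; coprime-divisor)
  open import Data.Nat.GCD using (module Bézout)
  open import Data.Rational as ℚ hiding (nonNegative; nonZero; NonZero; _÷_)
  open import Data.Rational.Properties
  open import Algebra.Bundles using (AbelianGroup)
  open import Level using (0ℓ)
  open import Tactic.RingSolver using (solve-∀)
  open RationalSums
  open TestFunctions
  open Distributions using (Summation)

  1≤m : 1 ℕ.≤ m
  1≤m = ℕ.<⇒≤ 2≤m

  instance
    m≢0 : ℕ.NonZero m
    m≢0 = ℕ.>-nonZero 1≤m

  %-* : ∀ {a a' b b'} → a % m ≡ a' % m → b % m ≡ b' % m → (a ℕ.* b) % m ≡ (a' ℕ.* b') % m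
  %-* {a} {a'} {b} {b'} p q = trans (%-distribˡ-* a b m) (trans (cong₂ (λ x y → (x ℕ.* y) % m) p q) (sym (%-distribˡ-* a' b' m)))

  1%m : 1 % m ≡ 1
  1%m = m<n⇒m%n≡m 2≤m

  coprime-* : ∀ {a b} → Coprime a m → Coprime b m → Coprime (a ℕ.* b) m
  coprime-* {a} {b} ca cb {d} (d∣ab , d∣m) = cb (coprime-divisor (λ { (e∣d , e∣a) → ca (e∣a , ∣-trans e∣d d∣m) }) d∣ab , d∣m)

  coprime-1 : Coprime 1 m
  coprime-1 = C.1-coprimeTo m

  coprime-*ˡ : ∀ {a b} → Coprime (a ℕ.* b) m → Coprime a m
  coprime-*ˡ {a} {b} c (d∣a , d∣m) = c (∣m⇒∣m*n b d∣a , d∣m)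

  coprime-% : ∀ {a b} → a % m ≡ b % m → Coprime a m → Coprime b m
  coprime-% {a} {b} e ca {d} (d∣b , d∣m) = ca (∣n∣m%n⇒∣m d∣m (subst (d ∣_) (sym e) (%-presˡ-∣ d∣b d∣m)) , d∣m)

  inverse-exists : ∀ u → Coprime u m → ∃ λ v → (u ℕ.* v) % m ≡ 1
  inverse-exists u c with coprime-Bézout c
  ... | Bézout.+- x y e = x , trans (cong (_% m) (trans (ℕ.*-comm u x) (sym e))) (trans ([m+kn]%n≡m%n 1 y m) 1%m)
  -- Here x u ≡ -1, and m - 1 ≡ -1 corrects the sign.
  ... | Bézout.-+ x y e = x ℕ.* ℕ.pred m , trans (sym ([m+kn]%n≡m%n (u ℕ.* (x ℕ.* ℕ.pred m)) y m)) (trans (cong (_% m) lem) (trans ([m+kn]%n≡m%n 1 (u ℕ.* x) m) 1%m))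
    where
    eq : ∀ u x p → u ℕ.* (x ℕ.* p) ℕ.+ (1 ℕ.+ x ℕ.* u) ≡ 1 ℕ.+ u ℕ.* x ℕ.* suc p
    eq = ℕR.solve-∀
    lem : u ℕ.* (x ℕ.* ℕ.pred m) ℕ.+ y ℕ.* m ≡ 1 ℕ.+ u ℕ.* x ℕ.* m
    lem = trans (cong (u ℕ.* (x ℕ.* ℕ.pred m) ℕ.+_) (sym e)) (trans (eq u x (ℕ.pred m)) (cong (λ z → 1 ℕ.+ u ℕ.* x ℕ.* z) (ℕ.suc-pred m)))

  Unit : Set
  Unit = ∃ λ n → Coprime n m

  _≋_ : Unit → Unit → Set
  a ≋ b = proj₁ a % m ≡ proj₁ b % m

  _⊙_ : Unit → Unit → Unit
  (a , p) ⊙ (b , q) = a ℕ.* b , coprime-* p q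

  recip : Unit → Unit
  recip (u , c) = proj₁ (inverse-exists u c) , coprime-*ˡ {proj₁ (inverse-exists u c)} {u}
    (coprime-% (trans 1%m (sym (trans (cong (_% m) (ℕ.*-comm (proj₁ (inverse-exists u c)) u)) (proj₂ (inverse-exists u c))))) coprime-1)

  recip-inverse : ∀ u → (proj₁ u ℕ.* proj₁ (recip u)) % m ≡ 1 % m
  recip-inverse (u , c) = trans (proj₂ (inverse-exists u c)) (sym 1%m)

  unit-cancel : ∀ (u : Unit) a b → (proj₁ u ℕ.* a) % m ≡ (proj₁ u ℕ.* b) % m → a % m ≡ b % m
  unit-cancel u a b e = trans (sym (clear a)) (trans (%-* {proj₁ (recip u)} {proj₁ (recip u)} refl e) (clear b))
    where
    clear : ∀ a → (proj₁ (recip u) ℕ.* (proj₁ u ℕ.* a)) % m ≡ a % m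
    clear a = trans (cong (_% m) (trans (sym (ℕ.*-assoc (proj₁ (recip u)) (proj₁ u) a)) (cong (ℕ._* a) (ℕ.*-comm (proj₁ (recip u)) (proj₁ u)))))
      (trans (%-* {proj₁ u ℕ.* proj₁ (recip u)} {1} {a} {a} (recip-inverse u) refl) (cong (_% m) (ℕ.*-identityˡ a)))

  recip-cong : ∀ {u v} → u ≋ v → recip u ≋ recip v
  recip-cong {u} {v} e = unit-cancel u (proj₁ (recip u)) (proj₁ (recip v)) (trans (recip-inverse u) (trans (sym (recip-inverse v)) (%-* {proj₁ v} {proj₁ u} {proj₁ (recip v)} {proj₁ (recip v)} (sym e) refl)))

  units : AbelianGroup 0ℓ 0ℓ
  units = record
    { Carrier = Unit ; _≈_ = _≋_ ; _∙_ = _⊙_ ; ε = 1 , coprime-1 ; _⁻¹ = recip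
    ; isAbelianGroup = record
      { isGroup = record
        { isMonoid = record
          { isSemigroup = record
            { isMagma = record { isEquivalence = record { refl = refl ; sym = sym ; trans = trans } ; ∙-cong = λ {a} {b} {c} {d} p q → %-* {proj₁ a} {proj₁ b} {proj₁ c} {proj₁ d} p q }
            ; assoc = λ a b c → cong (_% m) (ℕ.*-assoc (proj₁ a) (proj₁ b) (proj₁ c)) }
          ; identity = (λ a → cong (_% m) (ℕ.*-identityˡ (proj₁ a))) , (λ a → cong (_% m) (ℕ.*-identityʳ (proj₁ a))) }
        ; inverse = (λ a → trans (cong (_% m) (ℕ.*-comm (proj₁ (recip a)) (proj₁ a))) (recip-inverse a)) , recip-inverse
        ; ⁻¹-cong = λ {u} {v} → recip-cong {u} {v} }
      ; comm = λ a b → cong (_% m) (ℕ.*-comm (proj₁ a) (proj₁ b)) } }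

  Resp : (Unit → ℚ) → Set
  Resp f = ∀ {a b} → a ≋ b → f a ≡ f b

  at : (Unit → ℚ) → (n : ℕ) → Dec (Coprime n m) → ℚ
  at f n (yes p) = f (n , p)
  at f n (no _) = 0ℚ

  ext : (Unit → ℚ) → ℕ → ℚ
  ext f n = at f n (coprime? n m)

  at-unit : ∀ f → Resp f → ∀ n (p : Coprime n m) (d : Dec (Coprime n m)) → at f n d ≡ f (n , p)
  at-unit f r n p (yes _) = r refl
  at-unit f r n p (no ¬p) = ⊥-elim (¬p p)

  ext-unit : ∀ f → Resp f → ∀ n (p : Coprime n m) → ext f n ≡ f (n , p)
  ext-unit f r n p = at-unit f r n p (coprime? n m)

  ext-nonunit : ∀ f n → ¬ Coprime n m → ext f n ≡ 0ℚ
  ext-nonunit f n ¬p with coprime? n m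
  ... | yes p = ⊥-elim (¬p p)
  ... | no _ = refl

  ext-cong : ∀ f → Resp f → ∀ {a b} → a % m ≡ b % m → ext f a ≡ ext f b
  ext-cong f r {a} {b} e = go (coprime? a m)
    where
    go : Dec (Coprime a m) → ext f a ≡ ext f b
    go (yes p) = trans (ext-unit f r a p) (trans (r e) (sym (ext-unit f r b (coprime-% e p))))
    go (no ¬p) = trans (ext-nonunit f a ¬p) (sym (ext-nonunit f b (λ q → ¬p (coprime-% (sym e) q))))

  -- The representatives are 1, ..., m. As 2 ≤ m, the last is not a unit, so `z % m` meets each unit
  -- class exactly once.
  Sm : (Unit → ℚ) → ℚ
  Sm f = sum m (ext f)

  at-map : ∀ (T : ℚ → ℚ) → T 0ℚ ≡ 0ℚ → ∀ f n d → at (λ b → T (f b)) n d ≡ T (at f n d)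
  at-map T z f n (yes _) = refl
  at-map T z f n (no _) = sym z

  at-+ : ∀ f g n d → at (λ b → f b + g b) n d ≡ at f n d + at g n d
  at-+ f g n (yes _) = refl
  at-+ f g n (no _) = refl

  at-mono : ∀ {f g} → (∀ b → f b ≤ g b) → ∀ n d → at f n d ≤ at g n d
  at-mono h n (yes p) = h (n , p)
  at-mono h n (no _) = ≤-refl

  Sm-cong : ∀ {f g} → (∀ b → f b ≡ g b) → Sm f ≡ Sm g
  Sm-cong {f} {g} h = sum-ext m (λ n → go n (coprime? n m))
    where
    go : ∀ n d → at f n d ≡ at g n d
    go n (yes p) = h (n , p)
    go n (no _) = refl

  Sm-+ : ∀ f g → Sm (λ b → f b + g b) ≡ Sm f + Sm g
  Sm-+ f g = trans (sum-ext m (λ n → at-+ f g n (coprime? n m))) (sum-+ m (ext f) (ext g))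

  Sm-* : ∀ c f → Sm (λ b → c * f b) ≡ c * Sm f
  Sm-* c f = trans (sum-ext m (λ n → at-map (c *_) (*-zeroʳ c) f n (coprime? n m))) (sum-*ˡ m c (ext f))

  Sm-sum : ∀ x (F : ℕ → Unit → ℚ) → Sm (λ b → sum x (λ n → F n b)) ≡ sum x (λ n → Sm (F n))
  Sm-sum zero F = trans (Sm-cong {λ _ → 0ℚ} {λ _ → 0ℚ * 0ℚ} (λ _ → refl)) (trans (Sm-* 0ℚ (λ _ → 0ℚ)) (*-zeroˡ (Sm (λ _ → 0ℚ))))
  Sm-sum (suc x) F = trans (Sm-+ (λ b → sum x (λ n → F n b)) (F (suc x))) (cong (_+ Sm (F (suc x))) (Sm-sum x F))

  Sm-swap : ∀ (F : Unit → Unit → ℚ) → Sm (λ b → Sm (F b)) ≡ Sm (λ c → Sm (λ b → F b c))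
  Sm-swap F = trans (Sm-sum m (λ n b → ext (F b) n)) (sum-ext m (λ n → lem n (coprime? n m)))
    where
    lem : ∀ n d → Sm (λ b → at (F b) n d) ≡ at (λ c → Sm (λ b → F b c)) n d
    lem n (yes p) = refl
    lem n (no _) = sum-zero m (λ k _ _ → go k (coprime? k m))
      where
      go : ∀ k d → at (λ _ → 0ℚ) k d ≡ 0ℚ
      go k (yes _) = refl
      go k (no _) = refl

  e : ℕ → ℕ → ℚ
  e a b = χ (a % m ℕ.≟ b % m)

  e-cong : ∀ {a a' b b'} → (a % m ≡ b % m → a' % m ≡ b' % m) → (a' % m ≡ b' % m → a % m ≡ b % m) → e a b ≡ e a' b'
  e-cong {a} {a'} {b} {b'} f g = χ-iff (a % m ℕ.≟ b % m) (a' % m ℕ.≟ b' % m) f g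

  rep-bounds : ∀ {z} → Coprime z m → 1 ℕ.≤ z % m × z % m ℕ.≤ m
  rep-bounds {z} p = ℕ.n≢0⇒n>0 (λ z%m≡0 → ℕ.<⇒≢ 2≤m (sym (p (m%n≡0⇒n∣m z m z%m≡0 , ∣-refl)))) , ℕ.<⇒≤ (m%n<n z m)

  rep-unique : ∀ {z} k → Coprime z m → 1 ℕ.≤ k → k ℕ.≤ m → k % m ≡ z % m → k ≡ z % m
  rep-unique {z} k p 1≤k k≤m e with k ℕ.≟ m
  ... | yes refl = ⊥-elim (ℕ.<⇒≢ (proj₁ (rep-bounds p)) (sym (trans (sym e) (n%n≡0 k))))
  ... | no k≢m = trans (sym (m<n⇒m%n≡m (ℕ.≤∧≢⇒< k≤m k≢m))) e

  sum-e : ∀ z → Coprime z m → sum m (λ i → e i z) ≡ 1ℚ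
  sum-e z p = trans (sum-single m (z % m) (λ i → e i z) (proj₁ (rep-bounds p)) (proj₂ (rep-bounds p))
      (λ k 1≤k k≤m ne → χ-no (k % m ℕ.≟ z % m) (λ q → ne (rep-unique k p 1≤k k≤m q))))
    (χ-yes ((z % m) % m ℕ.≟ z % m) (m%n%n≡m%n z m))

  Sm-pick : ∀ f → Resp f → ∀ z → Sm (λ b → e (proj₁ z) (proj₁ b) * f b) ≡ f z
  Sm-pick f r (z , p) = trans (sum-single m (z % m) (ext F) (proj₁ (rep-bounds p)) (proj₂ (rep-bounds p))
      (λ k 1≤k k≤m ne → off k 1≤k k≤m ne (coprime? k m)))
    (trans (ext-unit F F-resp (z % m) p') (trans (cong₂ _*_ (χ-yes (z % m ℕ.≟ (z % m) % m) (sym (m%n%n≡m%n z m))) (r (m%n%n≡m%n z m))) (*-identityˡ (f (z , p)))))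
    where
    p' : Coprime (z % m) m
    p' = coprime-% (sym (m%n%n≡m%n z m)) p
    F : Unit → ℚ
    F b = e z (proj₁ b) * f b
    F-resp : Resp F
    F-resp {a} {b} h = cong₂ _*_ (e-cong {z} {z} {proj₁ a} {proj₁ b} (λ q → trans q h) (λ q → trans q (sym h))) (r h)
    off : ∀ k → 1 ℕ.≤ k → k ℕ.≤ m → k ≢ z % m → ∀ d → at F k d ≡ 0ℚ
    off k 1≤k k≤m ne (no _) = refl
    off k 1≤k k≤m ne (yes q) = trans (cong (_* f (k , q)) (χ-no (z % m ℕ.≟ k % m) (λ h → ne (rep-unique k p 1≤k k≤m (sym h))))) (*-zeroˡ (f (k , q)))

  -- Bijections are only bijections up to congruence, so f (π b) is expanded with the delta function
  -- `e`, the sums are exchanged and the delta is transported to the inverse ρ.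
  Sm-reindex : ∀ f → Resp f → (π ρ : Unit → Unit) → (∀ b c → π b ≋ c → ρ c ≋ b) → (∀ b c → ρ c ≋ b → π b ≋ c) → Sm (λ b → f (π b)) ≡ Sm f
  Sm-reindex f r π ρ to from = begin
    Sm (λ b → f (π b)) ≡⟨ Sm-cong (λ b → sym (Sm-pick f r (π b))) ⟩
    Sm (λ b → Sm (λ c → e (proj₁ (π b)) (proj₁ c) * f c)) ≡⟨ Sm-swap (λ b c → e (proj₁ (π b)) (proj₁ c) * f c) ⟩
    Sm (λ c → Sm (λ b → e (proj₁ (π b)) (proj₁ c) * f c)) ≡⟨ Sm-cong (λ c → trans (Sm-cong (λ b → trans (cong (_* f c) (e-cong {proj₁ (π b)} {proj₁ (ρ c)} {proj₁ c} {proj₁ b} (to b c) (from b c))) (swap (e (proj₁ (ρ c)) (proj₁ b)) (f c)))) (Sm-* (f c) (λ b → e (proj₁ (ρ c)) (proj₁ b) * 1ℚ))) ⟩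
    Sm (λ c → f c * Sm (λ b → e (proj₁ (ρ c)) (proj₁ b) * 1ℚ)) ≡⟨ Sm-cong (λ c → trans (cong (f c *_) (Sm-pick (λ _ → 1ℚ) (λ _ → refl) (ρ c))) (*-identityʳ (f c))) ⟩
    Sm f ∎
    where
    open ≡-Reasoning
    swap : ∀ a b → a * b ≡ b * (a * 1ℚ)
    swap = solve-∀ ℚ-ring

  open AbelianGroup units using (_∙_; _⁻¹; ∙-congʳ; ∙-congˡ; assoc; inverseʳ; inverseˡ; identityʳ; comm; ⁻¹-cong) renaming (ε to 𝟙; _-_ to _∙/_)
  open import Algebra.Properties.AbelianGroup units using (⁻¹-involutive)

  move-right : ∀ b u c → (b ∙ u) ≋ c → (c ∙ (u ⁻¹)) ≋ b
  move-right b u c h = trans (∙-congʳ {u ⁻¹} {c} {b ∙ u} (sym h)) (trans (assoc b u (u ⁻¹)) (trans (∙-congˡ {b} {u ∙ (u ⁻¹)} {𝟙} (inverseʳ u)) (identityʳ b)))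

  move-left : ∀ b u c → (c ∙ (u ⁻¹)) ≋ b → (b ∙ u) ≋ c
  move-left b u c h = trans (∙-congʳ {u} {b} {c ∙ (u ⁻¹)} (sym h)) (trans (assoc c (u ⁻¹) u) (trans (∙-congˡ {c} {(u ⁻¹) ∙ u} {𝟙} (inverseˡ u)) (identityʳ c)))

  Sm-count : ∀ f → (∀ b → f b ≡ 0ℚ ⊎ f b ≡ 1ℚ) → ∀ x → ∃ λ k → sum x (ext f) ≡ ι k
  Sm-count f h zero = 0 , refl
  Sm-count f h (suc x) = go (Sm-count f h x) (lem (coprime? (suc x) m))
    where
    lem : ∀ d → at f (suc x) d ≡ 0ℚ ⊎ at f (suc x) d ≡ 1ℚ
    lem (yes p) = h (suc x , p)
    lem (no _) = inj₁ refl
    go : (∃ λ k → sum x (ext f) ≡ ι k) → ext f (suc x) ≡ 0ℚ ⊎ ext f (suc x) ≡ 1ℚ → ∃ λ k → sum x (ext f) + ext f (suc x) ≡ ι k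
    go (k , q) (inj₁ z) = k , trans (cong₂ _+_ q z) (+-identityʳ (ι k))
    go (k , q) (inj₂ z) = suc k , trans (cong₂ _+_ q z) (+-comm (ι k) 1ℚ)

  summation : Summation units
  summation = record
    { S = Sm ; order = proj₁ cnt
    ; S-mono = λ h → sum-mono m (λ n _ _ → at-mono h n (coprime? n m))
    ; S-+ = Sm-+ ; S-* = Sm-* ; S-1 = proj₂ cnt
    ; S-term = term
    ; S-translate = λ f r u → Sm-reindex f (λ {a} {b} → r {a} {b}) (λ b → b ∙ u) (λ c → c ∙ (u ⁻¹)) (λ b c → move-right b u c) (λ b c → move-left b u c)
    ; S-invert = λ f r → Sm-reindex f (λ {a} {b} → r {a} {b}) (λ b → b ⁻¹) (λ c → c ⁻¹) (λ b c h → trans (sym (⁻¹-cong {b ⁻¹} {c} h)) (⁻¹-involutive b)) (λ b c h → trans (sym (⁻¹-cong {c ⁻¹} {b} h)) (⁻¹-involutive c))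
    ; S-count = λ f h → Sm-count f h m }
    where
    cnt : ∃ λ k → Sm (λ _ → 1ℚ) ≡ ι k
    cnt = Sm-count (λ _ → 1ℚ) (λ _ → inj₂ refl) m
    term : ∀ f → (∀ {a b} → a ≋ b → f a ≡ f b) → (∀ b → 0ℚ ≤ f b) → ∀ b → f b ≤ Sm f
    term f r 0≤f (n , p) = subst (_≤ Sm f) (trans (ext-unit f r (n % m) (coprime-% (sym (m%n%n≡m%n n m)) p)) (r (m%n%n≡m%n n m)))
      (sum-term m (n % m) (ext f) (proj₁ (rep-bounds p)) (proj₂ (rep-bounds p)) (λ k _ _ → nn k (coprime? k m)))
      where
      nn : ∀ k d → 0ℚ ≤ at f k d
      nn k (yes q) = 0≤f (k , q)
      nn k (no _) = ≤-refl

  U : ℕ → ℚ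
  U = ext (λ _ → 1ℚ)

  e-shift : ∀ k b → e (m ℕ.+ k) b ≡ e k b
  e-shift k b = cong (λ z → χ (z ℕ.≟ b % m)) (trans (cong (_% m) (ℕ.+-comm m k)) ([m+n]%n≡m%n k m))

  e-nonunit : ∀ d i b → ¬ Coprime d m → Coprime b m → e (d ℕ.* i) b ≡ 0ℚ
  e-nonunit d i b ¬p q = χ-no ((d ℕ.* i) % m ℕ.≟ b % m) (λ h → ¬p (coprime-*ˡ {d} {i} (coprime-% (sym h) q)))

  e-quotient : ∀ n (u b : Unit) → e (n ℕ.* proj₁ u) (proj₁ b) ≡ e n (proj₁ (b ∙/ u))
  e-quotient n u b = e-cong {n ℕ.* proj₁ u} {n} {proj₁ b} {proj₁ (b ∙/ u)}
    (λ h → sym (unit-cancel u (proj₁ (b ∙/ u)) n (trans (cong (_% m) (ℕ.*-comm (proj₁ u) (proj₁ (b ∙/ u)))) (trans (back) (trans (sym h) (cong (_% m) (ℕ.*-comm n (proj₁ u))))))))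
    (λ h → trans (%-* {n} {proj₁ (b ∙/ u)} {proj₁ u} {proj₁ u} h refl) back)
    where
    back : (proj₁ (b ∙/ u) ℕ.* proj₁ u) % m ≡ proj₁ b % m
    back = move-left (b ∙/ u) u b refl

  -- A unit d permutes the classes, and multiples of a non-unit never meet a unit class. The mean is
  -- thus independent of b, and differences of classes are test functions.
  class-mean : ∀ d (b : Unit) → sum m (λ i → e (d ℕ.* i) (proj₁ b)) ≡ U d
  class-mean d b = go (coprime? d m)
    where
    go : (dec : Dec (Coprime d m)) → sum m (λ i → e (d ℕ.* i) (proj₁ b)) ≡ at (λ _ → 1ℚ) d dec
    go (yes p) = trans (sum-ext m (λ i → trans (cong (λ z → e z (proj₁ b)) (ℕ.*-comm d i)) (e-quotient i (d , p) b))) (sum-e (proj₁ (b ∙/ (d , p))) (proj₂ (b ∙/ (d , p))))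
    go (no ¬p) = sum-zero m (λ i _ _ → e-nonunit d i (proj₁ b) ¬p (proj₂ b))

  class-test : ∀ b b' → Test m (λ n → e n (proj₁ b) - e n (proj₁ b'))
  class-test b b' = record
    { period = λ k → cong₂ _-_ (e-shift k (proj₁ b)) (e-shift k (proj₁ b'))
    ; bound = λ k → ∣∣≤ (lower k) (upper k)
    ; mean = λ d → trans (sum-- m (λ i → e (d ℕ.* i) (proj₁ b)) (λ i → e (d ℕ.* i) (proj₁ b'))) (trans (cong₂ _-_ (class-mean d b) (class-mean d b')) (+-inverseʳ (U d))) }
    where
    eq₁ : ∀ x → - x ≡ 0ℚ - x
    eq₁ = solve-∀ ℚ-ring
    eq₂ : ∀ x → x ≡ x - 0ℚ
    eq₂ = solve-∀ ℚ-ring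
    lower : ∀ k → - 1ℚ ≤ e k (proj₁ b) - e k (proj₁ b')
    lower k = subst (_≤ e k (proj₁ b) - e k (proj₁ b')) (sym (eq₁ 1ℚ)) (+-mono-≤ (0≤χ (k % m ℕ.≟ proj₁ b % m)) (neg-antimono-≤ (χ≤1 (k % m ℕ.≟ proj₁ b' % m))))
    upper : ∀ k → e k (proj₁ b) - e k (proj₁ b') ≤ 1ℚ
    upper k = subst (e k (proj₁ b) - e k (proj₁ b') ≤_) (sym (eq₂ 1ℚ)) (+-mono-≤ (χ≤1 (k % m ℕ.≟ proj₁ b % m)) (neg-antimono-≤ (0≤χ (k % m ℕ.≟ proj₁ b' % m))))

  e-class : ∀ n b b' → b % m ≡ b' % m → e n b ≡ e n b'
  e-class n b b' h = e-cong {n} {n} {b} {b'} (λ q → trans q h) (λ q → trans q (sym h))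

  module Classes (wt : ℕ → ℚ) where

    F : ℕ → Unit → ℚ
    F x b = sum x (λ n → e n (proj₁ b) * wt n)

    F-resp : ∀ x → Resp (F x)
    F-resp x {a} {b} h = sum-ext x (λ n → cong (_* wt n) (e-class n (proj₁ a) (proj₁ b) h))

    group : ∀ x H → Resp H → sum x (λ j → wt j * ext H j) ≡ Sm (λ u → H u * F x u)
    group x H r = begin
      sum x (λ j → wt j * ext H j) ≡⟨ sum-ext x (λ j → trans (cong (wt j *_) (lem j (coprime? j m))) (sym (Sm-* (wt j) (λ u → e j (proj₁ u) * H u)))) ⟩
      sum x (λ j → Sm (λ u → wt j * (e j (proj₁ u) * H u))) ≡⟨ sym (Sm-sum x (λ j u → wt j * (e j (proj₁ u) * H u))) ⟩
      Sm (λ u → sum x (λ j → wt j * (e j (proj₁ u) * H u))) ≡⟨ Sm-cong (λ u → trans (sum-ext x (λ j → eq (wt j) (e j (proj₁ u)) (H u))) (sum-*ˡ x (H u) (λ j → e j (proj₁ u) * wt j))) ⟩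
      Sm (λ u → H u * F x u) ∎
      where
      open ≡-Reasoning
      eq : ∀ a b c → a * (b * c) ≡ c * (b * a)
      eq = solve-∀ ℚ-ring
      lem : ∀ j d → at H j d ≡ Sm (λ u → e j (proj₁ u) * H u)
      lem j (yes p) = sym (Sm-pick H r (j , p))
      lem j (no ¬p) = sym (sum-zero m (λ k _ _ → off k (coprime? k m)))
        where
        off : ∀ k d → at (λ u → e j (proj₁ u) * H u) k d ≡ 0ℚ
        off k (no _) = refl
        off k (yes q) = trans (cong (_* H (k , q)) (χ-no (j % m ℕ.≟ k % m) (λ h → ¬p (coprime-% (sym h) q)))) (*-zeroˡ (H (k , q)))

    -- For a unit u, n u ≡ b means n ≡ b/u, and non-units j contribute nothing: the sum over n j ≡ b
    -- is the group convolution of the class sums.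
    convolve : ∀ x x' (b : Unit) → sum x' (λ n → wt n * sum x (λ j → wt j * e (n ℕ.* j) (proj₁ b))) ≡ Sm (λ u → F x u * F x' (b ∙/ u))
    convolve x x' b = begin
      sum x' (λ n → wt n * sum x (λ j → wt j * e (n ℕ.* j) (proj₁ b)))
        ≡⟨ sum-ext x' (λ n → sym (sum-*ˡ x (wt n) (λ j → wt j * e (n ℕ.* j) (proj₁ b)))) ⟩
      sum x' (λ n → sum x (λ j → wt n * (wt j * e (n ℕ.* j) (proj₁ b))))
        ≡⟨ sum-swap x' x (λ n j → wt n * (wt j * e (n ℕ.* j) (proj₁ b))) ⟩
      sum x (λ j → sum x' (λ n → wt n * (wt j * e (n ℕ.* j) (proj₁ b))))
        ≡⟨ sum-ext x (λ j → trans (sum-ext x' (λ n → eq (wt n) (wt j) (e (n ℕ.* j) (proj₁ b)))) (trans (sum-*ˡ x' (wt j) (λ n → e (n ℕ.* j) (proj₁ b) * wt n)) (cong (wt j *_) (inner j (coprime? j m))))) ⟩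
      sum x (λ j → wt j * ext H j)
        ≡⟨ group x H H-resp ⟩
      Sm (λ u → H u * F x u)
        ≡⟨ Sm-cong (λ u → *-comm (H u) (F x u)) ⟩
      Sm (λ u → F x u * F x' (b ∙/ u)) ∎
      where
      open ≡-Reasoning
      eq : ∀ a b c → a * (b * c) ≡ b * (c * a)
      eq = solve-∀ ℚ-ring
      H : Unit → ℚ
      H u = F x' (b ∙/ u)
      H-resp : Resp H
      H-resp {u} {v} h = F-resp x' {b ∙/ u} {b ∙/ v} (∙-congˡ {b} {u ⁻¹} {v ⁻¹} (⁻¹-cong {u} {v} h))
      inner : ∀ j d → sum x' (λ n → e (n ℕ.* j) (proj₁ b) * wt n) ≡ at H j d
      inner j (yes p) = sum-ext x' (λ n → cong (_* wt n) (e-quotient n (j , p) b))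
      inner j (no ¬p) = sum-zero x' (λ n _ _ → trans (cong (_* wt n) (trans (cong (λ z → e z (proj₁ b)) (ℕ.*-comm n j)) (e-nonunit j n (proj₁ b) ¬p (proj₂ b)))) (*-zeroˡ (wt n)))

    F-total : ∀ x → Sm (F x) ≡ sum x (λ n → U n * wt n)
    F-total x = trans (Sm-cong (λ u → sym (*-identityˡ (F x u)))) (trans (sym (group x (λ _ → 1ℚ) (λ _ → refl))) (sum-ext x (λ j → *-comm (wt j) (U j))))

  U-* : ∀ d k → U (d ℕ.* k) ≡ U d * U k
  U-* d k = go (coprime? d m) (coprime? k m)
    where
    go : (x : Dec (Coprime d m)) (y : Dec (Coprime k m)) → U (d ℕ.* k) ≡ at (λ _ → 1ℚ) d x * at (λ _ → 1ℚ) k y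
    go (yes p) (yes q) = ext-unit (λ _ → 1ℚ) (λ _ → refl) (d ℕ.* k) (coprime-* p q)
    go (no ¬p) y = trans (ext-nonunit (λ _ → 1ℚ) (d ℕ.* k) (λ c → ¬p (coprime-*ˡ {d} {k} c))) (sym (*-zeroˡ (at (λ _ → 1ℚ) k y)))
    go (yes _) (no ¬q) = ext-nonunit (λ _ → 1ℚ) (d ℕ.* k) (λ c → ¬q (coprime-*ˡ {k} {d} (subst (λ z → Coprime z m) (ℕ.*-comm d k) c)))

  U-01 : ∀ n → 0ℚ ≤ U n × U n ≤ 1ℚ
  U-01 n = go (coprime? n m)
    where
    go : ∀ d → 0ℚ ≤ at (λ _ → 1ℚ) n d × at (λ _ → 1ℚ) n d ≤ 1ℚ
    go (yes _) = 0≤1 , ≤-refl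
    go (no _) = ≤-refl , 0≤1

  U-period : ∀ k → U (m ℕ.+ k) ≡ U k
  U-period k = ext-cong (λ _ → 1ℚ) (λ _ → refl) (trans (cong (_% m) (ℕ.+-comm m k)) ([m+n]%n≡m%n k m))

  module Extend (sg : Unit → ℚ) (sg-resp : Resp sg) (sg-∙ : ∀ b c → sg (b ∙ c) ≡ sg b * sg c) (sg-1 : sg 𝟙 ≡ 1ℚ)
                (sg-values : ∀ b → sg b ≡ 1ℚ ⊎ sg b ≡ - 1ℚ) (sg-mean : Sm sg ≡ 0ℚ) where

    ψ : ℕ → ℚ
    ψ = ext sg

    ψ-* : ∀ a b → ψ (a ℕ.* b) ≡ ψ a * ψ b
    ψ-* d k = go (coprime? d m) (coprime? k m)
      where
      go : (x : Dec (Coprime d m)) (y : Dec (Coprime k m)) → ψ (d ℕ.* k) ≡ at sg d x * at sg k y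
      go (yes p) (yes q) = trans (ext-unit sg sg-resp (d ℕ.* k) (coprime-* p q)) (sg-∙ (d , p) (k , q))
      go (no ¬p) y = trans (ext-nonunit sg (d ℕ.* k) (λ c → ¬p (coprime-*ˡ {d} {k} c))) (sym (*-zeroˡ (at sg k y)))
      go (yes p) (no ¬q) = trans (ext-nonunit sg (d ℕ.* k) (λ c → ¬q (coprime-*ˡ {k} {d} (subst (λ z → Coprime z m) (ℕ.*-comm d k) c)))) (sym (*-zeroʳ (sg (d , p))))

    ψ-1 : ψ 1 ≡ 1ℚ
    ψ-1 = trans (ext-unit sg sg-resp 1 coprime-1) (trans (sg-resp refl) sg-1)

    ψ-values : ∀ n → ψ n ≡ 1ℚ ⊎ ψ n ≡ 0ℚ ⊎ ψ n ≡ - 1ℚ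
    ψ-values n = go (coprime? n m)
      where
      go : ∀ d → at sg n d ≡ 1ℚ ⊎ at sg n d ≡ 0ℚ ⊎ at sg n d ≡ - 1ℚ
      go (no _) = inj₂ (inj₁ refl)
      go (yes p) with sg-values (n , p)
      ... | inj₁ x = inj₁ x
      ... | inj₂ x = inj₂ (inj₂ x)

    ψ-test : Test m ψ
    ψ-test = record
      { period = λ k → ext-cong sg sg-resp (trans (cong (_% m) (ℕ.+-comm m k)) ([m+n]%n≡m%n k m))
      ; bound = λ k → bd (ψ-values k)
      ; mean = λ d → trans (sum-ext m (λ i → ψ-* d i)) (trans (sum-*ˡ m (ψ d) ψ) (trans (cong (ψ d *_) sg-mean) (*-zeroʳ (ψ d)))) }
      where
      bd : ∀ {x} → x ≡ 1ℚ ⊎ x ≡ 0ℚ ⊎ x ≡ - 1ℚ → ∣ x ∣ ≤ 1ℚ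
      bd (inj₁ refl) = ≤-refl
      bd (inj₂ (inj₁ refl)) = 0≤1
      bd (inj₂ (inj₂ refl)) = ≤-refl

-- Dirichlet's theorem on primes in arithmetic progressions

module Dirichlet where
  open import Data.Nat.DivMod using (_%_)
  open import Data.Nat.Divisibility
  open import Data.Nat.Coprimality using (Coprime)
  open import Data.Nat.Primality using (Prime; prime?)
  open import Data.Integer as ℤ using ()
  open import Data.Rational as ℚ hiding (nonNegative; nonZero; NonZero; _÷_)
  open import Data.Rational.Properties
  open import Algebra.Bundles using (AbelianGroup)
  open import Relation.Nullary.Decidable using (_×-dec_; toWitnessFalse)
  open import Data.Unit using (tt)
  open import Tactic.RingSolver using (solve-∀)
  open RationalSums
  open Multiplicative using (m<2^m)
  open Logarithm using (LogData; log-data)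
  open TestFunctions using (harmonic)
  open Distributions using (Summation; AlmostUniform; module Dichotomy; q2; pw)

  -- The first summand is m times the error of Selberg's relation between classes; the second is the
  -- error in the total mass from Mertens' theorem.
  error-bound : ℚ → ℕ → ℕ → ℚ
  error-bound M k k' = M * (M * ι 57 * ι (2 ℕ.^ k) + M * ι 6 * (ι k' + ι 14)) + (ι 14 * (M * M) * (ι k' + ι 14 * (M * M)) + (ι k + ι k) * (ι 14 * (M * M)))

  module Relation (m : ℕ) (2≤m : 2 ℕ.≤ m) (Y : ℕ) (D : LogData Y) where
    open UnitGroup m 2≤m
    open LogData D
    open Chebyshev Y D
    open Selberg Y D
    open AbelianGroup units using (_∙_; _⁻¹) renaming (_-_ to _∙/_; ε to 𝟙)
    open Summation summation using (order; S-1; S-term; S-mono; S-translate)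

    wt : ℕ → ℚ
    wt n = Λ n * inv n

    open Classes wt

    M h c : ℚ
    M = ι m
    h = ι order
    c = ι 14 * (M * M)

    0≤M : 0ℚ ≤ M
    0≤M = 0≤ι m

    1≤h : 1ℚ ≤ h
    1≤h = subst (1ℚ ≤_) S-1 (S-term (λ _ → 1ℚ) (λ _ → refl) (λ _ → 0≤1) 𝟙)

    h≤M : h ≤ M
    h≤M = subst₂ _≤_ S-1 (trans (sum-const m 1ℚ) (*-identityʳ M)) (sum-mono m (λ n _ _ → proj₂ (U-01 n)))

    0≤F : ∀ x b → 0ℚ ≤ F x b
    0≤F x b = sum-nonneg x (λ n _ _ → 0≤* (0≤χ (n % m ℕ.≟ proj₁ b % m)) (0≤Λinv n))

    mass : ∀ k → 2 ℕ.^ k ℕ.≤ Y → ∣ Sm (F (2 ℕ.^ k)) - ι k ∣ ≤ c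
    mass k le = subst (λ z → ∣ z - ι k ∣ ≤ c) (sym (F-total (2 ℕ.^ k)))
      (Mertens.mertens m 1≤m U (λ n → proj₁ (U-01 n)) (λ n → proj₂ (U-01 n)) U-* U-period k le (subst (1ℚ ≤_) (sym S-1) 1≤h))

    R : ℕ → ℕ → Unit → ℚ
    R k k' b = ι k * F (2 ℕ.^ k') b + Sm (λ u → F (2 ℕ.^ k) u * F (2 ℕ.^ k') (b ∙/ u))

    -- Selberg's relation for the test function [n ≡ b] - [n ≡ b'].
    R-difference : ∀ k k' → 2 ℕ.^ k ℕ.≤ Y → suc (2 ℕ.^ k') ℕ.≤ Y → ∀ b b' →
      ∣ R k k' b - R k k' b' ∣ ≤ M * ι 57 * ι (2 ℕ.^ k) + M * ι 6 * (ι k' + ι 14)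
    R-difference k k' le le' b b' = subst (λ z → ∣ z ∣ ≤ M * ι 57 * ι x + M * ι 6 * (ι k' + ι 14)) (trans split (cong₂ _-_ (one b) (one b')))
      (≤-trans (selberg m 1≤m φ (class-test b b') k k' le le') (+-monoʳ-≤ (M * ι 57 * ι x) (*-monoˡ (M * ι 6) (0≤* 0≤M (0≤ι 6)) (F₁-bound k' (ℕ.<⇒≤ le')))))
      where
      x = 2 ℕ.^ k
      x' = 2 ℕ.^ k'
      φ : ℕ → ℚ
      φ n = e n (proj₁ b) - e n (proj₁ b')
      G : Unit → ℕ → ℚ
      G b n = ι k * e n (proj₁ b) + sum x (λ j → wt j * e (n ℕ.* j) (proj₁ b))
      eq₁ : ∀ k a b → k * (a - b) ≡ k * a - k * b
      eq₁ = solve-∀ ℚ-ring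
      eq₂ : ∀ w a b s t → w * ((a - b) + (s - t)) ≡ w * (a + s) - w * (b + t)
      eq₂ = solve-∀ ℚ-ring
      split : sum x' (λ n → wt n * (ι k * φ n + sum x (λ j → wt j * φ (n ℕ.* j)))) ≡ sum x' (λ n → wt n * G b n) - sum x' (λ n → wt n * G b' n)
      split = trans (sum-ext x' (λ n → trans (cong (wt n *_) (cong₂ _+_ (eq₁ (ι k) (e n (proj₁ b)) (e n (proj₁ b')))
            (trans (sum-ext x (λ j → eq₁ (wt j) (e (n ℕ.* j) (proj₁ b)) (e (n ℕ.* j) (proj₁ b')))) (sum-- x (λ j → wt j * e (n ℕ.* j) (proj₁ b)) (λ j → wt j * e (n ℕ.* j) (proj₁ b'))))))
          (eq₂ (wt n) (ι k * e n (proj₁ b)) (ι k * e n (proj₁ b')) (sum x (λ j → wt j * e (n ℕ.* j) (proj₁ b))) (sum x (λ j → wt j * e (n ℕ.* j) (proj₁ b'))))))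
        (sum-- x' (λ n → wt n * G b n) (λ n → wt n * G b' n))
      eq₃ : ∀ w k a s → w * (k * a + s) ≡ k * (a * w) + w * s
      eq₃ = solve-∀ ℚ-ring
      one : ∀ b → sum x' (λ n → wt n * G b n) ≡ R k k' b
      one b = trans (sum-ext x' (λ n → eq₃ (wt n) (ι k) (e n (proj₁ b)) (sum x (λ j → wt j * e (n ℕ.* j) (proj₁ b)))))
        (trans (sum-+ x' (λ n → ι k * (e n (proj₁ b) * wt n)) (λ n → wt n * sum x (λ j → wt j * e (n ℕ.* j) (proj₁ b))))
          (cong₂ _+_ (sum-*ˡ x' (ι k) (λ n → e n (proj₁ b) * wt n)) (convolve x x' b)))

    R-total : ∀ k k' → Sm (R k k') ≡ ι k * Sm (F (2 ℕ.^ k')) + Sm (F (2 ℕ.^ k)) * Sm (F (2 ℕ.^ k'))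
    R-total k k' = trans (Sm-+ (λ b → ι k * F x' b) (λ b → Sm (λ u → F x u * F x' (b ∙/ u)))) (cong₂ _+_ (Sm-* (ι k) (F x'))
      (trans (Sm-swap (λ b u → F x u * F x' (b ∙/ u))) (trans (Sm-cong (λ u → trans (Sm-* (F x u) (λ b → F x' (b ∙/ u))) (trans (cong (F x u *_) (S-translate (F x') (λ {a} {b} → F-resp x' {a} {b}) (u ⁻¹))) (*-comm (F x u) (Sm (F x'))))))
        (trans (Sm-* (Sm (F x')) (F x)) (*-comm (Sm (F x')) (Sm (F x)))))))
      where
      x = 2 ℕ.^ k
      x' = 2 ℕ.^ k'

    err : ℕ → ℕ → ℚ
    err k k' = error-bound M k k'

    -- By `R-difference` each of the h values is close to their average, and Mertens' theorem gives
    -- the total k · k' + k · k'.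
    R-approx : ∀ k k' → 2 ℕ.^ k ℕ.≤ Y → suc (2 ℕ.^ k') ℕ.≤ Y → ∀ b → ∣ h * R k k' b - (ι k + ι k) * ι k' ∣ ≤ err k k'
    R-approx k k' le le' b = ∣∣-trans (h * R k k' b) (Sm (R k k')) ((ι k + ι k) * ι k') near total
      where
      E0 = M * ι 57 * ι (2 ℕ.^ k) + M * ι 6 * (ι k' + ι 14)
      0≤E0 : 0ℚ ≤ E0
      0≤E0 = ≤-trans (0≤∣p∣ (R k k' b - R k k' b)) (R-difference k k' le le' b b)
      A = Sm (F (2 ℕ.^ k))
      A' = Sm (F (2 ℕ.^ k'))
      eq₀ : ∀ r x → r - x ≡ r * 1ℚ + (- 1ℚ) * x
      eq₀ = solve-∀ ℚ-ring
      eq₀' : ∀ r x h → r * h + (- 1ℚ) * x ≡ h * r - x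
      eq₀' = solve-∀ ℚ-ring
      diff≡ : Sm (λ b' → R k k' b - R k k' b') ≡ h * R k k' b - Sm (R k k')
      diff≡ = trans (Sm-cong (λ b' → eq₀ (R k k' b) (R k k' b'))) (trans (Sm-+ (λ _ → R k k' b * 1ℚ) (λ b' → (- 1ℚ) * R k k' b'))
        (trans (cong₂ _+_ (trans (Sm-* (R k k' b) (λ _ → 1ℚ)) (cong (R k k' b *_) S-1)) (Sm-* (- 1ℚ) (R k k'))) (eq₀' (R k k' b) (Sm (R k k')) h)))
      constSm : ∀ x → Sm (λ _ → x) ≡ x * h
      constSm x = trans (Sm-cong (λ _ → sym (*-identityʳ x))) (trans (Sm-* x (λ _ → 1ℚ)) (cong (x *_) S-1))
      eq₁ : ∀ x h → - (h * x) ≡ (- x) * h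
      eq₁ = solve-∀ ℚ-ring
      near : ∣ h * R k k' b - Sm (R k k') ∣ ≤ M * E0
      near = subst (λ z → ∣ z ∣ ≤ M * E0) diff≡ (≤-trans (∣∣≤ {Sm (λ b' → R k k' b - R k k' b')} {h * E0}
         (subst (_≤ Sm (λ b' → R k k' b - R k k' b')) (trans (constSm (- E0)) (sym (eq₁ E0 h))) (S-mono (λ b' → ≤-∣∣ˡ {R k k' b - R k k' b'} (R-difference k k' le le' b b'))))
         (subst (Sm (λ b' → R k k' b - R k k' b') ≤_) (trans (constSm E0) (*-comm E0 h)) (S-mono (λ b' → ≤-∣∣ʳ {R k k' b - R k k' b'} (R-difference k k' le le' b b')))))
         (*-monoʳ E0 0≤E0 h≤M))
      eq₂ : ∀ k k' a a' → (a - k) * a' + (k + k) * (a' - k') ≡ k * a' + a * a' - (k + k) * k'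
      eq₂ = solve-∀ ℚ-ring
      eq₃ : ∀ a k → a - k + k ≡ a
      eq₃ = solve-∀ ℚ-ring
      ∣A'∣ : ∣ A' ∣ ≤ ι k' + c
      ∣A'∣ = subst₂ (λ y z → ∣ y ∣ ≤ z) (eq₃ A' (ι k')) (+-comm c (ι k')) (∣∣-tri {A' - ι k'} {ι k'} (mass k' (ℕ.<⇒≤ le')) (∣∣-pos (0≤ι k')))
      total : ∣ Sm (R k k') - (ι k + ι k) * ι k' ∣ ≤ c * (ι k' + c) + (ι k + ι k) * c
      total = subst (λ z → ∣ z - (ι k + ι k) * ι k' ∣ ≤ c * (ι k' + c) + (ι k + ι k) * c) (sym (R-total k k'))
        (subst (λ z → ∣ z ∣ ≤ c * (ι k' + c) + (ι k + ι k) * c) (eq₂ (ι k) (ι k') A A')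
          (∣∣-tri {(A - ι k) * A'} {(ι k + ι k) * (A' - ι k')} (∣∣-* {A - ι k} {A'} (mass k le) ∣A'∣) (∣∣-* {ι k + ι k} {A' - ι k'} (∣∣-pos (0≤+ (0≤ι k) (0≤ι k))) (mass k' (ℕ.<⇒≤ le')))))

    -- Division by k, the logarithm of the scale, makes the total mass about 1.
    density : ℕ → Unit → ℚ
    density k b = F (2 ℕ.^ k) b * inv k

    density-resp : ∀ k → Resp (density k)
    density-resp k {a} {b} q = cong (_* inv k) (F-resp (2 ℕ.^ k) {a} {b} q)

    0≤density : ∀ k b → 0ℚ ≤ density k b
    0≤density k b = 0≤* (0≤F (2 ℕ.^ k) b) (0≤inv k)

    density-relation : ∀ k k' Z → 1 ℕ.≤ Z → 1 ℕ.≤ k → 1 ℕ.≤ k' → 2 ℕ.^ k ℕ.≤ Y → suc (2 ℕ.^ k') ℕ.≤ Y → ι Z * err k k' ≤ ι k * ι k' → ∀ b →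
      ∣ h * (density k' b + Sm (λ u → density k u * density k' (b ∙/ u))) - q2 ∣ ≤ inv Z
    density-relation k k' Z 1≤Z 1≤k 1≤k' le le' small b = subst₂ (λ y z → ∣ y ∣ ≤ z) lhs refl
        (≤-trans (∣∣-* {h * R k k' b - (ι k + ι k) * ι k'} {inv k * inv k'} (R-approx k k' le le' b) (∣∣-pos (0≤* (0≤inv k) (0≤inv k')))) fin)
      where
      x = 2 ℕ.^ k
      x' = 2 ℕ.^ k'
      i = inv k
      i' = inv k'
      C = Sm (λ u → F x u * F x' (b ∙/ u))
      eq₁ : ∀ a i b j → a * i * (b * j) ≡ i * j * (a * b)
      eq₁ = solve-∀ ℚ-ring
      conv : Sm (λ u → density k u * density k' (b ∙/ u)) ≡ i * i' * C
      conv = trans (Sm-cong (λ u → eq₁ (F x u) i (F x' (b ∙/ u)) i')) (Sm-* (i * i') (λ u → F x u * F x' (b ∙/ u)))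
      eq₂ : ∀ h k k' f s i i' → (h * (k * f + s) - (k + k) * k') * (i * i') ≡ h * (k * i * (f * i') + i * i' * s) - q2 * (k * i) * (k' * i')
      eq₂ = solve-∀ ℚ-ring
      eq₃ : ∀ h f s → h * (1ℚ * f + s) - q2 * 1ℚ * 1ℚ ≡ h * (f + s) - q2
      eq₃ = solve-∀ ℚ-ring
      lhs : (h * R k k' b - (ι k + ι k) * ι k') * (i * i') ≡ h * (density k' b + Sm (λ u → density k u * density k' (b ∙/ u))) - q2
      lhs = trans (eq₂ h (ι k) (ι k') (F x' b) C i i') (trans (cong₂ (λ y z → h * (y * (F x' b * i') + i * i' * C) - q2 * y * z) (ι*inv {k} 1≤k) (ι*inv {k'} 1≤k'))
        (trans (eq₃ h (F x' b * i') (i * i' * C)) (cong (λ z → h * (F x' b * i' + z) - q2) (sym conv))))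
      eq₄ : ∀ z e i i' → z * (e * (i * i')) ≡ z * e * (i * i')
      eq₄ = solve-∀ ℚ-ring
      eq₅ : ∀ k k' i i' → k * k' * (i * i') ≡ k * i * (k' * i')
      eq₅ = solve-∀ ℚ-ring
      fin : err k k' * (i * i') ≤ inv Z
      fin = *-cancelˡ-≤ (ι Z) (0<ι {Z} 1≤Z) (subst₂ _≤_ (sym (eq₄ (ι Z) (err k k') i i')) (trans (eq₅ (ι k) (ι k') i i') (trans (cong₂ _*_ (ι*inv {k} 1≤k) (ι*inv {k'} 1≤k')) (sym (ι*inv {Z} 1≤Z))))
         (*-monoʳ (i * i') (0≤* (0≤inv k) (0≤inv k')) small))

    density-total : ∀ k Z → 1 ℕ.≤ Z → 1 ℕ.≤ k → 2 ℕ.^ k ℕ.≤ Y → ι Z * c ≤ ι k → ∣ Sm (density k) - 1ℚ ∣ ≤ inv Z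
    density-total k Z 1≤Z 1≤k le small = subst (λ z → ∣ z ∣ ≤ inv Z) lhs (≤-trans (∣∣-* {Sm (F x) - ι k} {inv k} (mass k le) (∣∣-pos (0≤inv k))) fin)
      where
      x = 2 ℕ.^ k
      eq : ∀ a k i → (a - k) * i ≡ i * a - k * i
      eq = solve-∀ ℚ-ring
      lhs : (Sm (F x) - ι k) * inv k ≡ Sm (density k) - 1ℚ
      lhs = trans (eq (Sm (F x)) (ι k) (inv k)) (cong₂ _-_ (trans (sym (Sm-* (inv k) (F x))) (Sm-cong (λ b → *-comm (inv k) (F x b)))) (ι*inv {k} 1≤k))
      fin : c * inv k ≤ inv Z
      fin = *-cancelˡ-≤ (ι Z) (0<ι {Z} 1≤Z) (subst₂ _≤_ (*-assoc (ι Z) c (inv k)) (trans (ι*inv {k} 1≤k) (sym (ι*inv {Z} 1≤Z))) (*-monoʳ (inv k) (0≤inv k) small))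

    L≤3n : ∀ n → suc n ℕ.≤ Y → L (suc n) ≤ ι 3 * ι n
    L≤3n zero _ = ≤-reflexive (trans L-1 (sym (*-zeroʳ (ι 3))))
    L≤3n (suc n) le = via (ι 3 * inv (suc n) - (L (suc (suc n)) - L (suc n)) + (ι 3 * ι n - L (suc n)) + ι 3 * (1ℚ - inv (suc n)))
      (0≤+ (0≤+ (0≤y-x (≤-∣∣ʳ {L (suc (suc n)) - L (suc n)} (L-step (suc n) (s≤s z≤n) le))) (0≤y-x (L≤3n n (ℕ.<⇒≤ le)))) (0≤* (0≤ι 3) (0≤y-x (inv≤1 (suc n)))))
      (eq (ι 3) (inv (suc n)) (L (suc (suc n))) (L (suc n)) (ι n))
      where
      eq : ∀ t i l' l n → t * (1ℚ + n) ≡ l' + (t * i - (l' - l) + (t * n - l) + t * (1ℚ - i))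
      eq = solve-∀ ℚ-ring

    -- The bound does not depend on x: primes up to N give at most N · 3 N, proper prime powers at
    -- most 18. Divided by a large k it makes the density at a negligible.
    no-primes : ∀ N (a : Unit) → N ℕ.< Y → (∀ q → Prime q → N ℕ.< q → q ℕ.≤ Y → ¬ q % m ≡ proj₁ a % m) → ∀ x → x ℕ.≤ Y →
      F x a ≤ ι 3 * (ι N * ι N) + ι 18
    no-primes N a N<Y none x x≤Y = ≤-trans (sum-grow (λ n → e n (proj₁ a) * wt n) x≤Y (λ n _ _ → 0≤* (0≤χ (n % m ℕ.≟ proj₁ a % m)) (0≤Λinv n)))
      (≤-trans (prime-powers N (λ n → e n (proj₁ a)) (λ n → 0≤χ (n % m ℕ.≟ proj₁ a % m)) (λ n → χ≤1 (n % m ℕ.≟ proj₁ a % m)) (λ q pq N<q q≤Y → χ-no (q % m ℕ.≟ proj₁ a % m) (none q pq N<q q≤Y)))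
      (≤-trans (≤-reflexive (trans (sum-ext Y (λ q → *-distribˡ-+ (L q) (χ (q ℕ.≤? N)) (inv q * inv q + inv q * inv q))) (sum-+ Y (λ q → L q * χ (q ℕ.≤? N)) (λ q → L q * (inv q * inv q + inv q * inv q)))))
        (+-mono-≤ first (second Y refl))))
      where
      first : sum Y (λ q → L q * χ (q ℕ.≤? N)) ≤ ι 3 * (ι N * ι N)
      first = subst (_≤ ι 3 * (ι N * ι N)) (sym (sum-extend (λ q → L q * χ (q ℕ.≤? N)) (ℕ.<⇒≤ N<Y) (λ k N<k _ → trans (cong (L k *_) (χ-no (k ℕ.≤? N) (ℕ.<⇒≱ N<k))) (*-zeroʳ (L k)))))
        (≤-trans (sum-mono N {λ q → L q * χ (q ℕ.≤? N)} {λ _ → ι 3 * ι N} term) (≤-reflexive (trans (sum-const N (ι 3 * ι N)) (eq (ι N) (ι 3)))))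
        where
        eq : ∀ n t → n * (t * n) ≡ t * (n * n)
        eq = solve-∀ ℚ-ring
        term : ∀ q → 1 ℕ.≤ q → q ℕ.≤ N → L q * χ (q ℕ.≤? N) ≤ ι 3 * ι N
        term (suc q) _ q≤N = ≤-trans (≤-trans (*-monoˡ (L (suc q)) (0≤L (suc q)) (χ≤1 (suc q ℕ.≤? N))) (≤-reflexive (*-identityʳ (L (suc q)))))
          (≤-trans (L≤3n q (ℕ.≤-trans q≤N (ℕ.<⇒≤ N<Y))) (*-monoˡ (ι 3) (0≤ι 3) (ι-mono (ℕ.<⇒≤ q≤N))))
      -- 2/q² ≤ 4/(q (q+1)) brings the terms below Y under `weight-sum`, at most 4 · 3 = 12. The
      -- term at Y, which that sum does not reach, is at most 6.
      second : ∀ Y' → Y' ≡ Y → sum Y' (λ q → L q * (inv q * inv q + inv q * inv q)) ≤ ι 18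
      second zero _ = 0≤ι 18
      second (suc y) refl = ≤-trans (+-mono-≤ (≤-trans (sum-mono y term) (≤-trans (≤-reflexive (sum-*ˡ y (ι 4) (λ q → L q * (inv q * inv (suc q))))) (*-monoˡ (ι 4) (0≤ι 4) (weight-sum y ℕ.≤-refl)))) last)
        (≤-reflexive refl)
        where
        inv≤2inv : ∀ q → 1 ℕ.≤ q → inv q ≤ ι 2 * inv (suc q)
        inv≤2inv q 1≤q = *-cancelˡ-≤ (ι q) (0<ι {q} 1≤q) (*-cancelˡ-≤ (ι (suc q)) (0<ι {suc q} (s≤s z≤n))
          (subst₂ _≤_ (sym (trans (cong (ι (suc q) *_) (ι*inv {q} 1≤q)) (*-identityʳ (ι (suc q))))) (sym (trans (eq (ι (suc q)) (ι q) (ι 2) (inv (suc q))) (trans (cong (_* (ι 2 * ι q)) (ι*inv {suc q} (s≤s z≤n))) (*-identityˡ (ι 2 * ι q)))))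
            (subst (ι (suc q) ≤_) (ι-* 2 q) (ι-mono (subst (suc q ℕ.≤_) (cong (q ℕ.+_) (sym (ℕ.+-identityʳ q))) (ℕ.+-monoˡ-≤ q 1≤q))))))
          where
          eq : ∀ s q t i → s * (q * (t * i)) ≡ s * i * (t * q)
          eq = solve-∀ ℚ-ring
        term : ∀ q → 1 ℕ.≤ q → q ℕ.≤ y → L q * (inv q * inv q + inv q * inv q) ≤ ι 4 * (L q * (inv q * inv (suc q)))
        term q 1≤q _ = via (ι 2 * (L q * (inv q * (ι 2 * inv (suc q) - inv q)))) (0≤* (0≤ι 2) (0≤* (0≤L q) (0≤* (0≤inv q) (0≤y-x (inv≤2inv q 1≤q))))) (eq (L q) (inv q) (inv (suc q)))
          where
          eq : ∀ l i j → ι 4 * (l * (i * j)) ≡ l * (i * i + i * i) + ι 2 * (l * (i * (ι 2 * j - i)))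
          eq = solve-∀ ℚ-ring
        last : L (suc y) * (inv (suc y) * inv (suc y) + inv (suc y) * inv (suc y)) ≤ ι 6
        last = ≤-trans (*-monoʳ (i * i + i * i) (0≤+ (0≤* 0≤i 0≤i) (0≤* 0≤i 0≤i)) (≤-trans (L≤3n y ℕ.≤-refl) (*-monoˡ (ι 3) (0≤ι 3) (ι-mono (ℕ.n≤1+n y)))))
          (≤-trans (≤-reflexive (trans (eq (ι 3) (ι (suc y)) i) (trans (cong (λ z → (ι 3 + ι 3) * (z * i)) (ι*inv {suc y} (s≤s z≤n))) refl)))
            (subst ((ι 3 + ι 3) * (1ℚ * i) ≤_) (refl) (*-monoˡ (ι 3 + ι 3) (0≤+ (0≤ι 3) (0≤ι 3)) (*-monoˡ 1ℚ 0≤1 (inv≤1 (suc y))))))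
          where
          i = inv (suc y)
          0≤i = 0≤inv (suc y)
          eq : ∀ t s i → t * s * (i * i + i * i) ≡ (t + t) * (s * i * i)
          eq = solve-∀ ℚ-ring

    density-small : ∀ k Z B x → 1 ℕ.≤ Z → 1 ℕ.≤ k → x ≤ ι B → ι Z * ι B ≤ ι k → x * inv k ≤ inv Z
    density-small k Z B x 1≤Z 1≤k x≤B small = *-cancelˡ-≤ (ι Z) (0<ι {Z} 1≤Z) (≤-trans (*-monoˡ (ι Z) (0≤ι Z) (*-monoʳ (inv k) (0≤inv k) x≤B))
      (subst₂ _≤_ (*-assoc (ι Z) (ι B) (inv k)) (trans (ι*inv {k} 1≤k) (sym (ι*inv {Z} 1≤Z))) (*-monoʳ (inv k) (0≤inv k) small)))

    module Character (sg : Unit → ℚ) (sg-resp : Resp sg) (sg-∙ : ∀ b c → sg (b ∙ c) ≡ sg b * sg c) (sg-1 : sg 𝟙 ≡ 1ℚ)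
                     (sg-values : ∀ b → sg b ≡ 1ℚ ⊎ sg b ≡ - 1ℚ) (sg-mean : Sm sg ≡ 0ℚ) where
      open Extend sg sg-resp sg-∙ sg-1 sg-values sg-mean

      -- For completely multiplicative ψ the sum `V` factors into a partial sum T of L(1, ψ) and B =
      -- ∑ ψ Λ/n. `V-bound` keeps the product small and T is bounded below, so B cannot be as
      -- negative as -k/2 once k is large.
      bias-bound : ∀ k → 1 ℕ.≤ k → suc (2 ℕ.^ k) ℕ.≤ Y → h * Sm (λ b → sg b * density k b) ≤ h * (- ½) →
        ι k ≤ ι 16 * (ι 19 * (ι 8 * (M * ι (RealCharacterBound.scale m)))) + ι 14
      bias-bound k 1≤k le neg = via G 0≤G (core (ι k) B S T M j (F₁ x))
        where
        x = 2 ℕ.^ k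
        s = RealCharacterBound.scale m
        S = ι s
        -- With y = 256 m s the remainder 2 m F₁/(y+1), multiplied by 128 s, costs at most F₁ ≤ k +
        -- 14.
        y = 16 ℕ.* (16 ℕ.* (m ℕ.* s))
        T = harmonic ψ y
        B = sum x (λ n → wt n * ψ n)
        V≡ : V m 1≤m ψ x y ≡ T * B
        V≡ = trans (sum-ext x (λ d → trans (cong (wt d *_) (trans (sum-ext y (λ j → trans (cong (_* inv j) (ψ-* d j)) (*-assoc (ψ d) (ψ j) (inv j)))) (sum-*ˡ y (ψ d) (λ j → ψ j * inv j)))) (eq (wt d) (ψ d) T))) (sum-*ˡ x T (λ d → wt d * ψ d))
          where
          eq : ∀ w p t → w * (p * t) ≡ t * (w * p)
          eq = solve-∀ ℚ-ring
        Vb : ∣ T * B ∣ ≤ M * ι 19 + (M + M) * inv (suc y) * F₁ x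
        Vb = subst (λ z → ∣ z ∣ ≤ M * ι 19 + (M + M) * inv (suc y) * F₁ x) V≡ (V-bound m 1≤m ψ ψ-test k y le)
        B≡ : B ≡ ι k * Sm (λ b → sg b * density k b)
        B≡ = trans (group x sg sg-resp) (trans (Sm-cong (λ u → trans (sym (*-identityʳ (sg u * F x u))) (trans (cong (sg u * F x u *_) (sym (ι*inv {k} 1≤k))) (eq (sg u) (F x u) (ι k) (inv k))))) (Sm-* (ι k) (λ b → sg b * density k b)))
          where
          eq : ∀ a f k i → a * f * (k * i) ≡ k * (a * (f * i))
          eq = solve-∀ ℚ-ring
        B≤ : B ≤ ι k * (- ½)
        B≤ = subst (_≤ ι k * (- ½)) (sym B≡) (*-monoˡ (ι k) (0≤ι k) (*-cancelˡ-≤ h (<-≤-trans (positive⁻¹ 1ℚ) 1≤h) neg))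
        lower : 1ℚ ≤ ι 32 * (S * T)
        lower = RealCharacterBound.character-lower m 1≤m ψ ψ-test ψ-* ψ-1 ψ-values y (ℕ.*-monoʳ-≤ 16 (ℕ.*-monoˡ-≤ (m ℕ.* s) {4} {16} (s≤s (s≤s (s≤s (s≤s z≤n))))))
        y≡ : ι y ≡ ι 16 * (ι 16 * (M * S))
        y≡ = trans (ι-* 16 (16 ℕ.* (m ℕ.* s))) (cong (ι 16 *_) (trans (ι-* 16 (m ℕ.* s)) (cong (ι 16 *_) (ι-* m s))))
        j = inv (suc y)
        yj : ι 16 * (ι 16 * (M * S)) * j ≤ 1ℚ
        yj = subst₂ _≤_ (cong (_* j) y≡) (ι*inv {suc y} (s≤s z≤n)) (*-monoʳ j (0≤inv (suc y)) (ι-mono (ℕ.n≤1+n y)))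
        -- k/2 ≤ -B ≤ 32 S T (-B) ≤ 32 S (19 M + 2 M j F₁) ≤ 608 S M + (k + 14)/4
        G : ℚ
        G = ι 2 * (ι 2 * (ι k * (- ½) - B))
          + ι 4 * ((ι 32 * (S * T) - 1ℚ) * (- B))
          + ι 4 * (ι 32 * (S * (M * ι 19 + (M + M) * j * F₁ x - - (T * B))))
          + (1ℚ - ι 16 * (ι 16 * (M * S)) * j) * F₁ x
          + (ι k + ι 14 - F₁ x)
        0≤-B : 0ℚ ≤ - B
        0≤-B = ≤-trans (≤-trans (0≤* (0≤ι k) (nonNegative⁻¹ ½)) (≤-reflexive (eq (ι k) ½))) (neg-antimono-≤ B≤)
          where
          eq : ∀ a b → a * b ≡ - (a * (- b))
          eq = solve-∀ ℚ-ring
        -TB≤ : - (T * B) ≤ M * ι 19 + (M + M) * j * F₁ x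
        -TB≤ = ≤-trans (-x≤∣x∣ (T * B)) Vb
        0≤S : 0ℚ ≤ S
        0≤S = 0≤ι s
        0≤G : 0ℚ ≤ G
        0≤G = 0≤+ (0≤+ (0≤+ (0≤+ (0≤* (0≤ι 2) (0≤* (0≤ι 2) (0≤y-x B≤))) (0≤* (0≤ι 4) (0≤* (0≤y-x lower) 0≤-B)))
          (0≤* (0≤ι 4) (0≤* (0≤ι 32) (0≤* 0≤S (0≤y-x -TB≤))))) (0≤* (0≤y-x yj) (0≤F₁ x))) (0≤y-x (F₁-bound k (ℕ.<⇒≤ le)))
        core : ∀ k B S T M j f → ι 16 * (ι 19 * (ι 8 * (M * S))) + ι 14 ≡ k + (ι 2 * (ι 2 * (k * (- ½) - B))
          + ι 4 * ((ι 32 * (S * T) - 1ℚ) * (- B))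
          + ι 4 * (ι 32 * (S * (M * ι 19 + (M + M) * j * f - - (T * B))))
          + (1ℚ - ι 16 * (ι 16 * (M * S)) * j) * f
          + (k + ι 14 - f))
        core = solve-∀ ℚ-ring

  ι-^ : ∀ m n → ι (m ℕ.^ n) ≡ pw (ι m) n
  ι-^ m zero = refl
  ι-^ m (suc n) = trans (ι-* m (m ℕ.^ n)) (cong (ι m *_) (ι-^ m n))

  pw-mono : ∀ {a b} n → 0ℚ ≤ a → a ≤ b → pw a n ≤ pw b n
  pw-mono zero _ _ = ≤-refl
  pw-mono {a} {b} (suc n) 0≤a a≤b = *-mono {a} {b} {pw a n} {pw b n} (nn n) (≤-trans 0≤a a≤b) a≤b (pw-mono n 0≤a a≤b)
    where
    nn : ∀ n → 0ℚ ≤ pw a n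
    nn zero = 0≤1
    nn (suc n) = 0≤* 0≤a (nn n)

  -- k₁ ≪ k₂ ≪ k₃ are three scales, so far apart that Selberg's relation between consecutive ones has error 1/Z.
  module Scales (m : ℕ) (2≤m : 2 ℕ.≤ m) (a : ∃ λ n → Coprime n m) (N Z C B k₁ k₂ k₃ : ℕ)
    (1≤Z : 1 ℕ.≤ Z) (1≤k₁ : 1 ℕ.≤ k₁) (k₁≤k₂ : k₁ ℕ.≤ k₂) (k₂≤k₃ : k₂ ℕ.≤ k₃)
    (ι-C : ι C ≡ ι 3 * (ι N * ι N) + ι 18)
    (ι-B : ι B ≡ ι 16 * (ι 19 * (ι 8 * (ι m * ι (RealCharacterBound.scale m)))) + ι 14)
    (Z-large : pw (ι m) 6 * inv Z ≤ ℤ.+ 1 ℚ./ 1000)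
    (k-mass : ι Z * (ι 14 * (ι m * ι m)) ≤ ι k₁) (k-C : ι Z * ι C ≤ ι k₁) (k-B : suc B ℕ.≤ k₁) (k-N : N ℕ.≤ k₁)
    (error₁₂ : ι Z * error-bound (ι m) k₁ k₂ ≤ ι k₁ * ι k₂) (error₂₃ : ι Z * error-bound (ι m) k₂ k₃ ≤ ι k₂ * ι k₃) where

    open UnitGroup m 2≤m
    open AbelianGroup units using (_∙_) renaming (_-_ to _∙/_; ε to 𝟙)

    Y : ℕ
    Y = suc (2 ℕ.^ k₃)

    k₁≤k₃ : k₁ ℕ.≤ k₃
    k₁≤k₃ = ℕ.≤-trans k₁≤k₂ k₂≤k₃

    level : ∀ {k} → k ℕ.≤ k₃ → 2 ℕ.^ k ℕ.≤ Y
    level h = ℕ.≤-trans (ℕ.^-monoʳ-≤ 2 h) (ℕ.n≤1+n (2 ℕ.^ k₃))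

    strict-level : ∀ {k} → k ℕ.≤ k₃ → suc (2 ℕ.^ k) ℕ.≤ Y
    strict-level h = s≤s (ℕ.^-monoʳ-≤ 2 h)

    open Relation m 2≤m Y (log-data Y)

    ε : ℚ
    ε = inv Z

    N<Y : N ℕ.< Y
    N<Y = s≤s (ℕ.≤-trans k-N (ℕ.≤-trans k₁≤k₃ (ℕ.<⇒≤ (m<2^m k₃))))

    module _ (none : ∀ q → Prime q → N ℕ.< q → q ℕ.≤ Y → ¬ q % m ≡ proj₁ a % m) where

      vanish : ∀ k → k₁ ℕ.≤ k → k ℕ.≤ k₃ → density k a ≤ ε
      vanish k lo hi = density-small k Z C (Classes.F wt (2 ℕ.^ k) a) 1≤Z (ℕ.≤-trans 1≤k₁ lo)
        (subst (Classes.F wt (2 ℕ.^ k) a ≤_) (sym ι-C) (no-primes N a N<Y none (2 ℕ.^ k) (level hi)))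
        (≤-trans k-C (ι-mono lo))

      relation : ∀ k k' → k₁ ℕ.≤ k → k ℕ.≤ k' → k' ℕ.≤ k₃ → ι Z * error-bound (ι m) k k' ≤ ι k * ι k' →
        ∀ b → ∣ h * (density k' b + Sm (λ u → density k u * density k' (b ∙/ u))) - q2 ∣ ≤ ε
      relation k k' lo le hi er = density-relation k k' Z 1≤Z (ℕ.≤-trans 1≤k₁ lo) (ℕ.≤-trans 1≤k₁ (ℕ.≤-trans lo le)) (level (ℕ.≤-trans le hi)) (strict-level hi) er

      total : ∀ k → k₁ ℕ.≤ k → k ℕ.≤ k₃ → ∣ Sm (density k) - 1ℚ ∣ ≤ ε
      total k lo hi = density-total k Z 1≤Z (ℕ.≤-trans 1≤k₁ lo) (level hi) (≤-trans k-mass (ι-mono lo))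

      -- The scale k₁ serves this bound: the relation between k₁ and k₂ contains a nonnegative
      -- convolution, which is dropped.
      f-upper : ∀ b → h * density k₂ b ≤ q2 + ε
      f-upper b = via ((ε - (h * (f b + W) - q2)) + h * W) (0≤+ (0≤y-x (≤-∣∣ʳ {h * (f b + W) - q2} (relation k₁ k₂ ℕ.≤-refl k₁≤k₂ k₂≤k₃ error₁₂ b))) (0≤* (≤-trans 0≤1 1≤h) 0≤W)) (eq h (f b) W ε q2)
        where
        f = density k₂
        W = Sm (λ u → density k₁ u * density k₂ (b ∙/ u))
        0≤W : 0ℚ ≤ W
        0≤W = ≤-trans (≤-reflexive (sym (trans (Sm-cong {λ _ → 0ℚ} {λ _ → 0ℚ * 0ℚ} (λ _ → refl)) (trans (Sm-* 0ℚ (λ _ → 0ℚ)) (*-zeroˡ (Sm (λ _ → 0ℚ)))))))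
          (Summation.S-mono summation (λ u → 0≤* (0≤density k₁ u) (0≤density k₂ (b ∙/ u))))
        eq : ∀ h f w e t → t + e ≡ h * f + ((e - (h * (f + w) - t)) + h * w)
        eq = solve-∀ ℚ-ring

      small : pw h 6 * ε ≤ ℤ.+ 1 ℚ./ 1000
      small = ≤-trans (*-monoʳ ε (0≤inv Z) (pw-mono 6 (≤-trans 0≤1 1≤h) h≤M)) Z-large

      almost-uniform : AlmostUniform
      almost-uniform = record
        { 𝔾 = units ; sm = summation ; f = density k₂ ; g = density k₃ ; a = a ; ε = ε
        ; f-resp = λ {x} {y} → density-resp k₂ {x} {y} ; g-resp = λ {x} {y} → density-resp k₃ {x} {y}
        ; 0≤f = 0≤density k₂ ; 0≤g = 0≤density k₃ ; 0≤ε = 0≤inv Z ; small = small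
        ; f-total = total k₂ k₁≤k₂ k₂≤k₃ ; g-total = total k₃ k₁≤k₃ ℕ.≤-refl ; f-upper = f-upper
        ; relation = relation k₂ k₃ k₁≤k₂ k₂≤k₃ ℕ.≤-refl error₂₃ ; f-a = vanish k₂ k₁≤k₂ k₂≤k₃ ; g-a = vanish k₃ k₁≤k₃ ℕ.≤-refl }

      open Dichotomy almost-uniform
        using (sign; sign-resp; sign-∙; sign-1; sign-values; sign-mean; sign-g)

      -- The sign character would have bias at most -1/2 at scale k₃, so `bias-bound` gives k₃ ≤ B,
      -- while B < k₁ ≤ k₃.
      contradiction : ⊥
      contradiction = toWitnessFalse {a? = 1ℚ ≤? 0ℚ} tt (via (ι B - ι k₃ + (ι k₃ - (1ℚ + ι B))) (0≤+ (0≤y-x upper) (0≤y-x (ι-mono (ℕ.≤-trans k-B k₁≤k₃)))) (eq (ι k₃) (ι B)))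
        where
        eq : ∀ k b → 0ℚ ≡ 1ℚ + (b - k + (k - (1ℚ + b)))
        eq = solve-∀ ℚ-ring
        upper : ι k₃ ≤ ι B
        upper = subst (ι k₃ ≤_) (sym ι-B)
          (Character.bias-bound sign (λ {x} {y} → sign-resp {x} {y}) sign-∙ sign-1 sign-values sign-mean k₃ (ℕ.≤-trans 1≤k₁ k₁≤k₃) ℕ.≤-refl sign-g)

    -- Only primes up to Y enter the contradiction, and their existence is decidable, so the
    -- refutation yields an actual prime.
    search : Dec (∃ λ q → q ℕ.< suc Y × (Prime q × N ℕ.< q × q % m ≡ proj₁ a % m)) → ∃ λ q → Prime q × N ℕ.< q × q % m ≡ proj₁ a % m
    search (yes (q , _ , found)) = q , found
    search (no none) = ⊥-elim (contradiction (λ q pq N<q q≤Y cong-a → none (q , s≤s q≤Y , pq , N<q , cong-a)))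

    prime-in-class : ∃ λ q → Prime q × N ℕ.< q × q % m ≡ proj₁ a % m
    prime-in-class = search (ℕ.anyUpTo? (λ q → prime? q ×-dec ((N ℕ.<? q) ×-dec (q % m ℕ.≟ proj₁ a % m))) (suc Y))

  module Parameters (m : ℕ) (1≤m : 1 ℕ.≤ m) (N : ℕ) where

    M : ℚ
    M = ι m

    -- Z = 1000 m⁶ makes h⁶/Z ≤ 1/1000. `base` is a sum of everything that the smallest scale has to
    -- exceed.
    Z C s bias base : ℕ
    Z = 10 ℕ.* (10 ℕ.* (10 ℕ.* m ℕ.^ 6))
    C = 3 ℕ.* (N ℕ.* N) ℕ.+ 18
    s = RealCharacterBound.scale m
    bias = 16 ℕ.* (19 ℕ.* (8 ℕ.* (m ℕ.* s))) ℕ.+ 14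
    base = suc (Z ℕ.* (40 ℕ.* (m ℕ.* m)) ℕ.+ Z ℕ.* C ℕ.+ bias ℕ.+ N)

    -- 2 Z times the part of the error that does not involve k'; the term 57 m² 2^k forces
    -- consecutive scales to be exponentially far apart. 84 is 6 · 14.
    next : ℕ → ℕ
    next k = Z ℕ.* (2 ℕ.* (57 ℕ.* (m ℕ.* m ℕ.* 2 ℕ.^ k) ℕ.+ (84 ℕ.* (m ℕ.* m) ℕ.+ (14 ℕ.* (m ℕ.* m) ℕ.* (14 ℕ.* (m ℕ.* m)) ℕ.+ (k ℕ.+ k) ℕ.* (14 ℕ.* (m ℕ.* m))))))

    1≤Z : 1 ℕ.≤ Z
    1≤Z = ℕ.*-mono-≤ {1} {10} (s≤s z≤n) (ℕ.*-mono-≤ {1} {10} (s≤s z≤n) (ℕ.*-mono-≤ {1} {10} (s≤s z≤n) (ℕ.m^n>0 m {{ℕ.>-nonZero 1≤m}} 6)))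

    grow : ∀ k → k ℕ.≤ next k
    grow k = ℕ.≤-trans (ℕ.<⇒≤ (m<2^m k)) (ℕ.≤-trans (ℕ.m≤n*m (2 ℕ.^ k) (m ℕ.* m) {{ℕ.>-nonZero (ℕ.*-mono-≤ 1≤m 1≤m)}}) (ℕ.≤-trans (ℕ.m≤n*m (m ℕ.* m ℕ.* 2 ℕ.^ k) 57)
      (ℕ.≤-trans (ℕ.m≤m+n (57 ℕ.* (m ℕ.* m ℕ.* 2 ℕ.^ k)) rest) (ℕ.≤-trans (ℕ.m≤n*m (57 ℕ.* (m ℕ.* m ℕ.* 2 ℕ.^ k) ℕ.+ rest) 2) (ℕ.m≤n*m (2 ℕ.* (57 ℕ.* (m ℕ.* m ℕ.* 2 ℕ.^ k) ℕ.+ rest)) Z {{ℕ.>-nonZero 1≤Z}})))))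
      where rest = 84 ℕ.* (m ℕ.* m) ℕ.+ (14 ℕ.* (m ℕ.* m) ℕ.* (14 ℕ.* (m ℕ.* m)) ℕ.+ (k ℕ.+ k) ℕ.* (14 ℕ.* (m ℕ.* m)))

    base-40 : ι Z * (ι 40 * (M * M)) ≤ ι base
    base-40 = subst (_≤ ι base) (trans (ι-* Z (40 ℕ.* (m ℕ.* m))) (cong (ι Z *_) (trans (ι-* 40 (m ℕ.* m)) (cong (ι 40 *_) (ι-* m m)))))
      (ι-mono le)
      where
      T₁ = Z ℕ.* (40 ℕ.* (m ℕ.* m))
      le : T₁ ℕ.≤ base
      le = ℕ.m≤n⇒m≤1+n (ℕ.≤-trans (ℕ.m≤m+n T₁ (Z ℕ.* C)) (ℕ.≤-trans (ℕ.m≤m+n (T₁ ℕ.+ Z ℕ.* C) bias) (ℕ.m≤m+n (T₁ ℕ.+ Z ℕ.* C ℕ.+ bias) N)))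

    base-C : ι Z * ι C ≤ ι base
    base-C = subst (_≤ ι base) (ι-* Z C) (ι-mono le)
      where
      T₁ = Z ℕ.* (40 ℕ.* (m ℕ.* m))
      le : Z ℕ.* C ℕ.≤ base
      le = ℕ.m≤n⇒m≤1+n (ℕ.≤-trans (ℕ.m≤n+m (Z ℕ.* C) T₁) (ℕ.≤-trans (ℕ.m≤m+n (T₁ ℕ.+ Z ℕ.* C) bias) (ℕ.m≤m+n (T₁ ℕ.+ Z ℕ.* C ℕ.+ bias) N)))

    base-bias : suc bias ℕ.≤ base
    base-bias = s≤s (ℕ.≤-trans (ℕ.m≤n+m bias (Z ℕ.* (40 ℕ.* (m ℕ.* m)) ℕ.+ Z ℕ.* C)) (ℕ.m≤m+n (Z ℕ.* (40 ℕ.* (m ℕ.* m)) ℕ.+ Z ℕ.* C ℕ.+ bias) N))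

    base-N : N ℕ.≤ base
    base-N = ℕ.m≤n⇒m≤1+n (ℕ.m≤n+m N (Z ℕ.* (40 ℕ.* (m ℕ.* m)) ℕ.+ Z ℕ.* C ℕ.+ bias))

    1≤base : 1 ℕ.≤ base
    1≤base = s≤s z≤n

    Br : ℕ → ℚ
    Br k = ι 57 * (M * M * ι (2 ℕ.^ k)) + (ι 84 * (M * M) + (ι 14 * (M * M) * (ι 14 * (M * M)) + (ι k + ι k) * (ι 14 * (M * M))))

    ι-next : ∀ k → ι (next k) ≡ ι Z * (ι 2 * Br k)
    ι-next k = trans (ι-* Z (2 ℕ.* (A₁ ℕ.+ (A₂ ℕ.+ (A₃ ℕ.+ A₄))))) (cong (ι Z *_) (trans (ι-* 2 (A₁ ℕ.+ (A₂ ℕ.+ (A₃ ℕ.+ A₄)))) (cong (ι 2 *_) t₀)))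
      where
      A₁ = 57 ℕ.* (m ℕ.* m ℕ.* 2 ℕ.^ k)
      A₂ = 84 ℕ.* (m ℕ.* m)
      A₃ = 14 ℕ.* (m ℕ.* m) ℕ.* (14 ℕ.* (m ℕ.* m))
      A₄ = (k ℕ.+ k) ℕ.* (14 ℕ.* (m ℕ.* m))
      c14 : ι (14 ℕ.* (m ℕ.* m)) ≡ ι 14 * (M * M)
      c14 = trans (ι-* 14 (m ℕ.* m)) (cong (ι 14 *_) (ι-* m m))
      t₁ : ι A₁ ≡ ι 57 * (M * M * ι (2 ℕ.^ k))
      t₁ = trans (ι-* 57 (m ℕ.* m ℕ.* 2 ℕ.^ k)) (cong (ι 57 *_) (trans (ι-* (m ℕ.* m) (2 ℕ.^ k)) (cong (_* ι (2 ℕ.^ k)) (ι-* m m))))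
      t₂ : ι A₂ ≡ ι 84 * (M * M)
      t₂ = trans (ι-* 84 (m ℕ.* m)) (cong (ι 84 *_) (ι-* m m))
      t₃ : ι A₃ ≡ ι 14 * (M * M) * (ι 14 * (M * M))
      t₃ = trans (ι-* (14 ℕ.* (m ℕ.* m)) (14 ℕ.* (m ℕ.* m))) (cong₂ _*_ c14 c14)
      t₄ : ι A₄ ≡ (ι k + ι k) * (ι 14 * (M * M))
      t₄ = trans (ι-* (k ℕ.+ k) (14 ℕ.* (m ℕ.* m))) (cong₂ _*_ (ι-+ k k) c14)
      t₀ : ι (A₁ ℕ.+ (A₂ ℕ.+ (A₃ ℕ.+ A₄))) ≡ Br k
      t₀ = trans (ι-+ A₁ (A₂ ℕ.+ (A₃ ℕ.+ A₄))) (cong₂ _+_ t₁ (trans (ι-+ A₂ (A₃ ℕ.+ A₄)) (cong₂ _+_ t₂ (trans (ι-+ A₃ A₄) (cong₂ _+_ t₃ t₄)))))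

    -- The coefficient of k' in the error is 20 m², and Z · 40 m² ≤ k makes that part at most k
    -- k'/2. The rest is at most k'/2 by the choice of `next`.
    error-small : ∀ k → ι Z * (ι 40 * (M * M)) ≤ ι k → 1 ℕ.≤ k → ι Z * error-bound M k (next k) ≤ ι k * ι (next k)
    error-small k big 1≤k = *-cancelˡ-≤ (ι 2) (positive⁻¹ (ι 2)) (via ((ι k - ι Z * (ι 40 * (M * M))) * k' + (ι k - 1ℚ) * k' + (k' - ι Z * (ι 2 * Br k)))
        (0≤+ (0≤+ (0≤* (0≤y-x big) (0≤ι (next k))) (0≤* (0≤y-x (1≤ι {k} 1≤k)) (0≤ι (next k)))) (0≤y-x (≤-reflexive (sym (ι-next k)))))
        (eq (ι Z) (ι k) k' M (ι (2 ℕ.^ k))))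
      where
      k' = ι (next k)
      eq : ∀ z k k' M x → ι 2 * (k * k') ≡ ι 2 * (z * (M * (M * ι 57 * x + M * ι 6 * (k' + ι 14)) + (ι 14 * (M * M) * (k' + ι 14 * (M * M)) + (k + k) * (ι 14 * (M * M)))))
        + ((k - z * (ι 40 * (M * M))) * k' + (k - 1ℚ) * k' + (k' - z * (ι 2 * (ι 57 * (M * M * x) + (ι 84 * (M * M) + (ι 14 * (M * M) * (ι 14 * (M * M)) + (k + k) * (ι 14 * (M * M))))))))
      eq = solve-∀ ℚ-ring

    base-mass : ι Z * (ι 14 * (M * M)) ≤ ι base
    base-mass = ≤-trans (via (ι Z * (ι 26 * (M * M))) (0≤* (0≤ι Z) (0≤* (0≤ι 26) (0≤* (0≤ι m) (0≤ι m)))) (eq (ι Z) (M * M))) base-40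
      where
      eq : ∀ z q → z * (ι 40 * q) ≡ z * (ι 14 * q) + z * (ι 26 * q)
      eq = solve-∀ ℚ-ring

    Z-large : pw M 6 * inv Z ≤ ℤ.+ 1 ℚ./ 1000
    Z-large = ≤-reflexive (trans (eq (pw M 6) (inv Z)) (trans (cong (λ z → (ℤ.+ 1 ℚ./ 1000) * (z * inv Z)) Z≡) (trans (cong ((ℤ.+ 1 ℚ./ 1000) *_) (ι*inv {Z} 1≤Z)) (*-identityʳ (ℤ.+ 1 ℚ./ 1000)))))
      where
      eq : ∀ p e → p * e ≡ (ℤ.+ 1 ℚ./ 1000) * (ι 10 * (ι 10 * (ι 10 * p)) * e)
      eq = solve-∀ ℚ-ring
      Z≡ : ι 10 * (ι 10 * (ι 10 * pw M 6)) ≡ ι Z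
      Z≡ = sym (trans (ι-* 10 (10 ℕ.* (10 ℕ.* m ℕ.^ 6))) (cong (ι 10 *_) (trans (ι-* 10 (10 ℕ.* m ℕ.^ 6)) (cong (ι 10 *_) (trans (ι-* 10 (m ℕ.^ 6)) (cong (ι 10 *_) (ι-^ m 6)))))))

    ι-C : ι C ≡ ι 3 * (ι N * ι N) + ι 18
    ι-C = trans (ι-+ (3 ℕ.* (N ℕ.* N)) 18) (cong (_+ ι 18) (trans (ι-* 3 (N ℕ.* N)) (cong (ι 3 *_) (ι-* N N))))

    ι-bias : ι bias ≡ ι 16 * (ι 19 * (ι 8 * (M * ι s))) + ι 14
    ι-bias = trans (ι-+ (16 ℕ.* (19 ℕ.* (8 ℕ.* (m ℕ.* s)))) 14) (cong (_+ ι 14) (trans (ι-* 16 (19 ℕ.* (8 ℕ.* (m ℕ.* s)))) (cong (ι 16 *_) (trans (ι-* 19 (8 ℕ.* (m ℕ.* s))) (cong (ι 19 *_) (trans (ι-* 8 (m ℕ.* s)) (cong (ι 8 *_) (ι-* m s))))))))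

  dirichlet : ∀ m a N .{{_ : ℕ.NonZero m}} → 2 ℕ.≤ m → Coprime a m → ∃ λ q → Prime q × N ℕ.< q × q % m ≡ a % m
  dirichlet m a N 2≤m c = Scales.prime-in-class m 2≤m (a , c) N Z C bias base (next base) (next (next base))
      1≤Z 1≤base (grow base) (grow (next base)) ι-C ι-bias Z-large base-mass base-C base-bias base-N
      (error-small base base-40 1≤base) (error-small (next base) (≤-trans base-40 (ι-mono (grow base))) (ℕ.≤-trans 1≤base (grow base)))
    where open Parameters m (ℕ.<⇒≤ 2≤m) N

-- Integer power series and the correctness of long division

module PowerSeries where
  open import Defs
  open import Data.Integer as ℤ using (ℤ; _+_; _*_; _-_; -_)
  open import Data.Integer.Properties as ℤ using (+-identityˡ; +-identityʳ; *-identityˡ; *-identityʳ; *-zeroˡ; *-zeroʳ; +-comm; *-comm; +-assoc; *-assoc; *-distribʳ-+)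
  open import Data.Integer.Tactic.RingSolver using (solve-∀)
  open import Data.List using (List; []; _∷_; _++_; [_]; reverse; replicate; length)
  import Data.List.Properties as L
  open import Level using (0ℓ)
  open import Algebra.Bundles using (CommutativeMonoid)

  Series : Set
  Series = ℕ → ℤ

  infix 4 _≈_
  _≈_ : Series → Series → Set
  f ≈ g = ∀ n → f n ≡ g n

  0ℤ 1ℤ : ℤ
  0ℤ = ℤ.+ 0
  1ℤ = ℤ.+ 1

  -- The Cauchy product by recursion on the head of f, the same recursion as in the product of
  -- coefficient lists.
  conv : Series → Series → Series
  conv f g zero = f 0 * g 0
  conv f g (suc n) = f 0 * g (suc n) + conv (f ∘ suc) g n

  conv-cong : ∀ {f f' g g'} → f ≈ f' → g ≈ g' → conv f g ≈ conv f' g'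
  conv-cong h k zero = cong₂ _*_ (h 0) (k 0)
  conv-cong h k (suc n) = cong₂ _+_ (cong₂ _*_ (h 0) (k (suc n))) (conv-cong (h ∘ suc) k n)

  conv-+ˡ : ∀ f f' g n → conv (λ k → f k + f' k) g n ≡ conv f g n + conv f' g n
  conv-+ˡ f f' g zero = *-distribʳ-+ (g 0) (f 0) (f' 0)
  conv-+ˡ f f' g (suc n) = trans (cong ((f 0 + f' 0) * g (suc n) +_) (conv-+ˡ (f ∘ suc) (f' ∘ suc) g n))
    (eq (f 0) (f' 0) (g (suc n)) (conv (f ∘ suc) g n) (conv (f' ∘ suc) g n))
    where
    eq : ∀ a b c x y → (a + b) * c + (x + y) ≡ (a * c + x) + (b * c + y)
    eq = solve-∀

  conv-*ˡ : ∀ c f g n → conv (λ k → c * f k) g n ≡ c * conv f g n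
  conv-*ˡ c f g zero = *-assoc c (f 0) (g 0)
  conv-*ˡ c f g (suc n) = trans (cong (c * f 0 * g (suc n) +_) (conv-*ˡ c (f ∘ suc) g n)) (eq c (f 0) (g (suc n)) (conv (f ∘ suc) g n))
    where
    eq : ∀ c a b x → c * a * b + c * x ≡ c * (a * b + x)
    eq = solve-∀

  conv-zeroˡ : ∀ {f} g → (∀ n → f n ≡ 0ℤ) → ∀ n → conv f g n ≡ 0ℤ
  conv-zeroˡ g h zero = trans (cong (_* g 0) (h 0)) (*-zeroˡ (g 0))
  conv-zeroˡ {f} g h (suc n) = cong₂ _+_ (trans (cong (_* g (suc n)) (h 0)) (*-zeroˡ (g (suc n)))) (conv-zeroˡ g (h ∘ suc) n)

  conv-suc : ∀ f g n → conv f g (suc n) ≡ f (suc n) * g 0 + conv f (g ∘ suc) n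
  conv-suc f g zero = +-comm (f 0 * g 1) (f 1 * g 0)
  conv-suc f g (suc n) = trans (cong (f 0 * g (suc (suc n)) +_) (conv-suc (f ∘ suc) g n))
    (eq (f 0 * g (suc (suc n))) (f (suc (suc n)) * g 0) (conv (f ∘ suc) (g ∘ suc) n))
    where
    eq : ∀ a b c → a + (b + c) ≡ b + (a + c)
    eq = solve-∀

  conv-comm : ∀ f g → conv f g ≈ conv g f
  conv-comm f g zero = *-comm (f 0) (g 0)
  conv-comm f g (suc n) = trans (cong₂ _+_ (*-comm (f 0) (g (suc n))) (conv-comm (f ∘ suc) g n)) (sym (conv-suc g f n))

  conv-assoc : ∀ f g h → conv (conv f g) h ≈ conv f (conv g h)
  conv-assoc f g h zero = *-assoc (f 0) (g 0) (h 0)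
  conv-assoc f g h (suc n) = trans (cong (f 0 * g 0 * h (suc n) +_) (trans (conv-+ˡ (λ k → f 0 * g (suc k)) (conv (f ∘ suc) g) h n)
      (cong₂ _+_ (conv-*ˡ (f 0) (g ∘ suc) h n) (conv-assoc (f ∘ suc) g h n))))
    (eq (f 0) (g 0) (h (suc n)) (conv (g ∘ suc) h n) (conv (f ∘ suc) (conv g h) n))
    where
    eq : ∀ a b c x y → a * b * c + (a * x + y) ≡ a * (b * c + x) + y
    eq = solve-∀

  mono : ℕ → Series
  mono zero zero = 1ℤ
  mono zero (suc n) = 0ℤ
  mono (suc s) zero = 0ℤ
  mono (suc s) (suc n) = mono s n

  mono-refl : ∀ s → mono s s ≡ 1ℤ
  mono-refl zero = refl
  mono-refl (suc s) = mono-refl s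

  mono-≢ : ∀ s n → s ≢ n → mono s n ≡ 0ℤ
  mono-≢ zero zero h = ⊥-elim (h refl)
  mono-≢ zero (suc n) h = refl
  mono-≢ (suc s) zero h = refl
  mono-≢ (suc s) (suc n) h = mono-≢ s n (h ∘ cong suc)

  shift : ℕ → Series → Series
  shift zero g n = g n
  shift (suc s) g zero = 0ℤ
  shift (suc s) g (suc n) = shift s g n

  shift-≤ : ∀ s g n → s ℕ.≤ n → shift s g n ≡ g (n ∸ s)
  shift-≤ zero g n _ = refl
  shift-≤ (suc s) g (suc n) (s≤s h) = shift-≤ s g n h

  shift-> : ∀ s g n → n ℕ.< s → shift s g n ≡ 0ℤ
  shift-> (suc s) g zero _ = refl
  shift-> (suc s) g (suc n) (s≤s h) = shift-> s g n h

  shift-mono : ∀ k s → shift k (mono s) ≈ mono (k ℕ.+ s)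
  shift-mono zero s n = refl
  shift-mono (suc k) s zero = refl
  shift-mono (suc k) s (suc n) = shift-mono k s n

  conv-mono : ∀ s g → conv (mono s) g ≈ shift s g
  conv-mono zero g zero = *-identityˡ (g 0)
  conv-mono zero g (suc n) = trans (cong₂ _+_ (*-identityˡ (g (suc n))) (conv-zeroˡ g (λ _ → refl) n)) (+-identityʳ (g (suc n)))
  conv-mono (suc s) g zero = *-zeroˡ (g 0)
  conv-mono (suc s) g (suc n) = trans (cong₂ _+_ (*-zeroˡ (g (suc n))) (conv-mono s g n)) (+-identityˡ (shift s g n))

  series : CommutativeMonoid 0ℓ 0ℓ
  series = record
    { Carrier = Series ; _≈_ = _≈_ ; _∙_ = conv ; ε = mono 0
    ; isCommutativeMonoid = record
      { isMonoid = record
        { isSemigroup = record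
          { isMagma = record { isEquivalence = record { refl = λ _ → refl ; sym = λ h n → sym (h n) ; trans = λ h k n → trans (h n) (k n) } ; ∙-cong = conv-cong }
          ; assoc = conv-assoc }
        ; identity = (λ f n → conv-mono 0 f n) , (λ f n → trans (conv-comm f (mono 0) n) (conv-mono 0 f n)) }
      ; comm = conv-comm } }

  -- The binomial x^k - 1.
  X : ℕ → Series
  X k n = mono k n - mono 0 n

  conv-X : ∀ k g n → conv (X k) g n ≡ shift k g n - g n
  conv-X k g n = trans (conv-+ˡ (mono k) (λ n → - mono 0 n) g n) (cong₂ _+_ (conv-mono k g n)
    (trans (conv-cong {λ n → - mono 0 n} {λ n → - 1ℤ * mono 0 n} (λ n → sym (ℤ.-1*i≡-i (mono 0 n))) (λ _ → refl) n) (trans (conv-*ˡ (- 1ℤ) (mono 0) g n) (trans (ℤ.-1*i≡-i _) (cong -_ (conv-mono 0 g n))))))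

  +-cancelʳ : ∀ c x y → x + c ≡ y + c → x ≡ y
  +-cancelʳ c x y h = trans (eq x c) (trans (cong (_- c) h) (sym (eq y c)))
    where
    eq : ∀ x c → x ≡ x + c - c
    eq = solve-∀

  -- A constant coefficient -1 is invertible, so the coefficients are determined one after another.
  -- Denominators x^k - 1 can thus be removed without a theory of fractions.
  cancel : ∀ u f g → u 0 ≡ - 1ℤ → conv u f ≈ conv u g → f ≈ g
  cancel u f g e h n = <-rec (λ n → f n ≡ g n) step n
    where
    open import Data.Nat.Induction using (<-rec)
    tail-cong : ∀ (v : Series) n → (∀ {k} → k ℕ.≤ n → f k ≡ g k) → conv v f n ≡ conv v g n
    tail-cong v zero ih = cong (v 0 *_) (ih z≤n)
    tail-cong v (suc n) ih = cong₂ _+_ (cong (v 0 *_) (ih ℕ.≤-refl)) (tail-cong (v ∘ suc) n (λ h → ih (ℕ.m≤n⇒m≤1+n h)))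
    neg-inj : ∀ {a b} → u 0 * a ≡ u 0 * b → a ≡ b
    neg-inj {a} {b} q = ℤ.neg-injective (trans (sym (ℤ.-1*i≡-i a)) (trans (cong (_* a) (sym e)) (trans q (trans (cong (_* b) e) (ℤ.-1*i≡-i b)))))
    step : ∀ n → (∀ {k} → k ℕ.< n → f k ≡ g k) → f n ≡ g n
    step zero ih = neg-inj (h 0)
    step (suc n) ih = neg-inj (+-cancelʳ (conv (u ∘ suc) f n) (u 0 * f (suc n)) (u 0 * g (suc n))
      (trans (h (suc n)) (cong (u 0 * g (suc n) +_) (sym (tail-cong (u ∘ suc) n (λ k≤n → ih (s≤s k≤n)))))))

  coeff-+ : ∀ p q → coeff (p +ₚ q) ≈ (λ n → coeff p n + coeff q n)
  coeff-+ [] q n = sym (+-identityˡ (coeff q n))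
  coeff-+ (a ∷ p) [] n = sym (+-identityʳ (coeff (a ∷ p) n))
  coeff-+ (a ∷ p) (b ∷ q) zero = refl
  coeff-+ (a ∷ p) (b ∷ q) (suc n) = coeff-+ p q n

  coeff-scale : ∀ c p → coeff (scale c p) ≈ (λ n → c * coeff p n)
  coeff-scale c [] n = sym (*-zeroʳ c)
  coeff-scale c (a ∷ p) zero = refl
  coeff-scale c (a ∷ p) (suc n) = coeff-scale c p n

  coeff-* : ∀ p q → coeff (p *ₚ q) ≈ conv (coeff p) (coeff q)
  coeff-* [] q n = sym (conv-zeroˡ (coeff q) (λ _ → refl) n)
  coeff-* (a ∷ p) q zero = trans (coeff-+ (scale a q) (0ℤ ∷ (p *ₚ q)) 0) (trans (+-identityʳ _) (coeff-scale a q 0))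
  coeff-* (a ∷ p) q (suc n) = trans (coeff-+ (scale a q) (0ℤ ∷ (p *ₚ q)) (suc n)) (cong₂ _+_ (coeff-scale a q (suc n)) (coeff-* p q n))

  coeff-++ˡ : ∀ xs ys n → n ℕ.< length xs → coeff (xs ++ ys) n ≡ coeff xs n
  coeff-++ˡ (x ∷ xs) ys zero _ = refl
  coeff-++ˡ (x ∷ xs) ys (suc n) (s≤s h) = coeff-++ˡ xs ys n h

  coeff-++ʳ : ∀ xs ys n → coeff (xs ++ ys) (length xs ℕ.+ n) ≡ coeff ys n
  coeff-++ʳ [] ys n = refl
  coeff-++ʳ (x ∷ xs) ys n = coeff-++ʳ xs ys n

  coeff-beyond : ∀ xs n → length xs ℕ.≤ n → coeff xs n ≡ 0ℤ
  coeff-beyond [] n _ = refl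
  coeff-beyond (x ∷ xs) (suc n) (s≤s h) = coeff-beyond xs n h

  coeff-xpow : ∀ n → coeff (xpow-minus-one (suc n)) ≈ X (suc n)
  coeff-xpow n zero = refl
  coeff-xpow n (suc k) = trans (go n k) (sym (+-identityʳ (mono n k)))
    where
    go : ∀ n k → coeff (replicate n 0ℤ ++ [ 1ℤ ]) k ≡ mono n k
    go zero zero = refl
    go zero (suc k) = refl
    go (suc n) zero = refl
    go (suc n) (suc k) = go n k

  coeff-reverse : ∀ xs n k → length xs ≡ suc (n ℕ.+ k) → coeff (reverse xs) k ≡ coeff xs n
  coeff-reverse (x ∷ xs) zero k e = trans (cong (λ z → coeff z k) (L.unfold-reverse x xs))
    (trans (cong (coeff (reverse xs ++ [ x ])) (trans (sym (trans (L.length-reverse xs) (ℕ.suc-injective e))) (sym (ℕ.+-identityʳ _)))) (coeff-++ʳ (reverse xs) [ x ] 0))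
  coeff-reverse (x ∷ xs) (suc n) k e = trans (cong (λ z → coeff z k) (L.unfold-reverse x xs))
    (trans (coeff-++ˡ (reverse xs) [ x ] k (subst (k ℕ.<_) (sym (trans (L.length-reverse xs) (ℕ.suc-injective e))) (s≤s (ℕ.m≤n+m k n)))) (coeff-reverse xs n k (ℕ.suc-injective e)))

  Supported : ℕ → Series → Set
  Supported a f = ∀ n → a ℕ.< n → f n ≡ 0ℤ

  rev : ℕ → Series → Series
  rev zero f zero = f 0
  rev zero f (suc n) = 0ℤ
  rev (suc a) f zero = f (suc a)
  rev (suc a) f (suc n) = rev a f n

  rev-≤ : ∀ a f n k → n ℕ.+ k ≡ a → rev a f k ≡ f n
  rev-≤ zero f zero zero e = refl
  rev-≤ (suc a) f n zero e = cong f (trans (sym e) (ℕ.+-identityʳ n))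
  rev-≤ (suc a) f n (suc k) e = rev-≤ a f n k (ℕ.suc-injective (trans (sym (ℕ.+-suc n k)) e))

  rev-> : ∀ a f k → a ℕ.< k → rev a f k ≡ 0ℤ
  rev-> zero f (suc k) _ = refl
  rev-> (suc a) f (suc k) (s≤s h) = rev-> a f k h

  rev-suc : ∀ a f n → rev (suc a) f n ≡ rev a (f ∘ suc) n + f 0 * mono (suc a) n
  rev-suc zero f zero = sym (trans (cong (f 1 +_) (*-zeroʳ (f 0))) (+-identityʳ (f 1)))
  rev-suc zero f (suc zero) = sym (trans (+-identityˡ _) (*-identityʳ (f 0)))
  rev-suc zero f (suc (suc n)) = sym (trans (+-identityˡ _) (*-zeroʳ (f 0)))
  rev-suc (suc a) f zero = sym (trans (cong (f (suc (suc a)) +_) (*-zeroʳ (f 0))) (+-identityʳ _))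
  rev-suc (suc a) f (suc n) = rev-suc a f n

  conv-beyond : ∀ a b f g → Supported a f → Supported b g → ∀ n → a ℕ.+ b ℕ.< n → conv f g n ≡ 0ℤ
  conv-beyond zero b f g hf hg (suc n) h = cong₂ _+_ (trans (cong (f 0 *_) (hg (suc n) h)) (*-zeroʳ (f 0))) (conv-zeroˡ g (λ k → hf (suc k) (s≤s z≤n)) n)
  conv-beyond (suc a) b f g hf hg (suc n) (s≤s h) = cong₂ _+_ (trans (cong (f 0 *_) (hg (suc n) (s≤s (ℕ.≤-trans (ℕ.m≤n+m b (suc a)) h)))) (*-zeroʳ (f 0)))
    (conv-beyond a b (f ∘ suc) g (λ k p → hf (suc k) (s≤s p)) hg n h)

  -- Reversal of coefficients is multiplicative for prescribed degrees; it connects the division,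
  -- which works from the top, with ordinary multiplication.
  conv-reverse : ∀ a b f g → Supported a f → Supported b g → ∀ n k → n ℕ.+ k ≡ a ℕ.+ b → conv f g n ≡ conv (rev a f) (rev b g) k
  conv-reverse zero b f g hf hg n k e = trans (constant f n (λ j → hf (suc j) (s≤s z≤n))) (sym (trans (constant (rev 0 f) k (λ _ → refl)) (cong (f 0 *_) flip)))
    where
    constant : ∀ f {g} n → (∀ j → f (suc j) ≡ 0ℤ) → conv f g n ≡ f 0 * g n
    constant f zero h = refl
    constant f {g} (suc n) h = trans (cong (f 0 * g (suc n) +_) (conv-zeroˡ g h n)) (+-identityʳ _)
    flip : rev b g k ≡ g n
    flip = rev-≤ b g n k e
  conv-reverse (suc a) b f g hf hg n k e = trans (left n e) (sym (trans (conv-cong {rev (suc a) f} {λ n → rev a (f ∘ suc) n + f 0 * mono (suc a) n} (rev-suc a f) (λ _ → refl) k)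
      (trans (conv-+ˡ (rev a (f ∘ suc)) (λ n → f 0 * mono (suc a) n) (rev b g) k) (cong (conv (rev a (f ∘ suc)) (rev b g) k +_)
        (trans (conv-*ˡ (f 0) (mono (suc a)) (rev b g) k) (cong (f 0 *_) (conv-mono (suc a) (rev b g) k)))))))
    where
    hf' : Supported a (f ∘ suc)
    hf' j p = hf (suc j) (s≤s p)
    flip : shift (suc a) (rev b g) k ≡ g n
    flip with suc a ℕ.≤? k
    ... | yes h = trans (shift-≤ (suc a) (rev b g) k h) (rev-≤ b g n (k ∸ suc a) (ℕ.+-cancelʳ-≡ (suc a) _ b (trans (ℕ.+-assoc n (k ∸ suc a) (suc a)) (trans (cong (n ℕ.+_) (ℕ.m∸n+n≡m h)) (trans e (ℕ.+-comm (suc a) b))))))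
    ... | no h = trans (shift-> (suc a) (rev b g) k (ℕ.≰⇒> h)) (sym (hg n (ℕ.≮⇒≥ λ { (s≤s n≤b) → h (ℕ.+-cancelˡ-≤ b (suc a) k (ℕ.≤-trans (ℕ.≤-reflexive (trans (ℕ.+-comm b (suc a)) (sym e))) (ℕ.+-monoˡ-≤ k n≤b))) })))
    left : ∀ n → n ℕ.+ k ≡ suc a ℕ.+ b → conv f g n ≡ conv (rev a (f ∘ suc)) (rev b g) k + f 0 * shift (suc a) (rev b g) k
    left zero e' = trans (cong (f 0 *_) (trans (cong g (sym n≡0)) (sym flip))) (sym (trans (cong (_+ f 0 * shift (suc a) (rev b g) k)
        (conv-beyond a b (rev a (f ∘ suc)) (rev b g) (rev-> a (f ∘ suc)) (rev-> b g) k (subst (a ℕ.+ b ℕ.<_) (sym e') ℕ.≤-refl))) (+-identityˡ _)))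
      where
      n≡0 : n ≡ 0
      n≡0 = ℕ.+-cancelʳ-≡ k n 0 (trans e (sym e'))
    left (suc m) e' = trans (cong₂ _+_ (cong (f 0 *_) (trans (cong g (sym n≡)) (sym flip))) (conv-reverse a b (f ∘ suc) g hf' hg m k (ℕ.suc-injective e')))
        (+-comm (f 0 * shift (suc a) (rev b g) k) _)
      where
      n≡ : n ≡ suc m
      n≡ = ℕ.+-cancelʳ-≡ k n (suc m) (trans e (sym e'))

  cons : ℤ → Series → Series
  cons c f zero = c
  cons c f (suc n) = f n

  length-subS : ∀ c gs fs → length (subS c gs fs) ≡ length fs
  length-subS c [] fs = refl
  length-subS c (g ∷ gs) [] = refl
  length-subS c (g ∷ gs) (f ∷ fs) = cong suc (length-subS c gs fs)

  coeff-subS : ∀ c gs fs n → n ℕ.< length fs → coeff (subS c gs fs) n ≡ coeff fs n - c * coeff gs n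
  coeff-subS c [] fs n h = sym (trans (cong (λ z → coeff fs n - z) (*-zeroʳ c)) (+-identityʳ (coeff fs n)))
  coeff-subS c (g ∷ gs) (f ∷ fs) zero h = refl
  coeff-subS c (g ∷ gs) (f ∷ fs) (suc n) (s≤s h) = coeff-subS c gs fs n h

  -- The leading coefficient of the dividend is that of the quotient η. After the subtraction the
  -- same product relation holds for the shifted η.
  divH-correct : ∀ k fs gs η → k ℕ.≤ length fs → (∀ n → n ℕ.< length fs → coeff fs n ≡ conv (cons 1ℤ (coeff gs)) η n) →
    length (divH k fs gs) ≡ k × (∀ n → n ℕ.< k → coeff (divH k fs gs) n ≡ η n)
  divH-correct zero fs gs η _ _ = refl , λ _ ()
  divH-correct (suc k) (c ∷ fs) gs η (s≤s k≤) h with divH-correct k (subS c gs fs) gs (η ∘ suc) (subst (k ℕ.≤_) (sym (length-subS c gs fs)) k≤) next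
    where
    c≡ : c ≡ η 0
    c≡ = trans (h 0 (s≤s z≤n)) (*-identityˡ (η 0))
    eq : ∀ a x g → 1ℤ * a + (g * x) - x * g ≡ 1ℤ * a
    eq = solve-∀
    eq' : ∀ a x g s → 1ℤ * a + (g * x + s) - x * g ≡ 1ℤ * a + s
    eq' = solve-∀
    body : ∀ n → conv (cons 1ℤ (coeff gs)) η (suc n) - η 0 * coeff gs n ≡ conv (cons 1ℤ (coeff gs)) (η ∘ suc) n
    body zero = eq (η 1) (η 0) (coeff gs 0)
    body (suc n) = trans (cong (λ z → 1ℤ * η (suc (suc n)) + z - η 0 * coeff gs (suc n)) (conv-suc (coeff gs) η n)) (eq' (η (suc (suc n))) (η 0) (coeff gs (suc n)) (conv (coeff gs) (η ∘ suc) n))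
    next : ∀ n → n ℕ.< length (subS c gs fs) → coeff (subS c gs fs) n ≡ conv (cons 1ℤ (coeff gs)) (η ∘ suc) n
    next n p = trans (coeff-subS c gs fs n p') (trans (cong₂ (λ x y → x - y * coeff gs n) (h (suc n) (s≤s p')) c≡) (body n))
      where p' = subst (n ℕ.<_) (length-subS c gs fs) p
  ... | len , co = cong suc len , λ { zero _ → trans (h 0 (s≤s z≤n)) (*-identityˡ (η 0)) ; (suc n) (s≤s p) → co n p }

  record Monic (l : Poly) (d : ℕ) : Set where
    field
      length≡ : length l ≡ suc d
      leading : coeff l d ≡ 1ℤ

  monic-support : ∀ {l d} → Monic l d → Supported d (coeff l)
  monic-support {l} m n h = coeff-beyond l n (subst (ℕ._≤ n) (sym (Monic.length≡ m)) h)

  divMonic-correct : ∀ f g dg dh h → Monic g dg → length f ≡ suc (dg ℕ.+ dh) → Supported dh h → coeff f ≈ conv (coeff g) h →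
    coeff (divMonic f g) ≈ h × length (divMonic f g) ≡ suc dh
  divMonic-correct f g dg dh h mg lf sh e = result , len'
    where
    gH = reverse g
    lg : length gH ≡ suc dg
    lg = trans (L.length-reverse g) (Monic.length≡ mg)
    lfH : length (reverse f) ≡ suc (dg ℕ.+ dh)
    lfH = trans (L.length-reverse f) lf
    ltail : ∀ l → length l ≡ suc dg → length (tail' l) ≡ dg
    ltail (x ∷ l) q = ℕ.suc-injective q
    k = length (reverse f) ∸ length (tail' gH)
    k≡ : k ≡ suc dh
    k≡ = trans (cong₂ _∸_ lfH (ltail gH lg)) (trans (cong (_∸ dg) (sym (ℕ.+-suc dg dh))) (ℕ.m+n∸m≡n dg (suc dh)))
    η : Series
    η = rev dh h
    gH≈ : cons 1ℤ (coeff (tail' gH)) ≈ rev dg (coeff g)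
    gH≈ n = trans (head-tail gH lg (trans (coeff-reverse g dg 0 (trans (Monic.length≡ mg) (cong suc (sym (ℕ.+-identityʳ dg))))) (Monic.leading mg)) n) (gHrev n)
      where
      head-tail : ∀ l → length l ≡ suc dg → coeff l 0 ≡ 1ℤ → cons 1ℤ (coeff (tail' l)) ≈ coeff l
      head-tail (x ∷ l) _ q zero = sym q
      head-tail (x ∷ l) _ q (suc n) = refl
      gHrev : ∀ n → coeff gH n ≡ rev dg (coeff g) n
      gHrev n with n ℕ.≤? dg
      ... | yes n≤ = trans (coeff-reverse g (dg ∸ n) n (trans (Monic.length≡ mg) (cong suc (sym (ℕ.m∸n+n≡m n≤))))) (sym (rev-≤ dg (coeff g) (dg ∸ n) n (ℕ.m∸n+n≡m n≤)))
      ... | no n≰ = trans (coeff-beyond gH n (subst (ℕ._≤ n) (sym lg) (ℕ.≰⇒> n≰))) (sym (rev-> dg (coeff g) n (ℕ.≰⇒> n≰)))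
    fH : ∀ n → n ℕ.< length (reverse f) → coeff (reverse f) n ≡ conv (cons 1ℤ (coeff (tail' gH))) η n
    fH n p = trans (coeff-reverse f (dg ℕ.+ dh ∸ n) n (trans lf (cong suc (sym sub)))) (trans (e (dg ℕ.+ dh ∸ n))
        (trans (conv-reverse dg dh (coeff g) h (monic-support mg) sh (dg ℕ.+ dh ∸ n) n sub) (conv-cong (λ n → sym (gH≈ n)) (λ _ → refl) n)))
      where
      sub : dg ℕ.+ dh ∸ n ℕ.+ n ≡ dg ℕ.+ dh
      sub = ℕ.m∸n+n≡m (ℕ.≤-pred (subst (n ℕ.<_) lfH p))
    core = divH-correct k (reverse f) (tail' gH) η (ℕ.m∸n≤m (length (reverse f)) (length (tail' gH))) fH
    D = divH k (reverse f) (tail' gH)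
    len' : length (reverse D) ≡ suc dh
    len' = trans (L.length-reverse D) (trans (proj₁ core) k≡)
    result : coeff (reverse D) ≈ h
    result n with n ℕ.≤? dh
    ... | yes n≤ = trans (coeff-reverse D (dh ∸ n) n (trans (proj₁ core) (trans k≡ (cong suc (sym (ℕ.m∸n+n≡m n≤)))))) (trans (proj₂ core (dh ∸ n) (subst (dh ∸ n ℕ.<_) (sym k≡) (s≤s (ℕ.m∸n≤m dh n))))
          (rev-≤ dh h n (dh ∸ n) (ℕ.m+[n∸m]≡n n≤)))
    ... | no n≰ = trans (coeff-beyond (reverse D) n (subst (ℕ._≤ n) (sym len') (ℕ.≰⇒> n≰))) (sym (sh n (ℕ.≰⇒> n≰)))

  conv-top : ∀ a b f g → Supported a f → Supported b g → conv f g (a ℕ.+ b) ≡ f a * g b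
  conv-top a b f g hf hg = trans (conv-reverse a b f g hf hg (a ℕ.+ b) 0 (ℕ.+-identityʳ (a ℕ.+ b))) (cong₂ _*_ (rev-≤ a f a 0 (ℕ.+-identityʳ a)) (rev-≤ b g b 0 (ℕ.+-identityʳ b)))

  -- The top coefficient of f h is that of h as f is monic, so it vanishes beyond degree N; this
  -- lowers the given bound B step by step to N - a.
  cofactor-support : ∀ a N f h B → Supported a f → f a ≡ 1ℤ → Supported N (conv f h) → Supported B h → ∀ n → N ℕ.< a ℕ.+ n → h n ≡ 0ℤ
  cofactor-support a N f h zero hf f1 hc hB zero p = trans (sym (*-identityˡ (h 0))) (trans (cong (_* h 0) (sym f1)) (trans (sym (conv-top a 0 f h hf hB)) (hc (a ℕ.+ 0) p)))
  cofactor-support a N f h zero hf f1 hc hB (suc n) p = hB (suc n) (s≤s z≤n)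
  cofactor-support a N f h (suc B) hf f1 hc hB n p with N ℕ.<? a ℕ.+ suc B
  ... | no q = hB n (ℕ.+-cancelˡ-< a (suc B) n (ℕ.≤-<-trans (ℕ.≮⇒≥ q) p))
  ... | yes q = cofactor-support a N f h B hf f1 hc smaller n p
    where
    top : h (suc B) ≡ 0ℤ
    top = trans (sym (*-identityˡ (h (suc B)))) (trans (cong (_* h (suc B)) (sym f1)) (trans (sym (conv-top a (suc B) f h hf hB)) (hc (a ℕ.+ suc B) q)))
    smaller : Supported B h
    smaller k k>B with k ℕ.≟ suc B
    ... | yes refl = top
    ... | no ne = hB k (ℕ.≤∧≢⇒< k>B (λ e → ne (sym e)))

-- Cyclotomic polynomials computed from their table

module CyclotomicFactors where
  open import Defs
  open import Data.Nat.Divisibility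
  open import Data.Nat.Primality
  open import Data.Integer as ℤ using (ℤ; _+_; _*_; _-_; -_)
  open import Data.Integer.Properties as ℤ using (+-identityʳ; *-identityˡ; *-identityʳ; *-zeroʳ)
  open import Data.List using (List; []; _∷_; _++_; [_]; replicate; length; foldr)
  import Data.List.Properties as L
  open import Data.List.Relation.Unary.All using (All; []; _∷_)
  open import Data.List.Relation.Unary.Any using (here; there)
  open import Data.List.Relation.Unary.AllPairs using (AllPairs; []; _∷_)
  open import Data.List.Membership.Propositional using (_∈_; _∉_)
  open import Data.Product using (Σ)
  open import Data.Vec using ([]; _∷_)
  open import Algebra.Bundles using (CommutativeMonoid)
  open PowerSeries
  open CommutativeMonoid series using () renaming (trans to ≈-trans; sym to ≈-sym; refl to ≈-refl)
  import Algebra.Solver.CommutativeMonoid series as CM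
  open CM using (_⊜_; _⊕_)

  -- The folding function inside `cycTable` is anonymous. The pair lets unification find it, so that
  -- it can be named afterwards.
  table-step : ∀ n → Σ (ℕ × Poly → Poly → Poly) λ F →
    cycTable (suc n) ≡ cycTable n ++ [ (suc n , divMonic (xpow-minus-one (suc n)) (foldr F [ 1ℤ ] (cycTable n))) ]
  table-step n = _ , refl

  accumulate : ℕ → ℕ × Poly → Poly → Poly
  accumulate n = proj₁ (table-step n)

  accumulate-∣ : ∀ n d φ acc → d ∣ suc n → accumulate n (d , φ) acc ≡ φ *ₚ acc
  accumulate-∣ n d φ acc h with d ∣? suc n
  ... | yes _ = refl
  ... | no ¬h = ⊥-elim (¬h h)

  accumulate-∤ : ∀ n d φ acc → ¬ d ∣ suc n → accumulate n (d , φ) acc ≡ acc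
  accumulate-∤ n d φ acc h with d ∣? suc n
  ... | yes h' = ⊥-elim (h h')
  ... | no _ = refl

  divisorProduct : ℕ → ℕ → Poly → Poly
  divisorProduct n k acc = foldr (accumulate n) acc (cycTable k)

  entry : ℕ → Poly
  entry n = divMonic (xpow-minus-one (suc n)) (divisorProduct n n [ 1ℤ ])

  lookup-beyond : ∀ n d ys → n ℕ.< d → lookupTab d (cycTable n ++ ys) ≡ lookupTab d ys
  lookup-beyond zero d ys _ = refl
  lookup-beyond (suc n) d ys n<d = trans (cong (λ z → lookupTab d (z ++ ys)) (proj₂ (table-step n)))
    (trans (cong (lookupTab d) (L.++-assoc (cycTable n) [ (suc n , entry n) ] ys)) (trans (lookup-beyond n d ((suc n , entry n) ∷ ys) (ℕ.<-trans (ℕ.n<1+n n) n<d)) skip))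
    where
    skip : lookupTab d ((suc n , entry n) ∷ ys) ≡ lookupTab d ys
    skip with d ℕ.≟ suc n
    ... | yes e = ⊥-elim (ℕ.<⇒≢ n<d (sym e))
    ... | no _ = refl

  cyclotomic-entry : ∀ n → cyclotomic (suc n) ≡ entry n
  cyclotomic-entry n = trans (cong (lookupTab (suc n)) (proj₂ (table-step n))) (trans (lookup-beyond n (suc n) [ (suc n , entry n) ] ℕ.≤-refl) hit)
    where
    hit : lookupTab (suc n) [ (suc n , entry n) ] ≡ entry n
    hit with suc n ℕ.≟ suc n
    ... | yes _ = refl
    ... | no ne = ⊥-elim (ne refl)

  Φ : ℕ → Series
  Φ n = coeff (cyclotomic n)

  divisorProduct-suc : ∀ n k acc → divisorProduct n (suc k) acc ≡ divisorProduct n k (accumulate n (suc k , cyclotomic (suc k)) acc)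
  divisorProduct-suc n k acc = trans (cong (foldr (accumulate n) acc) (trans (proj₂ (table-step k)) (cong (λ z → cycTable k ++ [ (suc k , z) ]) (sym (cyclotomic-entry k)))))
    (L.foldr-++ (accumulate n) acc (cycTable k) [ (suc k , cyclotomic (suc k)) ])

  product : (ℕ → Series) → ℕ → Series
  product E zero = mono 0
  product E (suc k) = conv (product E k) (E (suc k))

  factorAt : ℕ → ℕ → Series
  factorAt n d with d ∣? n
  ... | yes _ = Φ d
  ... | no _ = mono 0

  monic-* : ∀ {p q a b} → Monic p a → Monic q b → Monic (p *ₚ q) (a ℕ.+ b)
  monic-* {p} {q} {a} {b} mp mq = record
    { length≡ = len p a (Monic.length≡ mp)
    ; leading = trans (coeff-* p q (a ℕ.+ b)) (trans (conv-top a b (coeff p) (coeff q) (monic-support mp) (monic-support mq)) (trans (cong₂ _*_ (Monic.leading mp) (Monic.leading mq)) refl)) }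
    where
    length-scale : ∀ c l → length (scale c l) ≡ length l
    length-scale c [] = refl
    length-scale c (x ∷ l) = cong suc (length-scale c l)
    length-+ : ∀ l m → length l ℕ.≤ length m → length (l +ₚ m) ≡ length m
    length-+ [] m h = refl
    length-+ (x ∷ l) (y ∷ m) (s≤s h) = cong suc (length-+ l m h)
    length-+' : ∀ l m → length m ℕ.≤ length l → length (l +ₚ m) ≡ length l
    length-+' [] [] h = refl
    length-+' (x ∷ l) [] h = refl
    length-+' (x ∷ l) (y ∷ m) (s≤s h) = cong suc (length-+' l m h)
    len : ∀ p a → length p ≡ suc a → length (p *ₚ q) ≡ suc (a ℕ.+ b)
    len (x ∷ []) zero e = trans (length-+' (scale x q) (0ℤ ∷ []) (subst (1 ℕ.≤_) (sym (trans (length-scale x q) (Monic.length≡ mq))) (s≤s z≤n))) (trans (length-scale x q) (Monic.length≡ mq))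
    len (x ∷ p@(_ ∷ _)) (suc a) e = trans (length-+ (scale x q) (0ℤ ∷ (p *ₚ q)) (subst₂ ℕ._≤_ (sym (trans (length-scale x q) (Monic.length≡ mq))) (cong suc (sym ih)) (ℕ.m≤n⇒m≤1+n (s≤s (ℕ.m≤n+m b a))))) (cong suc ih)
      where ih = len p a (ℕ.suc-injective e)

  IsMonic : Poly → Set
  IsMonic l = ∃ λ d → Monic l d

  divisorProduct-coeff : ∀ n k acc → coeff (divisorProduct n k acc) ≈ conv (product (factorAt (suc n)) k) (coeff acc)
  divisorProduct-coeff n zero acc = ≈-sym {conv (mono 0) (coeff acc)} {coeff acc} (conv-mono 0 (coeff acc))
  divisorProduct-coeff n (suc k) acc m = trans (cong (λ z → coeff z m) (divisorProduct-suc n k acc)) (trans (divisorProduct-coeff n k (accumulate n (suc k , cyclotomic (suc k)) acc) m)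
     (trans (conv-cong {product (factorAt (suc n)) k} (λ _ → refl) one m) (sym (conv-assoc (product (factorAt (suc n)) k) (factorAt (suc n) (suc k)) (coeff acc) m))))
    where
    one : coeff (accumulate n (suc k , cyclotomic (suc k)) acc) ≈ conv (factorAt (suc n) (suc k)) (coeff acc)
    one j with suc k ∣? suc n
    ... | yes h = coeff-* (cyclotomic (suc k)) acc j
    ... | no h = sym (conv-mono 0 (coeff acc) j)

  divisorProduct-monic : ∀ n k acc → IsMonic acc → (∀ d → 1 ℕ.≤ d → d ℕ.≤ k → d ∣ suc n → IsMonic (cyclotomic d)) → IsMonic (divisorProduct n k acc)
  divisorProduct-monic n zero acc m h = m
  divisorProduct-monic n (suc k) acc m h = subst IsMonic (sym (divisorProduct-suc n k acc))
      (divisorProduct-monic n k (accumulate n (suc k , cyclotomic (suc k)) acc) (go (suc k ∣? suc n)) (λ d 1≤d d≤k → h d 1≤d (ℕ.m≤n⇒m≤1+n d≤k)))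
    where
    go : Dec (suc k ∣ suc n) → IsMonic (accumulate n (suc k , cyclotomic (suc k)) acc)
    go (yes d) = subst IsMonic (sym (accumulate-∣ n (suc k) (cyclotomic (suc k)) acc d)) (proj₁ c ℕ.+ proj₁ m , monic-* (proj₂ c) (proj₂ m))
      where c = h (suc k) (s≤s z≤n) ℕ.≤-refl d
    go (no ¬d) = subst IsMonic (sym (accumulate-∤ n (suc k) (cyclotomic (suc k)) acc ¬d)) m

  monic-one : IsMonic [ 1ℤ ]
  monic-one = 0 , record { length≡ = refl ; leading = refl }

  length-xpow : ∀ n → length (xpow-minus-one (suc n)) ≡ suc (suc n)
  length-xpow n = cong suc (trans (L.length-++ (replicate n 0ℤ)) (trans (cong (ℕ._+ 1) (L.length-replicate n)) (ℕ.+-comm n 1)))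

  X-support : ∀ n → Supported n (X n)
  X-support n k n<k = cong₂ _-_ (mono-≢ n k (ℕ.<⇒≢ n<k)) (mono-≢ 0 k (λ e → ℕ.<⇒≢ (ℕ.≤-<-trans z≤n n<k) e))

  1≢0 : - 1ℤ ≢ 0ℤ
  1≢0 ()

  -- To determine Φ it suffices to exhibit one finitely supported cofactor h of the product over
  -- proper divisors: division by a monic polynomial returns exactly h.
  evaluate : ∀ n h B → (∀ d → 1 ℕ.≤ d → d ℕ.≤ n → d ∣ suc n → IsMonic (cyclotomic d)) → Supported B h →
    conv (product (factorAt (suc n)) n) h ≈ X (suc n) → Φ (suc n) ≈ h × IsMonic (cyclotomic (suc n))
  evaluate n h B monics hB e = main (divisorProduct-monic n n [ 1ℤ ] monic-one monics)
    where
    G = divisorProduct n n [ 1ℤ ]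
    G≈ : conv (coeff G) h ≈ X (suc n)
    G≈ k = trans (conv-cong {coeff G} {product (factorAt (suc n)) n} (λ j → trans (divisorProduct-coeff n n [ 1ℤ ] j) (trans (conv-cong {product (factorAt (suc n)) n} (λ _ → refl) one j)
        (trans (conv-comm (product (factorAt (suc n)) n) (mono 0) j) (conv-mono 0 (product (factorAt (suc n)) n) j)))) (λ _ → refl) k) (e k)
      where
      one : coeff [ 1ℤ ] ≈ mono 0
      one zero = refl
      one (suc j) = refl
    main : IsMonic G → Φ (suc n) ≈ h × IsMonic (cyclotomic (suc n))
    main (dg , mg) = (λ k → trans (cong (λ z → coeff z k) (cyclotomic-entry n)) (proj₁ correct k)) ,
        dh , subst (λ z → Monic z dh) (sym (cyclotomic-entry n)) (record { length≡ = proj₂ correct ; leading = trans (proj₁ correct dh) top })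
      where
      sh : ∀ k → suc n ℕ.< dg ℕ.+ k → h k ≡ 0ℤ
      sh = cofactor-support dg (suc n) (coeff G) h B (monic-support mg) (Monic.leading mg) (λ k p → trans (G≈ k) (X-support (suc n) k p)) hB
      -- Were the degree larger, h 0 would vanish, but the constant coefficient of x^(n+1) - 1 is
      -- -1.
      dg≤ : dg ℕ.≤ suc n
      dg≤ = ℕ.≮⇒≥ (λ lt → 1≢0 (trans (sym (G≈ 0)) (trans (cong (coeff G 0 *_) (sh 0 (ℕ.≤-trans lt (ℕ.≤-reflexive (sym (ℕ.+-identityʳ dg)))))) (*-zeroʳ (coeff G 0)))))
      dh = suc n ∸ dg
      dg+dh : dg ℕ.+ dh ≡ suc n
      dg+dh = ℕ.m+[n∸m]≡n dg≤
      sdh : Supported dh h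
      sdh k p = sh k (subst (ℕ._< dg ℕ.+ k) dg+dh (ℕ.+-monoʳ-< dg p))
      correct : coeff (entry n) ≈ h × length (entry n) ≡ suc dh
      correct = divMonic-correct (xpow-minus-one (suc n)) G dg dh h mg (trans (length-xpow n) (cong suc (sym dg+dh))) sdh (λ k → trans (coeff-xpow n k) (sym (G≈ k)))
      top : h dh ≡ 1ℤ
      top = trans (sym (*-identityˡ (h dh))) (trans (cong (_* h dh) (sym (Monic.leading mg))) (trans (sym (conv-top dg dh (coeff G) h (monic-support mg) sdh))
        (trans (cong (conv (coeff G) h) dg+dh) (trans (G≈ (suc n)) (trans (+-identityʳ (mono n n)) (mono-refl n))))))

  remove : (ℕ → Series) → ℕ → ℕ → Series
  remove E d x with x ℕ.≟ d
  ... | yes _ = mono 0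
  ... | no _ = E x

  remove-≢ : ∀ E d x → x ≢ d → remove E d x ≈ E x
  remove-≢ E d x ne with x ℕ.≟ d
  ... | yes e = ⊥-elim (ne e)
  ... | no _ = ≈-refl {E x}

  remove-≡ : ∀ E d → remove E d d ≈ mono 0
  remove-≡ E d with d ℕ.≟ d
  ... | yes e = ≈-refl {mono 0}
  ... | no ne = ⊥-elim (ne refl)

  product-cong : ∀ k {E E'} → (∀ x → x ℕ.≤ k → E x ≈ E' x) → product E k ≈ product E' k
  product-cong zero h = ≈-refl {mono 0}
  product-cong (suc k) {E} {E'} h = conv-cong (product-cong k {E} {E'} (λ x p → h x (ℕ.m≤n⇒m≤1+n p))) (h (suc k) ℕ.≤-refl)

  identityʳ : ∀ f → conv f (mono 0) ≈ f
  identityʳ f n = trans (conv-comm f (mono 0) n) (conv-mono 0 f n)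

  product-extract : ∀ k d E → 1 ℕ.≤ d → d ℕ.≤ k → product E k ≈ conv (E d) (product (remove E d) k)
  product-extract zero d E 1≤d d≤k = ⊥-elim (ℕ.<⇒≱ 1≤d d≤k)
  product-extract (suc k) d E 1≤d d≤k with d ℕ.≟ suc k
  ... | yes refl = ≈-trans {product E (suc k)} {conv (product (remove E d) k) (E d)} {conv (E d) (product (remove E d) (suc k))}
        (conv-cong {product E k} {product (remove E d) k} (product-cong k {E} {remove E d} (λ x p → ≈-sym {remove E d x} {E x} (remove-≢ E d x (ℕ.<⇒≢ (s≤s p))))) (≈-refl {E d}))
        (≈-trans {conv (product (remove E d) k) (E d)} {conv (E d) (product (remove E d) k)} {conv (E d) (product (remove E d) (suc k))}
          (conv-comm (product (remove E d) k) (E d))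
          (conv-cong {E d} (≈-refl {E d}) (λ n → sym (trans (conv-cong {product (remove E d) k} (≈-refl {product (remove E d) k}) (remove-≡ E d) n) (identityʳ (product (remove E d) k) n)))))
  ... | no ne = λ n → trans (conv-cong (product-extract k d E 1≤d (ℕ.≤-pred (ℕ.≤∧≢⇒< d≤k ne))) (≈-sym {remove E d (suc k)} {E (suc k)} (remove-≢ E d (suc k) (λ e → ne (sym e)))) n)
          (conv-assoc (E d) (product (remove E d) k) (remove E d (suc k)) n)

  product-one : ∀ k E → (∀ x → 1 ℕ.≤ x → x ℕ.≤ k → E x ≈ mono 0) → product E k ≈ mono 0
  product-one zero E h = ≈-refl {mono 0}
  product-one (suc k) E h n = trans (conv-cong (product-one k E (λ x a b → h x a (ℕ.m≤n⇒m≤1+n b))) (h (suc k) (s≤s z≤n) ℕ.≤-refl) n) (conv-mono 0 (mono 0) n)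

  listProduct : (ℕ → Series) → List ℕ → Series
  listProduct E = foldr (λ d → conv (E d)) (mono 0)

  listProduct-cong : ∀ ds {E E'} → All (λ d → E d ≈ E' d) ds → listProduct E ds ≈ listProduct E' ds
  listProduct-cong [] [] = ≈-refl {mono 0}
  listProduct-cong (d ∷ ds) (h ∷ hs) = conv-cong h (listProduct-cong ds hs)

  -- A strictly increasing list has no repetitions, so each listed factor is pulled out of the
  -- product once and replaced there by 1.
  product-list : ∀ k ds E → AllPairs ℕ._<_ ds → All (λ d → 1 ℕ.≤ d × d ℕ.≤ k) ds → (∀ x → 1 ℕ.≤ x → x ℕ.≤ k → x ∉ ds → E x ≈ mono 0) → product E k ≈ listProduct E ds
  product-list k [] E _ _ h = product-one k E (λ x a b → h x a b (λ ()))
  product-list k (d ∷ ds) E (p ∷ ps) ((a , b) ∷ bs) h = ≈-trans {product E k} {conv (E d) (product (remove E d) k)} {listProduct E (d ∷ ds)} (product-extract k d E a b)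
    (conv-cong {E d} (≈-refl {E d}) (≈-trans {product (remove E d) k} {listProduct (remove E d) ds} {listProduct E ds} (product-list k ds (remove E d) ps bs rest) (listProduct-cong ds (others ds p))))
    where
    others : ∀ ds → All (d ℕ.<_) ds → All (λ x → remove E d x ≈ E x) ds
    others [] [] = []
    others (x ∷ xs) (q ∷ qs) = remove-≢ E d x (λ e → ℕ.<⇒≢ q (sym e)) ∷ others xs qs
    rest : ∀ x → 1 ℕ.≤ x → x ℕ.≤ k → x ∉ ds → remove E d x ≈ mono 0
    rest x 1≤x x≤k x∉ with x ℕ.≟ d
    ... | yes _ = ≈-refl {mono 0}
    ... | no ne = h x 1≤x x≤k λ { (here e) → ne e ; (there q) → x∉ q }

  factorAt-∣ : ∀ n d → d ∣ n → factorAt n d ≈ Φ d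
  factorAt-∣ n d h with d ∣? n
  ... | yes _ = ≈-refl {Φ d}
  ... | no ¬h = ⊥-elim (¬h h)

  factorAt-∤ : ∀ n d → ¬ d ∣ n → factorAt n d ≈ mono 0
  factorAt-∤ n d h with d ∣? n
  ... | yes h' = ⊥-elim (h h')
  ... | no _ = ≈-refl {mono 0}

  evaluate-list : ∀ n ds h B → 1 ℕ.≤ n → AllPairs ℕ._<_ ds → All (λ d → (1 ℕ.≤ d × d ℕ.< n) × d ∣ n × IsMonic (cyclotomic d)) ds →
    (∀ d → d ∣ n → d ∈ ds ⊎ d ≡ n) → Supported B h → conv (listProduct Φ ds) h ≈ X n → Φ n ≈ h × IsMonic (cyclotomic n)
  evaluate-list (suc n) ds h B _ sorted props complete hB e = evaluate n h B monics hB
      (≈-trans {conv (product (factorAt (suc n)) n) h} {conv (listProduct Φ ds) h} {X (suc n)} (conv-cong {product (factorAt (suc n)) n} {listProduct Φ ds} prods (≈-refl {h})) e)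
    where
    pick : ∀ {P : ℕ → Set} {d} ds → All P ds → d ∈ ds → P d
    pick (x ∷ ds) (p ∷ ps) (here refl) = p
    pick (x ∷ ds) (p ∷ ps) (there q) = pick ds ps q
    inList : ∀ d → d ℕ.≤ n → d ∣ suc n → d ∈ ds
    inList d d≤n d∣n with complete d d∣n
    ... | inj₁ q = q
    ... | inj₂ refl = ⊥-elim (ℕ.<⇒≱ (ℕ.n<1+n n) d≤n)
    monics : ∀ d → 1 ℕ.≤ d → d ℕ.≤ n → d ∣ suc n → IsMonic (cyclotomic d)
    monics d _ d≤n d∣n = proj₂ (proj₂ (pick ds props (inList d d≤n d∣n)))
    bounds : ∀ ds → All (λ d → (1 ℕ.≤ d × d ℕ.< suc n) × d ∣ suc n × IsMonic (cyclotomic d)) ds → All (λ d → 1 ℕ.≤ d × d ℕ.≤ n) ds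
    bounds [] [] = []
    bounds (x ∷ xs) (((a , b) , _) ∷ ps) = (a , ℕ.≤-pred b) ∷ bounds xs ps
    facts : ∀ ds → All (λ d → (1 ℕ.≤ d × d ℕ.< suc n) × d ∣ suc n × IsMonic (cyclotomic d)) ds → All (λ d → factorAt (suc n) d ≈ Φ d) ds
    facts [] [] = []
    facts (x ∷ xs) ((_ , d , _) ∷ ps) = factorAt-∣ (suc n) x d ∷ facts xs ps
    prods : product (factorAt (suc n)) n ≈ listProduct Φ ds
    prods = ≈-trans {product (factorAt (suc n)) n} {listProduct (factorAt (suc n)) ds} {listProduct Φ ds}
      (product-list n ds (factorAt (suc n)) sorted (bounds ds props) (λ x _ x≤n x∉ → factorAt-∤ (suc n) x (λ d → x∉ (inList x x≤n d))))
      (listProduct-cong ds (facts ds props))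

  divides-prime-* : ∀ p n {d} → Prime p → d ∣ p ℕ.* n → d ∣ n ⊎ (∃ λ e → d ≡ p ℕ.* e × e ∣ n)
  divides-prime-* p n {d} pp (divides k e) with p ∣? d
  ... | yes (divides j refl) = inj₂ (j , ℕ.*-comm j p , divides k (ℕ.*-cancelˡ-≡ n (k ℕ.* j) p {{prime⇒nonZero pp}} (trans e (trans (sym (ℕ.*-assoc k j p)) (ℕ.*-comm (k ℕ.* j) p)))))
  ... | no p∤d with euclidsLemma k d pp (subst (p ∣_) e (m∣m*n n))
  ... | inj₂ p∣d = ⊥-elim (p∤d p∣d)
  ... | inj₁ (divides j refl) = inj₁ (divides j (ℕ.*-cancelˡ-≡ n (j ℕ.* d) p {{prime⇒nonZero pp}} (trans e (trans (cong (ℕ._* d) (ℕ.*-comm j p)) (ℕ.*-assoc p j d)))))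

  Φ₁ : Φ 1 ≈ X 1 × IsMonic (cyclotomic 1)
  Φ₁ = evaluate-list 1 [] (X 1) 1 (s≤s z≤n) [] [] (λ d h → inj₂ (∣1⇒≡1 h)) (X-support 1) (conv-mono 0 (X 1))

  prime>1 : ∀ {p} → Prime p → 1 ℕ.< p
  prime>1 {p} pp = ℕ.nonTrivial⇒n>1 p {{prime⇒nonTrivial pp}}

  block : ℕ → Series
  block zero n = 0ℤ
  block (suc p) zero = 1ℤ
  block (suc p) (suc n) = block p n

  X₁-block : ∀ p → conv (X 1) (block p) ≈ X p
  X₁-block p n = trans (conv-X 1 (block p) n) (go p n)
    where
    go : ∀ p n → shift 1 (block p) n - block p n ≡ X p n
    go zero zero = refl
    go zero (suc n) = sym (ℤ.+-inverseʳ (mono 0 (suc n)))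
    go (suc p) zero = refl
    go (suc zero) (suc zero) = refl
    go (suc zero) (suc (suc n)) = refl
    go (suc (suc p)) (suc zero) = refl
    go (suc (suc p)) (suc (suc n)) = trans (go (suc p) (suc n)) refl

  block-support : ∀ p → Supported p (block p)
  block-support zero n _ = refl
  block-support (suc p) (suc n) (s≤s h) = block-support p n h

  Φ-prime : ∀ {p} → Prime p → conv (Φ 1) (Φ p) ≈ X p × IsMonic (cyclotomic p)
  Φ-prime {p} pp = (λ n → trans (conv-cong (proj₁ Φ₁) (proj₁ ev) n) (X₁-block p n)) , proj₂ ev
    where
    complete : ∀ d → d ∣ p → d ∈ (1 ∷ []) ⊎ d ≡ p
    complete d h with prime⇒irreducible pp h
    ... | inj₁ e = inj₁ (here e)
    ... | inj₂ e = inj₂ e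
    ev : Φ p ≈ block p × IsMonic (cyclotomic p)
    ev = evaluate-list p (1 ∷ []) (block p) p (ℕ.<⇒≤ (prime>1 pp)) ([] ∷ []) (((s≤s z≤n , prime>1 pp) , 1∣ p , proj₂ Φ₁) ∷ []) complete (block-support p)
      (λ n → trans (conv-cong {conv (Φ 1) (mono 0)} {X 1} (λ n → trans (identityʳ (Φ 1) n) (proj₁ Φ₁ n)) (≈-refl {block p}) n) (X₁-block p n))

  p<pq : ∀ {p q} → Prime p → Prime q → p ℕ.< p ℕ.* q
  p<pq {p} {q} pp pq = ℕ.m<m*n p q {{prime⇒nonZero pp}} (prime>1 pq)

  module Products {p q} (pp : Prime p) (pq : Prime q) where

    divisors : ∀ d → d ∣ p ℕ.* q → d ≡ 1 ⊎ d ≡ p ⊎ d ≡ q ⊎ d ≡ p ℕ.* q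
    divisors d h with divides-prime-* p q pp h
    ... | inj₁ d∣q with prime⇒irreducible pq d∣q
    ... | inj₁ e = inj₁ e
    ... | inj₂ e = inj₂ (inj₂ (inj₁ e))
    divisors d h | inj₂ (e , refl , e∣q) with prime⇒irreducible pq e∣q
    ... | inj₁ refl = inj₂ (inj₁ (ℕ.*-identityʳ p))
    ... | inj₂ refl = inj₂ (inj₂ (inj₂ refl))

  -- Φ_1 Φ_p = x^p - 1 and Φ_1 Φ_q = x^q - 1, so the equation for a is the required factorisation
  -- multiplied by x - 1, which cancels.
  Φ-two : ∀ {p q} → Prime p → Prime q → p ℕ.< q → ∀ a B → Supported B a → conv (X p) (conv (X q) a) ≈ conv (X 1) (X (p ℕ.* q)) →
    Φ (p ℕ.* q) ≈ a × IsMonic (cyclotomic (p ℕ.* q))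
  Φ-two {p} {q} pp pq p<q a B hB e = evaluate-list (p ℕ.* q) (1 ∷ p ∷ q ∷ []) a B (ℕ.<⇒≤ (ℕ.<-trans (prime>1 pp) (p<pq pp pq)))
      ((prime>1 pp ∷ prime>1 pq ∷ []) ∷ (p<q ∷ []) ∷ [] ∷ [])
      (((s≤s z≤n , ℕ.<-trans (prime>1 pp) (p<pq pp pq)) , 1∣ (p ℕ.* q) , proj₂ Φ₁) ∷ ((ℕ.<⇒≤ (prime>1 pp) , p<pq pp pq) , m∣m*n q , proj₂ (Φ-prime pp))
        ∷ ((ℕ.<⇒≤ (prime>1 pq) , subst (q ℕ.<_) (ℕ.*-comm q p) (p<pq pq pp)) , n∣m*n p , proj₂ (Φ-prime pq)) ∷ [])
      complete hB (cancel (X 1) (conv (listProduct Φ (1 ∷ p ∷ q ∷ [])) a) (X (p ℕ.* q)) refl eq)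
    where
    complete : ∀ d → d ∣ p ℕ.* q → d ∈ (1 ∷ p ∷ q ∷ []) ⊎ d ≡ p ℕ.* q
    complete d h with Products.divisors pp pq d h
    ... | inj₁ x = inj₁ (here x)
    ... | inj₂ (inj₁ x) = inj₁ (there (here x))
    ... | inj₂ (inj₂ (inj₁ x)) = inj₁ (there (there (here x)))
    ... | inj₂ (inj₂ (inj₂ x)) = inj₂ x
    eq : conv (X 1) (conv (listProduct Φ (1 ∷ p ∷ q ∷ [])) a) ≈ conv (X 1) (X (p ℕ.* q))
    eq n = trans (conv-cong {X 1} {Φ 1} (≈-sym {Φ 1} {X 1} (proj₁ Φ₁)) (≈-refl {conv (listProduct Φ (1 ∷ p ∷ q ∷ [])) a}) n)
      (trans (CM.solve 4 (λ x y z a → (x ⊕ ((x ⊕ (y ⊕ (z ⊕ CM.id))) ⊕ a)) ⊜ ((x ⊕ y) ⊕ ((x ⊕ z) ⊕ a))) (λ _ → refl) (Φ 1) (Φ p) (Φ q) a n)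
      (trans (conv-cong (proj₁ (Φ-prime pp)) (conv-cong (proj₁ (Φ-prime pq)) (≈-refl {a})) n) (e n)))

  Φ-two-product : ∀ {p q} → Prime p → Prime q → ∀ a → Φ (p ℕ.* q) ≈ a → conv (X p) (conv (X q) a) ≈ conv (X 1) (X (p ℕ.* q)) →
    conv (Φ 1) (conv (Φ p) (conv (Φ q) (Φ (p ℕ.* q)))) ≈ X (p ℕ.* q)
  Φ-two-product {p} {q} pp pq a ea e = cancel (X 1) (conv (Φ 1) (conv (Φ p) (conv (Φ q) (Φ (p ℕ.* q))))) (X (p ℕ.* q)) refl
    (λ n → trans (conv-cong {X 1} {Φ 1} (≈-sym {Φ 1} {X 1} (proj₁ Φ₁)) (≈-refl {conv (Φ 1) (conv (Φ p) (conv (Φ q) (Φ (p ℕ.* q))))}) n)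
      (trans (CM.solve 4 (λ x y z a → (x ⊕ (x ⊕ (y ⊕ (z ⊕ a)))) ⊜ ((x ⊕ y) ⊕ ((x ⊕ z) ⊕ a))) (λ _ → refl) (Φ 1) (Φ p) (Φ q) (Φ (p ℕ.* q)) n)
      (trans (conv-cong (proj₁ (Φ-prime pp)) (conv-cong (proj₁ (Φ-prime pq)) ea) n) (e n))))

-- Cyclotomic polynomials of products of two and three primes

module BinaryCyclotomic where
  open import Data.Nat using (_+_; _*_; _≤_; _<_)
  open import Data.Nat.DivMod using (_%_; m%n≤n; m≡m%n+[m/n]*n)
  open import Data.Nat.Divisibility
  open import Data.Nat.Primality
  open import Data.Nat.Coprimality as C using (Coprime)
  open import Data.Integer as ℤ using (ℤ; _-_; -_)
  open import Data.Integer.Properties as ℤ using (+-identityˡ; +-identityʳ; *-identityˡ; *-identityʳ)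
  open import Data.Integer.Tactic.RingSolver using (solve-∀)
  open import Data.List using (List; []; _∷_)
  open import Data.List.Relation.Unary.All using (All; []; _∷_)
  open import Data.List.Relation.Unary.Any using (here; there)
  open import Data.List.Relation.Unary.AllPairs using (AllPairs; []; _∷_)
  open import Data.List.Membership.Propositional using (_∈_)
  open import Algebra.Bundles using (CommutativeMonoid)
  open import Defs using (cyclotomic)
  open PowerSeries
  open CyclotomicFactors
  open CommutativeMonoid series using () renaming (trans to ≈-trans; sym to ≈-sym; refl to ≈-refl)
  import Algebra.Solver.CommutativeMonoid series as CM
  open CM using (_⊜_; _⊕_)

  Σ : ℕ → (ℕ → ℤ) → ℤ
  Σ zero f = 0ℤ
  Σ (suc n) f = Σ n f ℤ.+ f n

  Σ-cong : ∀ n {f g} → (∀ k → k < n → f k ≡ g k) → Σ n f ≡ Σ n g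
  Σ-cong zero h = refl
  Σ-cong (suc n) h = cong₂ ℤ._+_ (Σ-cong n (λ k p → h k (ℕ.m≤n⇒m≤1+n p))) (h n ℕ.≤-refl)

  Σ-zero : ∀ n {f} → (∀ k → k < n → f k ≡ 0ℤ) → Σ n f ≡ 0ℤ
  Σ-zero zero h = refl
  Σ-zero (suc n) h = cong₂ ℤ._+_ (Σ-zero n (λ k p → h k (ℕ.m≤n⇒m≤1+n p))) (h n ℕ.≤-refl)

  Σ-split : ∀ m n f → Σ (m + n) f ≡ Σ m f ℤ.+ Σ n (λ k → f (m + k))
  Σ-split m zero f = trans (cong (λ z → Σ z f) (ℕ.+-identityʳ m)) (sym (+-identityʳ _))
  Σ-split m (suc n) f = trans (cong (λ z → Σ z f) (ℕ.+-suc m n)) (trans (cong (ℤ._+ f (m + n)) (Σ-split m n f)) (ℤ.+-assoc (Σ m f) _ _))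

  Σ-first : ∀ n f → Σ (suc n) f ≡ f 0 ℤ.+ Σ n (f ∘ suc)
  Σ-first n f = trans (Σ-split 1 n f) (cong (ℤ._+ Σ n (f ∘ suc)) (+-identityˡ (f 0)))

  Σ-reverse : ∀ n g → Σ n (λ i → g (n ∸ suc i)) ≡ Σ n g
  Σ-reverse zero g = refl
  Σ-reverse (suc n) g = trans (Σ-first n (λ i → g (n ∸ i))) (trans (cong (λ z → g n ℤ.+ z) (Σ-reverse n g)) (ℤ.+-comm (g n) (Σ n g)))

  Σ-- : ∀ n f g → Σ n (λ k → f k - g k) ≡ Σ n f - Σ n g
  Σ-- zero f g = refl
  Σ-- (suc n) f g = trans (cong (ℤ._+ (f n - g n)) (Σ-- n f g)) (eq (Σ n f) (Σ n g) (f n) (g n))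
    where
    eq : ∀ a b c d → a - b ℤ.+ (c - d) ≡ a ℤ.+ c - (b ℤ.+ d)
    eq = solve-∀

  Σ-single : ∀ n a f → a < n → (∀ k → k < n → k ≢ a → f k ≡ 0ℤ) → Σ n f ≡ f a
  Σ-single (suc n) a f a<n h with a ℕ.≟ n
  ... | yes refl = trans (cong (ℤ._+ f a) (Σ-zero n (λ k p → h k (ℕ.m≤n⇒m≤1+n p) (ℕ.<⇒≢ p)))) (+-identityˡ (f a))
  ... | no a≢ = trans (cong₂ ℤ._+_ (Σ-single n a f (ℕ.≤∧≢⇒< (ℕ.≤-pred a<n) a≢) (λ k p → h k (ℕ.m≤n⇒m≤1+n p))) (h n ℕ.≤-refl (λ e → a≢ (sym e)))) (+-identityʳ (f a))

  Σ-telescope : ∀ n (f : ℕ → ℤ) → Σ n (λ k → f (suc k) - f k) ≡ f n - f 0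
  Σ-telescope zero f = sym (ℤ.+-inverseʳ (f 0))
  Σ-telescope (suc n) f = trans (cong (ℤ._+ (f (suc n) - f n)) (Σ-telescope n f)) (eq (f 0) (f n) (f (suc n)))
    where
    eq : ∀ a b c → b - a ℤ.+ (c - b) ≡ c - a
    eq = solve-∀

  conv-Σˡ : ∀ m (f : ℕ → Series) g n → conv (λ k → Σ m (λ x → f x k)) g n ≡ Σ m (λ x → conv (f x) g n)
  conv-Σˡ zero f g n = conv-zeroˡ g (λ _ → refl) n
  conv-Σˡ (suc m) f g n = trans (conv-+ˡ (λ k → Σ m (λ x → f x k)) (f m) g n) (cong (ℤ._+ conv (f m) g n) (conv-Σˡ m f g n))

  conv-Σʳ : ∀ m g (f : ℕ → Series) n → conv g (λ k → Σ m (λ x → f x k)) n ≡ Σ m (λ x → conv g (f x) n)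
  conv-Σʳ m g f n = trans (conv-comm g (λ k → Σ m (λ x → f x k)) n) (trans (conv-Σˡ m f g n) (Σ-cong m (λ x _ → conv-comm (f x) g n)))

  conv--ˡ : ∀ f f' g n → conv (λ k → f k - f' k) g n ≡ conv f g n - conv f' g n
  conv--ˡ f f' g n = trans (conv-+ˡ f (λ k → - f' k) g n) (cong (λ z → conv f g n ℤ.+ z)
    (trans (conv-cong {λ k → - f' k} {λ k → - 1ℤ ℤ.* f' k} (λ k → sym (ℤ.-1*i≡-i (f' k))) (λ _ → refl) n) (trans (conv-*ˡ (- 1ℤ) f' g n) (ℤ.-1*i≡-i (conv f' g n)))))

  conv--ʳ : ∀ g f f' n → conv g (λ k → f k - f' k) n ≡ conv g f n - conv g f' n
  conv--ʳ g f f' n = trans (conv-comm g (λ k → f k - f' k) n) (trans (conv--ˡ f f' g n) (cong₂ _-_ (conv-comm f g n) (conv-comm f' g n)))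

  X-mono : ∀ k e n → conv (X k) (mono e) n ≡ mono (k + e) n - mono e n
  X-mono k e n = trans (conv-X k (mono e) n) (cong (_- mono e n) (shift-mono k e n))

  rect : (a b c m l : ℕ) → Series
  rect a b c m l n = Σ m (λ x → Σ l (λ y → mono (c + (x * a + y * b)) n))

  -- Two geometric series: the rectangle is x^c (x^(m a) - 1)(x^(l b) - 1) divided by (x^a - 1)(x^b
  -- - 1), and only its four corners remain.
  rect-X : ∀ a b c m l n → conv (X a) (conv (X b) (rect a b c m l)) n ≡
    mono (c + (m * a + l * b)) n - mono (c + l * b) n - (mono (c + m * a) n - mono c n)
  rect-X a b c m l n = begin
    conv (X a) (conv (X b) (rect a b c m l)) n
      ≡⟨ conv-cong {X a} {X a} (λ _ → refl) inner n ⟩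
    conv (X a) (λ k → Σ m (λ x → mono (c + (x * a + l * b)) k - mono (c + x * a) k)) n
      ≡⟨ conv-Σʳ m (X a) (λ x k → mono (c + (x * a + l * b)) k - mono (c + x * a) k) n ⟩
    Σ m (λ x → conv (X a) (λ k → mono (c + (x * a + l * b)) k - mono (c + x * a) k) n)
      ≡⟨ Σ-cong m (λ x _ → term x) ⟩
    Σ m (λ x → h (suc x) - h x)
      ≡⟨ Σ-telescope m h ⟩
    h m - h 0
      ≡⟨ cong (λ z → h m - (mono (c + l * b) n - mono z n)) (ℕ.+-identityʳ c) ⟩
    h m - (mono (c + l * b) n - mono c n)
      ≡⟨ eq₁ (mono (c + (m * a + l * b)) n) (mono (c + m * a) n) (mono (c + l * b) n) (mono c n) ⟩
    mono (c + (m * a + l * b)) n - mono (c + l * b) n - (mono (c + m * a) n - mono c n) ∎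
    where
    open ≡-Reasoning
    eq₁ : ∀ a b c d → a - b - (c - d) ≡ a - c - (b - d)
    eq₁ = solve-∀
    h : ℕ → ℤ
    h x = mono (c + (x * a + l * b)) n - mono (c + x * a) n
    ex₁ : ∀ b c xa y → b + (c + (xa + y)) ≡ c + (xa + (b + y))
    ex₁ = ℕR.solve-∀
    ex₂ : ∀ a c xa l → a + (c + (xa + l)) ≡ c + (a + xa + l)
    ex₂ = ℕR.solve-∀
    ex₃ : ∀ a c xa → a + (c + xa) ≡ c + (a + xa)
    ex₃ = ℕR.solve-∀
    eq₂ : ∀ a b c d → a - b - (c - d) ≡ (a - c) - (b - d)
    eq₂ = solve-∀
    inner : conv (X b) (rect a b c m l) ≈ (λ k → Σ m (λ x → mono (c + (x * a + l * b)) k - mono (c + x * a) k))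
    inner k = trans (conv-Σʳ m (X b) (λ x k → Σ l (λ y → mono (c + (x * a + y * b)) k)) k) (Σ-cong m (λ x _ →
      trans (conv-Σʳ l (X b) (λ y → mono (c + (x * a + y * b))) k)
      (trans (Σ-cong l (λ y _ → trans (X-mono b (c + (x * a + y * b)) k) (cong (λ z → mono z k - mono (c + (x * a + y * b)) k) (ex₁ b c (x * a) (y * b)))))
      (trans (Σ-telescope l (λ y → mono (c + (x * a + y * b)) k)) (cong (λ z → mono (c + (x * a + l * b)) k - mono (c + z) k) (ℕ.+-identityʳ (x * a)))))))
    term : ∀ x → conv (X a) (λ k → mono (c + (x * a + l * b)) k - mono (c + x * a) k) n ≡ h (suc x) - h x
    term x = trans (conv--ʳ (X a) (mono (c + (x * a + l * b))) (mono (c + x * a)) n)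
      (trans (cong₂ _-_ (trans (X-mono a (c + (x * a + l * b)) n) (cong (λ z → mono z n - mono (c + (x * a + l * b)) n) (ex₂ a c (x * a) (l * b))))
         (trans (X-mono a (c + x * a) n) (cong (λ z → mono z n - mono (c + x * a) n) (ex₃ a c (x * a)))))
       (eq₂ (mono (c + (suc x * a + l * b)) n) (mono (c + (x * a + l * b)) n) (mono (c + suc x * a) n) (mono (c + x * a) n)))

  rect-support : ∀ a b c m l → Supported (c + (m * a + l * b)) (rect a b c m l)
  rect-support a b c m l n h = Σ-zero m (λ x x<m → Σ-zero l (λ y y<l → mono-≢ _ n (ℕ.<⇒≢ (ℕ.≤-<-trans
    (ℕ.+-monoʳ-≤ c (ℕ.+-mono-≤ (ℕ.*-monoˡ-≤ a (ℕ.<⇒≤ x<m)) (ℕ.*-monoˡ-≤ b (ℕ.<⇒≤ y<l)))) h))))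

  -- With μ p + λ q = p q + 1, binary 1 is Φ_pq (for primes p ≠ q) and binary s is Φ_pq(x^s).
  module BinaryPoly (p q μ l : ℕ) (μ≤q : μ ≤ q) (l≤p : l ≤ p) (bezout : μ * p + l * q ≡ suc (p * q)) where

    -- The second rectangle consists of the points (x, y) with x ≥ μ, y ≥ λ, lowered by p q. Its
    -- corner μ p + λ q - p q = 1 explains the offset s.
    binary : ℕ → Series
    binary s n = rect (s * p) (s * q) 0 μ l n - rect (s * p) (s * q) s (q ∸ μ) (p ∸ l) n

    co-l : suc ((q ∸ μ) * p) ≡ l * q
    co-l = ℕ.+-cancelˡ-≡ (μ * p) _ _ (trans (ℕ.+-suc (μ * p) _) (trans (cong suc (trans (sym (ℕ.*-distribʳ-+ p μ (q ∸ μ))) (trans (cong (_* p) (ℕ.m+[n∸m]≡n μ≤q)) (ℕ.*-comm q p)))) (sym bezout)))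

    co-μ : suc ((p ∸ l) * q) ≡ μ * p
    co-μ = ℕ.+-cancelʳ-≡ (l * q) _ _ (trans (cong suc (trans (ℕ.+-comm ((p ∸ l) * q) (l * q)) (trans (sym (ℕ.*-distribʳ-+ q l (p ∸ l))) (cong (_* q) (ℕ.m+[n∸m]≡n l≤p))))) (sym bezout))

    -- Of the eight corners of the two rectangles, the Bézout relation makes two of the first
    -- coincide with two of the second. The other four are those of (x^s - 1)(x^(s p q) - 1).
    binary-equation : ∀ s → conv (X (s * p)) (conv (X (s * q)) (binary s)) ≈ conv (X s) (X (s * (p * q)))
    binary-equation s n = trans (conv-cong {X (s * p)} {X (s * p)} (λ _ → refl) (conv--ʳ (X (s * q)) R₁ R₂) n)
      (trans (conv--ʳ (X (s * p)) (conv (X (s * q)) R₁) (conv (X (s * q)) R₂) n)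
      (trans (cong₂ _-_ (rect-X (s * p) (s * q) 0 μ l n) (rect-X (s * p) (s * q) s (q ∸ μ) (p ∸ l) n))
      (trans (cong₂ _-_ (cong (λ z → mono z n - mono (l * (s * q)) n - (mono (μ * (s * p)) n - mono 0 n)) e₁)
                (trans (cong₂ (λ y z → mono y n - mono z n - (mono (s + (q ∸ μ) * (s * p)) n - mono s n)) e₄ e₃) (cong (λ z → mono (s * (p * q)) n - mono (μ * (s * p)) n - (mono z n - mono s n)) e₂)))
      (trans (eq (mono (s + s * (p * q)) n) (mono (l * (s * q)) n) (mono (μ * (s * p)) n) (mono 0 n) (mono (s * (p * q)) n) (mono s n))
        (sym (trans (conv--ʳ (X s) (mono (s * (p * q))) (mono 0) n) (cong₂ _-_ (X-mono s (s * (p * q)) n) (trans (X-mono s 0 n) (cong (λ z → mono z n - mono 0 n) (ℕ.+-identityʳ s))))))))))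
      where
      R₁ = rect (s * p) (s * q) 0 μ l
      R₂ = rect (s * p) (s * q) s (q ∸ μ) (p ∸ l)
      eq : ∀ a b c d e f → a - b - (c - d) - (e - c - (b - f)) ≡ a - e - (f - d)
      eq = solve-∀
      n₁ : ∀ s μ p l q → μ * (s * p) + l * (s * q) ≡ s * (μ * p + l * q)
      n₁ = ℕR.solve-∀
      n₂ : ∀ s u p → s + u * (s * p) ≡ s * suc (u * p)
      n₂ = ℕR.solve-∀
      n₃ : ∀ s l q → s * (l * q) ≡ l * (s * q)
      n₃ = ℕR.solve-∀
      n₄ : ∀ s u p v q → s + (u * (s * p) + v * (s * q)) ≡ s * (suc (u * p) + v * q)
      n₄ = ℕR.solve-∀
      e₁ : μ * (s * p) + l * (s * q) ≡ s + s * (p * q)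
      e₁ = trans (n₁ s μ p l q) (trans (cong (s *_) bezout) (ℕ.*-suc s (p * q)))
      e₂ : s + (q ∸ μ) * (s * p) ≡ l * (s * q)
      e₂ = trans (n₂ s (q ∸ μ) p) (trans (cong (s *_) co-l) (n₃ s l q))
      e₃ : s + (p ∸ l) * (s * q) ≡ μ * (s * p)
      e₃ = trans (n₂ s (p ∸ l) q) (trans (cong (s *_) co-μ) (n₃ s μ p))
      e₄ : s + ((q ∸ μ) * (s * p) + (p ∸ l) * (s * q)) ≡ s * (p * q)
      e₄ = trans (n₄ s (q ∸ μ) p (p ∸ l) q) (cong (s *_) (trans (cong (_+ (p ∸ l) * q) co-l) (trans (sym (ℕ.*-distribʳ-+ q l (p ∸ l))) (cong (_* q) (ℕ.m+[n∸m]≡n l≤p)))))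

    binary-support : ∀ s → ∃ λ B → Supported B (binary s)
    binary-support s = (0 + (μ * (s * p) + l * (s * q))) + (s + ((q ∸ μ) * (s * p) + (p ∸ l) * (s * q))) ,
      λ n h → cong₂ _-_ (rect-support (s * p) (s * q) 0 μ l n (ℕ.≤-<-trans (ℕ.m≤m+n _ _) h)) (rect-support (s * p) (s * q) s (q ∸ μ) (p ∸ l) n (ℕ.≤-<-trans (ℕ.m≤n+m _ (μ * (s * p) + l * (s * q))) h))

    binary-equation-1 : conv (X p) (conv (X q) (binary 1)) ≈ conv (X 1) (X (p * q))
    binary-equation-1 n = subst₂ (λ a b → conv (X a) (conv (X b) (binary 1)) n ≡ conv (X 1) (X (p * q)) n) (ℕ.*-identityˡ p) (ℕ.*-identityˡ q)
      (trans (binary-equation 1 n) (cong (λ z → conv (X 1) (X z) n) (ℕ.*-identityˡ (p * q))))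

  prime-coprime : ∀ {p q} → Prime p → Prime q → p ≢ q → Coprime q p
  prime-coprime pp pq ne {d} (d∣q , d∣p) with prime⇒irreducible pp d∣p
  ... | inj₁ e = e
  ... | inj₂ refl with prime⇒irreducible pq d∣q
  ... | inj₁ e = e
  ... | inj₂ e = ⊥-elim (ne e)

  bezout-from : ∀ p q l → 2 ≤ p → 1 ≤ q → l ≤ p → .{{_ : ℕ.NonZero p}} → (l * q) % p ≡ 1 → ∃ λ μ → μ ≤ q × μ * p + l * q ≡ suc (p * q)
  bezout-from p q l 2≤p 1≤q l≤p e = q ∸ k , ℕ.m∸n≤m q k , ℕ.+-cancelʳ-≡ 0 _ _ (cong (_+ 0) main)
    where
    open Data.Nat.DivMod using (_/_)
    k = (l * q) / p
    lq≡ : l * q ≡ suc (k * p)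
    lq≡ = trans (m≡m%n+[m/n]*n (l * q) p) (cong (_+ k * p) e)
    k≤q : k ≤ q
    k≤q = ℕ.*-cancelʳ-≤ k q p (ℕ.≤-trans (ℕ.n≤1+n (k * p)) (ℕ.≤-trans (ℕ.≤-reflexive (sym lq≡)) (ℕ.≤-trans (ℕ.*-monoˡ-≤ q l≤p) (ℕ.≤-reflexive (ℕ.*-comm p q)))))
    main : (q ∸ k) * p + l * q ≡ suc (p * q)
    main = trans (cong ((q ∸ k) * p +_) lq≡) (trans (ℕ.+-suc ((q ∸ k) * p) (k * p)) (cong suc (trans (sym (ℕ.*-distribʳ-+ p (q ∸ k) k)) (trans (cong (_* p) (ℕ.m∸n+n≡m k≤q)) (ℕ.*-comm q p)))))

  -- Any inverse of q modulo p serves as λ here. It is applied to all three pairs among p, q, r.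
  Φ-binary : ∀ {p q} → Prime p → Prime q → p < q → (conv (Φ 1) (conv (Φ p) (conv (Φ q) (Φ (p * q)))) ≈ X (p * q)) × IsMonic (cyclotomic (p * q))
  Φ-binary {p} {q} pp pq p<q = Φ-two-product pp pq (binary 1) (proj₁ two) binary-equation-1 , proj₂ two
    where
    instance
      p≢0 : ℕ.NonZero p
      p≢0 = prime⇒nonZero pp
    inverse = UnitGroup.inverse-exists p (prime>1 pp) q (prime-coprime pp pq (ℕ.<⇒≢ p<q))
    l = proj₁ inverse % p
    l-inverse : (l * q) % p ≡ 1
    l-inverse = trans (UnitGroup.%-* p (prime>1 pp) {l} {proj₁ inverse} {q} {q} (Data.Nat.DivMod.m%n%n≡m%n (proj₁ inverse) p) refl) (trans (cong (_% p) (ℕ.*-comm (proj₁ inverse) q)) (proj₂ inverse))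
    bz = bezout-from p q l (prime>1 pp) (ℕ.<⇒≤ (prime>1 pq)) (m%n≤n (proj₁ inverse) p) l-inverse
    open BinaryPoly p q (proj₁ bz) l (proj₁ (proj₂ bz)) (m%n≤n (proj₁ inverse) p) (proj₂ (proj₂ bz))
    two = Φ-two pp pq p<q (binary 1) (proj₁ (binary-support 1)) (proj₂ (binary-support 1)) binary-equation-1

  -- Φ_pqr(x) = Φ_pq(x^r)/Φ_pq(x): A is Φ_pq(x^r), and the equation for F writes Φ_pq as (x -
  -- 1)(x^(pq) - 1)/((x^p - 1)(x^q - 1)). The factors at proper divisors are regrouped into the
  -- known products for one and two primes, and x^p - 1, x^q - 1, x^r - 1 cancel.
  Φ-three : ∀ {p q r} → Prime p → Prime q → Prime r → p < q → p * q < r → ∀ F A B → Supported B F →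
    conv F (conv (X 1) (X (p * q))) ≈ conv A (conv (X p) (X q)) → conv (X (r * p)) (conv (X (r * q)) A) ≈ conv (X r) (X (r * (p * q))) →
    Φ (p * q * r) ≈ F
  Φ-three {p} {q} {r} pp pq pr p<q pq<r F A B hB hF hA = proj₁ (evaluate-list n ds F B (ℕ.≤-trans 1≤pq pq≤n) sorted props complete hB
      (cancel (X r) (conv g F) (X n) (r-unit r (prime>1 pr)) (cancel (X q) (conv (X r) (conv g F)) (conv (X r) (X n)) (r-unit q (prime>1 pq))
        (cancel (X p) (conv (X q) (conv (X r) (conv g F))) (conv (X q) (conv (X r) (X n))) (r-unit p (prime>1 pp)) main))))
    where
    n = p * q * r
    ds = 1 ∷ p ∷ q ∷ p * q ∷ r ∷ p * r ∷ q * r ∷ []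
    g = listProduct Φ ds
    1<p = prime>1 pp
    1<q = prime>1 pq
    1<r = prime>1 pr
    q<pq : q < p * q
    q<pq = subst (q <_) (ℕ.*-comm q p) (p<pq pq pp)
    r<pr : r < p * r
    r<pr = subst (r <_) (ℕ.*-comm r p) (p<pq pr pp)
    pr<qr : p * r < q * r
    pr<qr = ℕ.*-monoˡ-< r {{prime⇒nonZero pr}} p<q
    1≤pq : 1 ≤ p * q
    1≤pq = ℕ.<⇒≤ (ℕ.<-trans 1<p (p<pq pp pq))
    pq≤n : p * q ≤ n
    pq≤n = ℕ.m≤m*n (p * q) r {{prime⇒nonZero pr}}
    qr<n : q * r < n
    qr<n = ℕ.*-monoˡ-< r {{prime⇒nonZero pr}} q<pq
    r-unit : ∀ k → 1 < k → X k 0 ≡ - 1ℤ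
    r-unit (suc k) _ = refl
    p<r = ℕ.<-trans (p<pq pp pq) pq<r
    q<r = ℕ.<-trans q<pq pq<r
    sorted : AllPairs _<_ ds
    sorted = (1<p ∷ 1<q ∷ ℕ.<-trans 1<q q<pq ∷ 1<r ∷ ℕ.<-trans 1<r r<pr ∷ ℕ.<-trans 1<r (ℕ.<-trans r<pr pr<qr) ∷ [])
      ∷ (p<q ∷ p<pq pp pq ∷ p<r ∷ ℕ.<-trans p<r r<pr ∷ ℕ.<-trans p<r (ℕ.<-trans r<pr pr<qr) ∷ [])
      ∷ (q<pq ∷ q<r ∷ ℕ.<-trans q<r r<pr ∷ ℕ.<-trans q<r (ℕ.<-trans r<pr pr<qr) ∷ [])
      ∷ (pq<r ∷ ℕ.<-trans pq<r r<pr ∷ ℕ.<-trans pq<r (ℕ.<-trans r<pr pr<qr) ∷ [])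
      ∷ (r<pr ∷ ℕ.<-trans r<pr pr<qr ∷ []) ∷ (pr<qr ∷ []) ∷ [] ∷ []
    Pq = Φ-binary pp pq p<q
    Pr = Φ-binary pp pr p<r
    Qr = Φ-binary pq pr q<r
    props : All (λ d → (1 ≤ d × d < n) × d ∣ n × IsMonic (cyclotomic d)) ds
    props = ((s≤s z≤n , ℕ.≤-<-trans (ℕ.<⇒≤ 1<q) (ℕ.<-trans (p<pq pq pr) qr<n)) , 1∣ n , proj₂ Φ₁)
      ∷ ((ℕ.<⇒≤ 1<p , ℕ.<-trans p<q (ℕ.<-trans (p<pq pq pr) qr<n)) , ∣-trans (m∣m*n q) (m∣m*n r) , proj₂ (Φ-prime pp))
      ∷ ((ℕ.<⇒≤ 1<q , ℕ.<-trans (p<pq pq pr) qr<n) , ∣-trans (n∣m*n p) (m∣m*n r) , proj₂ (Φ-prime pq))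
      ∷ ((1≤pq , ℕ.<-trans pq<r (ℕ.<-trans r<pr (ℕ.<-trans pr<qr qr<n))) , m∣m*n r , proj₂ Pq)
      ∷ ((ℕ.<⇒≤ 1<r , ℕ.<-trans r<pr (ℕ.<-trans pr<qr qr<n)) , n∣m*n (p * q) , proj₂ (Φ-prime pr))
      ∷ ((ℕ.<⇒≤ (ℕ.<-trans 1<r r<pr) , ℕ.<-trans pr<qr qr<n) , *-monoˡ-∣ r (m∣m*n {p} q) , proj₂ Pr)
      ∷ ((ℕ.<⇒≤ (ℕ.<-trans 1<r (ℕ.<-trans r<pr pr<qr)) , qr<n) , *-monoˡ-∣ r (n∣m*n p) , proj₂ Qr) ∷ []
    complete : ∀ d → d ∣ n → d ∈ ds ⊎ d ≡ n
    complete d h with divides-prime-* r (p * q) pr (subst (d ∣_) (ℕ.*-comm (p * q) r) h)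
    complete d h | inj₁ d∣ with Products.divisors pp pq d d∣
    ... | inj₁ x = inj₁ (here x)
    ... | inj₂ (inj₁ x) = inj₁ (there (here x))
    ... | inj₂ (inj₂ (inj₁ x)) = inj₁ (there (there (here x)))
    ... | inj₂ (inj₂ (inj₂ x)) = inj₁ (there (there (there (here x))))
    complete d h | inj₂ (e , refl , e∣) with Products.divisors pp pq e e∣
    ... | inj₁ refl = inj₁ (there (there (there (there (here (ℕ.*-identityʳ r))))))
    ... | inj₂ (inj₁ refl) = inj₁ (there (there (there (there (there (here (ℕ.*-comm r e)))))))
    ... | inj₂ (inj₂ (inj₁ refl)) = inj₁ (there (there (there (there (there (there (here (ℕ.*-comm r e))))))))
    ... | inj₂ (inj₂ (inj₂ refl)) = inj₂ (ℕ.*-comm r e)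
    sy : ∀ {f g} → f ≈ g → g ≈ f
    sy {f} {g} = ≈-sym {f} {g}
    rf : ∀ {f} → f ≈ f
    rf {f} = ≈-refl {f}
    E₁ = conv (Φ 1) (conv (Φ p) (conv (Φ q) (Φ (p * q))))
    E₂ = conv (Φ 1) (conv (Φ p) (conv (Φ r) (Φ (p * r))))
    E₃ = conv (Φ 1) (conv (Φ q) (conv (Φ r) (Φ (q * r))))
    main : conv (X p) (conv (X q) (conv (X r) (conv g F))) ≈ conv (X p) (conv (X q) (conv (X r) (X n)))
    main k = trans (conv-cong (sy (proj₁ (Φ-prime pp))) (conv-cong (sy (proj₁ (Φ-prime pq))) (conv-cong (sy (proj₁ (Φ-prime pr))) (rf {conv g F}))) k)
      (trans (CM.solve 8 (λ a b c d x y z f → ((a ⊕ b) ⊕ ((a ⊕ c) ⊕ ((a ⊕ d) ⊕ ((a ⊕ (b ⊕ (c ⊕ (x ⊕ (d ⊕ (y ⊕ (z ⊕ CM.id))))))) ⊕ f)))) ⊜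
          ((f ⊕ (a ⊕ (a ⊕ (b ⊕ (c ⊕ x))))) ⊕ ((a ⊕ (b ⊕ (d ⊕ y))) ⊕ (a ⊕ (c ⊕ (d ⊕ z)))))) (λ _ → refl) (Φ 1) (Φ p) (Φ q) (Φ r) (Φ (p * q)) (Φ (p * r)) (Φ (q * r)) F k)
      (trans (conv-cong (conv-cong (rf {F}) (conv-cong (proj₁ Φ₁) (proj₁ Pq))) (conv-cong (proj₁ Pr) (proj₁ Qr)) k)
      (trans (conv-cong hF (conv-cong (λ j → cong (λ z → X z j) (ℕ.*-comm p r)) (λ j → cong (λ z → X z j) (ℕ.*-comm q r))) k)
      (trans (CM.solve 5 (λ a b c d e → ((a ⊕ (b ⊕ c)) ⊕ (d ⊕ e)) ⊜ (b ⊕ (c ⊕ (d ⊕ (e ⊕ a))))) (λ _ → refl) A (X p) (X q) (X (r * p)) (X (r * q)) k)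
        (conv-cong (rf {X p}) (conv-cong (rf {X q}) (λ j → trans (hA j) (cong (λ z → conv (X r) (X z) j) (ℕ.*-comm r (p * q))))) k)))))

-- Coefficients of Φ_pqr as sums over a walk in the grid

module TernaryCyclotomic where
  open import Data.Nat using (_+_; _*_; _≤_; _<_)
  open import Data.Nat.Primality
  open import Data.Nat.DivMod
  open import Data.Nat.Divisibility
  open import Data.Nat.Coprimality as C using (Coprime)
  open import Data.Integer as ℤ using (ℤ; _-_; -_)
  open import Data.Integer.Properties as ℤ using (+-identityˡ; +-identityʳ; *-identityˡ; *-identityʳ; *-zeroˡ; *-zeroʳ)
  open import Data.Integer.Tactic.RingSolver using (solve-∀)
  open import Algebra.Bundles using (CommutativeMonoid)
  open PowerSeries
  open CyclotomicFactors using (prime>1; Φ)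
  open BinaryCyclotomic
  open CommutativeMonoid series using () renaming (trans to ≈-trans; sym to ≈-sym; refl to ≈-refl)
  import Algebra.Solver.CommutativeMonoid series as CM
  open CM using (_⊜_; _⊕_)
  open import Function.Bundles using (_⇔_; mk⇔)

  -- The l of the code is λ; the paper's l enters only through λ and β.
  record TernaryData : Set where
    field
      p q r μ l' β' : ℕ
      pp : Prime p
      pq : Prime q
      pr : Prime r
      p<q : p < q
      pq<r : p * q < r
      μ≤q : μ ≤ q
      l+β≡p : suc l' + suc β' ≡ p
      bezout : μ * p + suc l' * q ≡ suc (p * q)

    l β : ℕ
    l = suc l'
    β = suc β'

    l≤p : l ≤ p
    l≤p = subst (l ≤_) l+β≡p (ℕ.m≤m+n l β)

  module Coefficients (D : TernaryData) where
    open TernaryData D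
    open BinaryPoly p q μ l μ≤q l≤p bezout

    N : ℕ
    N = p * q

    1<p : 1 < p
    1<p = prime>1 pp

    1<q : 1 < q
    1<q = prime>1 pq

    p+q<N : suc (q + p) ≤ N
    p+q<N = ℕ.≤-trans (ℕ.+-monoʳ-< q p<q) (ℕ.≤-trans (ℕ.≤-reflexive (cong (q +_) (sym (ℕ.+-identityʳ q)))) (ℕ.*-monoˡ-≤ q 1<p))

    1<N : 1 < N
    1<N = ℕ.≤-trans (s≤s (ℕ.≤-trans (ℕ.<⇒≤ 1<q) (ℕ.m≤m+n q p))) p+q<N

    instance
      p≢0 : ℕ.NonZero p
      p≢0 = prime⇒nonZero pp
      q≢0 : ℕ.NonZero q
      q≢0 = prime⇒nonZero pq
      r≢0 : ℕ.NonZero r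
      r≢0 = prime⇒nonZero pr
      N≢0 : ℕ.NonZero N
      N≢0 = ℕ.>-nonZero (ℕ.<⇒≤ 1<N)

    %-+ : ∀ m .{{_ : ℕ.NonZero m}} {a a' b b'} → a % m ≡ a' % m → b % m ≡ b' % m → (a + b) % m ≡ (a' + b') % m
    %-+ m {a} {a'} {b} {b'} h k = trans (%-distribˡ-+ a b m) (trans (cong₂ (λ x y → (x + y) % m) h k) (sym (%-distribˡ-+ a' b' m)))

    %-cancel-+ : ∀ m .{{_ : ℕ.NonZero m}} c a b → (a + c) % m ≡ (b + c) % m → a % m ≡ b % m
    %-cancel-+ m c a b h = trans (sym (clear a)) (trans (%-+ m {a + c} {b + c} {c * ℕ.pred m} {c * ℕ.pred m} h refl) (clear b))
      where
      eq : ∀ a c k → a + c + c * k ≡ a + c * suc k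
      eq = ℕR.solve-∀
      clear : ∀ a → (a + c + c * ℕ.pred m) % m ≡ a % m
      clear a = trans (cong (_% m) (trans (eq a c (ℕ.pred m)) (cong (λ z → a + c * z) (ℕ.suc-pred m)))) ([m+kn]%n≡m%n a c m)

    %-≤-∣ : ∀ m .{{_ : ℕ.NonZero m}} a b → a ≤ b → a % m ≡ b % m → m ∣ b ∸ a
    %-≤-∣ m a b a≤b e = subst (m ∣_) (sym eq) (∣m+n∣m⇒∣n (subst (m ∣_) (sym sum≡) (n∣m*n (b / m))) (n∣m*n (a / m)))
      where
      d = b ∸ a
      eq : b ∸ a ≡ d
      eq = refl
      open ≡-Reasoning
      sum≡ : a / m * m + d ≡ b / m * m
      sum≡ = ℕ.+-cancelˡ-≡ (a % m) _ _ (begin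
        a % m + (a / m * m + d) ≡⟨ sym (ℕ.+-assoc (a % m) (a / m * m) d) ⟩
        a % m + a / m * m + d ≡⟨ cong (_+ d) (sym (m≡m%n+[m/n]*n a m)) ⟩
        a + d ≡⟨ ℕ.m+[n∸m]≡n a≤b ⟩
        b ≡⟨ m≡m%n+[m/n]*n b m ⟩
        b % m + b / m * m ≡⟨ cong (_+ b / m * m) (sym e) ⟩
        a % m + b / m * m ∎)

    ∣-% : ∀ m .{{_ : ℕ.NonZero m}} a b → a ≤ b → m ∣ b ∸ a → a % m ≡ b % m
    ∣-% m a b a≤b (divides k e) = sym (trans (cong (_% m) (trans (sym (ℕ.m+[n∸m]≡n a≤b)) (cong (a +_) e))) ([m+kn]%n≡m%n a k m))

    q⊥p : Coprime q p
    q⊥p = prime-coprime pp pq (ℕ.<⇒≢ p<q)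

    p*∣ : ∀ {d} → p ∣ d → q ∣ d → N ∣ d
    p*∣ {d} (divides k refl) q∣ with C.coprime-divisor q⊥p (subst (q ∣_) (ℕ.*-comm k p) q∣)
    ... | divides j refl = divides j (trans (ℕ.*-assoc j q p) (cong (j *_) (ℕ.*-comm q p)))

    chinese : ∀ a b → a % p ≡ b % p → a % q ≡ b % q → a % N ≡ b % N
    chinese a b hp hq with ℕ.≤-total a b
    ... | inj₁ a≤b = ∣-% N a b a≤b (p*∣ (%-≤-∣ p a b a≤b hp) (%-≤-∣ q a b a≤b hq))
    ... | inj₂ b≤a = sym (∣-% N b a b≤a (p*∣ (%-≤-∣ p b a b≤a (sym hp)) (%-≤-∣ q b a b≤a (sym hq))))

    mod-p : ∀ a b → a % N ≡ b % N → a % p ≡ b % p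
    mod-p a b h = trans (sym (m%n%m a)) (trans (cong (_% p) h) (m%n%m b))
      where
      m%n%m : ∀ a → a % N % p ≡ a % p
      m%n%m a = sym (trans (cong (_% p) (trans (m≡m%n+[m/n]*n a N) (cong (a % N +_) (trans (cong (a / N *_) (ℕ.*-comm p q)) (sym (ℕ.*-assoc (a / N) q p)))))) ([m+kn]%n≡m%n (a % N) (a / N * q) p))

    mod-q : ∀ a b → a % N ≡ b % N → a % q ≡ b % q
    mod-q a b h = trans (sym (m%n%m a)) (trans (cong (_% q) h) (m%n%m b))
      where
      m%n%m : ∀ a → a % N % q ≡ a % q
      m%n%m a = sym (trans (cong (_% q) (trans (m≡m%n+[m/n]*n a N) (cong (a % N +_) (sym (ℕ.*-assoc (a / N) p q))))) ([m+kn]%n≡m%n (a % N) (a / N * p) q))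

    h : ℕ → ℕ → ℕ
    h x y = x * p + y * q

    p<r : p < r
    p<r = ℕ.<-trans (ℕ.<-≤-trans p<q (ℕ.≤-trans (ℕ.m≤m+n q p) (ℕ.<⇒≤ p+q<N))) pq<r

    q<r : q < r
    q<r = ℕ.<-trans (ℕ.≤-trans (s≤s (ℕ.m≤m+n q p)) p+q<N) pq<r

    rh-mod-p : ∀ x y → (r * h x y) % p ≡ (r * q * y) % p
    rh-mod-p x y = trans (cong (_% p) (eq r x p y q)) (%-remove-+ˡ (r * q * y) (n∣m*n (r * x)))
      where
      eq : ∀ r x p y q → r * (x * p + y * q) ≡ r * x * p + r * q * y
      eq = ℕR.solve-∀

    rh-mod-q : ∀ x y → (r * h x y) % q ≡ (r * p * x) % q
    rh-mod-q x y = trans (cong (_% q) (eq r x p y q)) (%-remove-+ˡ (r * p * x) (n∣m*n (r * y)))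
      where
      eq : ∀ r x p y q → r * (x * p + y * q) ≡ r * y * q + r * p * x
      eq = ℕR.solve-∀

    rq-unit : Coprime (r * q) p
    rq-unit = UnitGroup.coprime-* p 1<p {r} {q} (prime-coprime pp pr (ℕ.<⇒≢ p<r)) q⊥p

    rp-unit : Coprime (r * p) q
    rp-unit = UnitGroup.coprime-* q 1<q {r} {p} (prime-coprime pq pr (ℕ.<⇒≢ q<r)) (C.sym q⊥p)

    small : ∀ m .{{_ : ℕ.NonZero m}} {x} → x < m → x % m ≡ x
    small m lt = m<n⇒m%n≡m lt

    module Modulus (m : ℕ) (1<m : 1 < m) .{{nz : ℕ.NonZero m}} (u : ℕ) (c : Coprime u m) where

      *-cong : ∀ {a a' b b'} → a % m ≡ a' % m → b % m ≡ b' % m → (a * b) % m ≡ (a' * b') % m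
      *-cong {a} {a'} {b} {b'} e f = UnitGroup.%-* m 1<m {a} {a'} {b} {b'} e f

      cancel-unit : ∀ {a b} → (u * a) % m ≡ (u * b) % m → a % m ≡ b % m
      cancel-unit {a} {b} e = UnitGroup.unit-cancel m 1<m (u , c) a b e

      injective : ∀ {a b} → a < m → b < m → (u * a) % m ≡ (u * b) % m → a ≡ b
      injective {a} {b} a< b< e = trans (sym (small m a<)) (trans (cancel-unit {a} {b} e) (small m b<))

      inverse : ∃ λ v → (u * v) % m ≡ 1
      inverse = UnitGroup.inverse-exists m 1<m u c

      1%m : 1 % m ≡ 1
      1%m = small m 1<m

      solution : ℕ → ℕ
      solution n = (proj₁ inverse * n) % m

      solves : ∀ n → (u * solution n) % m ≡ n % m
      solves n = begin
        (u * ((v * n) % m)) % m  ≡⟨ *-cong {u} {u} {(v * n) % m} {v * n} refl (m%n%n≡m%n (v * n) m) ⟩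
        (u * (v * n)) % m        ≡⟨ cong (_% m) (sym (ℕ.*-assoc u v n)) ⟩
        (u * v * n) % m          ≡⟨ *-cong {u * v} {1} {n} {n} (trans (proj₂ inverse) (sym 1%m)) refl ⟩
        (1 * n) % m                ≡⟨ cong (_% m) (ℕ.*-identityˡ n) ⟩
        n % m ∎
        where
        open ≡-Reasoning
        v = proj₁ inverse

    module ModP = Modulus p 1<p (r * q) rq-unit
    module ModQ = Modulus q 1<q (r * p) rp-unit

    rh-injective : ∀ x y x' y' → x < q → y < p → x' < q → y' < p → (r * h x y) % N ≡ (r * h x' y') % N → x ≡ x' × y ≡ y'
    rh-injective x y x' y' x< y< x'< y'< e =
      ModQ.injective x< x'< (trans (sym (rh-mod-q x y)) (trans (mod-q _ _ e) (rh-mod-q x' y'))) ,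
      ModP.injective y< y'< (trans (sym (rh-mod-p x y)) (trans (mod-p _ _ e) (rh-mod-p x' y')))

    rh-surjective : ∀ n → ∃ λ x → ∃ λ y → x < q × y < p × (r * h x y) % N ≡ n % N
    rh-surjective n = x , y , m%n<n (proj₁ ModQ.inverse * n) q , m%n<n (proj₁ ModP.inverse * n) p ,
        chinese (r * h x y) n (trans (rh-mod-p x y) (ModP.solves n)) (trans (rh-mod-q x y) (ModQ.solves n))
      where
      x = ModQ.solution n
      y = ModP.solution n

    -- The series x^e/(1 - x^(pq)) for e < p q.
    I : ℕ → Series
    I e n = mono e (n % N)

    -- The power series 1/Φ_pq(x) = (1 + x + ⋯ + x^(p-1))(1 - x^q)/(1 - x^(pq)).
    c : Series
    c n = Σ p (λ i → I i n - I (q + i) n)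

    F : Series
    F = conv (binary r) c

    X-I : ∀ e → e < N → conv (X N) (I e) ≈ (λ n → - mono e n)
    X-I e e<N n = trans (conv-X N (I e) n) (go (N ℕ.≤? n))
      where
      go : Dec (N ≤ n) → shift N (I e) n - I e n ≡ - mono e n
      go (no N≰n) = trans (cong₂ _-_ (shift-> N (I e) n (ℕ.≰⇒> N≰n)) (cong (mono e) (m<n⇒m%n≡m (ℕ.≰⇒> N≰n)))) (+-identityˡ (- mono e n))
      go (yes N≤n) = trans (cong₂ _-_ (trans (shift-≤ N (I e) n N≤n) (cong (mono e) (trans (sym ([m+n]%n≡m%n (n ∸ N) N)) (cong (_% N) (ℕ.m∸n+n≡m N≤n))))) refl)
        (trans (ℤ.+-inverseʳ (I e n)) (cong -_ (sym (mono-≢ e n (λ e≡n → ℕ.<⇒≱ e<N (subst (N ≤_) (sym e≡n) N≤n))))))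

    q+i<N : ∀ {i} → i < p → q + i < N
    q+i<N i<p = ℕ.<-trans (ℕ.+-monoʳ-< q i<p) p+q<N

    c-equation : conv c (conv (X 1) (X N)) ≈ conv (X p) (X q)
    c-equation n = begin
      conv c (conv (X 1) (X N)) n
        ≡⟨ CM.solve 3 (λ c x y → (c ⊕ (x ⊕ y)) ⊜ (x ⊕ (y ⊕ c))) (λ _ → refl) c (X 1) (X N) n ⟩
      conv (X 1) (conv (X N) c) n
        ≡⟨ conv-cong {X 1} {X 1} (λ _ → refl) XN n ⟩
      conv (X 1) (λ k → Σ p (λ i → mono (q + i) k - mono i k)) n
        ≡⟨ conv-Σʳ p (X 1) (λ i k → mono (q + i) k - mono i k) n ⟩
      Σ p (λ i → conv (X 1) (λ k → mono (q + i) k - mono i k) n)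
        ≡⟨ Σ-cong p (λ i _ → trans (conv--ʳ (X 1) (mono (q + i)) (mono i) n) (trans (cong₂ _-_ (X-mono 1 (q + i) n) (X-mono 1 i n))
             (trans (cong (λ z → mono z n - mono (q + i) n - (mono (suc i) n - mono i n)) (sym (ℕ.+-suc q i))) (eq (mono (q + suc i) n) (mono (q + i) n) (mono (suc i) n) (mono i n))))) ⟩
      Σ p (λ i → (mono (q + suc i) n - mono (suc i) n) - (mono (q + i) n - mono i n))
        ≡⟨ Σ-telescope p (λ i → mono (q + i) n - mono i n) ⟩
      (mono (q + p) n - mono p n) - (mono (q + 0) n - mono 0 n)
        ≡⟨ cong₂ (λ y z → (mono y n - mono p n) - (mono z n - mono 0 n)) (ℕ.+-comm q p) (ℕ.+-identityʳ q) ⟩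
      (mono (p + q) n - mono p n) - (mono q n - mono 0 n)
        ≡⟨ sym (trans (conv--ʳ (X p) (mono q) (mono 0) n) (trans (cong₂ _-_ (X-mono p q n) (trans (X-mono p 0 n) (cong (λ z → mono z n - mono 0 n) (ℕ.+-identityʳ p)))) (eq (mono (p + q) n) (mono q n) (mono p n) (mono 0 n)))) ⟩
      conv (X p) (X q) n ∎
      where
      open ≡-Reasoning
      eq : ∀ a b c d → a - b - (c - d) ≡ a - c - (b - d)
      eq = solve-∀
      eq₂ : ∀ a b → - a - - b ≡ b - a
      eq₂ = solve-∀
      XN : conv (X N) c ≈ (λ k → Σ p (λ i → mono (q + i) k - mono i k))
      XN k = trans (conv-Σʳ p (X N) (λ i k → I i k - I (q + i) k) k) (Σ-cong p (λ i i<p → trans (conv--ʳ (X N) (I i) (I (q + i)) k)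
        (trans (cong₂ _-_ (X-I i (ℕ.≤-<-trans (ℕ.m≤n+m i q) (q+i<N i<p)) k) (X-I (q + i) (q+i<N i<p) k)) (eq₂ (mono i k) (mono (q + i) k)))))

    F-equation : conv F (conv (X 1) (X N)) ≈ conv (binary r) (conv (X p) (X q))
    F-equation n = trans (conv-assoc (binary r) c (conv (X 1) (X N)) n) (conv-cong {binary r} {binary r} (λ _ → refl) c-equation n)

    Φ≈F : ∀ B → Supported B F → Φ (p * q * r) ≈ F
    Φ≈F B hB = Φ-three pp pq pr p<q pq<r F (binary r) B hB F-equation (binary-equation r)

    -- One summand of the periodic series at a time: Φ_pq(x^r) x^e/(1 - x^(pq)).
    K : ℕ → Series
    K e = conv (binary r) (I e)

    F-K : ∀ n → F n ≡ Σ p (λ i → K i n - K (q + i) n)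
    F-K n = trans (conv-Σʳ p (binary r) (λ i k → I i k - I (q + i) k) n) (Σ-cong p (λ i _ → conv--ʳ (binary r) (I i) (I (q + i)) n))

    ind : ∀ {P : Set} → Dec P → ℤ
    ind (yes _) = 1ℤ
    ind (no _) = 0ℤ

    ind-yes : ∀ {P : Set} (d : Dec P) → P → ind d ≡ 1ℤ
    ind-yes (yes _) _ = refl
    ind-yes (no ¬p) p = ⊥-elim (¬p p)

    ind-no : ∀ {P : Set} (d : Dec P) → ¬ P → ind d ≡ 0ℤ
    ind-no (yes p) ¬p = ⊥-elim (¬p p)
    ind-no (no _) _ = refl

    ind-iff : ∀ {P Q : Set} (d : Dec P) (e : Dec Q) → (P → Q) → (Q → P) → ind d ≡ ind e
    ind-iff (yes p) e f g = sym (ind-yes e (f p))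
    ind-iff (no ¬p) e f g = sym (ind-no e (λ q → ¬p (g q)))

    never : Dec ⊥
    never = no (λ ())

    -- The coefficient of Φ_pq at x p + y q mod p q, cut off after J.
    bv : ∀ {P Q R S : Set} → Dec P → Dec Q → Dec R → Dec S → ℤ
    bv (yes _) (yes _) d _ = ind d
    bv (yes _) (no _) _ _ = 0ℤ
    bv (no _) (yes _) _ _ = 0ℤ
    bv (no _) (no _) _ d = - ind d

    -- Where x ≥ μ and y ≥ λ the exponent in Φ_pq is x p + y q - p q, so the cut-off J becomes J +
    -- N.
    b : ℕ → ℕ → ℕ → ℤ
    b J x y = bv (x ℕ.<? μ) (y ℕ.<? l) (h x y ℕ.≤? J) (h x y ℕ.≤? J + N)

    ≤-div : ∀ E n → r * E ≤ n → E ≤ n / r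
    ≤-div E n le = subst (_≤ n / r) (m*n/n≡m E r) (/-monoˡ-≤ r (ℕ.≤-trans (ℕ.≤-reflexive (ℕ.*-comm E r)) le))

    div-≤ : ∀ E n → E ≤ n / r → r * E ≤ n
    div-≤ E n le = ℕ.≤-trans (ℕ.*-monoʳ-≤ r le) (ℕ.≤-trans (ℕ.≤-reflexive (ℕ.*-comm r (n / r))) (m/n*n≤m n r))

    module _ (n e x y : ℕ) (e<N : e < N) (x<q : x < q) (y<p : y < p) (hn : (r * h x y + e) % N ≡ n % N) where

      shift-I : ∀ s → (s ≤ n → (s + e) % N ≡ n % N) → shift s (I e) n ≡ ind (s ℕ.≤? n)
      shift-I s f with s ℕ.≤? n
      ... | no s≰n = shift-> s (I e) n (ℕ.≰⇒> s≰n)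
      ... | yes s≤n = trans (shift-≤ s (I e) n s≤n) (trans (cong (mono e) same) (mono-refl e))
        where
        same : (n ∸ s) % N ≡ e
        same = trans (%-cancel-+ N {{N≢0}} s (n ∸ s) e (trans (cong (λ z → _%_ z N {{N≢0}}) (ℕ.m∸n+n≡m s≤n)) (trans (sym (f s≤n)) (cong (_% N) (ℕ.+-comm s e))))) (small N {{N≢0}} e<N)

      shift-I-0 : ∀ s → (s ≤ n → (s + e) % N ≢ n % N) → shift s (I e) n ≡ 0ℤ
      shift-I-0 s f with s ℕ.≤? n
      ... | no s≰n = shift-> s (I e) n (ℕ.≰⇒> s≰n)
      ... | yes s≤n = trans (shift-≤ s (I e) n s≤n) (mono-≢ e _ (λ same → f s≤n (trans (cong (_% N) (ℕ.+-comm s e))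
          (trans (%-+ N {e} {n ∸ s} {s} {s} (trans (small N {{N≢0}} e<N) same) refl) (cong (λ z → _%_ z N {{N≢0}}) (ℕ.m∸n+n≡m s≤n))))))

      shift-point : ∀ x' y' s → x' < q → y' < p → (s + e) % N ≡ (r * h x' y' + e) % N → (x' ≢ x ⊎ y' ≢ y) → shift s (I e) n ≡ 0ℤ
      shift-point x' y' s x'<q y'<p es ne = shift-I-0 s (λ _ q → absurd ne (rh-injective x' y' x y x'<q y'<p x<q y<p (%-cancel-+ N e _ _ (trans (sym es) (trans q (sym hn))))))
        where
        absurd : x' ≢ x ⊎ y' ≢ y → x' ≡ x × y' ≡ y → ⊥
        absurd (inj₁ f) (a , b) = f a
        absurd (inj₂ f) (a , b) = f b

      ex₁ : ∀ x y r p q → 0 + (x * (r * p) + y * (r * q)) ≡ r * (x * p + y * q)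
      ex₁ = ℕR.solve-∀

      ex₂ : ∀ x y r p q → r + (x * (r * p) + y * (r * q)) ≡ r * suc (x * p + y * q)
      ex₂ = ℕR.solve-∀

      part₁ : conv (rect (r * p) (r * q) 0 μ l) (I e) n ≡ bv (x ℕ.<? μ) (y ℕ.<? l) (h x y ℕ.≤? n / r) never
      part₁ = trans (trans (conv-Σˡ μ (λ x k → Σ l (λ y → mono (0 + (x * (r * p) + y * (r * q))) k)) (I e) n)
          (Σ-cong μ (λ x' _ → trans (conv-Σˡ l (λ y k → mono (0 + (x' * (r * p) + y * (r * q))) k) (I e) n) (Σ-cong l (λ y' _ → trans (conv-mono (0 + (x' * (r * p) + y' * (r * q))) (I e) n) (cong (λ z → shift z (I e) n) (ex₁ x' y' r p q)))))))
          (go (x ℕ.<? μ) (y ℕ.<? l))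
        where
        G : ℕ → ℕ → ℤ
        G x' y' = shift (r * h x' y') (I e) n
        off : ∀ x' y' → x' < μ → y' < l → (x' ≢ x ⊎ y' ≢ y) → G x' y' ≡ 0ℤ
        off x' y' a b ne = shift-point x' y' (r * h x' y') (ℕ.<-≤-trans a μ≤q) (ℕ.<-≤-trans b l≤p) refl ne
        go : (dx : Dec (x < μ)) (dy : Dec (y < l)) → Σ μ (λ x' → Σ l (G x')) ≡ bv dx dy (h x y ℕ.≤? n / r) never
        go (yes x<μ) (yes y<l) = trans (Σ-single μ x (λ x' → Σ l (G x')) x<μ (λ x' a ne → Σ-zero l (λ y' b → off x' y' a b (inj₁ ne))))
          (trans (Σ-single l y (G x) y<l (λ y' b ne → off x y' x<μ b (inj₂ ne))) (trans (shift-I (r * h x y) (λ _ → hn))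
            (ind-iff (r * h x y ℕ.≤? n) (h x y ℕ.≤? n / r) (≤-div (h x y) n) (div-≤ (h x y) n))))
        go (yes _) (no y≮l) = Σ-zero μ (λ x' a → Σ-zero l (λ y' b → off x' y' a b (inj₂ (λ { refl → y≮l b }))))
        go (no x≮μ) (yes _) = Σ-zero μ (λ x' a → Σ-zero l (λ y' b → off x' y' a b (inj₁ (λ { refl → x≮μ a }))))
        go (no x≮μ) (no _) = Σ-zero μ (λ x' a → Σ-zero l (λ y' b → off x' y' a b (inj₁ (λ { refl → x≮μ a }))))

      -- x' p + y' q + 1 corresponds to the point (μ + x', l + y').
      corner : ∀ x' y' → h (μ + x') (l + y') ≡ suc (h x' y') + N
      corner x' y' = trans (eq μ x' p l y' q) (trans (cong (_+ (x' * p + y' * q)) bezout) (trans (cong suc (ℕ.+-comm N (h x' y'))) refl))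
        where
        eq : ∀ μ x p l y q → (μ + x) * p + (l + y) * q ≡ μ * p + l * q + (x * p + y * q)
        eq = ℕR.solve-∀

      part₂ : conv (rect (r * p) (r * q) r (q ∸ μ) (p ∸ l)) (I e) n ≡ - bv (x ℕ.<? μ) (y ℕ.<? l) never (h x y ℕ.≤? n / r + N)
      part₂ = trans (trans (conv-Σˡ (q ∸ μ) (λ x k → Σ (p ∸ l) (λ y → mono (r + (x * (r * p) + y * (r * q))) k)) (I e) n)
          (Σ-cong (q ∸ μ) (λ x' _ → trans (conv-Σˡ (p ∸ l) (λ y k → mono (r + (x' * (r * p) + y * (r * q))) k) (I e) n) (Σ-cong (p ∸ l) (λ y' _ → trans (conv-mono (r + (x' * (r * p) + y' * (r * q))) (I e) n) (cong (λ z → shift z (I e) n) (ex₂ x' y' r p q)))))))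
          (go (x ℕ.<? μ) (y ℕ.<? l))
        where
        G : ℕ → ℕ → ℤ
        G x' y' = shift (r * suc (h x' y')) (I e) n
        cong-corner : ∀ x' y' → (r * suc (h x' y') + e) % N ≡ (r * h (μ + x') (l + y') + e) % N
        cong-corner x' y' = sym (trans (cong (λ z → (r * z + e) % N) (corner x' y')) (trans (cong (_% N) (eq r (suc (h x' y')) N e)) ([m+kn]%n≡m%n (r * suc (h x' y') + e) r N)))
          where
          eq : ∀ r a N e → r * (a + N) + e ≡ r * a + e + r * N
          eq = ℕR.solve-∀
        in-x : ∀ {x'} → x' < q ∸ μ → μ + x' < q
        in-x {x'} a = subst (μ + x' <_) (ℕ.m+[n∸m]≡n μ≤q) (ℕ.+-monoʳ-< μ a)
        in-y : ∀ {y'} → y' < p ∸ l → l + y' < p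
        in-y {y'} a = subst (l + y' <_) (ℕ.m+[n∸m]≡n l≤p) (ℕ.+-monoʳ-< l a)
        off : ∀ x' y' → x' < q ∸ μ → y' < p ∸ l → (μ + x' ≢ x ⊎ l + y' ≢ y) → G x' y' ≡ 0ℤ
        off x' y' a b ne = shift-point (μ + x') (l + y') (r * suc (h x' y')) (in-x a) (in-y b) (cong-corner x' y') ne
        go : (dx : Dec (x < μ)) (dy : Dec (y < l)) → Σ (q ∸ μ) (λ x' → Σ (p ∸ l) (G x')) ≡ - bv dx dy never (h x y ℕ.≤? n / r + N)
        go (yes x<μ) (yes _) = Σ-zero (q ∸ μ) (λ x' a → Σ-zero (p ∸ l) (λ y' b → off x' y' a b (inj₁ (λ e → ℕ.<⇒≱ x<μ (subst (μ ≤_) e (ℕ.m≤m+n μ x'))))))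
        go (yes x<μ) (no _) = Σ-zero (q ∸ μ) (λ x' a → Σ-zero (p ∸ l) (λ y' b → off x' y' a b (inj₁ (λ e → ℕ.<⇒≱ x<μ (subst (μ ≤_) e (ℕ.m≤m+n μ x'))))))
        go (no _) (yes y<l) = Σ-zero (q ∸ μ) (λ x' a → Σ-zero (p ∸ l) (λ y' b → off x' y' a b (inj₂ (λ e → ℕ.<⇒≱ y<l (subst (l ≤_) e (ℕ.m≤m+n l y'))))))
        go (no x≮μ) (no y≮l) = trans (Σ-single (q ∸ μ) x₀ (λ x' → Σ (p ∸ l) (G x')) x₀< (λ x' a ne → Σ-zero (p ∸ l) (λ y' b → off x' y' a b (inj₁ (λ e → ne (ℕ.+-cancelˡ-≡ μ x' x₀ (trans e (sym x≡))))))))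
          (trans (Σ-single (p ∸ l) y₀ (G x₀) y₀< (λ y' b ne → off x₀ y' x₀< b (inj₂ (λ e → ne (ℕ.+-cancelˡ-≡ l y' y₀ (trans e (sym y≡)))))))
            (trans (shift-I (r * suc (h x₀ y₀)) (λ _ → trans (cong-corner x₀ y₀) (trans (cong (λ z → (r * z + e) % N) h≡) hn)))
              (trans (ind-iff (r * suc (h x₀ y₀) ℕ.≤? n) (h x y ℕ.≤? n / r + N)
                (λ le → subst (_≤ n / r + N) (trans (sym (corner x₀ y₀)) h≡) (ℕ.+-monoˡ-≤ N (≤-div (suc (h x₀ y₀)) n le)))
                (λ le → div-≤ (suc (h x₀ y₀)) n (ℕ.+-cancelʳ-≤ N (suc (h x₀ y₀)) (n / r) (subst (_≤ n / r + N) (trans (sym h≡) (corner x₀ y₀)) le))))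
                (sym (ℤ.neg-involutive _)))))
          where
          x₀ = x ∸ μ
          y₀ = y ∸ l
          x≡ : μ + x₀ ≡ x
          x≡ = ℕ.m+[n∸m]≡n (ℕ.≮⇒≥ x≮μ)
          y≡ : l + y₀ ≡ y
          y≡ = ℕ.m+[n∸m]≡n (ℕ.≮⇒≥ y≮l)
          x₀< : x₀ < q ∸ μ
          x₀< = ℕ.+-cancelˡ-< μ x₀ (q ∸ μ) (subst₂ _<_ (sym x≡) (sym (ℕ.m+[n∸m]≡n μ≤q)) x<q)
          y₀< : y₀ < p ∸ l
          y₀< = ℕ.+-cancelˡ-< l y₀ (p ∸ l) (subst₂ _<_ (sym y≡) (sym (ℕ.m+[n∸m]≡n l≤p)) y<p)
          h≡ : h (μ + x₀) (l + y₀) ≡ h x y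
          h≡ = cong₂ h x≡ y≡

      -- The grid meets each residue modulo p q once, so at most one monomial of Φ_pq(x^r) falls
      -- into the class of n - e; `part₁` and `part₂` treat the positive and the negative monomials.
      K-value : K e n ≡ b (n / r) x y
      K-value = trans (conv--ˡ (rect (r * p) (r * q) 0 μ l) (rect (r * p) (r * q) r (q ∸ μ) (p ∸ l)) (I e) n)
        (trans (cong₂ _-_ part₁ part₂) (go (x ℕ.<? μ) (y ℕ.<? l)))
        where
        go : (dx : Dec (x < μ)) (dy : Dec (y < l)) → bv dx dy (h x y ℕ.≤? n / r) never - - bv dx dy never (h x y ℕ.≤? n / r + N)
          ≡ bv dx dy (h x y ℕ.≤? n / r) (h x y ℕ.≤? n / r + N)
        go (yes _) (yes _) = +-identityʳ _
        go (yes _) (no _) = refl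
        go (no _) (yes _) = refl
        go (no _) (no _) = trans (+-identityˡ _) (ℤ.neg-involutive _)

    -- Neighbouring coefficients: (x - 1) F is an alternating sum of four terms K.
    shift-I-suc : ∀ i → suc i < N → shift 1 (I i) ≈ I (suc i)
    shift-I-suc i i< zero = sym (cong (mono (suc i)) (m<n⇒m%n≡m (ℕ.<⇒≤ 1<N)))
    shift-I-suc i i< (suc n) with suc (n % N) ℕ.<? N
    ... | yes lt = sym (cong (mono (suc i)) (trans (trans (cong (λ z → _%_ (suc z) N {{N≢0}}) (m≡m%n+[m/n]*n n N)) ([m+kn]%n≡m%n (suc (n % N)) (n / N) N)) (small N {{N≢0}} lt)))
    ... | no ¬lt = trans (mono-≢ i (n % N) (λ e → ¬lt (subst (λ z → suc z < N) e i<))) (sym (cong (mono (suc i)) zero'))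
      where
      last : suc (n % N) ≡ N
      last = ℕ.≤-antisym (m%n<n n N) (ℕ.≮⇒≥ ¬lt)
      zero' : suc n % N ≡ 0
      zero' = trans (cong (λ z → suc z % N) (m≡m%n+[m/n]*n n N)) (trans ([m+kn]%n≡m%n (suc (n % N)) (n / N) N) (trans (cong (_% N) last) (n%n≡0 N)))

    X₁-I : ∀ i → suc i < N → conv (X 1) (I i) ≈ (λ n → I (suc i) n - I i n)
    X₁-I i i< n = trans (conv-X 1 (I i) n) (cong (_- I i n) (shift-I-suc i i< n))

    F-difference : ∀ n → F (suc n) - F n ≡ K 0 (suc n) - K p (suc n) - K q (suc n) ℤ.+ K (q + p) (suc n)
    F-difference n = trans (eq₀ (F n) (F (suc n))) (trans (cong -_ main) (eq₁ (K 0 (suc n)) (K p (suc n)) (K q (suc n)) (K (q + p) (suc n))))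
      where
      m = suc n
      eq₀ : ∀ a b → b - a ≡ - (a - b)
      eq₀ = solve-∀
      eq₁ : ∀ a b c d → - ((b - d) - (a - c)) ≡ a - b - c ℤ.+ d
      eq₁ = solve-∀
      eq₂ : ∀ a b c d → a - b - (c - d) ≡ (a - c) - (b - d)
      eq₂ = solve-∀
      d : Series
      d k = (I p k - I (q + p) k) - (I 0 k - I q k)
      Xc : conv (X 1) c ≈ d
      Xc k = trans (conv-Σʳ p (X 1) (λ i k → I i k - I (q + i) k) k) (trans (Σ-cong p (λ i i<p → trans (conv--ʳ (X 1) (I i) (I (q + i)) k)
          (trans (cong₂ _-_ (X₁-I i (ℕ.≤-<-trans (ℕ.≤-trans (s≤s (ℕ.m≤n+m i q)) (ℕ.+-monoʳ-< q i<p)) p+q<N) k)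
              (trans (X₁-I (q + i) (ℕ.≤-<-trans (ℕ.+-monoʳ-< q i<p) p+q<N) k) (cong (λ z → I z k - I (q + i) k) (sym (ℕ.+-suc q i)))))
            (eq₂ (I (suc i) k) (I i k) (I (q + suc i) k) (I (q + i) k)))))
        (trans (Σ-telescope p (λ i → I i k - I (q + i) k)) (cong (λ z → (I p k - I (q + p) k) - (I 0 k - I z k)) (ℕ.+-identityʳ q))))
      main : F n - F m ≡ (K p m - K (q + p) m) - (K 0 m - K q m)
      main = trans (sym (conv-X 1 F m)) (trans (CM.solve 3 (λ x a c → (x ⊕ (a ⊕ c)) ⊜ (a ⊕ (x ⊕ c))) (λ _ → refl) (X 1) (binary r) c m)
        (trans (conv-cong {binary r} {binary r} (λ _ → refl) Xc m) (trans (conv--ʳ (binary r) (λ k → I p k - I (q + p) k) (λ k → I 0 k - I q k) m)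
          (cong₂ _-_ (conv--ʳ (binary r) (I p) (I (q + p)) m) (conv--ʳ (binary r) (I 0) (I q) m)))))

    Point : ℕ → ℕ → ℕ → ℕ → Set
    Point e n x y = (r * h x y + e) % N ≡ n % N

    point : ∀ e n → ∃ λ x → ∃ λ y → x < q × y < p × Point e n x y
    point e n = complete (rh-surjective (n + ℕ.pred N * e))
      where
      clear : (n + ℕ.pred N * e + e) % N ≡ n % N
      clear = trans (cong (λ z → _%_ z N {{N≢0}}) (trans (ℕ.+-assoc n (ℕ.pred N * e) e) (cong (n +_) (trans (ℕ.+-comm (ℕ.pred N * e) e) (trans (cong (_* e) (ℕ.suc-pred N)) (ℕ.*-comm N e)))))) ([m+kn]%n≡m%n n e N)
      complete : (∃ λ x → ∃ λ y → x < q × y < p × (r * h x y) % N ≡ (n + ℕ.pred N * e) % N) → ∃ λ x → ∃ λ y → x < q × y < p × Point e n x y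
      complete (x , y , x<q , y<p , eq) = x , y , x<q , y<p , trans (%-+ N {r * h x y} {n + ℕ.pred N * e} {e} {e} eq refl) clear

    same-x : ∀ {e e' n} x y x' y' → x < q → x' < q → Point e n x y → Point e' n x' y' → e % q ≡ e' % q → x ≡ x'
    same-x {e} {e'} {n} x y x' y' x< x'< P P' ee = ModQ.injective x< x'< (trans (sym (rh-mod-q x y))
      (trans (%-cancel-+ q e (r * h x y) (r * h x' y') (trans (mod-q _ _ (trans P (sym P'))) (%-+ q {r * h x' y'} {r * h x' y'} {e'} {e} refl (sym ee)))) (rh-mod-q x' y')))

    same-y : ∀ {e e' n} x y x' y' → y < p → y' < p → Point e n x y → Point e' n x' y' → e % p ≡ e' % p → y ≡ y'
    same-y {e} {e'} {n} x y x' y' y< y'< P P' ee = ModP.injective y< y'< (trans (sym (rh-mod-p x y))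
      (trans (%-cancel-+ p e (r * h x y) (r * h x' y') (trans (mod-p _ _ (trans P (sym P'))) (%-+ p {r * h x' y'} {r * h x' y'} {e'} {e} refl (sym ee)))) (rh-mod-p x' y')))

    Small : ℤ → Set
    Small z = - 1ℤ ℤ.≤ z × z ℤ.≤ 1ℤ

    small-diff : ∀ {P Q : Set} (d : Dec P) (e : Dec Q) → Small (ind d - ind e)
    small-diff (yes _) (yes _) = ℤ.-≤+ , ℤ.+≤+ z≤n
    small-diff (yes _) (no _) = ℤ.-≤+ , ℤ.≤-refl
    small-diff (no _) (yes _) = ℤ.≤-refl , ℤ.-≤+
    small-diff (no _) (no _) = ℤ.-≤+ , ℤ.+≤+ z≤n

    small-neg : ∀ {z} → Small z → Small (- z)
    small-neg (a , b) = ℤ.neg-mono-≤ b , ℤ.neg-mono-≤ a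

    via : ∀ {P Q : Set} {z} (d : Dec P) (e : Dec Q) → z ≡ ind d - ind e → Small z
    via d e eq = subst Small (sym eq) (small-diff d e)

    -- The values ±2 would need A, D on one side of J and B, C on the other, which A + D = B + C
    -- forbids.
    quad : ∀ {A B C D J} → A + D ≡ B + C → (a : Dec (A ≤ J)) (b : Dec (B ≤ J)) (c : Dec (C ≤ J)) (d : Dec (D ≤ J)) →
      Small (ind a - ind b - ind c ℤ.+ ind d)
    quad s (yes a) (no b) (no c) (yes d) = ⊥-elim (ℕ.<⇒≱ (ℕ.+-mono-< (ℕ.≰⇒> b) (ℕ.≰⇒> c)) (ℕ.≤-trans (ℕ.≤-reflexive (sym s)) (ℕ.+-mono-≤ a d)))
    quad s (no a) (yes b) (yes c) (no d) = ⊥-elim (ℕ.<⇒≱ (ℕ.+-mono-< (ℕ.≰⇒> a) (ℕ.≰⇒> d)) (ℕ.≤-trans (ℕ.≤-reflexive s) (ℕ.+-mono-≤ b c)))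
    quad s (yes a) (yes b) c d = subst Small (sym (eq (ind c) (ind d))) (small-diff d c)
      where
      eq : ∀ c d → 1ℤ - 1ℤ - c ℤ.+ d ≡ d - c
      eq = solve-∀
    quad s (no a) (no b) c d = subst Small (sym (eq (ind c) (ind d))) (small-diff d c)
      where
      eq : ∀ c d → 0ℤ - 0ℤ - c ℤ.+ d ≡ d - c
      eq = solve-∀
    quad s (yes a) (no b) (yes c) d = subst Small (sym (eq (ind d))) (small-diff d never)
      where
      eq : ∀ d → 1ℤ - 0ℤ - 1ℤ ℤ.+ d ≡ d - 0ℤ
      eq = solve-∀
    quad s (yes a) (no b) (no c) (no d) = ℤ.-≤+ , ℤ.≤-refl
    quad s (no a) (yes b) (yes c) (yes d) = ℤ.≤-refl , ℤ.-≤+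
    quad s (no a) (yes b) (no c) d = subst Small (sym (eq (ind d))) (small-diff d (yes (refl {x = 0})))
      where
      eq : ∀ d → 0ℤ - 1ℤ - 0ℤ ℤ.+ d ≡ d - 1ℤ
      eq = solve-∀

    module _ {A B C D J M : ℕ} (s : A + D ≡ B + C) {P P' Q Q' : Set} where

      private
        a = A ℕ.≤? J
        b₁ = B ℕ.≤? J
        c₁ = C ℕ.≤? J
        d = D ℕ.≤? J
        a⁻ = A ℕ.≤? M
        b⁻ = B ℕ.≤? M
        c⁻ = C ℕ.≤? M
        d⁻ = D ℕ.≤? M

      -- If all four points lie in the same rectangle this is `quad`. In every other case at most
      -- two indicators survive, and they enter with opposite signs.
      small-square : (x : Dec P) (x' : Dec P') (y : Dec Q) (y' : Dec Q') → Small (bv x y a a⁻ - bv x' y b₁ b⁻ - bv x y' c₁ c⁻ ℤ.+ bv x' y' d d⁻)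
      small-square (yes _) (yes _) (yes _) (yes _) = quad s a b₁ c₁ d
      small-square (no _) (no _) (no _) (no _) = subst Small (eq (ind a⁻) (ind b⁻) (ind c⁻) (ind d⁻)) (small-neg (quad s a⁻ b⁻ c⁻ d⁻))
        where
        eq : ∀ a b c d → - (a - b - c ℤ.+ d) ≡ - a - - b - - c ℤ.+ - d
        eq = solve-∀
      small-square (yes _) (yes _) (yes _) (no _) = via a b₁ (eq (ind a) (ind b₁))
        where
        eq : ∀ a b → a - b - 0ℤ ℤ.+ 0ℤ ≡ a - b
        eq = solve-∀
      small-square (yes _) (yes _) (no _) (yes _) = via d c₁ (eq (ind c₁) (ind d))
        where
        eq : ∀ c d → 0ℤ - 0ℤ - c ℤ.+ d ≡ d - c
        eq = solve-∀
      small-square (yes _) (yes _) (no _) (no _) = ℤ.-≤+ , ℤ.+≤+ z≤n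
      small-square (no _) (no _) (yes _) (yes _) = ℤ.-≤+ , ℤ.+≤+ z≤n
      small-square (yes _) (no _) (yes _) (yes _) = via a c₁ (eq (ind a) (ind c₁))
        where
        eq : ∀ a c → a - 0ℤ - c ℤ.+ 0ℤ ≡ a - c
        eq = solve-∀
      small-square (no _) (yes _) (yes _) (yes _) = via d b₁ (eq (ind b₁) (ind d))
        where
        eq : ∀ b d → 0ℤ - b - 0ℤ ℤ.+ d ≡ d - b
        eq = solve-∀
      small-square (yes _) (no _) (yes _) (no _) = via a d⁻ (eq (ind a) (ind d⁻))
        where
        eq : ∀ a d → a - 0ℤ - 0ℤ ℤ.+ - d ≡ a - d
        eq = solve-∀
      small-square (yes _) (no _) (no _) (yes _) = via b⁻ c₁ (eq (ind b⁻) (ind c₁))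
        where
        eq : ∀ b c → 0ℤ - - b - c ℤ.+ 0ℤ ≡ b - c
        eq = solve-∀
      small-square (no _) (yes _) (yes _) (no _) = via c⁻ b₁ (eq (ind b₁) (ind c⁻))
        where
        eq : ∀ b c → 0ℤ - b - - c ℤ.+ 0ℤ ≡ c - b
        eq = solve-∀
      small-square (no _) (yes _) (no _) (yes _) = via d a⁻ (eq (ind a⁻) (ind d))
        where
        eq : ∀ a d → - a - 0ℤ - 0ℤ ℤ.+ d ≡ d - a
        eq = solve-∀
      small-square (yes _) (no _) (no _) (no _) = via b⁻ d⁻ (eq (ind b⁻) (ind d⁻))
        where
        eq : ∀ b d → 0ℤ - - b - 0ℤ ℤ.+ - d ≡ b - d
        eq = solve-∀
      small-square (no _) (yes _) (no _) (no _) = via c⁻ a⁻ (eq (ind a⁻) (ind c⁻))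
        where
        eq : ∀ a c → - a - 0ℤ - - c ℤ.+ 0ℤ ≡ c - a
        eq = solve-∀
      small-square (no _) (no _) (yes _) (no _) = via c⁻ d⁻ (eq (ind c⁻) (ind d⁻))
        where
        eq : ∀ c d → 0ℤ - 0ℤ - - c ℤ.+ - d ≡ c - d
        eq = solve-∀
      small-square (no _) (no _) (no _) (yes _) = via b⁻ a⁻ (eq (ind a⁻) (ind b⁻))
        where
        eq : ∀ a b → - a - - b - 0ℤ ℤ.+ 0ℤ ≡ b - a
        eq = solve-∀

    -- The points for the exponents 0 and q share x, those for 0 and p share y, and that for q + p
    -- has the x of p and the y of q. The four points thus form a rectangle.
    jump : ∀ n → Small (F (suc n) - F n)
    jump n = go (point 0 m) (point p m) (point q m) (point (q + p) m)
      where
      m = suc n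
      At : ℕ → Set
      At e = ∃ λ x → ∃ λ y → x < q × y < p × Point e m x y
      eq : ∀ x y x' y' p q → x * p + y * q + (x' * p + y' * q) ≡ x' * p + y * q + (x * p + y' * q)
      eq = ℕR.solve-∀
      value : ∀ e x y x' y' → e < N → x < q → y < p → Point e m x y → x ≡ x' → y ≡ y' → K e m ≡ b (m / r) x' y'
      value e x y x' y' e< x< y< P refl refl = K-value m e x y e< x< y< P
      p<N : p < N
      p<N = ℕ.≤-<-trans (ℕ.m≤n+m p q) p+q<N
      q<N : q < N
      q<N = ℕ.≤-<-trans (ℕ.m≤m+n q p) p+q<N
      go : At 0 → At p → At q → At (q + p) → Small (F m - F n)
      go (x , y , x< , y< , P) (x₁ , y₁ , x₁< , y₁< , P₁) (x₂ , y₂ , x₂< , y₂< , P₂) (x₃ , y₃ , x₃< , y₃< , P₃) =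
        subst Small (sym (trans (F-difference n) (cong₂ ℤ._+_ (cong₂ _-_ (cong₂ _-_
          (value 0 x y x y (ℕ.<⇒≤ 1<N) x< y< P refl refl)
          (value p x₁ y₁ x₁ y p<N x₁< y₁< P₁ refl (same-y {p} {0} x₁ y₁ x y y₁< y< P₁ P (trans (n%n≡0 p) (sym (small p (ℕ.<⇒≤ 1<p)))))))
          (value q x₂ y₂ x y₂ q<N x₂< y₂< P₂ (same-x {q} {0} x₂ y₂ x y x₂< x< P₂ P (trans (n%n≡0 q) (sym (small q (ℕ.<⇒≤ 1<q))))) refl))
          (value (q + p) x₃ y₃ x₁ y₂ p+q<N x₃< y₃< P₃
            (same-x {q + p} {p} x₃ y₃ x₁ y₁ x₃< x₁< P₃ P₁ (trans (cong (_% q) (ℕ.+-comm q p)) ([m+n]%n≡m%n p q)))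
            (same-y {q + p} {q} x₃ y₃ x₂ y₂ y₃< y₂< P₃ P₂ ([m+n]%n≡m%n q p))))))
          (small-square {h x y} {h x₁ y} {h x y₂} {h x₁ y₂} {m / r} {m / r + N} (eq x y x₁ y₂ p q)
            (x ℕ.<? μ) (x₁ ℕ.<? μ) (y ℕ.<? l) (y₂ ℕ.<? l))

    ascend : (G : Series) → (∀ n → G (suc n) - G n ℤ.≤ 1ℤ) → ∀ z d a → G a ℤ.≤ z → z ℤ.≤ G (d + a) → ∃ λ k → G k ≡ z
    ascend G step z zero a lo hi = a , ℤ.≤-antisym lo hi
    ascend G step z (suc d) a lo hi = go (G a ℤ.≟ z)
      where
      eq : ∀ x y → y - x ℤ.+ x ≡ y
      eq = solve-∀
      go : Dec (G a ≡ z) → ∃ λ k → G k ≡ z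
      go (yes e) = a , e
      go (no ne) = ascend G step z d (suc a) (ℤ.≤-trans (subst (ℤ._≤ 1ℤ ℤ.+ G a) (eq (G a) (G (suc a))) (ℤ.+-monoˡ-≤ (G a) (step a))) (ℤ.i<j⇒suc[i]≤j (ℤ.≤∧≢⇒< lo ne)))
        (subst (λ n → z ℤ.≤ G n) (sym (ℕ.+-suc d a)) hi)

    between : ∀ z a b → F a ℤ.≤ z → z ℤ.≤ F b → ∃ λ k → F k ≡ z
    between z a b lo hi with ℕ.≤-total a b
    ... | inj₁ a≤b = ascend F (λ n → proj₂ (jump n)) z (b ∸ a) a lo (subst (λ n → z ℤ.≤ F n) (sym (ℕ.m∸n+n≡m a≤b)) hi)
    ... | inj₂ b≤a = negate (ascend (λ n → - F n) (λ n → subst (ℤ._≤ 1ℤ) (eq (F (suc n)) (F n)) (proj₂ (small-neg (jump n)))) (- z) (a ∸ b) b (ℤ.neg-mono-≤ hi)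
        (subst (λ n → - z ℤ.≤ - F n) (sym (ℕ.m∸n+n≡m b≤a)) (ℤ.neg-mono-≤ lo)))
      where
      eq : ∀ x y → - (x - y) ≡ - x - - y
      eq = solve-∀
      negate : (∃ λ k → - F k ≡ - z) → ∃ λ k → F k ≡ z
      negate (k , e) = k , ℤ.neg-injective e

    Σ-mono : ∀ n {f g} → (∀ k → k < n → f k ℤ.≤ g k) → Σ n f ℤ.≤ Σ n g
    Σ-mono zero h = ℤ.≤-refl
    Σ-mono (suc n) h = ℤ.+-mono-≤ (Σ-mono n (λ k k< → h k (ℕ.m≤n⇒m≤1+n k<))) (h n ℕ.≤-refl)

    Σ-const : ∀ n c → Σ n (λ _ → c) ≡ ℤ.+ n ℤ.* c
    Σ-const zero c = sym (ℤ.*-zeroˡ c)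
    Σ-const (suc n) c = trans (cong (ℤ._+ c) (Σ-const n c)) (eq (ℤ.+ n) c)
      where
      eq : ∀ m c → m ℤ.* c ℤ.+ c ≡ (1ℤ ℤ.+ m) ℤ.* c
      eq = solve-∀

    Σ-cyclic : ∀ m .{{_ : ℕ.NonZero m}} k (g : ℕ → ℤ) → Σ m (λ i → g ((k + i) % m)) ≡ Σ m g
    Σ-cyclic m zero g = Σ-cong m (λ i i<m → cong g (small m i<m))
    Σ-cyclic m (suc k) g = trans (Σ-cong m (λ i _ → cong (λ z → g (z % m)) (sym (ℕ.+-suc k i))))
        (trans (+-cancelʳ (H 0) (Σ m (H ∘ suc)) (Σ m H) (trans (ℤ.+-comm (Σ m (H ∘ suc)) (H 0)) (trans (sym (Σ-first m H)) (cong (λ z → Σ m H ℤ.+ z) wrap)))) (Σ-cyclic m k g))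
      where
      H : ℕ → ℤ
      H i = g ((k + i) % m)
      wrap : H m ≡ H 0
      wrap = cong g (trans ([m+n]%n≡m%n k m) (cong (_% m) (sym (ℕ.+-identityʳ k))))

    low : ℕ → ℤ
    low y = ind (y ℕ.<? l)

    Σ-low : Σ p low ≡ ℤ.+ l
    Σ-low = trans (cong (λ z → Σ z low) (sym l+β≡p)) (trans (Σ-split l β low) (trans (cong₂ ℤ._+_
      (trans (Σ-cong l (λ k k< → ind-yes (k ℕ.<? l) k<)) (trans (Σ-const l 1ℤ) (ℤ.*-identityʳ (ℤ.+ l))))
      (Σ-zero β (λ k _ → ind-no (l + k ℕ.<? l) (ℕ.m+n≮m l k)))) (+-identityʳ _)))

    h-mod : ∀ x y → (r * h (x % q) (y % p)) % N ≡ (r * h x y) % N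
    h-mod x y = chinese (r * h (x % q) (y % p)) (r * h x y)
      (trans (rh-mod-p (x % q) (y % p)) (trans (ModP.*-cong {r * q} {r * q} {y % p} {y} refl (m%n%n≡m%n y p)) (sym (rh-mod-p x y))))
      (trans (rh-mod-q (x % q) (y % p)) (trans (ModQ.*-cong {r * p} {r * p} {x % q} {x} refl (m%n%n≡m%n x q)) (sym (rh-mod-q x y))))

    -- As r > p q, every block of r consecutive integers contains all residues modulo p q; cut-off
    -- and starting point can be prescribed independently.
    point-exists : ∀ s x y J → ∃ λ n → n / r ≡ J × Point s n x y
    point-exists s x y J = u + J * r , div≡ , sym same
      where
      R = r * h x y + s
      u = (R + ℕ.pred N * (J * r)) % N
      u<r : u < r
      u<r = ℕ.<-trans (m%n<n (R + ℕ.pred N * (J * r)) N) pq<r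
      div≡ : (u + J * r) / r ≡ J
      div≡ = trans (+-distrib-/-∣ʳ u (n∣m*n J)) (cong₂ _+_ (m<n⇒m/n≡0 u<r) (m*n/n≡m J r))
      eq : ∀ R k m → R + k * m + m ≡ R + m * suc k
      eq = ℕR.solve-∀
      same : (u + J * r) % N ≡ R % N
      same = trans (%-+ N {u} {R + ℕ.pred N * (J * r)} {J * r} {J * r} (m%n%n≡m%n (R + ℕ.pred N * (J * r)) N) refl)
        (trans (cong (λ z → _%_ z N {{N≢0}}) (trans (eq R (ℕ.pred N) (J * r)) (cong (λ z → R + J * r * z) (ℕ.suc-pred N)))) ([m+kn]%n≡m%n R (J * r) N))

    module _ {J x y : ℕ} where

      b-in : x < μ → y < l → h x y ≤ J → b J x y ≡ 1ℤ
      b-in x< y< hJ = go (x ℕ.<? μ) (y ℕ.<? l)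
        where
        go : (dx : Dec (x < μ)) (dy : Dec (y < l)) → bv dx dy (h x y ℕ.≤? J) (h x y ℕ.≤? J + N) ≡ 1ℤ
        go (yes _) (yes _) = ind-yes (h x y ℕ.≤? J) hJ
        go (no ¬x) _ = ⊥-elim (¬x x<)
        go _ (no ¬y) = ⊥-elim (¬y y<)

      b-out : μ ≤ x → l ≤ y → h x y ≤ J + N → b J x y ≡ - 1ℤ
      b-out x≥ y≥ hJ = go (x ℕ.<? μ) (y ℕ.<? l)
        where
        go : (dx : Dec (x < μ)) (dy : Dec (y < l)) → bv dx dy (h x y ℕ.≤? J) (h x y ℕ.≤? J + N) ≡ - 1ℤ
        go (no _) (no _) = cong -_ (ind-yes (h x y ℕ.≤? J + N) hJ)
        go (yes x<) _ = ⊥-elim (ℕ.<⇒≱ x< x≥)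
        go _ (yes y<) = ⊥-elim (ℕ.<⇒≱ y< y≥)

      b-in-0 : x < μ → (y < l → J < h x y) → b J x y ≡ 0ℤ
      b-in-0 x< hJ = go (x ℕ.<? μ) (y ℕ.<? l)
        where
        go : (dx : Dec (x < μ)) (dy : Dec (y < l)) → bv dx dy (h x y ℕ.≤? J) (h x y ℕ.≤? J + N) ≡ 0ℤ
        go (yes _) (yes y<) = ind-no (h x y ℕ.≤? J) (ℕ.<⇒≱ (hJ y<))
        go (yes _) (no _) = refl
        go (no ¬x) _ = ⊥-elim (¬x x<)

      b-out-0 : μ ≤ x → (l ≤ y → J + N < h x y) → b J x y ≡ 0ℤ
      b-out-0 x≥ hJ = go (x ℕ.<? μ) (y ℕ.<? l)
        where
        go : (dx : Dec (x < μ)) (dy : Dec (y < l)) → bv dx dy (h x y ℕ.≤? J) (h x y ℕ.≤? J + N) ≡ 0ℤ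
        go (no _) (no ¬y) = cong -_ (ind-no (h x y ℕ.≤? J + N) (ℕ.<⇒≱ (hJ (ℕ.≮⇒≥ ¬y))))
        go (no _) (yes _) = refl
        go (yes x<) _ = ⊥-elim (ℕ.<⇒≱ x< x≥)

      b-total : x < q → y < p → N + N ≤ J → b J x y ≡ ind (x ℕ.<? μ) ℤ.+ low y - 1ℤ
      b-total x< y< NN = go (x ℕ.<? μ) (y ℕ.<? l)
        where
        hJ : h x y ≤ J
        hJ = ℕ.≤-trans (ℕ.+-mono-≤ (ℕ.≤-trans (ℕ.*-monoˡ-≤ p (ℕ.<⇒≤ x<)) (ℕ.≤-reflexive (ℕ.*-comm q p))) (ℕ.*-monoˡ-≤ q (ℕ.<⇒≤ y<))) NN
        go : (dx : Dec (x < μ)) (dy : Dec (y < l)) → bv dx dy (h x y ℕ.≤? J) (h x y ℕ.≤? J + N) ≡ ind dx ℤ.+ ind dy - 1ℤ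
        go (yes _) (yes _) = ind-yes (h x y ℕ.≤? J) hJ
        go (yes _) (no _) = refl
        go (no _) (yes _) = refl
        go (no _) (no _) = cong -_ (ind-yes (h x y ℕ.≤? J + N) (ℕ.≤-trans hJ (ℕ.m≤m+n J N)))

    ind-0≤ : ∀ {P : Set} (d : Dec P) → 0ℤ ℤ.≤ ind d
    ind-0≤ (yes _) = ℤ.+≤+ z≤n
    ind-0≤ (no _) = ℤ.≤-refl

    ind-≤1 : ∀ {P : Set} (d : Dec P) → ind d ℤ.≤ 1ℤ
    ind-≤1 (yes _) = ℤ.≤-refl
    ind-≤1 (no _) = ℤ.+≤+ z≤n

    ind-mono : ∀ {P Q : Set} (d : Dec P) (e : Dec Q) → (P → Q) → ind d ℤ.≤ ind e
    ind-mono (yes p) e f = ℤ.≤-reflexive (sym (ind-yes e (f p)))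
    ind-mono (no _) e f = ind-0≤ e

    module _ {x y y₂ J M : ℕ} where

      -- Columns on the same side of λ are compared with y ≤ y₂, so the indicator can only drop from
      -- y to y₂. Columns on different sides leave at most one indicator, whose sign is that of the
      -- side of y.
      square-sign : (dx : Dec (x < μ)) (dy : Dec (y < l)) (dy₂ : Dec (y₂ < l)) →
        ((y < l → y₂ < l → y ≤ y₂) × (l ≤ y → l ≤ y₂ → y ≤ y₂)) →
        ind dy - 1ℤ ℤ.≤ bv dx dy (h x y ℕ.≤? J) (h x y ℕ.≤? M) - bv dx dy₂ (h x y₂ ℕ.≤? J) (h x y₂ ℕ.≤? M) ×
        bv dx dy (h x y ℕ.≤? J) (h x y ℕ.≤? M) - bv dx dy₂ (h x y₂ ℕ.≤? J) (h x y₂ ℕ.≤? M) ℤ.≤ ind dy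
      square-sign (yes _) (yes y<) (yes y₂<) (m , _) = ℤ.i≤j⇒0≤j-i (ind-mono (h x y₂ ℕ.≤? J) (h x y ℕ.≤? J) (ℕ.≤-trans (ℕ.+-monoʳ-≤ (x * p) (ℕ.*-monoˡ-≤ q (m y< y₂<))))) ,
        proj₂ (small-diff (h x y ℕ.≤? J) (h x y₂ ℕ.≤? J))
      square-sign (yes _) (yes _) (no _) _ = subst (λ z → 0ℤ ℤ.≤ z × z ℤ.≤ 1ℤ) (sym (+-identityʳ _)) (ind-0≤ (h x y ℕ.≤? J) , ind-≤1 (h x y ℕ.≤? J))
      square-sign (no _) (yes _) (yes _) _ = ℤ.≤-refl , ℤ.+≤+ z≤n
      square-sign (no _) (yes _) (no _) _ = subst (λ z → 0ℤ ℤ.≤ z × z ℤ.≤ 1ℤ) (eq (ind (h x y₂ ℕ.≤? M))) (ind-0≤ (h x y₂ ℕ.≤? M) , ind-≤1 (h x y₂ ℕ.≤? M))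
        where
        eq : ∀ a → a ≡ 0ℤ - - a
        eq = solve-∀
      square-sign (yes _) (no _) (yes _) _ = subst (λ z → - 1ℤ ℤ.≤ z × z ℤ.≤ 0ℤ) (sym (+-identityˡ _)) (ℤ.neg-mono-≤ (ind-≤1 (h x y₂ ℕ.≤? J)) , ℤ.neg-mono-≤ (ind-0≤ (h x y₂ ℕ.≤? J)))
      square-sign (yes _) (no _) (no _) _ = ℤ.-≤+ , ℤ.≤-refl
      square-sign (no _) (no _) (yes _) _ = subst (λ z → - 1ℤ ℤ.≤ z × z ℤ.≤ 0ℤ) (sym (+-identityʳ _)) (ℤ.neg-mono-≤ (ind-≤1 (h x y ℕ.≤? M)) , ℤ.neg-mono-≤ (ind-0≤ (h x y ℕ.≤? M)))
      square-sign (no _) (no ¬y) (no ¬y₂) (_ , m) = subst (λ z → - 1ℤ ℤ.≤ z × z ℤ.≤ 0ℤ) (eq (ind (h x y₂ ℕ.≤? M)) (ind (h x y ℕ.≤? M)))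
          (proj₁ (small-diff (h x y₂ ℕ.≤? M) (h x y ℕ.≤? M)) , ℤ.i≤j⇒i-j≤0 (ind-mono (h x y₂ ℕ.≤? M) (h x y ℕ.≤? M) (ℕ.≤-trans (ℕ.+-monoʳ-≤ (x * p) (ℕ.*-monoˡ-≤ q (m (ℕ.≮⇒≥ ¬y) (ℕ.≮⇒≥ ¬y₂)))))))
        where
        eq : ∀ a b → a - b ≡ - b - - a
        eq = solve-∀

    -- The walk visits, in the i-th step, the exponent idx i of 1 + x + ⋯ + x^(p−1).
    record Orientation : Set where
      field
        e f τ ω s : ℕ
        idx : ℕ → ℕ
        f+e≡q : f + e ≡ q
        τ+ep≡q : τ + e * p ≡ q
        idx<p : ∀ i → i < p → idx i < p
        Σ-idx : ∀ g → Σ p (g ∘ idx) ≡ Σ p g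
        idx-τ : ∀ i → i < p → (i * (r * τ) + idx i) % N ≡ s % N
        ω-r : p ∣ suc (r * ω)
        ω≤l : ω ≤ l
        ω≤β : ω ≤ β
        1≤ω : 1 ≤ ω

    module Path (O : Orientation) where
      open Orientation O

      xs ys : ℕ → ℕ → ℕ
      xs x₀ i = (x₀ + i * f) % q
      ys y₀ i = (y₀ + i) % p

      -- One step of the walk, the difference of the terms for i and q + i: raising the exponent by
      -- q keeps x and moves y by ω, because r ω ≡ -1 mod p.
      T : ℕ → ℕ → ℕ → ℤ
      T J x y = b J x y - b J x ((y + ω) % p)

      path-point : ∀ {n} x₀ y₀ → Point s n x₀ y₀ → ∀ i → i < p → Point (idx i) n (xs x₀ i) (ys y₀ i)
      path-point {n} x₀ y₀ P i i<p = begin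
        (r * h (xs x₀ i) (ys y₀ i) + idx i) % N
          ≡⟨ %-+ N {r * h (xs x₀ i) (ys y₀ i)} {r * h (x₀ + i * f) (y₀ + i)} {idx i} {idx i} (h-mod (x₀ + i * f) (y₀ + i)) refl ⟩
        (r * h (x₀ + i * f) (y₀ + i) + idx i) % N
          ≡⟨ cong (λ z → _%_ z N {{N≢0}}) (trans (eq₁ r x₀ y₀ i f p q (idx i)) (trans (cong (λ z → r * h x₀ y₀ + r * i * z + idx i) fp+q) (eq₂ (r * h x₀ y₀) r i τ N (idx i)))) ⟩
        (r * h x₀ y₀ + (i * (r * τ) + idx i) + r * i * N) % N
          ≡⟨ [m+kn]%n≡m%n (r * h x₀ y₀ + (i * (r * τ) + idx i)) (r * i) N ⟩
        (r * h x₀ y₀ + (i * (r * τ) + idx i)) % N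
          ≡⟨ %-+ N {r * h x₀ y₀} {r * h x₀ y₀} {i * (r * τ) + idx i} {s} refl (idx-τ i i<p) ⟩
        (r * h x₀ y₀ + s) % N
          ≡⟨ P ⟩
        n % N ∎
        where
        open ≡-Reasoning
        eq₁ : ∀ r x y i f p q k → r * ((x + i * f) * p + (y + i) * q) + k ≡ r * (x * p + y * q) + r * i * (f * p + q) + k
        eq₁ = ℕR.solve-∀
        eq₂ : ∀ R r i t N k → R + r * i * (t + N) + k ≡ R + (i * (r * t) + k) + r * i * N
        eq₂ = ℕR.solve-∀
        eq₃ : ∀ f p t e → f * p + (t + e * p) ≡ t + p * (f + e)
        eq₃ = ℕR.solve-∀
        fp+q : f * p + q ≡ τ + N
        fp+q = trans (cong (f * p +_) (sym τ+ep≡q)) (trans (eq₃ f p τ e) (cong (λ z → τ + p * z) f+e≡q))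

      shifted-point : ∀ {n} k x y → Point k n x y → Point (q + k) n x ((y + ω) % p)
      shifted-point {n} k x y P = trans (chinese (r * h x y' + (q + k)) (r * h x y + k) mod-p≡ mod-q≡) P
        where
        y' = (y + ω) % p
        eq : ∀ r q y w k → r * q * (y + w) + (q + k) ≡ r * q * y + k + q * suc (r * w)
        eq = ℕR.solve-∀
        mod-p≡ : (r * h x y' + (q + k)) % p ≡ (r * h x y + k) % p
        mod-p≡ = trans (%-+ p {r * h x y'} {r * q * (y + ω)} {q + k} {q + k}
            (trans (rh-mod-p x y') (ModP.*-cong {r * q} {r * q} {y'} {y + ω} refl (m%n%n≡m%n (y + ω) p))) refl)
          (trans (cong (_% p) (eq r q y ω k)) (trans (%-remove-+ʳ (r * q * y + k) (∣n⇒∣m*n q ω-r))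
            (%-+ p {r * q * y} {r * h x y} {k} {k} (sym (rh-mod-p x y)) refl)))
        mod-q≡ : (r * h x y' + (q + k)) % q ≡ (r * h x y + k) % q
        mod-q≡ = %-+ q {r * h x y'} {r * h x y} {q + k} {k} (trans (rh-mod-q x y') (sym (rh-mod-q x y)))
          (trans (cong (_% q) (ℕ.+-comm q k)) ([m+n]%n≡m%n k q))

      F-path : ∀ n x₀ y₀ → Point s n x₀ y₀ → F n ≡ Σ p (λ i → T (n / r) (xs x₀ i) (ys y₀ i))
      F-path n x₀ y₀ P = trans (F-K n) (trans (sym (Σ-idx (λ i → K i n - K (q + i) n))) (Σ-cong p (λ i i<p → cong₂ _-_
        (K-value n (idx i) (xs x₀ i) (ys y₀ i) (ℕ.<-trans (ℕ.<-≤-trans (idx<p i i<p) (ℕ.m≤n+m p q)) p+q<N) (m%n<n (x₀ + i * f) q) (m%n<n (y₀ + i) p) (path-point x₀ y₀ P i i<p))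
        (K-value n (q + idx i) (xs x₀ i) ((ys y₀ i + ω) % p) (q+i<N (idx<p i i<p)) (m%n<n (x₀ + i * f) q) (m%n<n (ys y₀ i + ω) p)
          (shifted-point (idx i) (xs x₀ i) (ys y₀ i) (path-point x₀ y₀ P i i<p))))))

      next-column : ∀ {y} → y < p → ((y + ω) % p ≡ y + ω) ⊎ ((y + ω) % p < ω × p ≤ y + ω)
      next-column {y} y<p with y + ω ℕ.<? p
      ... | yes lt = inj₁ (small p lt)
      ... | no ¬lt = inj₂ (subst (_< ω) (sym wrapped) (ℕ.+-cancelʳ-< p d ω (ℕ.<-≤-trans (ℕ.≤-<-trans (ℕ.≤-reflexive (ℕ.m∸n+n≡m p≤)) (ℕ.+-monoˡ-< ω y<p)) (ℕ.≤-reflexive (ℕ.+-comm p ω)))) , p≤)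
        where
        p≤ : p ≤ y + ω
        p≤ = ℕ.≮⇒≥ ¬lt
        d = y + ω ∸ p
        ω<p : ω < p
        ω<p = ℕ.<-≤-trans (s≤s ω≤l) (ℕ.≤-trans (ℕ.≤-trans (s≤s (ℕ.m≤m+n l β')) (ℕ.≤-reflexive (sym (ℕ.+-suc l β')))) (ℕ.≤-reflexive l+β≡p))
        d<p : d < p
        d<p = ℕ.+-cancelʳ-< p d p (ℕ.≤-<-trans (ℕ.≤-reflexive (ℕ.m∸n+n≡m p≤)) (ℕ.+-mono-< y<p ω<p))
        wrapped : (y + ω) % p ≡ d
        wrapped = trans (cong (_% p) (sym (ℕ.m∸n+n≡m p≤))) (trans ([m+n]%n≡m%n d p) (small p d<p))

      -- Moving by ω wraps around only from y ≥ λ, as ω ≤ β, and then lands below ω ≤ λ. Two columns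
      -- on the same side are therefore always in increasing order.
      T-bounds : ∀ J x y → y < p → low y - 1ℤ ℤ.≤ T J x y × T J x y ℤ.≤ low y
      T-bounds J x y y<p = square-sign {x} {y} {(y + ω) % p} {J} {J + N} (x ℕ.<? μ) (y ℕ.<? l) ((y + ω) % p ℕ.<? l) (go (next-column y<p))
        where
        go : ((y + ω) % p ≡ y + ω) ⊎ ((y + ω) % p < ω × p ≤ y + ω) →
          (y < l → (y + ω) % p < l → y ≤ (y + ω) % p) × (l ≤ y → l ≤ (y + ω) % p → y ≤ (y + ω) % p)
        go (inj₁ e) = (λ _ _ → up) , (λ _ _ → up)
          where
          up = subst (y ≤_) (sym e) (ℕ.m≤m+n y ω)
        go (inj₂ (lt , ge)) = (λ y<l _ → ⊥-elim (ℕ.<⇒≱ (ℕ.+-mono-<-≤ y<l ω≤β) (subst (_≤ y + ω) (sym l+β≡p) ge))) , (λ _ l≤ → ⊥-elim (ℕ.<⇒≱ (ℕ.<-≤-trans lt ω≤l) l≤))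

      bounds : ∀ n → - ℤ.+ β ℤ.≤ F n × F n ℤ.≤ ℤ.+ l
      bounds n = go (point s n)
        where
        lower≡ : Σ p (λ i → low i - 1ℤ) ≡ - ℤ.+ β
        lower≡ = trans (Σ-- p low (λ _ → 1ℤ)) (trans (cong₂ _-_ Σ-low (trans (Σ-const p 1ℤ) (trans (ℤ.*-identityʳ (ℤ.+ p)) (cong ℤ.+_ (sym l+β≡p))))) (eq (ℤ.+ l) (ℤ.+ β)))
          where
          eq : ∀ a b → a - (a ℤ.+ b) ≡ - b
          eq = solve-∀
        go : (∃ λ x → ∃ λ y → x < q × y < p × Point s n x y) → - ℤ.+ β ℤ.≤ F n × F n ℤ.≤ ℤ.+ l
        go (x , y , _ , _ , P) =
          subst₂ ℤ._≤_ (trans (Σ-cyclic p y (λ z → low z - 1ℤ)) lower≡) (sym (F-path n x y P)) (Σ-mono p (λ i _ → proj₁ (T-bounds (n / r) (xs x i) (ys y i) (m%n<n (y + i) p)))) ,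
          subst₂ ℤ._≤_ (sym (F-path n x y P)) (trans (Σ-cyclic p y low) Σ-low) (Σ-mono p (λ i _ → proj₂ (T-bounds (n / r) (xs x i) (ys y i) (m%n<n (y + i) p))))

      -- From 2 p q r on nothing is cut off, so each step contributes [y < λ] - [y + ω < λ], and
      -- over a full cycle of columns this sums to 0. Hence the series F is a polynomial.
      F-support : Supported (r * (N + N)) F
      F-support n rNN<n = go (point s n)
        where
        J = n / r
        NN≤J : N + N ≤ J
        NN≤J = ≤-div (N + N) n (ℕ.<⇒≤ rNN<n)
        go : (∃ λ x → ∃ λ y → x < q × y < p × Point s n x y) → F n ≡ 0ℤ
        go (x , y , _ , _ , P) = trans (F-path n x y P) (trans (Σ-cong p (λ i _ → term i)) (trans (Σ-- p (λ i → low ((y + i) % p)) (λ i → low ((y + ω + i) % p)))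
            (trans (cong₂ _-_ (Σ-cyclic p y low) (Σ-cyclic p (y + ω) low)) (ℤ.+-inverseʳ (Σ p low)))))
          where
          eq : ∀ a b c → a ℤ.+ b - 1ℤ - (a ℤ.+ c - 1ℤ) ≡ b - c
          eq = solve-∀
          swap : ∀ y i w → y + i + w ≡ y + w + i
          swap = ℕR.solve-∀
          column : ∀ i → (ys y i + ω) % p ≡ (y + ω + i) % p
          column i = trans (%-+ p {(y + i) % p} {y + i} {ω} {ω} (m%n%n≡m%n (y + i) p) refl) (cong (_% p) (swap y i ω))
          term : ∀ i → T J (xs x i) (ys y i) ≡ low ((y + i) % p) - low ((y + ω + i) % p)
          term i = trans (cong₂ _-_ (b-total {J} {xs x i} {ys y i} (m%n<n (x + i * f) q) (m%n<n (y + i) p) NN≤J)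
              (b-total {J} {xs x i} {(ys y i + ω) % p} (m%n<n (x + i * f) q) (m%n<n (ys y i + ω) p) NN≤J))
            (trans (eq (ind (xs x i ℕ.<? μ)) (low (ys y i)) (low ((ys y i + ω) % p))) (cong (λ z → low (ys y i) - low z) (column i)))

      F-attains : ∀ x₀ y₀ J m k v w → m + k ≡ p → (∀ i → i < m → T J (xs x₀ i) (ys y₀ i) ≡ v) →
        (∀ t → t < k → T J (xs x₀ (m + t)) (ys y₀ (m + t)) ≡ w) → ∃ λ n → F n ≡ ℤ.+ m ℤ.* v ℤ.+ ℤ.+ k ℤ.* w
      F-attains x₀ y₀ J m k v w m+k≡p first second with point-exists s x₀ y₀ J
      ... | n , refl , P = n , trans (F-path n x₀ y₀ P) (trans (cong (λ z → Σ z (λ i → T (n / r) (xs x₀ i) (ys y₀ i))) (sym m+k≡p)) (trans (Σ-split m k (λ i → T (n / r) (xs x₀ i) (ys y₀ i)))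
          (cong₂ ℤ._+_ (trans (Σ-cong m first) (Σ-const m v)) (trans (Σ-cong k second) (Σ-const k w)))))

      xs-value : ∀ {x₀ x₁} i k → x₁ < q → x₀ + i * f ≡ x₁ + k * q → xs x₀ i ≡ x₁
      xs-value {x₀} {x₁} i k x₁<q e = trans (cong (_% q) e) (trans ([m+kn]%n≡m%n x₁ k q) (small q x₁<q))

      ys-value : ∀ {y₀ Y} i k → Y < p → y₀ + i ≡ Y + k * p → ys y₀ i ≡ Y
      ys-value {y₀} {Y} i k Y<p e = trans (cong (_% p) e) (trans ([m+kn]%n≡m%n Y k p) (small p Y<p))

      T-value : ∀ {J x y x' y' u v} → x ≡ x' → y ≡ y' → b J x' y' ≡ u → b J x' ((y' + ω) % p) ≡ v → T J x y ≡ u - v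
      T-value refl refl e e' = cong₂ _-_ e e'

      low-next : ∀ {y} → y < l → (y + ω) % p ≡ y + ω
      low-next y<l = small p (subst (_ <_) l+β≡p (ℕ.+-mono-<-≤ y<l ω≤β))

      h-monoʳ : ∀ x {y y'} → y ≤ y' → h x y ≤ h x y'
      h-monoʳ x y≤ = ℕ.+-monoʳ-≤ (x * p) (ℕ.*-monoˡ-≤ q y≤)

      b-out-next : ∀ {J x₁ y} → y < p → μ ≤ x₁ → J + N < h x₁ (y + ω) → b J x₁ ((y + ω) % p) ≡ 0ℤ
      b-out-next {J} {x₁} {y} y<p μ≤x₁ far = b-out-0 {J} {x₁} {(y + ω) % p} μ≤x₁ (go (next-column y<p))
        where
        go : ((y + ω) % p ≡ y + ω) ⊎ ((y + ω) % p < ω × p ≤ y + ω) → l ≤ (y + ω) % p → J + N < h x₁ ((y + ω) % p)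
        go (inj₁ e) _ = subst (λ z → J + N < h x₁ z) (sym e) far
        go (inj₂ (lt , _)) l≤ = ⊥-elim (ℕ.<⇒≱ (ℕ.<-≤-trans lt ω≤l) l≤)

      ep≤q : e * p ≤ q
      ep≤q = subst (e * p ≤_) τ+ep≡q (ℕ.m≤n+m (e * p) τ)

      jep≤jq : ∀ j → j * e * p ≤ j * q
      jep≤jq j = ℕ.≤-trans (ℕ.≤-reflexive (ℕ.*-assoc j e p)) (ℕ.*-monoʳ-≤ j ep≤q)

      l<p : l < p
      l<p = subst (l <_) l+β≡p (ℕ.m<m+n l (s≤s z≤n))

      -- A step of the path lowers x p + y q by e p and raises it by q.
      module _ (C₁ : l' * τ < ω * q) where

        -- With i + j = m the point (j e, i) lies at or below the level m q (`stay`) and misses it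
        -- by j τ. Since j τ < ω q by C₁, moving up ω columns overshoots the level.
        leave : ∀ {m} i j → i + j ≡ m → m ≤ l' → m * q < j * e * p + (i + ω) * q
        leave {m} i j refl m≤l' = begin-strict
          m * q                                    ≡⟨ cong (m *_) (sym τ+ep≡q) ⟩
          m * (τ + e * p)                      ≡⟨ eq₁ i j τ e p ⟩
          m * τ + (j * e * p + i * e * p)
            <⟨ ℕ.+-mono-<-≤ (ℕ.≤-<-trans (ℕ.*-monoˡ-≤ τ m≤l') C₁) (ℕ.+-monoʳ-≤ (j * e * p) (jep≤jq i)) ⟩
          ω * q + (j * e * p + i * q)    ≡⟨ eq₂ ω q (j * e * p) i ⟩
          j * e * p + (i + ω) * q ∎
          where
          open ℕ.≤-Reasoning
          eq₁ : ∀ i j t e p → (i + j) * (t + e * p) ≡ (i + j) * t + (j * e * p + i * e * p)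
          eq₁ = ℕR.solve-∀
          eq₂ : ∀ w q j i → w * q + (j + i * q) ≡ j + (i + w) * q
          eq₂ = ℕR.solve-∀

        stay : ∀ {m} i j → i + j ≡ m → j * e * p + i * q ≤ m * q
        stay {m} i j refl = ℕ.≤-trans (ℕ.+-monoˡ-≤ (i * q) (jep≤jq j)) (ℕ.≤-reflexive (trans (ℕ.+-comm (j * q) (i * q)) (sym (ℕ.*-distribʳ-+ q i j))))

        module _ (1≤e : 1 ≤ e) (1≤τ : 1 ≤ τ) (C₃ : μ + β * e ≤ q) where

          te>0 : ∀ t → 0 < suc t * e
          te>0 t = ℕ.≤-trans 1≤e (ℕ.m≤m+n e (t * e))

          tτ>0 : ∀ t → 0 < suc t * τ
          tτ>0 t = ℕ.≤-trans 1≤τ (ℕ.m≤m+n τ (t * τ))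

          -- The walk starts at ((λ - 1) e, 0) with cut-off (λ - 1) q: it passes (j e, i) with i + j
          -- = λ - 1, each contributing 1, down to (0, λ - 1), after which x wraps around.
          maximum : l' * e < μ → ∃ λ n → F n ≡ ℤ.+ l
          maximum C₂ = proj₁ attained , trans (proj₂ attained) (trans (cong₂ ℤ._+_ (ℤ.*-identityʳ (ℤ.+ l)) (ℤ.*-zeroʳ (ℤ.+ β))) (+-identityʳ (ℤ.+ l)))
            where
            J = l' * q
            first : ∀ i → i < l → T J (xs (l' * e) i) (ys 0 i) ≡ 1ℤ
            first i i<l = T-value {J} {x' = x₁} {y' = i} (xs-value {l' * e} {x₁} i i (ℕ.<-≤-trans x₁<μ μ≤q) x≡) (ys-value {0} {i} i 0 (ℕ.<-trans i<l l<p) (sym (ℕ.+-identityʳ i)))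
                (b-in {J} {x₁} {i} x₁<μ i<l (stay i j i+j)) (b-in-0 {J} {x₁} {(i + ω) % p} x₁<μ (λ _ → subst (λ z → J < h x₁ z) (sym (low-next i<l)) (leave i j i+j ℕ.≤-refl)))
              where
              j = l' ∸ i
              i+j : i + j ≡ l'
              i+j = ℕ.m+[n∸m]≡n (ℕ.≤-pred i<l)
              x₁ = j * e
              x₁<μ : x₁ < μ
              x₁<μ = ℕ.≤-<-trans (ℕ.*-monoˡ-≤ e (ℕ.m∸n≤m l' i)) C₂
              eq : ∀ i j e f → (i + j) * e + i * f ≡ j * e + i * (f + e)
              eq = ℕR.solve-∀
              x≡ : l' * e + i * f ≡ x₁ + i * q
              x≡ = trans (cong (λ z → z * e + i * f) (sym i+j)) (trans (eq i j e f) (cong (λ z → x₁ + i * z) f+e≡q))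
            -- Now x = q - (t+1) e, which C₃ keeps at least μ, and the exponent is J + N + (t+1) τ,
            -- just beyond the cut-off of the upper rectangle.
            second : ∀ t → t < β → T J (xs (l' * e) (l + t)) (ys 0 (l + t)) ≡ 0ℤ
            second t t<β = T-value {J} {x' = x₁} {y' = l + t} (xs-value {l' * e} {x₁} (l + t) (l' + t) x₁<q x≡) (ys-value {0} {l + t} (l + t) 0 y<p (sym (ℕ.+-identityʳ (l + t))))
                (b-out-0 {J} {x₁} {l + t} μ≤x₁ (λ _ → far)) (b-out-next {J} {x₁} {l + t} y<p μ≤x₁ (ℕ.<-≤-trans far (h-monoʳ x₁ (ℕ.m≤m+n (l + t) ω))))
              where
              te = suc t * e
              te≤ : μ + te ≤ q
              te≤ = ℕ.≤-trans (ℕ.+-monoʳ-≤ μ (ℕ.*-monoˡ-≤ e t<β)) C₃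
              x₁ = q ∸ te
              x₁+te : x₁ + te ≡ q
              x₁+te = ℕ.m∸n+n≡m (ℕ.≤-trans (ℕ.m≤n+m te μ) te≤)
              μ≤x₁ : μ ≤ x₁
              μ≤x₁ = ℕ.+-cancelʳ-≤ te μ x₁ (ℕ.≤-trans te≤ (ℕ.≤-reflexive (sym x₁+te)))
              x₁<q : x₁ < q
              x₁<q = subst (x₁ <_) x₁+te (ℕ.m<m+n x₁ (te>0 t))
              y<p : l + t < p
              y<p = subst (l + t <_) l+β≡p (ℕ.+-monoʳ-< l t<β)
              eq₁ : ∀ l t e f → l * e + (suc l + t) * f + suc t * e ≡ f + e + (l + t) * (f + e)
              eq₁ = ℕR.solve-∀
              eq₂ : ∀ x₁ te k q → x₁ + te + k * q ≡ x₁ + k * q + te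
              eq₂ = ℕR.solve-∀
              x≡ : l' * e + (l + t) * f ≡ x₁ + (l' + t) * q
              x≡ = ℕ.+-cancelʳ-≡ te _ _ (trans (eq₁ l' t e f) (trans (cong₂ (λ u v → u + (l' + t) * v) (trans f+e≡q (sym x₁+te)) f+e≡q) (eq₂ x₁ te (l' + t) q)))
              eq₃ : ∀ x₁ p l t q e → x₁ * p + (suc l + t) * q + suc t * e * p ≡ l * q + p * (x₁ + suc t * e) + suc t * q
              eq₃ = ℕR.solve-∀
              eq₄ : ∀ R t τ e p → R + suc t * (τ + e * p) ≡ R + suc t * τ + suc t * e * p
              eq₄ = ℕR.solve-∀
              far : J + N < h x₁ (l + t)
              far = ℕ.<-≤-trans (ℕ.m<m+n (J + N) (tτ>0 t)) (ℕ.≤-reflexive (ℕ.+-cancelʳ-≡ (te * p) _ _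
                (sym (trans (eq₃ x₁ p l' t q e) (trans (cong₂ (λ u v → J + p * u + suc t * v) x₁+te (sym τ+ep≡q)) (eq₄ (J + N) t τ e p))))))
            attained = F-attains (l' * e) 0 J l β 1ℤ 0ℤ l+β≡p first second

          -- The mirror image in the upper rectangle: from (μ + (β - 1) e, λ) the walk descends to
          -- (μ, p - 1), each point contributing -1. The 1 in J comes from μ p + λ q = p q + 1.
          minimum : β ≤ l → ∃ λ n → F n ≡ - ℤ.+ β
          minimum β≤l = proj₁ attained , trans (proj₂ attained) (eq (ℤ.+ β) (ℤ.+ l))
            where
            eq : ∀ b l → b ℤ.* - 1ℤ ℤ.+ l ℤ.* 0ℤ ≡ - b
            eq = solve-∀
            x₀ = μ + β' * e
            J = suc (β' * q)
            μp : μ * p ≡ suc (β * q)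
            μp = trans (sym co-μ) (cong (λ z → suc (z * q)) (trans (cong (_∸ l) (sym l+β≡p)) (ℕ.m+n∸m≡n l β)))
            first : ∀ i → i < β → T J (xs x₀ i) (ys l i) ≡ - 1ℤ
            first i i<β = T-value {J} {x' = x₁} {y' = l + i} (xs-value {x₀} {x₁} i i x₁<q x≡) (ys-value {l} {l + i} i 0 y<p (sym (ℕ.+-identityʳ (l + i))))
                (b-out {J} {x₁} {l + i} μ≤x₁ (ℕ.m≤m+n l i) (ℕ.≤-trans (ℕ.≤-reflexive (h≡ i)) (ℕ.≤-trans (s≤s (ℕ.+-monoʳ-≤ N (stay i j i+j))) (ℕ.≤-reflexive (cong suc (ℕ.+-comm N (β' * q)))))))
                (b-out-next {J} {x₁} {l + i} y<p μ≤x₁ (ℕ.<-≤-trans (s≤s (ℕ.≤-<-trans (ℕ.≤-reflexive (ℕ.+-comm (β' * q) N)) (ℕ.+-monoʳ-< N (leave i j i+j (ℕ.≤-pred β≤l)))))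
                  (ℕ.≤-reflexive (sym (trans (cong (h x₁) (ℕ.+-assoc l i ω)) (h≡ (i + ω)))))))
              where
              j = β' ∸ i
              i+j : i + j ≡ β'
              i+j = ℕ.m+[n∸m]≡n (ℕ.≤-pred i<β)
              x₁ = μ + j * e
              μ≤x₁ : μ ≤ x₁
              μ≤x₁ = ℕ.m≤m+n μ (j * e)
              x₁<q : x₁ < q
              x₁<q = ℕ.<-≤-trans (ℕ.+-monoʳ-< μ (ℕ.≤-<-trans (ℕ.*-monoˡ-≤ e (ℕ.m∸n≤m β' i)) (ℕ.m<n+m (β' * e) 1≤e))) C₃
              y<p : l + i < p
              y<p = subst (l + i <_) l+β≡p (ℕ.+-monoʳ-< l i<β)
              eq₁ : ∀ μ i j e f → μ + (i + j) * e + i * f ≡ μ + j * e + i * (f + e)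
              eq₁ = ℕR.solve-∀
              x≡ : x₀ + i * f ≡ x₁ + i * q
              x≡ = trans (cong (λ z → μ + z * e + i * f) (sym i+j)) (trans (eq₁ μ i j e f) (cong (λ z → x₁ + i * z) f+e≡q))
              eq₂ : ∀ μ je p l k q → (μ + je) * p + (l + k) * q ≡ μ * p + l * q + (je * p + k * q)
              eq₂ = ℕR.solve-∀
              h≡ : ∀ k → h x₁ (l + k) ≡ suc (N + (j * e * p + k * q))
              h≡ k = trans (eq₂ μ (j * e) p l k q) (cong (_+ (j * e * p + k * q)) bezout)
            eq₃ : ∀ x₁ p t q e → x₁ * p + t * q + suc t * e * p ≡ (x₁ + suc t * e) * p + t * q
            eq₃ = ℕR.solve-∀
            eq₄ : ∀ β M t τ e p q → suc (suc β * q) + M + t * q ≡ suc (β * q) + M + suc t * q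
            eq₄ = ℕR.solve-∀
            eq₅ : ∀ R t τ e p → R + suc t * (τ + e * p) ≡ R + suc t * τ + suc t * e * p
            eq₅ = ℕR.solve-∀
            far : ∀ {x₁ M} t → (x₁ + suc t * e) * p ≡ μ * p + M → J + M < h x₁ t
            far {x₁} {M} t hX = ℕ.<-≤-trans (ℕ.m<m+n (J + M) (tτ>0 t)) (ℕ.≤-reflexive (ℕ.+-cancelʳ-≡ (suc t * e * p) _ _
              (sym (trans (eq₃ x₁ p t q e) (trans (cong (_+ t * q) (trans hX (cong (_+ M) μp)))
                (trans (eq₄ β' M t τ e p q) (trans (cong (λ z → J + M + suc t * z) (sym τ+ep≡q)) (eq₅ (J + M) t τ e p))))))))
            -- x continues downwards from μ and may wrap modulo q. Before the wrap the points lie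
            -- above J in the lower rectangle; after it x ≥ μ, so only the upper cut-off J + N
            -- matters.
            second : ∀ t → t < l → T J (xs x₀ (β + t)) (ys l (β + t)) ≡ 0ℤ
            second t t<l = go (suc t * e ℕ.≤? μ)
              where
              te = suc t * e
              y≡ : ys l (β + t) ≡ t
              y≡ = ys-value {l} {t} (β + t) 1 (ℕ.<-trans t<l l<p) (trans (sym (ℕ.+-assoc l β t)) (trans (cong (_+ t) l+β≡p) (trans (ℕ.+-comm p t) (cong (t +_) (sym (ℕ.+-identityʳ p))))))
              next : ∀ {A x₁} → A < h x₁ t → A < h x₁ ((t + ω) % p)
              next {A} {x₁} lt = ℕ.<-≤-trans lt (h-monoʳ x₁ (ℕ.≤-trans (ℕ.m≤m+n t ω) (ℕ.≤-reflexive (sym (low-next t<l)))))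
              go : Dec (te ≤ μ) → T J (xs x₀ (β + t)) (ys l (β + t)) ≡ 0ℤ
              go (yes te≤μ) = T-value {J} {x' = x₁} {y' = t} (xs-value {x₀} {x₁} (β + t) (β + t) (ℕ.<-≤-trans x₁<μ μ≤q) x≡) y≡
                  (b-in-0 {J} {x₁} {t} x₁<μ (λ _ → above)) (b-in-0 {J} {x₁} {(t + ω) % p} x₁<μ (λ _ → next {J} {x₁} above))
                where
                x₁ = μ ∸ te
                x₁+te : x₁ + te ≡ μ
                x₁+te = ℕ.m∸n+n≡m te≤μ
                x₁<μ : x₁ < μ
                x₁<μ = subst (x₁ <_) x₁+te (ℕ.m<m+n x₁ (te>0 t))
                above : J < h x₁ t
                above = ℕ.≤-<-trans (ℕ.≤-reflexive (sym (ℕ.+-identityʳ J))) (far {x₁} {0} t (trans (cong (_* p) x₁+te) (sym (ℕ.+-identityʳ (μ * p)))))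
                eq₁ : ∀ x₁ t e b f → x₁ + suc t * e + b * e + (suc b + t) * f ≡ x₁ + (suc b + t) * (f + e)
                eq₁ = ℕR.solve-∀
                x≡ : x₀ + (β + t) * f ≡ x₁ + (β + t) * q
                x≡ = trans (cong (λ z → z + β' * e + (β + t) * f) (sym x₁+te)) (trans (eq₁ x₁ t e β' f) (cong (λ z → x₁ + (β + t) * z) f+e≡q))
              go (no te≰μ) = T-value {J} {x' = x₁} {y' = t} (xs-value {x₀} {x₁} (β + t) (β' + t) x₁<q x≡) y≡
                  (b-out-0 {J} {x₁} {t} μ≤x₁ (λ l≤t → ⊥-elim (ℕ.<⇒≱ t<l l≤t))) (b-out-0 {J} {x₁} {(t + ω) % p} μ≤x₁ (λ _ → next {J + N} {x₁} above))
                where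
                te≤q : te ≤ q
                te≤q = ℕ.≤-trans (ℕ.*-monoˡ-≤ e (ℕ.≤-trans t<l l≤p)) (ℕ.≤-trans (ℕ.≤-reflexive (ℕ.*-comm p e)) ep≤q)
                x₁ = μ + q ∸ te
                x₁+te : x₁ + te ≡ μ + q
                x₁+te = ℕ.m∸n+n≡m (ℕ.≤-trans te≤q (ℕ.m≤n+m q μ))
                μ≤x₁ : μ ≤ x₁
                μ≤x₁ = ℕ.+-cancelʳ-≤ te μ x₁ (ℕ.≤-trans (ℕ.+-monoʳ-≤ μ te≤q) (ℕ.≤-reflexive (sym x₁+te)))
                x₁<q : x₁ < q
                x₁<q = ℕ.+-cancelʳ-< te x₁ q (ℕ.≤-<-trans (ℕ.≤-reflexive (trans x₁+te (ℕ.+-comm μ q))) (ℕ.+-monoʳ-< q (ℕ.≰⇒> te≰μ)))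
                above : J + N < h x₁ t
                above = far {x₁} {N} t (trans (cong (_* p) x₁+te) (trans (ℕ.*-distribʳ-+ p μ q) (cong (μ * p +_) (ℕ.*-comm q p))))
                eq₁ : ∀ μ t e b f → μ + b * e + (suc b + t) * f + suc t * e ≡ μ + (f + e) + (b + t) * (f + e)
                eq₁ = ℕR.solve-∀
                eq₂ : ∀ x₁ te k → x₁ + te + k ≡ x₁ + k + te
                eq₂ = ℕR.solve-∀
                x≡ : x₀ + (β + t) * f ≡ x₁ + (β' + t) * q
                x≡ = ℕ.+-cancelʳ-≡ te _ _ (trans (eq₁ μ t e β' f) (trans (cong (λ z → μ + z + (β' + t) * z) f+e≡q)
                  (trans (cong (_+ (β' + t) * q) (sym x₁+te)) (eq₂ x₁ te ((β' + t) * q)))))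
            attained = F-attains x₀ l J β l (- 1ℤ) 0ℤ (trans (ℕ.+-comm β l) l+β≡p) first second

          range : l' * e < μ → β ≤ l → ∀ z → (∃ λ k → Φ (p * q * r) k ≡ z) ⇔ (- ℤ.+ β ℤ.≤ z × z ℤ.≤ ℤ.+ l)
          range C₂ β≤l z = mk⇔ (λ { (k , refl) → subst (λ u → - ℤ.+ β ℤ.≤ u × u ℤ.≤ ℤ.+ l) (sym (Φ≡F k)) (bounds k) }) attain
            where
            Φ≡F : Φ (p * q * r) ≈ F
            Φ≡F = Φ≈F (r * (N + N)) F-support
            attain : - ℤ.+ β ℤ.≤ z × z ℤ.≤ ℤ.+ l → ∃ λ k → Φ (p * q * r) k ≡ z
            attain (lo , hi) = proj₁ found , trans (Φ≡F (proj₁ found)) (proj₂ found)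
              where
              found = between z (proj₁ (minimum β≤l)) (proj₁ (maximum C₂)) (subst (ℤ._≤ z) (sym (proj₂ (minimum β≤l))) lo) (subst (z ℤ.≤_) (sym (proj₂ (maximum C₂))) hi)

-- Location of q modulo p

module Residue where
  open import Data.Nat
  open import Data.Nat.Properties
  open import Data.Nat.Tactic.RingSolver using (solve-∀)

  -- A linear refutation: three inequalities are added, and the ring identity shows that the sum is
  -- off by `suc m`.
  absurd-sum : ∀ {A B C D E G} → A ≤ B → C ≤ D → E ≤ G → ∀ m → A + C + E ≡ suc m + (B + D + G) → ⊥
  absurd-sum a c e m eq = m+n≮n m _ (≤-trans (≤-reflexive (sym eq)) (+-mono-≤ (+-mono-≤ a c) e))

  module _ (w t β p u k : ℕ) (w≡ : w ≡ suc (2 * t)) (3≤w : 3 ≤ w) (p≡ : 2 * β + w ≡ p) (large : w * w + 3 ≤ p + w)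
    (wu : w * u ≡ 2 + k * p) (u<p : u < p) where

    k≥1 : 1 ≤ k
    k≥1 = go k u wu
      where
      go : ∀ k u → w * u ≡ 2 + k * p → 1 ≤ k
      go (suc _) _ _ = s≤s z≤n
      go zero zero e = ⊥-elim (0≢1+n (trans (sym (*-zeroʳ w)) e))
      go zero (suc u) e = ⊥-elim (<⇒≱ 3≤w (≤-trans (m≤m*n w (suc u)) (≤-reflexive e)))

    p≤kp : p ≤ k * p
    p≤kp = ≤-trans (≤-reflexive (sym (*-identityˡ p))) (*-monoˡ-≤ p k≥1)

    -- u < w would give p + 2 ≤ w u ≤ w² - w, against w² + 3 ≤ p + w.
    w≤u : w ≤ u
    w≤u = ≮⇒≥ (λ u<w → absurd-sum (subst (_≤ w * w) (trans (*-suc w u) (cong (w +_) wu)) (*-monoʳ-≤ w u<w)) p≤kp large 4 (eq w (k * p) p))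
      where
      eq : ∀ w K p → w + (2 + K) + p + (w * w + 3) ≡ 5 + (w * w + K + (p + w))
      eq = solve-∀

    k<w : k < w
    k<w = *-cancelʳ-< p k w (≤-<-trans (m≤n+m (k * p) 1) (≤-trans (≤-reflexive (cong suc refl)) (≤-trans (≤-reflexive (sym wu)) (*-monoʳ-≤ w (<⇒≤ u<p)))))

    w+u≤p : w + u ≤ p
    w+u≤p = ≮⇒≥ (λ p<w+u → absurd-sum (subst (w * suc p ≤_) (trans (*-distribˡ-+ w w u) (cong (w * w +_) wu)) (*-monoʳ-≤ w p<w+u)) (*-monoˡ-≤ p k<w) large 0 (eq w p k))
      where
      eq : ∀ w p k → w * suc p + suc k * p + (w * w + 3) ≡ 1 + (w * w + (2 + k * p) + w * p + (p + w))
      eq = solve-∀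

    -- u is about (k/w) p, and k/w is not 1/2 because w = 2 t + 1 is odd. For k ≤ t it falls below
    -- p/2 by enough to reach β = (p - w)/2, and for k > t so does p - u.
    near-half : u ≤ β ⊎ p ≤ u + β
    near-half = go (u ≤? β) (p ≤? u + β) (k ≤? t)
      where
      eq₁ : ∀ w β → w * (2 * suc β + w) ≡ w * (2 * β + w) + 2 * w
      eq₁ = solve-∀
      eq₂ : ∀ w u → w * (2 * u + w) ≡ 2 * (w * u) + w * w
      eq₂ = solve-∀
      eq₃ : ∀ w p k → w * p + 2 * w + suc (2 * k) * p + (w * w + 3 + w) ≡ w + (3 + 2 * k * p + p + 2 * w + w * w + w * p)
      eq₃ = solve-∀
      eq₄ : ∀ w p k → 2 * (2 + k * p) + w * w + w * p + (p + w + w) ≡ 1 + (3 + 2 * k * p + p + 2 * w + w * w + w * p)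
      eq₄ = solve-∀
      eq₅ : ∀ w u β → w * (2 * suc (u + β)) ≡ 2 * (w * u) + (w * (2 * β) + 2 * w)
      eq₅ = solve-∀
      below : β < u → k ≤ t → ⊥
      below β<u k≤t = absurd-sum (subst₂ _≤_ (trans (eq₁ w β) (cong (λ z → w * z + 2 * w) p≡)) (trans (eq₂ w u) (cong (λ z → 2 * z + w * w) wu)) (*-monoʳ-≤ w (+-monoˡ-≤ w (*-monoʳ-≤ 2 β<u))))
        (*-monoˡ-≤ p (≤-trans (s≤s (*-monoʳ-≤ 2 k≤t)) (≤-reflexive (sym w≡)))) (+-monoˡ-≤ w large) (w ∸ 2) (trans (eq₃ w p k) (trans (cong (_+ R) (sym w-2)) (trans (eq₇ (w ∸ 2) R) (cong (λ z → suc (w ∸ 2) + z) (sym (eq₄ w p k))))))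
        where
        R = 3 + 2 * k * p + p + 2 * w + w * w + w * p
        w-2 : suc (suc (w ∸ 2)) ≡ w
        w-2 = m+[n∸m]≡n (<⇒≤ 3≤w)
        eq₇ : ∀ a R → suc (suc a) + R ≡ suc a + (1 + R)
        eq₇ = solve-∀
      above : u + β < p → t < k → ⊥
      above lt t<k = absurd-sum ineq (*-monoˡ-≤ p w+1≤2k) large (6 + w) (subst (λ p → Balance p) p≡ (eq w β k))
        where
        w+1≤2k : suc w ≤ 2 * k
        w+1≤2k = ≤-trans (≤-reflexive (trans (cong suc w≡) (eq' t))) (*-monoʳ-≤ 2 t<k)
          where
          eq' : ∀ t → suc (suc (2 * t)) ≡ 2 * suc t
          eq' = solve-∀
        ineq : 2 * (2 + k * p) + (w * (2 * β) + 2 * w) ≤ w * (2 * p)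
        ineq = subst (_≤ w * (2 * p)) (trans (eq₅ w u β) (cong (λ z → 2 * z + (w * (2 * β) + 2 * w)) wu)) (*-monoʳ-≤ w (*-monoʳ-≤ 2 lt))
        Balance : ℕ → Set
        Balance p = 2 * (2 + k * p) + (w * (2 * β) + 2 * w) + suc w * p + (w * w + 3) ≡ suc (6 + w) + (w * (2 * p) + 2 * k * p + (p + w))
        eq : ∀ w β k → 2 * (2 + k * (2 * β + w)) + (w * (2 * β) + 2 * w) + suc w * (2 * β + w) + (w * w + 3) ≡
          suc (6 + w) + (w * (2 * (2 * β + w)) + 2 * k * (2 * β + w) + (2 * β + w + w))
        eq = solve-∀
      go : Dec (u ≤ β) → Dec (p ≤ u + β) → Dec (k ≤ t) → u ≤ β ⊎ p ≤ u + β
      go (yes a) _ _ = inj₁ a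
      go (no _) (yes b) _ = inj₂ b
      go (no a) (no _) (yes c) = ⊥-elim (below (≰⇒> a) c)
      go (no _) (no b) (no c) = ⊥-elim (above (≰⇒> b) (≰⇒> c))

-- Choice of the primes q and r

module PrimeChoice where
  open import Defs
  open import Data.Nat using (_+_; _*_; _≤_; _<_; _^_)
  open import Data.Nat.DivMod
  open import Data.Nat.Divisibility
  open import Data.Nat.Primality
  open import Data.Nat.Coprimality as C using (Coprime)
  open import Data.Integer as ℤ using (ℤ)
  open import Function using (id)
  open import Function.Bundles using (_⇔_)
  open CyclotomicFactors using (Φ; prime>1)
  open BinaryCyclotomic using (bezout-from; Σ-reverse)
  open Dirichlet using (dirichlet)
  open TernaryCyclotomic using (module Coefficients; TernaryData)
  open Residue

  *-%-cong : ∀ m .{{_ : ℕ.NonZero m}} {a a' b b'} → a % m ≡ a' % m → b % m ≡ b' % m → (a * b) % m ≡ (a' * b') % m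
  *-%-cong m {a} {a'} {b} {b'} h k = trans (%-distribˡ-* a b m) (trans (cong₂ (λ x y → (x * y) % m) h k) (sym (%-distribˡ-* a' b' m)))

  +-%-cong : ∀ m .{{_ : ℕ.NonZero m}} {a a' b b'} → a % m ≡ a' % m → b % m ≡ b' % m → (a + b) % m ≡ (a' + b') % m
  +-%-cong m {a} {a'} {b} {b'} h k = trans (%-distribˡ-+ a b m) (trans (cong₂ (λ x y → (x + y) % m) h k) (sym (%-distribˡ-+ a' b' m)))

  unit-inverse : ∀ m .{{_ : ℕ.NonZero m}} → 2 ≤ m → ∀ u → Coprime u m → ∃ λ v → Coprime v m × (u * v) % m ≡ 1
  unit-inverse m 2≤m u c = proj₁ w , proj₂ w , trans (UnitGroup.recip-inverse m 2≤m (u , c)) (UnitGroup.1%m m 2≤m)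
    where
    w = UnitGroup.recip m 2≤m (u , c)

  small-coprime : ∀ {p u} → Prime p → 1 ≤ u → u < p → Coprime u p
  small-coprime {p} {u} pp 1≤u u<p {d} (d∣u , d∣p) with prime⇒irreducible pp d∣p
  ... | inj₁ e = e
  ... | inj₂ refl = ⊥-elim (ℕ.<⇒≱ u<p (∣⇒≤ {{ℕ.>-nonZero 1≤u}} d∣u))

  coprime-product : ∀ {u p q} → Coprime u p → Coprime u q → Coprime u (p * q)
  coprime-product {u} {p} {q} cp cq {d} (d∣u , d∣pq) = cq (d∣u , C.coprime-divisor (λ { (x∣d , x∣p) → cp (∣-trans x∣d d∣u , x∣p) }) d∣pq)

  coprime-pred : ∀ n → Coprime n (suc n)
  coprime-pred n {d} (d∣n , d∣sn) = ∣1⇒≡1 (∣m+n∣m⇒∣n (subst (d ∣_) (ℕ.+-comm 1 n) d∣sn) d∣n)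

  prime-in-class : ∀ m .{{_ : ℕ.NonZero m}} → 2 ≤ m → ∀ u → Coprime u m → ∀ M → ∃ λ q → Prime q × M < q × (u * q) % m ≡ 1
  prime-in-class m 2≤m u c M = go (unit-inverse m 2≤m u c)
    where
    go : (∃ λ v → Coprime v m × (u * v) % m ≡ 1) → ∃ λ q → Prime q × M < q × (u * q) % m ≡ 1
    go (v , cv , e) = solve (dirichlet m v M 2≤m cv)
      where
      solve : (∃ λ q → Prime q × M < q × q % m ≡ v % m) → ∃ λ q → Prime q × M < q × (u * q) % m ≡ 1
      solve (q , pq , M<q , q≡) = q , pq , M<q , trans (*-%-cong m {u} {u} {q} {v} refl q≡) e

  -- With m = n + 1 one has n ≡ -1, so n v is minus the inverse of u.
  prime-in-negative-class : ∀ m → 2 ≤ m → ∀ u → Coprime u m → ∀ M → ∃ λ q → Prime q × M < q × m ∣ suc (u * q)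
  prime-in-negative-class (suc n) 2≤m u c M = go (unit-inverse (suc n) 2≤m u c)
    where
    eq : ∀ u n v → u * (n * v) ≡ n * (u * v)
    eq = ℕR.solve-∀
    go : (∃ λ v → Coprime v (suc n) × (u * v) % suc n ≡ 1) → ∃ λ q → Prime q × M < q × suc n ∣ suc (u * q)
    go (v , cv , e) = solve (dirichlet (suc n) (n * v) M 2≤m (UnitGroup.coprime-* (suc n) 2≤m {n} {v} (coprime-pred n) cv))
      where
      uq : ∀ q → q % suc n ≡ (n * v) % suc n → (u * q) % suc n ≡ n % suc n
      uq q q≡ = trans (*-%-cong (suc n) {u} {u} {q} {n * v} refl q≡) (trans (cong (_% suc n) (eq u n v))
        (trans (*-%-cong (suc n) {n} {n} {u * v} {1} refl (trans e (sym (m<n⇒m%n≡m 2≤m)))) (cong (_% suc n) (ℕ.*-identityʳ n))))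
      solve : (∃ λ q → Prime q × M < q × q % suc n ≡ (n * v) % suc n) → ∃ λ q → Prime q × M < q × suc n ∣ suc (u * q)
      solve (q , pq , M<q , q≡) = q , pq , M<q , m%n≡0⇒n∣m (suc (u * q)) (suc n) (trans (+-%-cong (suc n) {1} {1} {u * q} {n} refl (uq q q≡)) (n%n≡0 (suc n)))

  -- With ℓ + 2 = w = 2 t + 3, β = (p − w) / 2 and l = p − β, the paper's interval is [ − β , l ].
  module Primes (t β' p : ℕ) (pp : Prime p) (p≡ : p ≡ 2 * β' + 2 * t + 5) (w l' : ℕ) (w≡ : w ≡ 2 * t + 3)
    (l'≡ : l' ≡ β' + 2 * t + 3) (large : w * w + 3 ≤ p + w) where

    β l : ℕ
    β = suc β'
    l = suc l'

    1<p : 1 < p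
    1<p = prime>1 pp

    instance
      p≢0 : ℕ.NonZero p
      p≢0 = prime⇒nonZero pp

    l+β≡p : l + β ≡ p
    l+β≡p rewrite p≡ | l'≡ = eq β' t
      where
      eq : ∀ b t → suc (b + 2 * t + 3) + suc b ≡ 2 * b + 2 * t + 5
      eq = ℕR.solve-∀

    2β+w≡p : 2 * β + w ≡ p
    2β+w≡p rewrite p≡ | w≡ = eq β' t
      where
      eq : ∀ b t → 2 * suc b + (2 * t + 3) ≡ 2 * b + 2 * t + 5
      eq = ℕR.solve-∀

    l≡β+w : l ≡ β + w
    l≡β+w rewrite l'≡ | w≡ = eq β' t
      where
      eq : ∀ b t → suc (b + 2 * t + 3) ≡ suc b + (2 * t + 3)
      eq = ℕR.solve-∀

    w≡' : w ≡ suc (2 * suc t)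
    w≡' = trans w≡ (eq t)
      where
      eq : ∀ t → 2 * t + 3 ≡ suc (2 * suc t)
      eq = ℕR.solve-∀

    3≤w : 3 ≤ w
    3≤w = subst (3 ≤_) (sym w≡) (ℕ.m≤n+m 3 (2 * t))

    1≤β : 1 ≤ β
    1≤β = s≤s z≤n

    β≤l' : β ≤ l'
    β≤l' = ℕ.≤-pred (ℕ.≤-trans (ℕ.≤-trans (ℕ.≤-reflexive (ℕ.+-comm 1 β)) (ℕ.+-monoʳ-≤ β (ℕ.≤-trans (s≤s z≤n) 3≤w))) (ℕ.≤-reflexive (sym l≡β+w)))

    l'≤ : suc l' ≤ β + w
    l'≤ = ℕ.≤-reflexive l≡β+w

    β<l' : β < l'
    β<l' = ℕ.≤-pred (ℕ.≤-trans (ℕ.≤-trans (ℕ.≤-reflexive (ℕ.+-comm 2 β)) (ℕ.+-monoʳ-≤ β (ℕ.<⇒≤ 3≤w))) (ℕ.≤-reflexive (sym l≡β+w)))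

    1≤l' : 1 ≤ l'
    1≤l' = ℕ.≤-trans 1≤β β≤l'

    β≤l : β ≤ l
    β≤l = subst (β ≤_) (sym l≡β+w) (ℕ.m≤m+n β w)

    l<p : l < p
    l<p = subst (l <_) l+β≡p (ℕ.m<m+n l 1≤β)

    l'+β : suc (l' + β) ≡ p
    l'+β = l+β≡p

    module _ (q : ℕ) (pq : Prime q) (lq : (l * q) % p ≡ 1) (lp<q : l' * p < q) (p<q : p < q)
      (μ : ℕ) (μ≤q : μ ≤ q) (bezout : μ * p + l * q ≡ suc (p * q)) where

      u = q % p

      k = (w * u) / p

      -- 2 λ = p + w and λ q ≡ 1, so w q ≡ 2 λ q ≡ 2 mod p.
      wu : w * u ≡ 2 + k * p
      wu = trans (m≡m%n+[m/n]*n (w * u) p) (cong (_+ k * p) wu%p)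
        where
        open ≡-Reasoning
        eq : ∀ β w → 2 * (β + w) ≡ w + 1 * (2 * β + w)
        eq = ℕR.solve-∀
        2<p : 2 < p
        2<p = ℕ.≤-trans 3≤w (subst (w ≤_) 2β+w≡p (ℕ.m≤n+m w (2 * β)))
        wu%p : (w * u) % p ≡ 2
        wu%p = begin
          (w * u) % p             ≡⟨ *-%-cong p {w} {2 * l} {u} {q} (sym (trans (cong (_% p) (trans (cong (2 *_) l≡β+w) (trans (eq β w) (cong (λ z → w + 1 * z) 2β+w≡p)))) ([m+kn]%n≡m%n w 1 p))) (m%n%n≡m%n q p) ⟩
          (2 * l * q) % p       ≡⟨ cong (_% p) (ℕ.*-assoc 2 l q) ⟩
          (2 * (l * q)) % p     ≡⟨ *-%-cong p {2} {2} {l * q} {1} refl (trans lq (sym (m<n⇒m%n≡m 1<p))) ⟩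
          2 % p                     ≡⟨ m<n⇒m%n≡m 2<p ⟩
          2 ∎

      u<p : u < p
      u<p = m%n<n q p

      w≤u' : w ≤ u
      w≤u' = w≤u w (suc t) β p u k w≡' 3≤w 2β+w≡p large wu u<p

      w+u≤p' : w + u ≤ p
      w+u≤p' = w+u≤p w (suc t) β p u k w≡' 3≤w 2β+w≡p large wu u<p

      d = l' * p

      instance
        d≢0 : ℕ.NonZero d
        d≢0 = ℕ.m*n≢0 l' p {{ℕ.>-nonZero 1≤l'}} {{p≢0}}

      -- The largest e with λ' e p ≤ β q, where λ' = λ - 1. This inequality gives C₂ and C₃, since μ
      -- p = β q + 1, and maximality gives C₁.
      e = (β * q) / d

      ed≤βq : e * d ≤ β * q
      ed≤βq = m/n*n≤m (β * q) d

      βq<ed+d : β * q < d + e * d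
      βq<ed+d = subst (_< d + e * d) (sym (m≡m%n+[m/n]*n (β * q) d)) (ℕ.+-monoˡ-< (e * d) (m%n<n (β * q) d))

      1≤e : 1 ≤ e
      1≤e = m≥n⇒m/n>0 (ℕ.≤-trans (ℕ.<⇒≤ lp<q) (ℕ.≤-trans (ℕ.≤-reflexive (sym (ℕ.*-identityˡ q))) (ℕ.*-monoˡ-≤ q 1≤β)))

      eq-d : ∀ l e p → l * (e * p) ≡ e * (l * p)
      eq-d = ℕR.solve-∀

      1≤q : 1 ≤ q
      1≤q = ℕ.<⇒≤ (prime>1 pq)

      ep<q : e * p < q
      ep<q = ℕ.*-cancelˡ-< l' (e * p) q (ℕ.≤-<-trans (ℕ.≤-reflexive (eq-d l' e p)) (ℕ.≤-<-trans ed≤βq (ℕ.*-monoˡ-< q {{ℕ.>-nonZero 1≤q}} β<l')))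

      τ = q ∸ e * p

      τ+ep : τ + e * p ≡ q
      τ+ep = ℕ.m∸n+n≡m (ℕ.<⇒≤ ep<q)

      1≤τ : 1 ≤ τ
      1≤τ = ℕ.m<n⇒0<n∸m ep<q

      e≤q : e ≤ q
      e≤q = ℕ.≤-trans (ℕ.m≤m*n e p) (ℕ.<⇒≤ ep<q)

      μp : μ * p ≡ suc (β * q)
      μp = ℕ.+-cancelʳ-≡ (l * q) _ _ (trans bezout (cong suc (trans (cong (_* q) (trans (sym l+β≡p) (ℕ.+-comm l β))) (ℕ.*-distribʳ-+ q β l))))

      -- By maximality λ' τ + β q < λ' (τ + e p) + λ' p = λ' q + λ' p. With λ' p < q this is below λ
      -- q = (β + w) q, so already w q exceeds λ' τ.
      C₁ : ∀ ω → w ≤ ω → l' * τ < ω * q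
      C₁ ω w≤ω = ℕ.<-≤-trans (ℕ.+-cancelʳ-< (β * q) (l' * τ) (w * q) (begin-strict
          l' * τ + β * q                  <⟨ ℕ.+-monoʳ-< (l' * τ) βq<ed+d ⟩
          l' * τ + (d + e * d)          ≡⟨ eq l' τ p e ⟩
          l' * (τ + e * p) + d          ≡⟨ cong (λ z → l' * z + d) τ+ep ⟩
          l' * q + d                        ≤⟨ ℕ.+-monoʳ-≤ (l' * q) (ℕ.<⇒≤ lp<q) ⟩
          l' * q + q                        ≡⟨ ℕ.+-comm (l' * q) q ⟩
          suc l' * q                          ≤⟨ ℕ.*-monoˡ-≤ q l'≤ ⟩
          (β + w) * q                       ≡⟨ trans (ℕ.*-distribʳ-+ q β w) (ℕ.+-comm (β * q) (w * q)) ⟩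
          w * q + β * q ∎)) (ℕ.*-monoˡ-≤ q w≤ω)
        where
        open ℕ.≤-Reasoning
        eq : ∀ l t p e → l * t + (l * p + e * (l * p)) ≡ l * (t + e * p) + l * p
        eq = ℕR.solve-∀

      C₂ : l' * e < μ
      C₂ = ℕ.*-cancelʳ-< p (l' * e) μ (ℕ.≤-<-trans (ℕ.≤-reflexive (eq l' e p)) (ℕ.≤-<-trans ed≤βq (ℕ.≤-reflexive (sym μp))))
        where
        eq : ∀ l e p → l * e * p ≡ e * (l * p)
        eq = ℕR.solve-∀

      C₃ : μ + β * e ≤ q
      C₃ = ℕ.*-cancelˡ-≤ d (begin
          d * (μ + β * e)                                   ≡⟨ eq₁ l' p μ β e ⟩
          l' * (μ * p) + β * (e * d)                    ≤⟨ ℕ.+-mono-≤ (ℕ.≤-reflexive (cong (l' *_) μp)) (ℕ.*-monoʳ-≤ β ed≤βq) ⟩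
          l' * suc (β * q) + β * (β * q)                ≡⟨ eq₂ l' β q ⟩
          l' * 1 + β * ((l' + β) * q)                   ≤⟨ ℕ.+-mono-≤ (ℕ.*-monoʳ-≤ l' 1≤q) (ℕ.*-monoˡ-≤ ((l' + β) * q) β≤l') ⟩
          l' * q + l' * ((l' + β) * q)                  ≡⟨ eq₃ l' β q ⟩
          l' * suc (l' + β) * q                             ≡⟨ cong (λ z → l' * z * q) l'+β ⟩
          d * q ∎)
        where
        open ℕ.≤-Reasoning
        eq₁ : ∀ l p m b e → l * p * (m + b * e) ≡ l * (m * p) + b * (e * (l * p))
        eq₁ = ℕR.solve-∀
        eq₂ : ∀ l b q → l * suc (b * q) + b * (b * q) ≡ l * 1 + b * ((l + b) * q)
        eq₂ = ℕR.solve-∀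
        eq₃ : ∀ l b q → l * q + l * ((l + b) * q) ≡ l * suc (l + b) * q
        eq₃ = ℕR.solve-∀

      τ≡u : τ % p ≡ u % p
      τ≡u = trans (sym ([m+kn]%n≡m%n τ e p)) (trans (cong (_% p) τ+ep) (sym (m%n%n≡m%n q p)))

      1≤u : 1 ≤ u
      1≤u = ℕ.≤-trans (ℕ.≤-trans (s≤s z≤n) 3≤w) w≤u'

      τ⊥p : Coprime τ p
      τ⊥p = UnitGroup.coprime-% p 1<p {u} {τ} (sym τ≡u) (small-coprime pp 1≤u u<p)

      τ⊥q : Coprime τ q
      τ⊥q = small-coprime pq 1≤τ (subst (τ <_) τ+ep (ℕ.m<m+n τ (ℕ.≤-trans 1≤e (ℕ.m≤m*n e p))))

      N = p * q

      1<N : 1 < N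
      1<N = ℕ.≤-trans (prime>1 pq) (ℕ.m≤n*m q p)

      instance
        N≢0 : ℕ.NonZero N
        N≢0 = ℕ.m*n≢0 p q {{p≢0}} {{prime⇒nonZero pq}}

      Range : ℕ → Set
      Range r = ∀ z → (∃ λ k → Φ (p * q * r) k ≡ z) ⇔ (ℤ.- ℤ.+ β ℤ.≤ z × z ℤ.≤ ℤ.+ l)

      range : ∀ r → Prime r → N < r → ∀ ω s (idx : ℕ → ℕ) → (∀ i → i < p → idx i < p) → (∀ g → BinaryCyclotomic.Σ p (g ∘ idx) ≡ BinaryCyclotomic.Σ p g) →
        (∀ i → i < p → (i * (r * τ) + idx i) % N ≡ s % N) → p ∣ suc (r * ω) → w ≤ ω → ω ≤ β → Range r
      range r pr N<r ω s idx idx<p Σ-idx idx-τ ω-r w≤ω ω≤β = Coefficients.Path.range D O (C₁ ω w≤ω) 1≤e 1≤τ C₃ C₂ β≤l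
        where
        D : TernaryData
        D = record { p = p ; q = q ; r = r ; μ = μ ; l' = l' ; β' = β' ; pp = pp ; pq = pq ; pr = pr ; p<q = p<q ; pq<r = N<r ; μ≤q = μ≤q ; l+β≡p = l+β≡p ; bezout = bezout }
        O : Coefficients.Orientation D
        O = record
          { e = e ; f = q ∸ e ; τ = τ ; ω = ω ; s = s ; idx = idx ; f+e≡q = ℕ.m∸n+n≡m e≤q ; τ+ep≡q = τ+ep ; idx<p = idx<p ; Σ-idx = Σ-idx ; idx-τ = idx-τ
          ; ω-r = ω-r ; ω≤l = ℕ.≤-trans ω≤β β≤l ; ω≤β = ω≤β ; 1≤ω = ℕ.≤-trans (ℕ.≤-trans (s≤s z≤n) 3≤w) w≤ω }

      -- As τ ≡ u mod p, the condition r ω ≡ -1 mod p gives ω = u when τ r ≡ -1, and ω = p - u when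
      -- τ r ≡ 1. `near-half` decides which of the two is at most β.
      third : ∃ λ r → Prime r × N < r × Range r
      third = go (near-half w (suc t) β p u k w≡' 3≤w 2β+w≡p large wu u<p)
        where
        go : u ≤ β ⊎ p ≤ u + β → ∃ λ r → Prime r × N < r × Range r
        go (inj₁ u≤β) = build (prime-in-negative-class N 1<N τ (coprime-product τ⊥p τ⊥q) N)
          where
          build : (∃ λ r → Prime r × N < r × N ∣ suc (τ * r)) → ∃ λ r → Prime r × N < r × Range r
          build (r , pr , N<r , N∣) = r , pr , N<r , range r pr N<r u 0 id (λ _ i<p → i<p) (λ _ → refl) along p∣ w≤u' u≤β
            where
            eq : ∀ i r t → i * (r * t) + i ≡ 0 + i * suc (t * r)
            eq = ℕR.solve-∀
            along : ∀ i → i < p → (i * (r * τ) + i) % N ≡ 0 % N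
            along i _ = trans (cong (_% N) (eq i r τ)) (%-remove-+ʳ 0 (∣n⇒∣m*n i N∣))
            p∣ : p ∣ suc (r * u)
            p∣ = m%n≡0⇒n∣m _ _ (trans (+-%-cong p {1} {1} {r * u} {τ * r} refl (trans (cong (_% p) (ℕ.*-comm r u)) (*-%-cong p {u} {τ} {r} {r} (sym τ≡u) refl)))
              (n∣m⇒m%n≡0 _ _ (∣-trans (m∣m*n q) N∣)))
        go (inj₂ p≤u+β) = build (prime-in-class N 1<N τ (coprime-product τ⊥p τ⊥q) N)
          where
          ω = p ∸ u
          ω+u : ω + u ≡ p
          ω+u = ℕ.m∸n+n≡m (ℕ.<⇒≤ u<p)
          build : (∃ λ r → Prime r × N < r × (τ * r) % N ≡ 1) → ∃ λ r → Prime r × N < r × Range r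
          -- For τ r ≡ 1 a step of the walk raises the multiple of r by 1, so the exponents 0, ...,
          -- p - 1 are visited in reverse order, starting from s = p - 1.
          build (r , pr , N<r , τr) = r , pr , N<r , range r pr N<r ω (ℕ.pred p) (λ i → p ∸ suc i)
              (λ i i<p → ℕ.∸-monoʳ-< {p} {suc i} {0} (s≤s z≤n) i<p) (Σ-reverse p) along p∣
              (ℕ.+-cancelʳ-≤ u w ω (ℕ.≤-trans w+u≤p' (ℕ.≤-reflexive (sym ω+u)))) (ℕ.m≤n+o⇒m∸n≤o p u p≤u+β)
            where
            along : ∀ i → i < p → (i * (r * τ) + (p ∸ suc i)) % N ≡ ℕ.pred p % N
            along i i<p = trans (+-%-cong N {i * (r * τ)} {i} {p ∸ suc i} {p ∸ suc i}
                (trans (*-%-cong N {i} {i} {r * τ} {1} refl (trans (cong (_% N) (ℕ.*-comm r τ)) (trans τr (sym (m<n⇒m%n≡m 1<N))))) (cong (_% N) (ℕ.*-identityʳ i))) refl)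
              (cong (_% N) (cong ℕ.pred (ℕ.m+[n∸m]≡n i<p)))
            eq : ∀ r w u → suc (r * w) + u * r ≡ 1 + r * (w + u)
            eq = ℕR.solve-∀
            ur : (u * r) % p ≡ 1
            ur = trans (*-%-cong p {u} {τ} {r} {r} (sym τ≡u) refl) (trans (sym lift) (m<n⇒m%n≡m 1<p))
              where
              split : τ * r ≡ 1 + ((τ * r) / N * q) * p
              split = trans (m≡m%n+[m/n]*n (τ * r) N) (cong₂ _+_ τr (eq' ((τ * r) / N) p q))
                where
                eq' : ∀ a p q → a * (p * q) ≡ a * q * p
                eq' = ℕR.solve-∀
              lift : 1 % p ≡ (τ * r) % p
              lift = sym (trans (cong (_% p) split) ([m+kn]%n≡m%n 1 ((τ * r) / N * q) p))
            p∣ : p ∣ suc (r * ω)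
            p∣ = m%n≡0⇒n∣m _ _ (%-cancel-1 (suc (r * ω)) (begin
                (suc (r * ω) + 1) % p            ≡⟨ +-%-cong p {suc (r * ω)} {suc (r * ω)} {1} {u * r} refl (trans (m<n⇒m%n≡m 1<p) (sym ur)) ⟩
                (suc (r * ω) + u * r) % p      ≡⟨ cong (_% p) (trans (eq r ω u) (cong (λ z → 1 + r * z) ω+u)) ⟩
                (1 + r * p) % p                  ≡⟨ [m+kn]%n≡m%n 1 r p ⟩
                1 % p ∎))
              where
              open ≡-Reasoning
              %-cancel-1 : ∀ a → (a + 1) % p ≡ 1 % p → a % p ≡ 0
              %-cancel-1 a h = trans (sym ([m+n]%n≡m%n a p)) (trans (cong (_% p) shuffle) (trans (+-%-cong p {a + 1} {1} {ℕ.pred p} {ℕ.pred p} h refl) (trans (cong (_% p) (ℕ.suc-pred p)) (n%n≡0 p))))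
                where
                shuffle : a + p ≡ a + 1 + ℕ.pred p
                shuffle = trans (cong (a +_) (sym (ℕ.suc-pred p))) (sym (ℕ.+-assoc a 1 (ℕ.pred p)))

    Good : ℕ → ℕ → Set
    Good q r = Prime q × Prime r × p < q × p * q < r × (∀ z → (∃ λ k → Φ (p * q * r) k ≡ z) ⇔ (ℤ.- ℤ.+ β ℤ.≤ z × z ℤ.≤ ℤ.+ l))

    -- The lower bound for q serves three ends: it makes the sequence increase, gives p < q, and
    -- gives λ' p < q, which e ≥ 1 and C₁ rest on.
    good-pair : ∀ M → ∃ λ q → ∃ λ r → M < q × Good q r
    good-pair M = go (prime-in-class p 1<p l (small-coprime pp (s≤s z≤n) l<p) (M + p + l' * p))
      where
      go : (∃ λ q → Prime q × M + p + l' * p < q × (l * q) % p ≡ 1) → ∃ λ q → ∃ λ r → M < q × Good q r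
      go (q , pq , lt , lq) = go' (bezout-from p q l 1<p (ℕ.<⇒≤ (prime>1 pq)) (ℕ.<⇒≤ l<p) lq)
        where
        M+p<q : M + p < q
        M+p<q = ℕ.≤-<-trans (ℕ.m≤m+n (M + p) (l' * p)) lt
        p<q : p < q
        p<q = ℕ.≤-<-trans (ℕ.m≤n+m p M) M+p<q
        go' : (∃ λ μ → μ ≤ q × μ * p + l * q ≡ suc (p * q)) → ∃ λ q → ∃ λ r → M < q × Good q r
        go' (μ , μ≤q , bezout) = finish (third q pq lq (ℕ.≤-<-trans (ℕ.m≤n+m (l' * p) (M + p)) lt) p<q μ μ≤q bezout)
          where
          finish : (∃ λ r → Prime r × p * q < r × (∀ z → (∃ λ k → Φ (p * q * r) k ≡ z) ⇔ (ℤ.- ℤ.+ β ℤ.≤ z × z ℤ.≤ ℤ.+ l))) → ∃ λ q → ∃ λ r → M < q × Good q r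
          finish (r , pr , N<r , range) = q , r , ℕ.≤-<-trans (ℕ.m≤m+n M p) M+p<q , pq , pr , p<q , N<r , range

  increasing-pairs : ∀ {P : ℕ → ℕ → Set} → (∀ M → ∃ λ q → ∃ λ r → M < q × P q r) →
    ∃ λ (q : ℕ → ℕ) → ∃ λ (r : ℕ → ℕ) → (∀ j → P (q j) (r j)) × (∀ j → q j < q (suc j))
  increasing-pairs {P} next = (proj₁ ∘ pair) , (λ j → proj₁ (proj₂ (pair j))) , (λ j → proj₂ (proj₂ (pair j))) , step
    where
    choose : ℕ → ∃ λ q → ∃ λ r → P q r
    choose M = proj₁ (next M) , proj₁ (proj₂ (next M)) , proj₂ (proj₂ (proj₂ (next M)))
    pair : ℕ → ∃ λ q → ∃ λ r → P q r
    pair zero = choose 0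
    pair (suc j) = choose (proj₁ (pair j))
    step : ∀ j → proj₁ (pair j) < proj₁ (pair (suc j))
    step j = proj₁ (proj₂ (proj₂ (next (proj₁ (pair j)))))

  -- The bound gives p ≥ 2 t + 9, so p is not 2 and hence odd, and the quotient of p by 2 is at
  -- least t + 2.
  odd-prime-form : ∀ t p → Prime p → suc (2 * t) ^ 2 + 3 * suc (2 * t) + 5 ≤ p → ∃ λ β' → p ≡ 2 * β' + 2 * t + 5
  odd-prime-form t p pp le = go (p % 2) refl (m%n<n p 2)
    where
    instance
      p≢0 : ℕ.NonZero p
      p≢0 = prime⇒nonZero pp
    h = p / 2
    expand : ∀ t → suc (2 * t) * (suc (2 * t) * 1) + 3 * suc (2 * t) + 5 ≡ 4 * (t * t) + 8 * t + (2 * t + 9)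
    expand = ℕR.solve-∀
    bound : 2 * t + 9 ≤ p
    bound = ℕ.≤-trans (ℕ.m≤n+m (2 * t + 9) (4 * (t * t) + 8 * t)) (ℕ.≤-trans (ℕ.≤-reflexive (sym (expand t))) le)
    p-split : p ≡ p % 2 + h * 2
    p-split = m≡m%n+[m/n]*n p 2
    go : ∀ c → p % 2 ≡ c → c < 2 → ∃ λ β' → p ≡ 2 * β' + 2 * t + 5
    go 0 e _ = ⊥-elim (two (prime⇒irreducible pp (m%n≡0⇒n∣m p 2 e)))
      where
      two : 2 ≡ 1 ⊎ 2 ≡ p → ⊥
      two (inj₂ e) = ℕ.<⇒≱ (ℕ.≤-trans (s≤s (s≤s (s≤s z≤n))) (ℕ.≤-trans (ℕ.m≤n+m 9 (2 * t)) bound)) (ℕ.≤-reflexive (sym e))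
    go 1 e _ = h ∸ (t + 2) , trans p-split (trans (cong₂ (λ a b → a + b * 2) e (sym (ℕ.m∸n+n≡m t+2≤h))) (eq (h ∸ (t + 2)) t))
      where
      eq : ∀ b t → 1 + (b + (t + 2)) * 2 ≡ 2 * b + 2 * t + 5
      eq = ℕR.solve-∀
      eq₂ : ∀ t → 2 * t + 9 ≡ 4 + suc ((t + 2) * 2)
      eq₂ = ℕR.solve-∀
      t+2≤h : t + 2 ≤ h
      t+2≤h = ℕ.*-cancelʳ-≤ (t + 2) h 2 (ℕ.≤-pred (ℕ.≤-trans (ℕ.m≤n+m (suc ((t + 2) * 2)) 4) (ℕ.≤-trans (ℕ.≤-reflexive (sym (eq₂ t))) (ℕ.≤-trans bound (ℕ.≤-reflexive (trans p-split (cong (_+ h * 2) e)))))))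
    go (suc (suc c)) e (s≤s (s≤s ()))

-- Translation of the parameters into the interval of the statement

open import Defs
open import Data.Nat using (ℕ; suc; _+_; _*_; _∸_; _^_; _≤_; _<_; _/_)
open import Data.Nat.Primality using (Prime)
open import Data.Integer as ℤ using (ℤ; +_; -_)
open import Data.Product using (Σ; ∃; _×_; _,_)
open import Function.Bundles using (_⇔_)
open import Relation.Binary.PropositionalEquality using (_≡_)
open import Data.Nat.DivMod using (m*n/n≡m)
open PrimeChoice

theorem1 : (l p : ℕ) → (∃ λ t → l ≡ suc (2 * t)) → Prime p
         → l ^ 2 + 3 * l + 5 ≤ p
         → Σ (ℕ → ℕ) λ q → Σ (ℕ → ℕ) λ r →
             ((j : ℕ) → Prime (q j) × Prime (r j) × p < q j × p * q j < r j × q j < q (suc j))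
           × ((j : ℕ) (z : ℤ) →
                (∃ λ k → a (p * q j * r j) k ≡ z)
                ⇔ ((- (+ ((p ∸ l ∸ 2) / 2)) ℤ.≤ z) × (z ℤ.≤ + ((p + l + 2) / 2))))
theorem1 _ p (t , refl) pp le with odd-prime-form t p pp le
... | β' , p≡ = q , r , (λ j → let (pq , pr , p<q , N<r , _) = good j in pq , pr , p<q , N<r , mono j) ,
    λ j z → subst₂ (λ b l → (∃ λ k → a (p * q j * r j) k ≡ z) ⇔ ((- (+ b) ℤ.≤ z) × (z ℤ.≤ + l))) (sym β≡) (sym l≡) (proj₂ (proj₂ (proj₂ (proj₂ (good j)))) z)
  where
  β = suc β'
  l' = β' + 2 * t + 3
  w = 2 * t + 3
  ℓ = suc (2 * t)
  -- (ℓ + 2)² + 3 = (ℓ² + 3 ℓ + 5) + (ℓ + 2): the hypothesis on p is exactly w² + 3 ≤ p + w for w =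
  -- ℓ + 2.
  eq₁ : ∀ t → (2 * t + 3) * (2 * t + 3) + 3 ≡ suc (2 * t) * (suc (2 * t) * 1) + 3 * suc (2 * t) + 5 + (2 * t + 3)
  eq₁ = ℕR.solve-∀
  large : w * w + 3 ≤ p + w
  large = ℕ.≤-trans (ℕ.≤-reflexive (eq₁ t)) (ℕ.+-monoˡ-≤ w le)
  pairs = increasing-pairs (Primes.good-pair t β' p pp p≡ w l' refl refl large)
  q = proj₁ pairs
  r = proj₁ (proj₂ pairs)
  good = proj₁ (proj₂ (proj₂ pairs))
  mono = proj₂ (proj₂ (proj₂ pairs))
  eq₂ : ∀ b t → 2 * b + 2 * t + 5 ≡ suc (2 * t) + (2 + suc b * 2)
  eq₂ = ℕR.solve-∀
  eq₃ : ∀ b t → 2 * b + 2 * t + 5 + suc (2 * t) + 2 ≡ suc (b + 2 * t + 3) * 2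
  eq₃ = ℕR.solve-∀
  β≡ : (p ∸ ℓ ∸ 2) / 2 ≡ β
  β≡ = trans (cong (λ z → (z ∸ 2) / 2) (trans (cong (_∸ ℓ) (trans p≡ (eq₂ β' t))) (ℕ.m+n∸m≡n ℓ (2 + β * 2)))) (m*n/n≡m β 2)
  l≡ : (p + ℓ + 2) / 2 ≡ suc l'
  l≡ = trans (cong (_/ 2) (trans (cong (λ z → z + ℓ + 2) p≡) (eq₃ β' t))) (m*n/n≡m (suc l') 2)
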